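{- Let $p$ be an odd prime. For $k\in\mathbb{F}_p$ with $k^2\notin\{ -1,0\}$ let $a_{k,p}=p+1-\#E_k(\mathbb{F}_p)$ where $E_k:y^2=x(k^2(1+k^2)^3+2(1+k^2)^2x+x^2)$, and for $k\in\mathbb{F}_p\setminus\{ -1,0,1\}$ let $b_{k,p}=p+1-\#F_k(\mathbb{F}_p)$ where $F_k:y^2=(x-(k-1)^2)(x-(k+1)^2)x$. Then \[\sum_{\substack{k\in\mathbb{F}_p\\ k^2\notin\{ -1,0\}}}a_{k,p}^2=\begin{cases}p^2-5p-2-c_f(p), & p\equiv 1\pmod 4,\\ p^2-p-2-c_f(p), & p\equiv 3\pmod 4,\end{cases}\] and \[\sum_{k\in\mathbb{F}_p\setminus\{ -1,0,1\}}b_{k,p}^2=p^2-3p-4-c_f(p).\]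
   Context: Point counts of elliptic curves are projective (including the point at infinity). $f(\tau)=\sum_{n\ge1}c_f(n)q^n=q-4q^3-2q^5+24q^7-11q^9-44q^{11}+\dots$, $q=e^{2\pi i\tau}$, is the newform spanning the one-dimensional space $S_4(\Gamma_0(8))$ of weight $4$ cusp forms for $\Gamma_0(8)$; equivalently $f=\eta(2\tau)^4\eta(4\tau)^4$ with $\eta$ the Dedekind eta function. -}

module Defs where

open import Data.Nat as ℕ using (ℕ; zero; suc; NonZero)
open import Data.Integer as ℤ using (ℤ; +_; -_; _+_; _-_; _*_)
open import Data.Integer.DivMod using (_%ℕ_)
open import Data.List using (List; []; _∷_; upTo; map; replicate; _++_; foldr)
open import Data.Bool using (Bool; true; false; if_then_else_)
open import Relation.Nullary.Decidable using (⌊_⌋)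

sumℤ : List ℤ → ℤ
sumℤ = foldr _+_ (+ 0)

-- the residues 0,1,…,p-1 represent 𝔽_p
residues : ℕ → List ℕ
residues p = upTo p

_≡[_]? : ℤ → (p : ℕ) → .{{NonZero p}} → Bool
(a ≡[ p ]?) = ⌊ (a %ℕ p) ℕ.≟ 0 ⌋

-- Projective point count of  y^2 = g(x)  over 𝔽_p (p odd):
-- affine solutions (x,y) ∈ 𝔽_p^2 plus the single point at infinity.

affineCount : (p : ℕ) → .{{NonZero p}} → (ℤ → ℤ) → ℤ
affineCount p g =
  sumℤ (map (λ x → sumℤ (map (λ y →
     if ((+ y) * (+ y) - g (+ x)) ≡[ p ]? then + 1 else + 0)
     (residues p))) (residues p))

pointCount : (p : ℕ) → .{{NonZero p}} → (ℤ → ℤ) → ℤ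
pointCount p g = + 1 + affineCount p g

Ecubic : ℤ → ℤ → ℤ
Ecubic k x = x * (k * k * ((+ 1 + k * k) * (+ 1 + k * k) * (+ 1 + k * k))
                  + + 2 * ((+ 1 + k * k) * (+ 1 + k * k)) * x + x * x)

Fcubic : ℤ → ℤ → ℤ
Fcubic k x = (x - (k - + 1) * (k - + 1)) * (x - (k + + 1) * (k + + 1)) * x

aCoeff : (p : ℕ) → .{{NonZero p}} → ℕ → ℤ
aCoeff p k = + p + + 1 - pointCount p (Ecubic (+ k))

bCoeff : (p : ℕ) → .{{NonZero p}} → ℕ → ℤ
bCoeff p k = + p + + 1 - pointCount p (Fcubic (+ k))

sumA : (p : ℕ) → .{{NonZero p}} → ℤ
sumA p = sumℤ (map (λ k →
   if ((+ k) * (+ k)) ≡[ p ]? then + 0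
   else if ((+ k) * (+ k) + + 1) ≡[ p ]? then + 0
   else aCoeff p k * aCoeff p k) (residues p))

sumB : (p : ℕ) → .{{NonZero p}} → ℤ
sumB p = sumℤ (map (λ k →
   if (+ k) ≡[ p ]? then + 0
   else if (+ k - + 1) ≡[ p ]? then + 0
   else if (+ k + + 1) ≡[ p ]? then + 0
   else bCoeff p k * bCoeff p k) (residues p))

-- The newform f = η(2τ)^4 η(4τ)^4 = q ∏_{m≥1} (1-q^{2m})^4 (1-q^{4m})^4.
-- Polynomials / power series as coefficient lists (constant term first).

Poly : Set
Poly = List ℤ

addP : Poly → Poly → Poly
addP [] q = q
addP (a ∷ p) [] = a ∷ p
addP (a ∷ p) (b ∷ q) = (a + b) ∷ addP p q

scaleP : ℤ → Poly → Poly
scaleP c = map (c *_)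

mulP : Poly → Poly → Poly
mulP [] q = []
mulP (a ∷ p) q = addP (scaleP a q) (+ 0 ∷ mulP p q)

powP : Poly → ℕ → Poly
powP f zero = + 1 ∷ []
powP f (suc n) = mulP f (powP f n)

oneMinusQ : ℕ → Poly
oneMinusQ zero = + 0 ∷ []
oneMinusQ (suc d) = + 1 ∷ (replicate d (+ 0) ++ (- + 1) ∷ [])

etaPartial : ℕ → Poly
etaPartial zero = + 1 ∷ []
etaPartial (suc M) =
  mulP (mulP (powP (oneMinusQ (2 ℕ.* suc M)) 4) (powP (oneMinusQ (4 ℕ.* suc M)) 4))
       (etaPartial M)

coeff : Poly → ℕ → ℤ
coeff [] n = + 0
coeff (a ∷ p) zero = a
coeff (a ∷ p) (suc n) = coeff p n

-- c_f(n) for n ≥ 1: coefficient of q^(n-1) in ∏_{m≥1}(1-q^{2m})^4(1-q^{4m})^4;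
-- factors with m ≥ n are ≡ 1 mod q^n, so the partial product up to m = n is exact.
cf : ℕ → ℤ
cf zero = + 0
cf (suc n) = coeff (etaPartial (suc n)) n

-- Write p = 2m + 1, ε for the quadratic character and L(λ) = Σ_t ε(t(1-t)(λ-t)). A 2-isogeny and
-- changes of variable give sumB = Z_B - 3 and sumA = Z_A - 1, where Z_B = Σ_k L(k²)² and
-- Z_B = Z_A + 2p ε(-1), so the claim is that Z_B = p² - 3p - 1 - c_f(p). Both sides are congruent
-- modulo 8 and lie in an interval shorter than 8p²: for Z_B by second moments, for c_f(p) by
-- comparison with q ψ(q²)⁴, whose p-th coefficient is p + 1. A congruence modulo p² thus suffices.
--
-- Since ε(x) ≡ x^(pm) modulo p², Z_B is a sum of C(m,r)⁴ with corrections by harmonic numbers. On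
-- the modular side f = F² D u with D = q d/dq, where F = φ(q²)² is the hypergeometric series
-- Σ C(2n,n)² u^(2n) in a parameter u = q + …; the second solution of its differential equation
-- modulo p gives c_f(p) modulo p² as another such sum. The two sums agree because
-- Σ_x G′(x) ≡ 4 modulo p for G(x) = (4x+1) ∏_{l≤m} (x+l)⁴, x running over the residues.
module Submission where

open import Defs
open import Level using (0ℓ)
open import Data.Nat as ℕ using (ℕ; zero; suc; NonZero; _≤_; _<_; z≤n; s≤s; _∸_)
import Data.Nat.Properties as ℕ
open import Data.Integer as ℤ using (ℤ; +_; -_; _+_; _-_; _*_; _^_; ∣_∣)
import Data.Integer.Properties as ℤ
open import Data.Integer.Tactic.RingSolver using (solve-∀)
open import Data.List using ([]; _∷_; map; applyUpTo; replicate; _++_)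
import Data.List.Properties as Listₚ
open import Data.Product using (_×_; _,_; proj₁; proj₂; ∃)
open import Data.Sum using (_⊎_; inj₁; inj₂)
open import Data.Empty using (⊥)
open import Data.Nat.Primality using (Prime; prime⇒irreducible; euclidsLemma; ¬prime[1])
open import Data.Nat.Combinatorics using (_C_; nCn≡1; nC1≡n; nCk≡nC[n∸k]; nCk+nC[k+1]≡[n+1]C[k+1])
open import Data.Nat.Combinatorics.Specification using (k>n⇒nCk≡0)
open import Data.Integer.DivMod using (_%ℕ_; a≡a%ℕn+[a/ℕn]*n; n%ℕd<d)
import Data.Integer.Divisibility.Signed as Signed
open import Data.Nat.Divisibility using (divides; _∣_; _∣?_; ∣⇒≤)
open import Data.Bool using (true; false; if_then_else_)
open import Data.Unit using (⊤; tt)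
open import Data.Maybe using (Maybe; just; nothing)
open import Function using (_∘_)
open import Relation.Nullary using (¬_; Dec; yes; no; contradiction)
open import Relation.Binary.PropositionalEquality
open import Relation.Binary.Definitions using (Tri; tri<; tri≈; tri>)
open import Algebra.Bundles using (CommutativeRing)
import Algebra.Solver.Ring as RingSolver
open import Algebra.Solver.Ring.AlmostCommutativeRing using (fromCommutativeRing; _-Raw-AlmostCommutative⟶_)
import Relation.Binary.Reasoning.Setoid as SetoidReasoning
open import Data.Nat using (_%_; _/_)
open import Data.Nat.DivMod using (m%n<n; m≡m%n+[m/n]*n)
open import Data.Nat.Induction using (<-rec)
import Data.Nat.Tactic.RingSolver as ℕ-Solver

-- Both sides have size about p², so the congruence has to be pushed from p to p², and this shapes
-- the proof. Over arbitrary representatives t of the residues power sums are known modulo p; over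
-- the representatives t^p they are known modulo p². The price is a truncated logarithm in the
-- expansion of ε(1 - t), from which the harmonic numbers come. On the modular side they come from
-- the logarithmic solution of the differential equation: log u plus a series in u² has to be log q
-- up to q^(p-1), modulo p.
--
-- The size of c_f is read off a Wronskian. With β = uF one has f = F Dβ - β DF, while D(βF) = F Dβ
-- + β DF. Both products have nonnegative coefficients and βF = q ψ(q²)⁴, so |c_f(p)| ≤ p(p + 1).
-- Since 4 divides DF, the same two formulas give the residue modulo 8.
--
-- In G the fourth power is symmetric about -(m + 1)/2 ≡ -1/4 modulo p, and 4x + 1 is the linear
-- factor that vanishes there. It raises the degree to 2p - 1, where a sum of derivatives over the
-- residues sees exactly the leading coefficient 4.

infix 4 _≈_[_]
-- The quotient is kept as data and the congruence as an equation solved for `a`: matching on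
-- `by q refl` replaces `a` everywhere, after which a claim is an identity for the ring solver. For
-- `N = 0` the relation is equality.
record _≈_[_] (a b N : ℤ) : Set where
  constructor by
  field
    quotient : ℤ
    equality : a ≡ b + quotient * N

≡⇒≈ : ∀ {a b N} → a ≡ b → a ≈ b [ N ]
≡⇒≈ {a} {_} {N} refl = by (+ 0) (lemma a N)
  where
  lemma : ∀ a N → a ≡ a + + 0 * N
  lemma = solve-∀

≈-sym : ∀ {a b N} → a ≈ b [ N ] → b ≈ a [ N ]
≈-sym {_} {b} {N} (by q refl) = by (- q) (lemma b q N)
  where
  lemma : ∀ b q N → b ≡ b + q * N + - q * N
  lemma = solve-∀

≈-trans : ∀ {a b c N} → a ≈ b [ N ] → b ≈ c [ N ] → a ≈ c [ N ]
≈-trans {_} {_} {c} {N} (by q refl) (by r refl) = by (r + q) (lemma c q r N)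
  where
  lemma : ∀ c q r N → c + r * N + q * N ≡ c + (r + q) * N
  lemma = solve-∀

+-cong-≈ : ∀ {a b c d N} → a ≈ b [ N ] → c ≈ d [ N ] → a + c ≈ b + d [ N ]
+-cong-≈ {_} {b} {_} {d} {N} (by q refl) (by r refl) = by (q + r) (lemma b d q r N)
  where
  lemma : ∀ b d q r N → b + q * N + (d + r * N) ≡ b + d + (q + r) * N
  lemma = solve-∀

*-cong-≈ : ∀ {a b c d N} → a ≈ b [ N ] → c ≈ d [ N ] → a * c ≈ b * d [ N ]
*-cong-≈ {_} {b} {_} {d} {N} (by q refl) (by r refl) = by (b * r + q * d + q * r * N) (lemma b d q r N)
  where
  lemma : ∀ b d q r N → (b + q * N) * (d + r * N) ≡ b * d + (b * r + q * d + q * r * N) * N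
  lemma = solve-∀

-‿cong-≈ : ∀ {a b N} → a ≈ b [ N ] → - a ≈ - b [ N ]
-‿cong-≈ {_} {b} {N} (by q refl) = by (- q) (lemma b q N)
  where
  lemma : ∀ b q N → - (b + q * N) ≡ - b + - q * N
  lemma = solve-∀

ℤ/ : ℤ → CommutativeRing 0ℓ 0ℓ
ℤ/ N = record
  { Carrier = ℤ ; _≈_ = _≈_[ N ] ; _+_ = _+_ ; _*_ = _*_ ; -_ = -_ ; 0# = + 0 ; 1# = + 1
  ; isCommutativeRing = record
    { isRing = record
      { +-isAbelianGroup = record
        { isGroup = record
          { isMonoid = record
            { isSemigroup = record
              { isMagma = record
                { isEquivalence = record { refl = ≡⇒≈ refl ; sym = ≈-sym ; trans = ≈-trans }
                ; ∙-cong = +-cong-≈ }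
              ; assoc = λ x y z → ≡⇒≈ (ℤ.+-assoc x y z) }
            ; identity = (λ x → ≡⇒≈ (ℤ.+-identityˡ x)) , (λ x → ≡⇒≈ (ℤ.+-identityʳ x)) }
          ; inverse = (λ x → ≡⇒≈ (ℤ.+-inverseˡ x)) , (λ x → ≡⇒≈ (ℤ.+-inverseʳ x))
          ; ⁻¹-cong = -‿cong-≈ }
        ; comm = λ x y → ≡⇒≈ (ℤ.+-comm x y) }
      ; *-cong = *-cong-≈
      ; *-assoc = λ x y z → ≡⇒≈ (ℤ.*-assoc x y z)
      ; *-identity = (λ x → ≡⇒≈ (ℤ.*-identityˡ x)) , (λ x → ≡⇒≈ (ℤ.*-identityʳ x))
      ; distrib = (λ x y z → ≡⇒≈ (ℤ.*-distribˡ-+ x y z)) , (λ x y z → ≡⇒≈ (ℤ.*-distribʳ-+ x y z)) }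
    ; *-comm = λ x y → ≡⇒≈ (ℤ.*-comm x y) } }

module ≈-Reasoning (N : ℤ) = SetoidReasoning (CommutativeRing.setoid (ℤ/ N))

≈-refl : ∀ {a N} → a ≈ a [ N ]
≈-refl = ≡⇒≈ refl

-- Finite sums

sum : ℕ → (ℕ → ℤ) → ℤ
sum zero f = + 0
sum (suc n) f = sum n f + f n

sum-cong : ∀ n {f g} → (∀ i → i < n → f i ≡ g i) → sum n f ≡ sum n g
sum-cong zero h = refl
sum-cong (suc n) h = cong₂ _+_ (sum-cong n λ i i<n → h i (ℕ.m<n⇒m<1+n i<n)) (h n (ℕ.n<1+n n))

sum-ext : ∀ n {f g} → (∀ i → f i ≡ g i) → sum n f ≡ sum n g
sum-ext n h = sum-cong n λ i _ → h i

sum-cong-≈ : ∀ {N} n {f g} → (∀ i → i < n → f i ≈ g i [ N ]) → sum n f ≈ sum n g [ N ]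
sum-cong-≈ zero h = ≈-refl
sum-cong-≈ (suc n) h = +-cong-≈ (sum-cong-≈ n λ i i<n → h i (ℕ.m<n⇒m<1+n i<n)) (h n (ℕ.n<1+n n))

sum-suc : ∀ n f → sum (suc n) f ≡ f 0 + sum n (f ∘ suc)
sum-suc zero f = trans (ℤ.+-identityˡ (f 0)) (sym (ℤ.+-identityʳ (f 0)))
sum-suc (suc n) f = trans (cong (_+ f (suc n)) (sum-suc n f)) (ℤ.+-assoc (f 0) _ _)

sum-+ : ∀ n f g → sum n (λ i → f i + g i) ≡ sum n f + sum n g
sum-+ zero f g = refl
sum-+ (suc n) f g = trans (cong (_+ (f n + g n)) (sum-+ n f g)) (lemma (sum n f) (sum n g) (f n) (g n))
  where
  lemma : ∀ a b c d → a + b + (c + d) ≡ a + c + (b + d)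
  lemma = solve-∀

sum-*ˡ : ∀ n c f → sum n (λ i → c * f i) ≡ c * sum n f
sum-*ˡ zero c f = sym (ℤ.*-zeroʳ c)
sum-*ˡ (suc n) c f = trans (cong (_+ c * f n) (sum-*ˡ n c f)) (sym (ℤ.*-distribˡ-+ c (sum n f) (f n)))

sum-*ʳ : ∀ n c f → sum n (λ i → f i * c) ≡ sum n f * c
sum-*ʳ n c f = trans (sum-ext n λ i → ℤ.*-comm (f i) c) (trans (sum-*ˡ n c f) (ℤ.*-comm c _))

sum-neg : ∀ n f → sum n (λ i → - f i) ≡ - sum n f
sum-neg zero f = refl
sum-neg (suc n) f = trans (cong (_+ - f n) (sum-neg n f)) (sym (ℤ.neg-distrib-+ (sum n f) (f n)))

sum-0 : ∀ n → sum n (λ _ → + 0) ≡ + 0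
sum-0 zero = refl
sum-0 (suc n) = trans (ℤ.+-identityʳ _) (sum-0 n)

sum-zero : ∀ n {f} → (∀ i → i < n → f i ≡ + 0) → sum n f ≡ + 0
sum-zero n h = trans (sum-cong n h) (sum-0 n)

sum-const : ∀ n c → sum n (λ _ → c) ≡ + n * c
sum-const zero c = refl
sum-const (suc n) c = trans (cong (_+ c) (sum-const n c)) (lemma (+ n) c)
  where
  lemma : ∀ n c → n * c + c ≡ (+ 1 + n) * c
  lemma = solve-∀

sum-swap : ∀ m n (f : ℕ → ℕ → ℤ) → sum m (λ i → sum n (f i)) ≡ sum n (λ j → sum m (λ i → f i j))
sum-swap zero n f = sym (sum-0 n)
sum-swap (suc m) n f = trans (cong (_+ sum n (f m)) (sum-swap m n f)) (sym (sum-+ n _ (f m)))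

sum-product : ∀ m n f g → sum m f * sum n g ≡ sum m (λ i → sum n (λ j → f i * g j))
sum-product m n f g = trans (sym (sum-*ʳ m (sum n g) f)) (sum-ext m λ i → sym (sum-*ˡ n (f i) g))

sum-++ : ∀ m n f → sum (m ℕ.+ n) f ≡ sum m f + sum n (λ i → f (m ℕ.+ i))
sum-++ m zero f = trans (cong (λ k → sum k f) (ℕ.+-identityʳ m)) (sym (ℤ.+-identityʳ _))
sum-++ m (suc n) f rewrite ℕ.+-suc m n = trans (cong (_+ f (m ℕ.+ n)) (sum-++ m n f)) (ℤ.+-assoc (sum m f) _ _)

sum-rev : ∀ n f → sum (suc n) f ≡ sum (suc n) (λ i → f (n ∸ i))
sum-rev zero f = refl
sum-rev (suc n) f = begin
  sum (suc n) f + f (suc n) ≡⟨ ℤ.+-comm _ (f (suc n)) ⟩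
  f (suc n) + sum (suc n) f ≡⟨ cong (_+_ (f (suc n))) (sum-rev n f) ⟩
  f (suc n) + sum (suc n) (λ i → f (n ∸ i)) ≡⟨ sym (sum-suc (suc n) (λ i → f (suc n ∸ i))) ⟩
  sum (suc (suc n)) (λ i → f (suc n ∸ i)) ∎
  where open ≡-Reasoning

sum-single : ∀ n k f → k < n → (∀ i → i < n → i ≢ k → f i ≡ + 0) → sum n f ≡ f k
sum-single (suc n) k f k<1+n h with k ℕ.≟ n
... | yes refl = trans (cong (_+ f n) (sum-zero n λ i i<n → h i (ℕ.m<n⇒m<1+n i<n) (ℕ.<⇒≢ i<n))) (ℤ.+-identityˡ (f n))
... | no k≢n = trans (cong₂ _+_ (sum-single n k f (ℕ.≤∧≢⇒< (ℕ.≤-pred k<1+n) k≢n) λ i i<n → h i (ℕ.m<n⇒m<1+n i<n))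
                                (h n (ℕ.n<1+n n) (k≢n ∘ sym)))
                     (ℤ.+-identityʳ (f k))

sumℤ-residues : ∀ n (f : ℕ → ℤ) → sumℤ (map f (residues n)) ≡ sum n f
sumℤ-residues n f = trans (cong sumℤ (Listₚ.map-upTo f n)) (go n f)
  where
  go : ∀ n f → sumℤ (applyUpTo f n) ≡ sum n f
  go zero f = refl
  go (suc n) f = trans (cong (_+_ (f 0)) (go n (f ∘ suc))) (sym (sum-suc n f))

kronecker : ℕ → ℕ → ℤ
kronecker j i with j ℕ.≟ i
... | yes _ = + 1
... | no _ = + 0

kronecker-≡ : ∀ i → kronecker i i ≡ + 1
kronecker-≡ i with i ℕ.≟ i
... | yes _ = refl
... | no i≢i = contradiction refl i≢i

kronecker-≢ : ∀ {j i} → j ≢ i → kronecker j i ≡ + 0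
kronecker-≢ {j} {i} j≢i with j ℕ.≟ i
... | yes j≡i = contradiction j≡i j≢i
... | no _ = refl

sum-kronecker : ∀ n i (f : ℕ → ℤ) → i < n → sum n (λ k → f k * kronecker k i) ≡ f i
sum-kronecker n i f i<n = trans (sum-single n i (λ k → f k * kronecker k i) i<n λ k _ k≢i → trans (cong (_*_ (f k)) (kronecker-≢ k≢i)) (ℤ.*-zeroʳ (f k))) (trans (cong (_*_ (f i)) (kronecker-≡ i)) (ℤ.*-identityʳ (f i)))

kronecker-suc : ∀ j i → kronecker (suc j) (suc i) ≡ kronecker j i
kronecker-suc j i with j ℕ.≟ i
... | yes refl = kronecker-≡ (suc j)
... | no j≢i = kronecker-≢ (j≢i ∘ ℕ.suc-injective)

kronecker-+ : ∀ {i m} j → i ≤ m → kronecker (i ℕ.+ j) m ≡ kronecker j (m ∸ i)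
kronecker-+ {i} {m} j i≤m with j ℕ.≟ m ∸ i
... | yes refl = trans (cong (λ n → kronecker n m) (ℕ.m+[n∸m]≡n i≤m)) (kronecker-≡ m)
... | no j≢ = kronecker-≢ (λ eq → j≢ (trans (sym (ℕ.m+n∸m≡n i j)) (cong (_∸ i) eq)))

-- The usual way to prove a congruence below: `l - r` is displayed as a combination of differences
-- that vanish modulo `N`. The cofactors are supplied explicitly, and the polynomial identity that
-- remains is left to the ring solver.
linear-≈ : ∀ {N l r a b} c → a ≈ b [ N ] → l ≡ r + c * (a - b) → l ≈ r [ N ]
linear-≈ {N} {_} {r} {_} {b} c (by q refl) refl = by (c * q) (lemma r c b q N)
  where
  lemma : ∀ r c b q N → r + c * (b + q * N - b) ≡ r + c * q * N
  lemma = solve-∀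

linear-≈₂ : ∀ {N l r a b a′ b′} c c′ → a ≈ b [ N ] → a′ ≈ b′ [ N ] → l ≡ r + c * (a - b) + c′ * (a′ - b′) → l ≈ r [ N ]
linear-≈₂ {N} {_} {r} {_} {b} c c′ h h′ e = ≈-trans (linear-≈ c′ h′ e) (linear-≈ c h refl)

linear-≈₃ : ∀ {N l r a b a′ b′ a″ b″} c c′ c″ → a ≈ b [ N ] → a′ ≈ b′ [ N ] → a″ ≈ b″ [ N ] →
            l ≡ r + c * (a - b) + c′ * (a′ - b′) + c″ * (a″ - b″) → l ≈ r [ N ]
linear-≈₃ c c′ c″ h h′ h″ e = ≈-trans (linear-≈ c″ h″ e) (linear-≈₂ c c′ h h′ refl)

≈-weaken : ∀ {a b N} M → a ≈ b [ M * N ] → a ≈ b [ N ]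
≈-weaken {_} {b} {N} M (by q refl) = by (q * M) (cong (_+_ b) (sym (ℤ.*-assoc q M N)))

-- A term that carries a factor `P` need only be known modulo `P` in order to be known modulo
-- `P * P`.
≈-scale : ∀ {a b N} M → a ≈ b [ N ] → M * a ≈ M * b [ M * N ]
≈-scale {_} {b} {N} M (by q refl) = by q (lemma M b q N)
  where
  lemma : ∀ M b q N → M * (b + q * N) ≡ M * b + q * (M * N)
  lemma = solve-∀

^-cong-≈ : ∀ {a b N} n → a ≈ b [ N ] → a ^ n ≈ b ^ n [ N ]
^-cong-≈ zero h = ≈-refl
^-cong-≈ (suc n) h = *-cong-≈ h (^-cong-≈ n h)

^-distrib-* : ∀ x y n → (x * y) ^ n ≡ x ^ n * y ^ n
^-distrib-* x y zero = refl
^-distrib-* x y (suc n) = trans (cong (_*_ (x * y)) (^-distrib-* x y n)) (lemma x y (x ^ n) (y ^ n))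
  where
  lemma : ∀ x y a b → x * y * (a * b) ≡ x * a * (y * b)
  lemma = solve-∀

^-swap : ∀ x m n → (x ^ m) ^ n ≡ (x ^ n) ^ m
^-swap x m n = trans (ℤ.^-*-assoc x m n) (trans (cong (x ^_) (ℕ.*-comm m n)) (sym (ℤ.^-*-assoc x n m)))

strong-induction : ∀ (P : ℕ → Set) → (∀ n → (∀ k → k < n → P k) → P n) → ∀ n → P n
strong-induction P step = <-rec P λ n ih → step n λ k k<n → ih k<n

-- Binomial coefficients

abstract
  binom : ℕ → ℕ → ℤ
  binom n k = + (n C k)

  binom-0 : ∀ n → binom n 0 ≡ + 1
  binom-0 n = cong +_ (trans (nCk≡nC[n∸k] {0} {n} z≤n) (nCn≡1 n))

  binom-n : ∀ n → binom n n ≡ + 1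
  binom-n n = cong +_ (nCn≡1 n)

  binom-> : ∀ {n k} → n < k → binom n k ≡ + 0
  binom-> h = cong +_ (k>n⇒nCk≡0 h)

  binom-1 : ∀ n → binom n 1 ≡ + n
  binom-1 n = cong +_ (nC1≡n n)

  pascal : ∀ n k → binom (suc n) (suc k) ≡ binom n k + binom n (suc k)
  pascal n k = cong +_ (sym (nCk+nC[k+1]≡[n+1]C[k+1] n k))

  binom-sym : ∀ {n k} → k ≤ n → binom n k ≡ binom n (n ∸ k)
  binom-sym h = cong +_ (nCk≡nC[n∸k] h)

binom-absorb : ∀ n k → + suc k * binom (suc n) (suc k) ≡ + suc n * binom n k
binom-absorb zero zero = cong₂ _*_ (refl {x = + 1}) (trans (binom-1 1) (sym (binom-0 0)))
binom-absorb zero (suc k) = trans (cong (_*_ (+ suc (suc k))) (binom-> {1} {suc (suc k)} (s≤s (s≤s z≤n))))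
                                  (trans (ℤ.*-zeroʳ (+ suc (suc k))) (sym (trans (cong (_*_ (+ 1)) (binom-> {0} {suc k} (s≤s z≤n))) refl)))
binom-absorb (suc n) zero = trans (cong (_*_ (+ 1)) (pascal (suc n) 0)) (trans
  (cong (λ x → + 1 * (x + binom (suc n) 1)) (binom-0 (suc n))) (trans (cong (λ x → + 1 * (+ 1 + x)) (binom-1 (suc n)))
  (trans (lemma (+ suc n)) (cong (_*_ (+ suc (suc n))) (sym (binom-0 (suc n)))))))
  where
  lemma : ∀ n → + 1 * (+ 1 + n) ≡ (+ 1 + n) * + 1
  lemma = solve-∀
binom-absorb (suc n) (suc k) = begin
  + suc (suc k) * binom (suc (suc n)) (suc (suc k))
    ≡⟨ cong (_*_ (+ suc (suc k))) (pascal (suc n) (suc k)) ⟩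
  + suc (suc k) * (binom (suc n) (suc k) + binom (suc n) (suc (suc k)))
    ≡⟨ lemma₁ (+ suc k) (binom (suc n) (suc k)) (binom (suc n) (suc (suc k))) ⟩
  + suc k * binom (suc n) (suc k) + binom (suc n) (suc k) + + suc (suc k) * binom (suc n) (suc (suc k))
    ≡⟨ cong₂ (λ x y → x + binom (suc n) (suc k) + y) (binom-absorb n k) (binom-absorb n (suc k)) ⟩
  + suc n * binom n k + binom (suc n) (suc k) + + suc n * binom n (suc k)
    ≡⟨ lemma₂ (+ suc n) (binom n k) (binom n (suc k)) (binom (suc n) (suc k)) ⟩
  + suc n * (binom n k + binom n (suc k)) + binom (suc n) (suc k)
    ≡⟨ cong (λ x → + suc n * x + binom (suc n) (suc k)) (sym (pascal n k)) ⟩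
  + suc n * binom (suc n) (suc k) + binom (suc n) (suc k)
    ≡⟨ lemma₃ (+ suc n) (binom (suc n) (suc k)) ⟩
  + suc (suc n) * binom (suc n) (suc k) ∎
  where
  open ≡-Reasoning
  lemma₁ : ∀ k a b → (+ 1 + k) * (a + b) ≡ k * a + a + (+ 1 + k) * b
  lemma₁ = solve-∀
  lemma₂ : ∀ n a b c → n * a + c + n * b ≡ n * (a + b) + c
  lemma₂ = solve-∀
  lemma₃ : ∀ n c → n * c + c ≡ (+ 1 + n) * c
  lemma₃ = solve-∀

binomial : ∀ x n → (+ 1 + x) ^ n ≡ sum (suc n) (λ k → binom n k * x ^ k)
binomial x zero = trans (cong (_* + 1) (sym (binom-0 0))) (sym (ℤ.+-identityˡ _))
binomial x (suc n) = begin
  (+ 1 + x) * (+ 1 + x) ^ n ≡⟨ cong (_*_ (+ 1 + x)) (binomial x n) ⟩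
  (+ 1 + x) * T ≡⟨ trans (ℤ.*-distribʳ-+ T (+ 1) x) (cong (_+ x * T) (ℤ.*-identityˡ T)) ⟩
  T + x * T ≡⟨ cong₂ _+_ extended (trans (sym (sum-*ˡ (suc n) x _)) (sum-ext (suc n) λ k → lemma₁ x (binom n k) (x ^ k))) ⟩
  binom n 0 * + 1 + sum (suc n) (λ k → binom n (suc k) * x ^ suc k) + sum (suc n) (λ k → binom n k * x ^ suc k)
    ≡⟨ lemma₂ (binom n 0) (sum (suc n) (λ k → binom n (suc k) * x ^ suc k)) (sum (suc n) (λ k → binom n k * x ^ suc k)) ⟩
  binom n 0 * + 1 + (sum (suc n) (λ k → binom n k * x ^ suc k) + sum (suc n) (λ k → binom n (suc k) * x ^ suc k))
    ≡⟨ cong₂ (λ a b → a * + 1 + b) (trans (binom-0 n) (sym (binom-0 (suc n)))) (trans (sym (sum-+ (suc n) _ _)) (sum-ext (suc n) λ k →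
         trans (sym (ℤ.*-distribʳ-+ (x ^ suc k) (binom n k) (binom n (suc k)))) (cong (_* x ^ suc k) (sym (pascal n k))))) ⟩
  binom (suc n) 0 * + 1 + sum (suc n) (λ k → binom (suc n) (suc k) * x ^ suc k)
    ≡⟨ sym (sum-suc (suc n) (λ k → binom (suc n) k * x ^ k)) ⟩
  sum (suc (suc n)) (λ k → binom (suc n) k * x ^ k) ∎
  where
  open ≡-Reasoning
  T = sum (suc n) (λ k → binom n k * x ^ k)
  extended : T ≡ binom n 0 * + 1 + sum (suc n) (λ k → binom n (suc k) * x ^ suc k)
  extended = trans (sym (ℤ.+-identityʳ T)) (trans (cong (_+_ T) (sym (cong (_* x ^ suc n) (binom-> (ℕ.n<1+n n)))))
    (sum-suc (suc n) (λ k → binom n k * x ^ k)))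
  lemma₁ : ∀ x a b → x * (a * b) ≡ a * (x * b)
  lemma₁ = solve-∀
  lemma₂ : ∀ a b c → a * + 1 + b + c ≡ a * + 1 + (c + b)
  lemma₂ = solve-∀

-- Arithmetic modulo a prime and its square

-- First-order Taylor expansion of a power. Every `c` it is applied to is a multiple of `P`, so that
-- the error is invisible modulo `P * P`.
power-perturb : ∀ b c n → (b + c) ^ suc n ≈ b ^ suc n + + suc n * b ^ n * c [ c * c ]
power-perturb b c zero = ≡⇒≈ (lemma b c)
  where
  lemma : ∀ b c → (b + c) * + 1 ≡ b * + 1 + + 1 * + 1 * c
  lemma = solve-∀
power-perturb b c (suc n) = ≈-trans (*-cong-≈ {b + c} ≈-refl (power-perturb b c n)) (by (+ suc n * b ^ n) (lemma b c (b ^ n) (+ suc n)))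
  where
  lemma : ∀ b c d n → (b + c) * (b * d + n * d * c) ≡ b * (b * d) + (+ 1 + n) * (b * d) * c + n * d * (c * c)
  lemma = solve-∀

≈⇒≡ : ∀ {N i j} → i < N → j < N → + i ≈ + j [ + N ] → i ≡ j
≈⇒≡ {N} i<N j<N (by q eq) = go q i<N j<N eq
  where
  above : ∀ {i j} t → i < N → + i ≢ + j + + suc t * + N
  above {i} {j} t i<N eq = ℕ.<⇒≱ i<N (ℕ.≤-trans (ℕ.≤-trans (ℕ.m≤m+n N (t ℕ.* N)) (ℕ.m≤n+m (suc t ℕ.* N) j))
    (ℕ.≤-reflexive (sym (ℤ.+-injective (trans eq (cong (_+_ (+ j)) (sym (ℤ.pos-* (suc t) N))))))))
  go : ∀ {i j} q → i < N → j < N → + i ≡ + j + q * + N → i ≡ j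
  go {i} {j} (+ zero) _ _ eq = ℤ.+-injective (trans eq (ℤ.+-identityʳ (+ j)))
  go (+ suc t) i<N _ eq = contradiction eq (above t i<N)
  go (ℤ.-[1+ t ]) _ j<N eq = contradiction (trans (lemma (+ _) (+ suc t) (+ N)) (cong (_+ + suc t * + N) (sym eq))) (above t j<N)
    where
    lemma : ∀ j q N → j ≡ j + - q * N + q * N
    lemma = solve-∀

double-+ : ∀ i j → i ℕ.+ i ℕ.+ (j ℕ.+ j) ≡ i ℕ.+ j ℕ.+ (i ℕ.+ j)
double-+ = ℕ-Solver.solve-∀

module PrimeField (m : ℕ) (pr : Prime (suc (m ℕ.+ m))) where

  2m p : ℕ
  2m = m ℕ.+ m
  p = suc 2m

  P PP : ℤ
  P = + p
  PP = P * P

  0<m : 0 < m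
  0<m = positive m pr
    where
    positive : ∀ m → Prime (suc (m ℕ.+ m)) → 0 < m
    positive zero pr = contradiction pr ¬prime[1]
    positive (suc m) pr = s≤s z≤n

  0<2m : 0 < 2m
  0<2m = ℕ.≤-trans 0<m (ℕ.m≤m+n m m)

  P≈0 : P ≈ + 0 [ P ]
  P≈0 = by (+ 1) (lemma P)
    where
    lemma : ∀ P → P ≡ + 0 + + 1 * P
    lemma = solve-∀

  PP≈0 : PP ≈ + 0 [ PP ]
  PP≈0 = by (+ 1) (sym (trans (ℤ.+-identityˡ (+ 1 * PP)) (ℤ.*-identityˡ PP)))

  P²⇒P : ∀ {a b} → a ≈ b [ PP ] → a ≈ b [ P ]
  P²⇒P = ≈-weaken P

  ≈0⇒∣ : ∀ {a} → a ≈ + 0 [ P ] → p ∣ ∣ a ∣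
  ≈0⇒∣ {a} (by q eq) = Signed.∣⇒∣ᵤ {P} {a} (Signed.divides q (trans eq (ℤ.+-identityˡ _)))

  ∣⇒≈0 : ∀ {a} → p ∣ ∣ a ∣ → a ≈ + 0 [ P ]
  ∣⇒≈0 {a} h with Signed.∣ᵤ⇒∣ {P} {a} h
  ... | Signed.divides q eq = by q (trans eq (sym (ℤ.+-identityˡ _)))

  ≈0? : ∀ a → Dec (a ≈ + 0 [ P ])
  ≈0? a with p ∣? ∣ a ∣
  ... | yes h = yes (∣⇒≈0 h)
  ... | no h = no (h ∘ ≈0⇒∣)

  Unit : ℤ → Set
  Unit a = ¬ a ≈ + 0 [ P ]

  euclid : ∀ a b → a * b ≈ + 0 [ P ] → a ≈ + 0 [ P ] ⊎ b ≈ + 0 [ P ]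
  euclid a b h with euclidsLemma ∣ a ∣ ∣ b ∣ pr (subst (p ∣_) (ℤ.abs-* a b) (≈0⇒∣ h))
  ... | inj₁ h = inj₁ (∣⇒≈0 h)
  ... | inj₂ h = inj₂ (∣⇒≈0 h)

  Unit-* : ∀ {a b} → Unit a → Unit b → Unit (a * b)
  Unit-* {a} {b} ua ub h with euclid a b h
  ... | inj₁ h = ua h
  ... | inj₂ h = ub h

  cancel : ∀ {a b c} → Unit c → c * a ≈ c * b [ P ] → a ≈ b [ P ]
  cancel {a} {b} {c} uc h = go (euclid c (a - b) (linear-≈ (+ 1) h (lemma a b c)))
    where
    lemma : ∀ a b c → c * (a - b) ≡ + 0 + + 1 * (c * a - c * b)
    lemma = solve-∀
    lemma′ : ∀ a b → a ≡ b + + 1 * (a - b - + 0)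
    lemma′ = solve-∀
    go : c ≈ + 0 [ P ] ⊎ a - b ≈ + 0 [ P ] → a ≈ b [ P ]
    go (inj₁ c≈0) = contradiction c≈0 uc
    go (inj₂ h) = linear-≈ (+ 1) h (lemma′ a b)

  unit-small : ∀ n → 0 < n → n < p → Unit (+ n)
  unit-small (suc n) _ n<p h = ℕ.<⇒≱ n<p (∣⇒≤ (≈0⇒∣ h))

  ≈-small : ∀ {i j} → i < p → j < p → + i ≈ + j [ P ] → i ≡ j
  ≈-small = ≈⇒≡

  residue : ℤ → ℕ
  residue a = a %ℕ p

  residue< : ∀ a → residue a < p
  residue< a = n%ℕd<d a p

  residue-≈ : ∀ a → a ≈ + residue a [ P ]
  residue-≈ a = by (a ℤ./ℕ p) (a≡a%ℕn+[a/ℕn]*n a p)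

  p∣binom : ∀ k → suc k < p → binom p (suc k) ≈ + 0 [ P ]
  p∣binom k k<p with euclid (+ suc k) (binom p (suc k)) (by (binom 2m k) (trans (binom-absorb 2m k) (lemma P (binom 2m k))))
    where
    lemma : ∀ a b → a * b ≡ + 0 + b * a
    lemma = solve-∀
  ... | inj₁ h = contradiction h (unit-small (suc k) (s≤s z≤n) k<p)
  ... | inj₂ h = h

  frobenius : ∀ x → (+ 1 + x) ^ p ≈ + 1 + x ^ p [ P ]
  frobenius x = begin
    (+ 1 + x) ^ p ≡⟨ binomial x p ⟩
    sum p (λ k → binom p k * x ^ k) + binom p p * x ^ p ≡⟨ cong (_+ binom p p * x ^ p) (sum-suc 2m _) ⟩
    binom p 0 * + 1 + sum 2m (λ k → binom p (suc k) * x ^ suc k) + binom p p * x ^ p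
      ≈⟨ +-cong-≈ (+-cong-≈ (≡⇒≈ (cong (_* + 1) (binom-0 p))) (≈-trans (sum-cong-≈ 2m λ k k< → *-cong-≈ {_} {+ 0} {x ^ suc k} (p∣binom k (s≤s k<)) ≈-refl) (≡⇒≈ (sum-0 2m))))
                  (≡⇒≈ (trans (cong (_* x ^ p) (binom-n p)) (ℤ.*-identityˡ (x ^ p)))) ⟩
    + 1 + x ^ p ∎
    where open ≈-Reasoning P

  fermat : ∀ x → x ^ p ≈ x [ P ]
  fermat x = ≈-trans (^-cong-≈ p (residue-≈ x)) (≈-trans (natural (residue x)) (≈-sym (residue-≈ x)))
    where
    natural : ∀ n → (+ n) ^ p ≈ + n [ P ]
    natural zero = ≈-refl
    natural (suc n) = ≈-trans (frobenius (+ n)) (+-cong-≈ {+ 1} ≈-refl (natural n))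

  fermat-unit : ∀ {x} → Unit x → x ^ 2m ≈ + 1 [ P ]
  fermat-unit {x} ux = cancel ux (≈-trans (fermat x) (≡⇒≈ (sym (ℤ.*-identityʳ x))))

  -- Raising to the power `p` gains a factor `P`: the linear term of the expansion carries the
  -- exponent `p` besides the difference of the bases.
  lift : ∀ {a b} → a ≈ b [ P ] → a ^ p ≈ b ^ p [ PP ]
  lift {_} {b} (by q refl) = ≈-trans (widen (power-perturb b (q * P) 2m)) (by (b ^ 2m * q) (lemma (b ^ p) P (b ^ 2m) q))
    where
    widen : ∀ {x y} → x ≈ y [ q * P * (q * P) ] → x ≈ y [ PP ]
    widen h = ≈-weaken (q * q) (subst (_ ≈ _ [_]) (assoc q P) h)
      where
      assoc : ∀ q P → q * P * (q * P) ≡ q * q * (P * P)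
      assoc = solve-∀
    lemma : ∀ b P c q → b + P * c * (q * P) ≡ b + c * q * (P * P)
    lemma = solve-∀

  -- Modulo `PP` this is the Teichmüller representative: it depends only on the residue of `x`
  -- modulo `P` and is its own `p`-th power.
  τ : ℤ → ℤ
  τ x = x ^ p

  τ-* : ∀ x y → τ (x * y) ≡ τ x * τ y
  τ-* x y = ^-distrib-* x y p

  τ-idem : ∀ x → τ (τ x) ≈ τ x [ PP ]
  τ-idem x = lift (fermat x)

  τ-unit : ∀ {x} → Unit x → τ x ^ 2m ≈ + 1 [ PP ]
  τ-unit {x} ux = ≈-trans (≡⇒≈ (^-swap x p 2m)) (≈-trans (lift (fermat-unit ux)) (≡⇒≈ (ℤ.^-zeroˡ p)))

  zero-power : ∀ n → 0 < n → (+ 0) ^ n ≡ + 0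
  zero-power (suc n) _ = refl

  abstract
    -- A power of `x`, hence one total function that inverts units modulo `PP`, respects congruences
    -- to every modulus and sends `0` to `0`; modulo `P` it permutes all residues. It is abstract to
    -- keep the huge exponent from unfolding.
    inv : ℤ → ℤ
    inv x = x ^ ℕ.pred (p ℕ.* 2m)

    inv-right : ∀ {x} → Unit x → x * inv x ≈ + 1 [ PP ]
    inv-right {x} ux = ≈-trans (≡⇒≈ (trans (cong (x ^_) exponent) (sym (ℤ.^-*-assoc x p 2m)))) (τ-unit ux)
      where
      exponent : suc (ℕ.pred (p ℕ.* 2m)) ≡ p ℕ.* 2m
      exponent = ℕ.suc-pred _ {{ℕ.>-nonZero (ℕ.≤-trans 0<m (ℕ.≤-trans (ℕ.m≤m+n m m) (ℕ.m≤m+n 2m _)))}}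

    inv-cong : ∀ {x y N} → x ≈ y [ N ] → inv x ≈ inv y [ N ]
    inv-cong = ^-cong-≈ (ℕ.pred (p ℕ.* 2m))

    inv-0 : inv (+ 0) ≡ + 0
    inv-0 = zero-power _ (ℕ.≤-pred (ℕ.≤-trans p>2′ (ℕ.≤-reflexive (sym (ℕ.suc-pred _ {{ℕ.>-nonZero (ℕ.≤-trans (s≤s z≤n) p>2′)}})))))
      where
      p>2′ : 2 ≤ p ℕ.* 2m
      p>2′ = ℕ.≤-trans (ℕ.+-mono-≤ 0<m 0<m) (ℕ.m≤m+n 2m _)

  inv-zero : ∀ {x N} → x ≈ + 0 [ N ] → inv x ≈ + 0 [ N ]
  inv-zero h = ≈-trans (inv-cong h) (≡⇒≈ inv-0)

  inv-rightₚ : ∀ {x} → Unit x → x * inv x ≈ + 1 [ P ]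
  inv-rightₚ ux = P²⇒P (inv-right ux)

  inv-unit : ∀ {x} → Unit x → Unit (inv x)
  inv-unit {x} ux h = unit-small 1 (s≤s z≤n) (s≤s 0<2m)
    (≈-trans (≈-sym (inv-rightₚ ux)) (≈-trans (*-cong-≈ {x} ≈-refl h) (≡⇒≈ (ℤ.*-zeroʳ x))))

  1-unit : Unit (+ 1)
  1-unit = unit-small 1 (s≤s z≤n) (s≤s 0<2m)

  p>2 : 2 < p
  p>2 = s≤s (ℕ.+-mono-≤ 0<m 0<m)

  2-unit : Unit (+ 2)
  2-unit = unit-small 2 (s≤s z≤n) p>2

  powerSum : ℕ → ℤ
  powerSum n = sum p (λ x → (+ x) ^ n)

  telescope : ∀ n (f : ℕ → ℤ) → sum n (λ x → f (suc x) - f x) ≡ f n - f 0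
  telescope zero f = sym (ℤ.+-inverseʳ (f 0))
  telescope (suc n) f = trans (cong (_+ (f (suc n) - f n)) (telescope n f)) (lemma (f n) (f 0) (f (suc n)))
    where
    lemma : ∀ a b c → a - b + (c - a) ≡ c - b
    lemma = solve-∀

  -- Telescoping `(x + 1)^(n+1) - x^(n+1)` over the residues gives `P^(n+1)`. By the binomial
  -- theorem the same sum is `(n + 1) * powerSum n` plus multiples of lower power sums, which vanish
  -- by induction, and `n + 1 < p` can be cancelled.
  powerSum-zero : ∀ n → n < 2m → powerSum n ≈ + 0 [ P ]
  powerSum-zero = strong-induction (λ n → n < 2m → powerSum n ≈ + 0 [ P ]) step
    where
    step : ∀ n → (∀ k → k < n → k < 2m → powerSum k ≈ + 0 [ P ]) → n < 2m → powerSum n ≈ + 0 [ P ]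
    step n ih n< = cancel {_} {+ 0} {+ suc n} (unit-small (suc n) (s≤s z≤n) (s≤s n<)) (begin
      + suc n * powerSum n ≡⟨ cong (_* powerSum n) (sym top) ⟩
      binom (suc n) n * powerSum n ≡⟨ sym (ℤ.+-identityˡ _) ⟩
      + 0 + binom (suc n) n * powerSum n
        ≈⟨ +-cong-≈ (≈-sym (≈-trans (sum-cong-≈ n λ k k<n → *-cong-≈ {binom (suc n) k} {_} {_} {+ 0} ≈-refl (ih k k<n (ℕ.<-trans k<n n<)))
             (≡⇒≈ (sum-zero n λ k _ → ℤ.*-zeroʳ (binom (suc n) k))))) (≈-refl {binom (suc n) n * powerSum n}) ⟩
      sum (suc n) (λ k → binom (suc n) k * powerSum k) ≡⟨ sum-ext (suc n) (λ k → sym (sum-*ˡ p (binom (suc n) k) _)) ⟩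
      sum (suc n) (λ k → sum p (λ x → binom (suc n) k * (+ x) ^ k)) ≡⟨ sum-swap (suc n) p _ ⟩
      sum p (λ x → sum (suc n) (λ k → binom (suc n) k * (+ x) ^ k)) ≡⟨ sum-ext p (λ x → difference x) ⟩
      sum p (λ x → (+ suc x) ^ suc n - (+ x) ^ suc n) ≡⟨ telescope p (λ x → (+ x) ^ suc n) ⟩
      P ^ suc n - + 0 ≈⟨ by (P ^ n) (lemma P (P ^ n)) ⟩
      + 0 ≡⟨ sym (ℤ.*-zeroʳ (+ suc n)) ⟩
      + suc n * + 0 ∎)
      where
      open ≈-Reasoning P
      lemma : ∀ a b → a * b - + 0 ≡ + 0 + b * a
      lemma = solve-∀
      top : binom (suc n) n ≡ + suc n
      top = trans (binom-sym (ℕ.n≤1+n n)) (trans (cong (binom (suc n)) (ℕ.m+n∸n≡m 1 n)) (binom-1 (suc n)))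
      difference : ∀ x → sum (suc n) (λ k → binom (suc n) k * (+ x) ^ k) ≡ (+ suc x) ^ suc n - (+ x) ^ suc n
      difference x = trans (lemma′ _ ((+ x) ^ suc n)) (cong (_- (+ x) ^ suc n) (sym (trans (binomial (+ x) (suc n))
          (cong (_+_ (sum (suc n) (λ k → binom (suc n) k * (+ x) ^ k))) (trans (cong (_* (+ x) ^ suc n) (binom-n (suc n))) (ℤ.*-identityˡ _))))))
        where
        lemma′ : ∀ a b → a ≡ a + b - b
        lemma′ = solve-∀

  powerSum-top : powerSum 2m ≈ - + 1 [ P ]
  powerSum-top = begin
    powerSum 2m ≡⟨ sum-suc 2m _ ⟩
    (+ 0) ^ 2m + sum 2m (λ x → (+ suc x) ^ 2m)
      ≈⟨ +-cong-≈ (≡⇒≈ (zero-power 2m 0<2m))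
           (sum-cong-≈ 2m λ x x< → fermat-unit (unit-small (suc x) (s≤s z≤n) (s≤s x<))) ⟩
    + 0 + sum 2m (λ _ → + 1) ≡⟨ cong (_+_ (+ 0)) (sum-const 2m (+ 1)) ⟩
    + 0 + + 2m * + 1 ≈⟨ by (+ 1) (lemma (+ 2m)) ⟩
    - + 1 ∎
    where
    open ≈-Reasoning P
    lemma : ∀ x → + 0 + x * + 1 ≡ - + 1 + + 1 * (+ 1 + x)
    lemma = solve-∀

module CharacterSums (m : ℕ) (pr : Prime (suc (m ℕ.+ m))) where
  open PrimeField m pr

  -- Sums over the residues modulo p

  abstract
    ∑ : (ℤ → ℤ) → ℤ
    ∑ f = sum p (λ i → f (+ i))

    ∑-ext : ∀ {f g} → (∀ x → f x ≡ g x) → ∑ f ≡ ∑ g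
    ∑-ext h = sum-ext p λ i → h (+ i)

    ∑-+ : ∀ f g → ∑ (λ x → f x + g x) ≡ ∑ f + ∑ g
    ∑-+ f g = sum-+ p (λ i → f (+ i)) (λ i → g (+ i))

    ∑-*ˡ : ∀ c f → ∑ (λ x → c * f x) ≡ c * ∑ f
    ∑-*ˡ c f = sum-*ˡ p c (λ i → f (+ i))

    ∑-*ʳ : ∀ f c → ∑ (λ x → f x * c) ≡ ∑ f * c
    ∑-*ʳ f c = sum-*ʳ p c (λ i → f (+ i))

    ∑-neg : ∀ f → ∑ (λ x → - f x) ≡ - ∑ f
    ∑-neg f = sum-neg p (λ i → f (+ i))

    ∑-swap : ∀ (f : ℤ → ℤ → ℤ) → ∑ (λ x → ∑ (f x)) ≡ ∑ (λ y → ∑ (λ x → f x y))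
    ∑-swap f = sum-swap p p (λ i j → f (+ i) (+ j))

    ∑-const : ∀ c → ∑ (λ _ → c) ≡ P * c
    ∑-const c = sum-const p c

    ∑-1 : ∑ (λ _ → + 1) ≡ P
    ∑-1 = trans (∑-const (+ 1)) (ℤ.*-identityʳ P)

    ∑-product : ∀ f g → ∑ f * ∑ g ≡ ∑ (λ x → ∑ (λ y → f x * g y))
    ∑-product f g = sum-product p p (λ i → f (+ i)) (λ i → g (+ i))

    ∑-def : ∀ f → ∑ f ≡ sum p (λ i → f (+ i))
    ∑-def f = refl

    ∑-cong-≈ : ∀ {N} {f g : ℤ → ℤ} → (∀ x → f x ≈ g x [ N ]) → ∑ f ≈ ∑ g [ N ]
    ∑-cong-≈ h = sum-cong-≈ p λ i _ → h (+ i)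

    ∑-sum-swap : ∀ n (f : ℤ → ℕ → ℤ) → ∑ (λ x → sum n (f x)) ≡ sum n (λ k → ∑ (λ x → f x k))
    ∑-sum-swap n f = sum-swap p n (λ i → f (+ i))

    ∑-single : ∀ (f : ℤ → ℤ) k → k < p → (∀ i → i < p → i ≢ k → f (+ i) ≡ + 0) → ∑ f ≡ f (+ k)
    ∑-single f k = sum-single p k (λ i → f (+ i))

    ∑-zero : ∀ {f : ℤ → ℤ} → (∀ i → i < p → f (+ i) ≡ + 0) → ∑ f ≡ + 0
    ∑-zero h = sum-zero p h

  Periodic : (ℤ → ℤ) → Set
  Periodic f = ∀ a b → a ≈ b [ P ] → f a ≡ f b

  abstract
    δ : ℤ → ℤ
    δ a = if a ≡[ p ]? then + 1 else + 0

    δ-yes : ∀ {a} → a ≈ + 0 [ P ] → δ a ≡ + 1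
    δ-yes {a} h with a %ℕ p ℕ.≟ 0
    ... | yes _ = refl
    ... | no ≢0 = contradiction (≈-small (residue< a) (s≤s z≤n) (≈-trans (≈-sym (residue-≈ a)) h)) ≢0

    δ-no : ∀ {a} → Unit a → δ a ≡ + 0
    δ-no {a} ua with a %ℕ p ℕ.≟ 0
    ... | yes ≡0 = contradiction (≈-trans (residue-≈ a) (≡⇒≈ (cong +_ ≡0))) ua
    ... | no _ = refl

    δ-def : ∀ a → δ a ≡ (if a ≡[ p ]? then + 1 else + 0)
    δ-def a = refl

  δ-equivalent : ∀ {a b} → (a ≈ + 0 [ P ] → b ≈ + 0 [ P ]) → (b ≈ + 0 [ P ] → a ≈ + 0 [ P ]) → δ a ≡ δ b
  δ-equivalent {a} {b} f g with ≈0? a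
  ... | yes h = trans (δ-yes h) (sym (δ-yes (f h)))
  ... | no h = trans (δ-no h) (sym (δ-no (h ∘ g)))

  δ-cong : Periodic δ
  δ-cong a b h = δ-equivalent (≈-trans (≈-sym h)) (≈-trans h)

  δ-neg : ∀ a b → δ (a - b) ≡ δ (b - a)
  δ-neg a b = δ-equivalent (flip a b) (flip b a)
    where
    flip : ∀ a b → a - b ≈ + 0 [ P ] → b - a ≈ + 0 [ P ]
    flip a b h = linear-≈ (- + 1) h (lemma a b)
      where
      lemma : ∀ a b → b - a ≡ + 0 + - + 1 * (a - b - + 0)
      lemma = solve-∀

  ≈⇒-≈0 : ∀ {a b} → a ≈ b [ P ] → a - b ≈ + 0 [ P ]
  ≈⇒-≈0 {a} {b} h = linear-≈ (+ 1) h (lemma a b)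
    where
    lemma : ∀ a b → a - b ≡ + 0 + + 1 * (a - b)
    lemma = solve-∀

  -≈0⇒≈ : ∀ {a b} → a - b ≈ + 0 [ P ] → a ≈ b [ P ]
  -≈0⇒≈ {a} {b} h = linear-≈ (+ 1) h (lemma a b)
    where
    lemma : ∀ a b → a ≡ b + + 1 * (a - b - + 0)
    lemma = solve-∀

  ∑-δ : ∀ f a → Periodic f → ∑ (λ x → δ (x - a) * f x) ≡ f a
  ∑-δ f a per = trans (∑-single (λ x → δ (x - a) * f x) (residue a) (residue< a) λ i i<p i≢ →
      cong (_* f (+ i)) (δ-no λ h → i≢ (≈-small i<p (residue< a) (≈-trans (-≈0⇒≈ {+ i} {a} h) (residue-≈ a)))))
    (trans (cong₂ _*_ (δ-yes (≈⇒-≈0 (≈-sym (residue-≈ a)))) (per _ _ (≈-sym (residue-≈ a)))) (ℤ.*-identityˡ (f a)))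

  ∑-δ1 : ∀ a → ∑ (λ x → δ (x - a)) ≡ + 1
  ∑-δ1 a = trans (∑-ext λ x → sym (ℤ.*-identityʳ (δ (x - a)))) (∑-δ (λ _ → + 1) a (λ _ _ _ → refl))

  ∑-fibres : ∀ (f σ : ℤ → ℤ) → Periodic f → ∑ (λ x → f (σ x)) ≡ ∑ (λ y → ∑ (λ x → δ (y - σ x)) * f y)
  ∑-fibres f σ per = trans (∑-ext λ x → sym (∑-δ f (σ x) per)) (trans (∑-swap λ x y → δ (y - σ x) * f y)
    (∑-ext λ y → ∑-*ʳ (λ x → δ (y - σ x)) (f y)))

  ∑-bijection : ∀ (f σ σ⁻¹ : ℤ → ℤ) → Periodic f → (∀ {a b} → a ≈ b [ P ] → σ a ≈ σ b [ P ]) → (∀ {a b} → a ≈ b [ P ] → σ⁻¹ a ≈ σ⁻¹ b [ P ]) →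
                (∀ x → σ⁻¹ (σ x) ≈ x [ P ]) → (∀ y → σ (σ⁻¹ y) ≈ y [ P ]) → ∑ (λ x → f (σ x)) ≡ ∑ f
  ∑-bijection f σ σ⁻¹ per σ-cong σ⁻¹-cong left right = trans (∑-fibres f σ per) (∑-ext λ y →
    trans (cong (_* f y) (trans (∑-ext λ x → δ-equivalent (to x y) (from x y)) (∑-δ1 (σ⁻¹ y)))) (ℤ.*-identityˡ (f y)))
    where
    to : ∀ x y → y - σ x ≈ + 0 [ P ] → x - σ⁻¹ y ≈ + 0 [ P ]
    to x y h = ≈⇒-≈0 (≈-trans (≈-sym (left x)) (≈-sym (σ⁻¹-cong (-≈0⇒≈ {y} {σ x} h))))
    from : ∀ x y → x - σ⁻¹ y ≈ + 0 [ P ] → y - σ x ≈ + 0 [ P ]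
    from x y h = ≈⇒-≈0 (≈-trans (≈-sym (right y)) (≈-sym (σ-cong (-≈0⇒≈ {x} {σ⁻¹ y} h))))

  ∑-affine : ∀ f c d → Periodic f → Unit c → ∑ (λ x → f (c * x + d)) ≡ ∑ f
  ∑-affine f c d per uc = ∑-bijection f (λ x → c * x + d) (λ y → inv c * (y - d)) per
    (λ {a} {b} h → +-cong-≈ (*-cong-≈ {c} ≈-refl h) (≈-refl {d})) (λ {a} {b} h → *-cong-≈ {inv c} ≈-refl (+-cong-≈ h (≈-refl { - d})))
    (λ x → linear-≈ x (inv-rightₚ uc) (lemma₁ c (inv c) x d)) (λ y → linear-≈ (y - d) (inv-rightₚ uc) (lemma₂ c (inv c) y d))
    where
    lemma₁ : ∀ c i x d → i * (c * x + d - d) ≡ x + x * (c * i - + 1)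
    lemma₁ = solve-∀
    lemma₂ : ∀ c i y d → c * (i * (y - d)) + d ≡ y + (y - d) * (c * i - + 1)
    lemma₂ = solve-∀

  ∑-shift : ∀ f d → Periodic f → ∑ (λ x → f (x + d)) ≡ ∑ f
  ∑-shift f d per = trans (∑-ext λ x → cong (λ y → f (y + d)) (sym (ℤ.*-identityˡ x))) (∑-affine f (+ 1) d per 1-unit)

  inv-involutive : ∀ x → inv (inv x) ≈ x [ P ]
  inv-involutive x with ≈0? x
  ... | yes h = ≈-trans (inv-cong (inv-zero h)) (≈-trans (≡⇒≈ inv-0) (≈-sym h))
  ... | no ux = cancel (inv-unit ux) (≈-trans (inv-rightₚ (inv-unit ux)) (≈-trans (≈-sym (inv-rightₚ ux)) (≡⇒≈ (ℤ.*-comm x (inv x)))))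

  ∑-inv : ∀ f → Periodic f → ∑ (λ x → f (inv x)) ≡ ∑ f
  ∑-inv f per = ∑-bijection f inv inv per inv-cong inv-cong inv-involutive inv-involutive

  -- The quadratic character

  abstract
    -- The quadratic character, defined by counting square roots: point counts then become sums of
    -- `1 + ε` at once, and multiplicativity is recovered from Euler's criterion.
    ε : ℤ → ℤ
    ε a = ∑ (λ y → δ (y * y - a)) - + 1

    ε-def : ∀ a → ε a ≡ ∑ (λ y → δ (y * y - a)) - + 1
    ε-def a = refl

  ε-cong : Periodic ε
  ε-cong a b h = trans (ε-def a) (trans (cong (_- + 1) (∑-ext λ y → δ-cong (y * y - a) (y * y - b) (+-cong-≈ (≈-refl {y * y}) (-‿cong-≈ h)))) (sym (ε-def b)))

  roots : ∀ a → ∑ (λ y → δ (y * y - a)) ≡ + 1 + ε a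
  roots a = trans (lemma (∑ (λ y → δ (y * y - a)))) (cong (_+_ (+ 1)) (sym (ε-def a)))
    where
    lemma : ∀ x → x ≡ + 1 + (x - + 1)
    lemma = solve-∀

  square-zero : ∀ {y} → y * y ≈ + 0 [ P ] → y ≈ + 0 [ P ]
  square-zero {y} h with euclid y y h
  ... | inj₁ h = h
  ... | inj₂ h = h

  ε-zero : ∀ {a} → a ≈ + 0 [ P ] → ε a ≡ + 0
  ε-zero {a} h = trans (ε-cong a (+ 0) h) (trans (ε-def (+ 0)) (cong (_- + 1) (trans (∑-ext λ y → δ-equivalent (to y) (from y)) (∑-δ1 (+ 0)))))
    where
    to : ∀ y → y * y - + 0 ≈ + 0 [ P ] → y - + 0 ≈ + 0 [ P ]
    to y h = ≈⇒-≈0 {y} {+ 0} (square-zero {y} (-≈0⇒≈ {y * y} {+ 0} h))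
    from : ∀ y → y - + 0 ≈ + 0 [ P ] → y * y - + 0 ≈ + 0 [ P ]
    from y h = ≈⇒-≈0 {y * y} {+ 0} (*-cong-≈ {y} {+ 0} {y} {+ 0} (-≈0⇒≈ {y} {+ 0} h) (-≈0⇒≈ {y} {+ 0} h))

  Sign : ℤ → Set
  Sign x = x ≡ + 1 ⊎ x ≡ - + 1

  -- As soon as there is one root `y₀`, `y² - a` factors into `y - y₀` and `y + y₀`, whose roots
  -- differ because `2 y₀` is a unit.
  ε-unit : ∀ {a} → Unit a → Sign (ε a)
  ε-unit {a} ua with ℕ.anyUpTo? (λ y → ≈0? (+ y * + y - a)) p
  ... | no none = inj₂ (trans (ε-def a) (cong (_- + 1) (∑-zero λ i i<p → δ-no λ h → none (i , i<p , h))))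
  ... | yes (y₀ , _ , h₀) = inj₁ (trans (ε-def a) (cong (_- + 1) (trans (∑-ext split) (trans (∑-+ (λ y → δ (y - + y₀)) (λ y → δ (y - - + y₀))) (cong₂ _+_ (∑-δ1 (+ y₀)) (∑-δ1 (- + y₀)))))))
    where
    r = + y₀
    r-unit : Unit r
    r-unit h = ua (≈-trans (≈-sym (-≈0⇒≈ {r * r} {a} h₀)) (*-cong-≈ {r} {+ 0} {r} {+ 0} h h))
    factor : ∀ r y a → y * y - a ≡ (y - r) * (y - - r) + + 1 * (r * r - a - + 0)
    factor = solve-∀
    factor′ : ∀ r y a → (y - r) * (y - - r) ≡ y * y - a + - + 1 * (r * r - a - + 0)
    factor′ = solve-∀
    split : ∀ y → δ (y * y - a) ≡ δ (y - r) + δ (y - - r)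
    split y with ≈0? (y - r) | ≈0? (y - - r)
    ... | yes h | yes h′ = contradiction (linear-≈₂ (+ 1) (- + 1) h′ h (lemma y r)) (Unit-* 2-unit r-unit)
      where
      lemma : ∀ y r → + 2 * r ≡ + 0 + + 1 * (y - - r - + 0) + - + 1 * (y - r - + 0)
      lemma = solve-∀
    ... | yes h | no h′ = trans (δ-yes (≈-trans {_} {(y - r) * (y - - r)} (linear-≈ (+ 1) h₀ (factor r y a)) (*-cong-≈ {_} {+ 0} {y - - r} h ≈-refl))) (sym (cong₂ _+_ (δ-yes h) (δ-no h′)))
    ... | no h | yes h′ = trans (δ-yes (≈-trans {_} {(y - r) * (y - - r)} (linear-≈ (+ 1) h₀ (factor r y a)) (≈-trans (*-cong-≈ {y - r} ≈-refl h′) (≡⇒≈ (ℤ.*-zeroʳ (y - r)))))) (sym (cong₂ _+_ (δ-no h) (δ-yes h′)))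
    ... | no h | no h′ = trans (δ-no λ z → Unit-* h h′ (≈-trans {_} {y * y - a} (linear-≈ (- + 1) h₀ (factor′ r y a)) z)) (sym (cong₂ _+_ (δ-no h) (δ-no h′)))

  ∑ε : ∑ ε ≡ + 0
  ∑ε = begin
    ∑ ε ≡⟨ ∑-ext ε-def ⟩
    ∑ (λ a → ∑ (λ y → δ (y * y - a)) - + 1) ≡⟨ ∑-+ (λ a → ∑ (λ y → δ (y * y - a))) (λ _ → - + 1) ⟩
    ∑ (λ a → ∑ (λ y → δ (y * y - a))) + ∑ (λ _ → - + 1) ≡⟨ cong₂ _+_ (trans (∑-swap λ a y → δ (y * y - a)) (trans (∑-ext λ y → trans (∑-ext λ a → δ-neg (y * y) a) (∑-δ1 (y * y))) (∑-const (+ 1)))) (∑-const (- + 1)) ⟩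
    P * + 1 + P * - + 1 ≡⟨ lemma P ⟩
    + 0 ∎
    where
    open ≡-Reasoning
    lemma : ∀ x → x * + 1 + x * - + 1 ≡ + 0
    lemma = solve-∀

  powerSum-periodic : ∀ n → powerSum (suc (2m ℕ.+ n)) ≈ powerSum (suc n) [ P ]
  powerSum-periodic n = sum-cong-≈ p λ x _ → ≈-trans (≡⇒≈ (ℤ.^-distribˡ-+-* (+ x) p n)) (*-cong-≈ {(+ x) ^ p} {+ x} {(+ x) ^ n} (fermat (+ x)) ≈-refl)

  δ-fermat : ∀ z → δ z ≈ + 1 - z ^ 2m [ P ]
  δ-fermat z with ≈0? z
  ... | yes h = ≈-trans (≡⇒≈ (δ-yes h)) (≈-sym (+-cong-≈ {+ 1} ≈-refl (-‿cong-≈ (≈-trans (^-cong-≈ 2m h) (≡⇒≈ (zero-power 2m 0<2m))))))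
  ... | no uz = ≈-trans (≡⇒≈ (δ-no uz)) (≈-sym (+-cong-≈ {+ 1} ≈-refl (-‿cong-≈ (fermat-unit uz))))

  signPower : ℕ → ℤ
  signPower n = (- + 1) ^ n

  neg-power : ∀ x n → (- x) ^ n ≡ signPower n * x ^ n
  neg-power x n = trans (cong (_^ n) (sym (ℤ.-1*i≡-i x))) (^-distrib-* (- + 1) x n)

  signPower² : ∀ n → signPower n * signPower n ≡ + 1
  signPower² zero = refl
  signPower² (suc n) = trans (lemma (signPower n)) (signPower² n)
    where
    lemma : ∀ x → - + 1 * x * (- + 1 * x) ≡ x * x
    lemma = solve-∀

  binom-sign : ∀ k → k ≤ 2m → binom 2m k ≈ signPower k [ P ]
  binom-sign zero _ = ≡⇒≈ (binom-0 2m)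
  binom-sign (suc k) k< = linear-≈₂ (+ 1) (- + 1) (p∣binom k (s≤s k<)) (binom-sign k (ℕ.<⇒≤ k<)) (trans (lemma (binom 2m k) (binom 2m (suc k)) (signPower k))
      (cong (λ x → - + 1 * signPower k + + 1 * (x - + 0) + - + 1 * (binom 2m k - signPower k)) (sym (pascal 2m k))))
    where
    lemma : ∀ a b s → b ≡ - + 1 * s + + 1 * (a + b - + 0) + - + 1 * (a - s)
    lemma = solve-∀

  -- Replacing `δ z` by `1 - z^(p-1)` turns the count of roots into power sums with exponents `2k`,
  -- `k ≤ 2m`. Modulo `P` only `k = m` and `k = 2m` contribute: the first gives `a^m`, the second
  -- cancels the `1` in the definition of `ε`.
  euler : ∀ a → ε a ≈ a ^ m [ P ]
  euler a with ≈0? a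
  ... | yes h = ≈-trans (≡⇒≈ (ε-zero h)) (≈-sym (≈-trans (^-cong-≈ m h) (≡⇒≈ (zero-power m 0<m))))
  ... | no ua = begin
    ε a ≡⟨ ε-def a ⟩
    ∑ (λ y → δ (y * y - a)) - + 1 ≈⟨ +-cong-≈ (∑-cong-≈ λ y → ≈-trans (δ-fermat (y * y - a)) (expand y)) (≈-refl { - + 1}) ⟩
    ∑ (λ y → + 1 - sum (suc 2m) (λ k → c k * y ^ (k ℕ.+ k))) - + 1
      ≡⟨ cong (_- + 1) (trans (∑-+ (λ _ → + 1) (λ y → - g y)) (cong₂ _+_ (∑-const (+ 1)) (trans (∑-neg g) (cong -_ (trans (∑-sum-swap (suc 2m) (λ y k → c k * y ^ (k ℕ.+ k))) (sum-ext (suc 2m) λ k → trans (∑-*ˡ (c k) (λ y → y ^ (k ℕ.+ k))) (cong (_*_ (c k)) (∑-def (λ y → y ^ (k ℕ.+ k)))))))))) ⟩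
    P * + 1 - sum (suc 2m) (λ k → c k * powerSum (k ℕ.+ k)) - + 1
      ≈⟨ +-cong-≈ (+-cong-≈ P*1≈0 (-‿cong-≈ evaluated)) (≈-refl { - + 1}) ⟩
    + 0 - (- c m - c 2m) - + 1
      ≈⟨ linear-≈₂ (+ 1) (+ 1) cm c2m (lemma′ (c m) (c 2m) (a ^ m)) ⟩
    a ^ m ∎
    where
    open ≈-Reasoning P
    lemma : ∀ x → x * + 1 ≡ + 0 + + 1 * x
    lemma = solve-∀
    lemma′ : ∀ x y z → + 0 - (- x - y) - + 1 ≡ z + + 1 * (x - z) + + 1 * (y - + 1)
    lemma′ = solve-∀
    P*1≈0 : P * + 1 ≈ + 0 [ P ]
    P*1≈0 = by (+ 1) (lemma P)
    i = inv a
    c : ℕ → ℤ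
    c k = binom 2m k * (- i) ^ k
    g : ℤ → ℤ
    g y = sum (suc 2m) (λ k → c k * y ^ (k ℕ.+ k))
    expand : ∀ y → + 1 - (y * y - a) ^ 2m ≈ + 1 - sum (suc 2m) (λ k → c k * y ^ (k ℕ.+ k)) [ P ]
    expand y = +-cong-≈ {+ 1} ≈-refl (-‿cong-≈ (begin
      -- The factor `- a` is taken out to reach the shape `1 + x` of `binomial`; its own power is
      -- `1` by Fermat.
      (y * y - a) ^ 2m ≈⟨ ^-cong-≈ 2m (linear-≈ (- (y * y)) (inv-rightₚ ua) (lemma₁ a i y)) ⟩
      (- a * (+ 1 + - i * (y * y))) ^ 2m ≡⟨ ^-distrib-* (- a) (+ 1 + - i * (y * y)) 2m ⟩
      (- a) ^ 2m * (+ 1 + - i * (y * y)) ^ 2m ≈⟨ *-cong-≈ (fermat-unit -a-unit) (≈-refl {(+ 1 + - i * (y * y)) ^ 2m}) ⟩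
      + 1 * (+ 1 + - i * (y * y)) ^ 2m ≡⟨ trans (ℤ.*-identityˡ _) (binomial (- i * (y * y)) 2m) ⟩
      sum (suc 2m) (λ k → binom 2m k * (- i * (y * y)) ^ k)
        ≡⟨ sum-ext (suc 2m) (λ k → trans (cong (_*_ (binom 2m k)) (trans (^-distrib-* (- i) (y * y) k) (cong (_*_ ((- i) ^ k)) (trans (^-distrib-* y y k) (sym (ℤ.^-distribˡ-+-* y k k)))))) (sym (ℤ.*-assoc (binom 2m k) ((- i) ^ k) (y ^ (k ℕ.+ k))))) ⟩
      sum (suc 2m) (λ k → c k * y ^ (k ℕ.+ k)) ∎))
      where
      lemma₁ : ∀ a i y → y * y - a ≡ - a * (+ 1 + - i * (y * y)) + - (y * y) * (a * i - + 1)
      lemma₁ = solve-∀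
      -a-unit : Unit (- a)
      -a-unit h = ua (≈-trans (≡⇒≈ (sym (ℤ.neg-involutive a))) (-‿cong-≈ h))
    vanishing : ∀ k → k < 2m → k ≢ m → powerSum (k ℕ.+ k) ≈ + 0 [ P ]
    vanishing k k< k≢m with k ℕ.<? m
    ... | yes k<m = powerSum-zero (k ℕ.+ k) (ℕ.+-mono-<-≤ k<m (ℕ.<⇒≤ k<m))
    ... | no k≮m = ≈-trans (≡⇒≈ (cong powerSum (exponent m<k))) (≈-trans (powerSum-periodic r) (powerSum-zero (suc r) r<))
      where
      m<k : m < k
      m<k = ℕ.≤∧≢⇒< (ℕ.≮⇒≥ k≮m) (k≢m ∘ sym)
      r : ℕ
      r = ℕ.pred (k ℕ.+ k ∸ 2m)
      positive : 0 < k ℕ.+ k ∸ (m ℕ.+ m)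
      positive = ℕ.m<n⇒0<n∸m (ℕ.+-mono-<-≤ m<k (ℕ.<⇒≤ m<k))
      sr : suc r ≡ k ℕ.+ k ∸ 2m
      sr = ℕ.suc-pred _ {{ℕ.>-nonZero positive}}
      exponent : m < k → k ℕ.+ k ≡ suc (2m ℕ.+ r)
      exponent _ = trans (sym (ℕ.m+[n∸m]≡n (ℕ.+-mono-≤ (ℕ.<⇒≤ m<k) (ℕ.<⇒≤ m<k)))) (trans (cong (2m ℕ.+_) (sym sr)) (ℕ.+-suc 2m r))
      r< : suc r < 2m
      r< = subst (_< 2m) (sym sr) (ℕ.+-cancelˡ-< 2m _ _ (subst (_< 2m ℕ.+ 2m) (sym (ℕ.m+[n∸m]≡n (ℕ.+-mono-≤ (ℕ.<⇒≤ m<k) (ℕ.<⇒≤ m<k)))) (ℕ.+-mono-<-≤ k< (ℕ.<⇒≤ k<))))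
    evaluated : sum (suc 2m) (λ k → c k * powerSum (k ℕ.+ k)) ≈ - c m - c 2m [ P ]
    evaluated = +-cong-≈
      (≈-trans (sum-cong-≈ 2m pointwise) (≈-trans (≡⇒≈ (sum-single 2m m (λ k → indicator k * - c k) (ℕ.+-monoˡ-≤ m 0<m) λ k _ k≢m → cong (_* - c k) (indicator-≢ k≢m))) (≡⇒≈ (trans (cong (_* - c m) (indicator-≡ m)) (ℤ.*-identityˡ (- c m))))))
      (≈-trans (*-cong-≈ {c 2m} ≈-refl top) (≡⇒≈ (lemma₂ (c 2m))))
      where
      lemma₂ : ∀ x → x * - + 1 ≡ - x
      lemma₂ = solve-∀
      indicator : ℕ → ℤ
      indicator k with k ℕ.≟ m
      ... | yes _ = + 1
      ... | no _ = + 0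
      indicator-≢ : ∀ {k} → k ≢ m → indicator k ≡ + 0
      indicator-≢ {k} k≢m with k ℕ.≟ m
      ... | yes k≡m = contradiction k≡m k≢m
      ... | no _ = refl
      indicator-≡ : ∀ k → indicator m ≡ + 1
      indicator-≡ k with m ℕ.≟ m
      ... | yes _ = refl
      ... | no m≢m = contradiction refl m≢m
      pointwise : ∀ k → k < 2m → c k * powerSum (k ℕ.+ k) ≈ indicator k * - c k [ P ]
      pointwise k k< with k ℕ.≟ m
      ... | yes refl = ≈-trans (*-cong-≈ {c k} ≈-refl powerSum-top) (≡⇒≈ (lemma₃ (c k)))
        where
        lemma₃ : ∀ x → x * - + 1 ≡ + 1 * - x
        lemma₃ = solve-∀
      ... | no k≢m = ≈-trans (*-cong-≈ {c k} ≈-refl (vanishing k k< k≢m)) (≡⇒≈ (ℤ.*-zeroʳ (c k)))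
      top : powerSum (2m ℕ.+ 2m) ≈ - + 1 [ P ]
      top = ≈-trans (≡⇒≈ (cong powerSum exponent)) (≈-trans (powerSum-periodic (ℕ.pred 2m)) (≈-trans (≡⇒≈ (cong powerSum s)) powerSum-top))
        where
        s : suc (ℕ.pred 2m) ≡ 2m
        s = ℕ.suc-pred _ {{ℕ.>-nonZero 0<2m}}
        exponent : 2m ℕ.+ 2m ≡ suc (2m ℕ.+ ℕ.pred 2m)
        exponent = trans (cong (2m ℕ.+_) (sym s)) (ℕ.+-suc 2m _)
    i-power : i ^ 2m ≈ + 1 [ P ]
    i-power = fermat-unit (inv-unit ua)
    c2m : c 2m ≈ + 1 [ P ]
    c2m = ≈-trans (*-cong-≈ (≡⇒≈ {N = P} (binom-n (m ℕ.+ m))) (fermat-unit λ h → inv-unit ua (≈-trans (≡⇒≈ (sym (ℤ.neg-involutive i))) (-‿cong-≈ h)))) ≈-refl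
    cm : c m ≈ a ^ m [ P ]
    cm = begin
      binom 2m m * (- i) ^ m ≈⟨ *-cong-≈ (binom-sign m (ℕ.m≤m+n m m)) (≡⇒≈ (trans (cong (_^ m) (sym (ℤ.-1*i≡-i i))) (^-distrib-* (- + 1) i m))) ⟩
      signPower m * (signPower m * i ^ m) ≡⟨ trans (sym (ℤ.*-assoc (signPower m) (signPower m) (i ^ m))) (trans (cong (_* i ^ m) (signPower² m)) (ℤ.*-identityˡ (i ^ m))) ⟩
      i ^ m ≈⟨ linear-≈₂ (- i ^ m) (a ^ m) (fermat-unit ua) reciprocal (trans (lemma₄ (i ^ m) (a ^ m)) (cong (λ x → a ^ m + - i ^ m * (x - + 1) + a ^ m * (a ^ m * i ^ m - + 1)) (sym (ℤ.^-distribˡ-+-* a m m)))) ⟩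
      a ^ m ∎
      where
      reciprocal : a ^ m * i ^ m ≈ + 1 [ P ]
      reciprocal = ≈-trans (≡⇒≈ (sym (^-distrib-* a i m))) (≈-trans (^-cong-≈ m (inv-rightₚ ua)) (≡⇒≈ (ℤ.^-zeroˡ m)))
      lemma₄ : ∀ i a → i ≡ a + - i * (a * a - + 1) + a * (a * i - + 1)
      lemma₄ = solve-∀

  Trit : ℤ → Set
  Trit x = x ≡ + 0 ⊎ Sign x

  trit-ε : ∀ a → Trit (ε a)
  trit-ε a with ≈0? a
  ... | yes h = inj₁ (ε-zero h)
  ... | no ua = inj₂ (ε-unit ua)

  trit-* : ∀ {x y} → Trit x → Trit y → Trit (x * y)
  trit-* (inj₁ refl) _ = inj₁ refl
  trit-* {x} (inj₂ _) (inj₁ refl) = inj₁ (ℤ.*-zeroʳ x)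
  trit-* (inj₂ (inj₁ refl)) (inj₂ (inj₁ refl)) = inj₂ (inj₁ refl)
  trit-* (inj₂ (inj₁ refl)) (inj₂ (inj₂ refl)) = inj₂ (inj₂ refl)
  trit-* (inj₂ (inj₂ refl)) (inj₂ (inj₁ refl)) = inj₂ (inj₂ refl)
  trit-* (inj₂ (inj₂ refl)) (inj₂ (inj₂ refl)) = inj₂ (inj₁ refl)

  -- Since `p > 2`, the residues of `0`, `1` and `-1` are distinct; this is how congruences such as
  -- Euler's criterion become equalities.
  trit-≈ : ∀ {x y} → Trit x → Trit y → x ≈ y [ P ] → x ≡ y
  trit-≈ (inj₁ refl) (inj₁ refl) h = refl
  trit-≈ (inj₁ refl) (inj₂ (inj₁ refl)) h = contradiction (≈-sym h) 1-unit
  trit-≈ (inj₁ refl) (inj₂ (inj₂ refl)) h = contradiction (-‿cong-≈ (≈-sym h)) 1-unit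
  trit-≈ (inj₂ (inj₁ refl)) (inj₁ refl) h = contradiction h 1-unit
  trit-≈ (inj₂ (inj₁ refl)) (inj₂ (inj₁ refl)) h = refl
  trit-≈ (inj₂ (inj₁ refl)) (inj₂ (inj₂ refl)) h = contradiction (+-cong-≈ h (≈-refl {+ 1})) 2-unit
  trit-≈ (inj₂ (inj₂ refl)) (inj₁ refl) h = contradiction (-‿cong-≈ h) 1-unit
  trit-≈ (inj₂ (inj₂ refl)) (inj₂ (inj₁ refl)) h = contradiction (+-cong-≈ (≈-sym h) (≈-refl {+ 1})) 2-unit
  trit-≈ (inj₂ (inj₂ refl)) (inj₂ (inj₂ refl)) h = refl

  ε-* : ∀ a b → ε (a * b) ≡ ε a * ε b
  ε-* a b = trit-≈ (trit-ε (a * b)) (trit-* (trit-ε a) (trit-ε b))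
    (≈-trans (euler (a * b)) (≈-trans (≡⇒≈ (^-distrib-* a b m)) (≈-sym (*-cong-≈ (euler a) (euler b)))))

  sign-square : ∀ {x} → Sign x → x * x ≡ + 1
  sign-square (inj₁ refl) = refl
  sign-square (inj₂ refl) = refl

  ε-1 : ε (+ 1) ≡ + 1
  ε-1 = trit-≈ (trit-ε (+ 1)) (inj₂ (inj₁ refl)) (≈-trans (euler (+ 1)) (≡⇒≈ (ℤ.^-zeroˡ m)))

  ε² : ∀ {a} → Unit a → ε a * ε a ≡ + 1
  ε² ua = sign-square (ε-unit ua)

  ε-square : ∀ {a} → Unit a → ε (a * a) ≡ + 1
  ε-square {a} ua = trans (ε-* a a) (ε² ua)

  ε-square* : ∀ {a} b → Unit a → ε (a * a * b) ≡ ε b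
  ε-square* {a} b ua = trans (ε-* (a * a) b) (trans (cong (_* ε b) (ε-square ua)) (ℤ.*-identityˡ (ε b)))

-- Character sums of quadratics and cubics: second moments and two-isogenies

module Moments (m : ℕ) (pr : Prime (suc (m ℕ.+ m))) where
  open PrimeField m pr
  open CharacterSums m pr
  open ≡-Reasoning

  ε-inv : ∀ a → ε (inv a) ≡ ε a
  ε-inv a with ≈0? a
  ... | yes h = trans (ε-zero (inv-zero h)) (sym (ε-zero h))
  ... | no ua = begin
    ε (inv a) ≡⟨ sym (ℤ.*-identityˡ (ε (inv a))) ⟩
    + 1 * ε (inv a) ≡⟨ cong (_* ε (inv a)) (sym (ε² ua)) ⟩
    ε a * ε a * ε (inv a) ≡⟨ ℤ.*-assoc (ε a) (ε a) (ε (inv a)) ⟩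
    ε a * (ε a * ε (inv a)) ≡⟨ cong (_*_ (ε a)) (trans (sym (ε-* a (inv a))) (trans (ε-cong _ _ (inv-rightₚ ua)) ε-1)) ⟩
    ε a * + 1 ≡⟨ ℤ.*-identityʳ (ε a) ⟩
    ε a ∎

  ε²-δ : ∀ a → ε a * ε a ≡ + 1 - δ a
  ε²-δ a with ≈0? a
  ... | yes h = trans (cong₂ _*_ (ε-zero h) (ε-zero h)) (sym (cong (_-_ (+ 1)) (δ-yes h)))
  ... | no ua = trans (ε² ua) (sym (cong (_-_ (+ 1)) (δ-no ua)))

  ∑-1-δ : ∀ a → ∑ (λ x → + 1 - δ (x - a)) ≡ P - + 1
  ∑-1-δ a = trans (∑-+ (λ _ → + 1) (λ x → - δ (x - a))) (cong₂ _+_ ∑-1 (trans (∑-neg (λ x → δ (x - a))) (cong -_ (∑-δ1 a))))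

  ∑-δ0 : ∑ δ ≡ + 1
  ∑-δ0 = trans (∑-ext λ x → cong δ (sym (ℤ.+-identityʳ x))) (∑-δ1 (+ 0))

  neg-unit : ∀ {a} → Unit a → Unit (- a)
  neg-unit {a} ua h = ua (≈-trans (≡⇒≈ (sym (ℤ.neg-involutive a))) (-‿cong-≈ h))

  -- After a shift the summand is `ε (x * (x + d))`, and for `x ≠ 0` division by `x²` makes it
  -- `ε (1 + d / x)`. With `x` also `inv x` runs through all residues; the value `ε 1` that this
  -- adds at `x = 0` is what `δ x` takes away.
  quadraticSum : ∀ s t → ∑ (λ x → ε ((x - s) * (x - t))) ≡ P * δ (s - t) - + 1
  quadraticSum s t with ≈0? (s - t)
  ... | yes h = begin
    ∑ (λ x → ε ((x - s) * (x - t))) ≡⟨ ∑-ext (λ x → trans (ε-cong _ _ (*-cong-≈ {x - s} ≈-refl (+-cong-≈ (≈-refl {x}) (-‿cong-≈ (≈-sym (-≈0⇒≈ h)))))) (trans (ε-* (x - s) (x - s)) (ε²-δ (x - s)))) ⟩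
    ∑ (λ x → + 1 - δ (x - s)) ≡⟨ ∑-1-δ s ⟩
    P - + 1 ≡⟨ cong (_- + 1) (sym (trans (cong (_*_ P) (δ-yes h)) (ℤ.*-identityʳ P))) ⟩
    P * δ (s - t) - + 1 ∎
  ... | no ud = begin
    ∑ (λ x → ε ((x - s) * (x - t))) ≡⟨ sym (∑-shift (λ x → ε ((x - s) * (x - t))) s (λ a b h → ε-cong _ _ (*-cong-≈ (+-cong-≈ h (≈-refl { - s})) (+-cong-≈ h (≈-refl { - t}))))) ⟩
    ∑ (λ x → ε ((x + s - s) * (x + s - t))) ≡⟨ ∑-ext (λ x → trans (cong ε (lemma x s t)) (term x)) ⟩
    ∑ (λ x → ε (d * inv x + + 1) - δ x) ≡⟨ trans (∑-+ (λ x → ε (d * inv x + + 1)) (λ x → - δ x)) (cong₂ _+_ first (trans (∑-neg δ) (cong -_ ∑-δ0))) ⟩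
    + 0 - + 1 ≡⟨ cong (_- + 1) (sym (trans (cong (_*_ P) (δ-no ud)) (ℤ.*-zeroʳ P))) ⟩
    P * δ (s - t) - + 1 ∎
    where
    d = s - t
    lemma : ∀ x s t → (x + s - s) * (x + s - t) ≡ x * (x + (s - t))
    lemma = solve-∀
    lemma₁ : ∀ x d i → x * (x + d) ≡ x * x * (d * i + + 1) + - (x * d) * (x * i - + 1)
    lemma₁ = solve-∀
    term : ∀ x → ε (x * (x + d)) ≡ ε (d * inv x + + 1) - δ x
    term x with ≈0? x
    ... | yes h = trans (ε-zero (*-cong-≈ {_} {+ 0} {x + d} h ≈-refl)) (sym (cong₂ _-_ (trans (ε-cong _ _ (+-cong-≈ (≈-trans (*-cong-≈ {d} ≈-refl (inv-zero h)) (≡⇒≈ (ℤ.*-zeroʳ d))) (≈-refl {+ 1}))) ε-1) (δ-yes h)))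
    ... | no ux = trans (ε-cong _ _ (linear-≈ (- (x * d)) (inv-rightₚ ux) (lemma₁ x d (inv x)))) (trans (ε-square* (d * inv x + + 1) ux) (sym (trans (cong (_-_ (ε (d * inv x + + 1))) (δ-no ux)) (ℤ.+-identityʳ _))))
    first : ∑ (λ x → ε (d * inv x + + 1)) ≡ + 0
    first = trans (∑-inv (λ y → ε (d * y + + 1)) (λ a b h → ε-cong _ _ (+-cong-≈ (*-cong-≈ {d} ≈-refl h) (≈-refl {+ 1})))) (trans (∑-affine ε d (+ 1) ε-cong ud) ∑ε)

  ∑ε-linear : ∀ s → ∑ (λ x → ε (x - s)) ≡ + 0
  ∑ε-linear s = trans (∑-shift ε (- s) ε-cong) ∑ε

  -- Once the square is opened, summing over `l` first leaves a `quadraticSum` for each pair `g x`,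
  -- `g y`, so that only the collisions of `g` remain to be counted.
  secondMoment : ∀ (c g : ℤ → ℤ) → ∑ (λ l → ∑ (λ x → c x * ε (l - g x)) * ∑ (λ x → c x * ε (l - g x)))
                       ≡ P * ∑ (λ x → ∑ (λ y → c x * c y * δ (g x - g y))) - ∑ c * ∑ c
  secondMoment c g = begin
    ∑ (λ l → ∑ (λ x → c x * ε (l - g x)) * ∑ (λ x → c x * ε (l - g x)))
      ≡⟨ ∑-ext (λ l → trans (∑-product (λ x → c x * ε (l - g x)) (λ x → c x * ε (l - g x))) (∑-ext λ x → ∑-ext λ y →
           trans (lemma₁ (c x) (ε (l - g x)) (c y) (ε (l - g y))) (cong (_*_ (c x * c y)) (sym (ε-* (l - g x) (l - g y)))))) ⟩
    ∑ (λ l → ∑ (λ x → ∑ (λ y → c x * c y * ε ((l - g x) * (l - g y)))))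
      ≡⟨ trans (∑-swap (λ l x → ∑ (λ y → c x * c y * ε ((l - g x) * (l - g y))))) (∑-ext λ x → ∑-swap (λ l y → c x * c y * ε ((l - g x) * (l - g y)))) ⟩
    ∑ (λ x → ∑ (λ y → ∑ (λ l → c x * c y * ε ((l - g x) * (l - g y)))))
      ≡⟨ ∑-ext (λ x → ∑-ext λ y → trans (∑-*ˡ (c x * c y) (λ l → ε ((l - g x) * (l - g y)))) (trans (cong (_*_ (c x * c y)) (quadraticSum (g x) (g y))) (lemma₂ (c x) (c y) P (δ (g x - g y))))) ⟩
    ∑ (λ x → ∑ (λ y → P * (c x * c y * δ (g x - g y)) + - (c x * c y)))
      ≡⟨ ∑-ext (λ x → trans (∑-+ (λ y → P * (c x * c y * δ (g x - g y))) (λ y → - (c x * c y))) (cong₂ _+_ (∑-*ˡ P (λ y → c x * c y * δ (g x - g y))) (∑-neg (λ y → c x * c y)))) ⟩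
    ∑ (λ x → P * ∑ (λ y → c x * c y * δ (g x - g y)) + - ∑ (λ y → c x * c y))
      ≡⟨ trans (∑-+ (λ x → P * ∑ (λ y → c x * c y * δ (g x - g y))) (λ x → - ∑ (λ y → c x * c y))) (cong₂ _+_ (∑-*ˡ P (λ x → ∑ (λ y → c x * c y * δ (g x - g y)))) (trans (∑-neg (λ x → ∑ (λ y → c x * c y))) (cong -_ (sym (∑-product c c))))) ⟩
    P * ∑ (λ x → ∑ (λ y → c x * c y * δ (g x - g y))) - ∑ c * ∑ c ∎
    where
    lemma₁ : ∀ a b c d → a * b * (c * d) ≡ a * c * (b * d)
    lemma₁ = solve-∀
    lemma₂ : ∀ a b P d → a * b * (P * d - + 1) ≡ P * (a * b * d) + - (a * b)
    lemma₂ = solve-∀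

  4-unit : Unit (+ 2 * + 2)
  4-unit = Unit-* 2-unit 2-unit

  rootsQuadratic : ∀ z b → ∑ (λ x → δ (x * x - z * x + b)) ≡ + 1 + ε (z * z - + 4 * b)
  rootsQuadratic z b = trans (∑-ext λ x → δ-equivalent (to x) (from x))
    (trans (∑-affine (λ y → δ (y * y - (z * z - + 4 * b))) (+ 2) (- z) (λ a b′ h → δ-cong _ _ (+-cong-≈ (*-cong-≈ h h) (≈-refl { - (z * z - + 4 * b)}))) 2-unit) (roots (z * z - + 4 * b)))
    where
    lemma : ∀ x z b → (+ 2 * x + - z) * (+ 2 * x + - z) - (z * z - + 4 * b) ≡ + 2 * + 2 * (x * x - z * x + b)
    lemma = solve-∀
    to : ∀ x → x * x - z * x + b ≈ + 0 [ P ] → (+ 2 * x + - z) * (+ 2 * x + - z) - (z * z - + 4 * b) ≈ + 0 [ P ]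
    to x h = ≈-trans (≡⇒≈ (lemma x z b)) (*-cong-≈ {+ 2 * + 2} ≈-refl h)
    from : ∀ x → (+ 2 * x + - z) * (+ 2 * x + - z) - (z * z - + 4 * b) ≈ + 0 [ P ] → x * x - z * x + b ≈ + 0 [ P ]
    from x h = cancel {_} {+ 0} 4-unit (≈-trans (≡⇒≈ (sym (lemma x z b))) h)

  -- Both sides count points on a curve and on its quotient by a point of order two.
  isogeny : ∀ a b → Unit b → ∑ (λ x → ε (x * (x * x + a * x + b))) ≡ ∑ (λ z → ε (z * (z * z - + 2 * a * z + (a * a - + 4 * b))))
  isogeny a b ub = begin
    ∑ (λ x → ε (x * (x * x + a * x + b))) ≡⟨ ∑-ext term ⟩
    ∑ (λ x → ∑ (λ z → δ (x * x - z * x + b) * ε (z + a))) ≡⟨ ∑-swap (λ x z → δ (x * x - z * x + b) * ε (z + a)) ⟩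
    ∑ (λ z → ∑ (λ x → δ (x * x - z * x + b) * ε (z + a))) ≡⟨ ∑-ext (λ z → trans (∑-*ʳ (λ x → δ (x * x - z * x + b)) (ε (z + a))) (trans (cong (_* ε (z + a)) (rootsQuadratic z b)) (trans (lemma₁ (ε (z * z - + 4 * b)) (ε (z + a))) (cong (_+_ (ε (z + a))) (sym (ε-* (z + a) (z * z - + 4 * b))))))) ⟩
    ∑ (λ z → ε (z + a) + ε ((z + a) * (z * z - + 4 * b))) ≡⟨ trans (∑-+ (λ z → ε (z + a)) (λ z → ε ((z + a) * (z * z - + 4 * b)))) (cong (_+ ∑ (λ z → ε ((z + a) * (z * z - + 4 * b)))) (trans (∑-shift ε a ε-cong) ∑ε)) ⟩
    + 0 + ∑ (λ z → ε ((z + a) * (z * z - + 4 * b))) ≡⟨ ℤ.+-identityˡ _ ⟩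
    ∑ (λ z → ε ((z + a) * (z * z - + 4 * b))) ≡⟨ sym (∑-shift (λ z → ε ((z + a) * (z * z - + 4 * b))) (- a) (λ x y h → ε-cong _ _ (*-cong-≈ (+-cong-≈ h (≈-refl {a})) (+-cong-≈ (*-cong-≈ h h) (≈-refl { - (+ 4 * b)}))))) ⟩
    ∑ (λ z → ε ((z + - a + a) * ((z + - a) * (z + - a) - + 4 * b))) ≡⟨ ∑-ext (λ z → cong ε (lemma₂ z a b)) ⟩
    ∑ (λ z → ε (z * (z * z - + 2 * a * z + (a * a - + 4 * b)))) ∎
    where
    lemma₁ : ∀ d c → (+ 1 + d) * c ≡ c + c * d
    lemma₁ = solve-∀
    lemma₂ : ∀ z a b → (z + - a + a) * ((z + - a) * (z + - a) - + 4 * b) ≡ z * (z * z - + 2 * a * z + (a * a - + 4 * b))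
    lemma₂ = solve-∀
    term : ∀ x → ε (x * (x * x + a * x + b)) ≡ ∑ (λ z → δ (x * x - z * x + b) * ε (z + a))
    term x with ≈0? x
    ... | yes h = trans (ε-zero (*-cong-≈ {_} {+ 0} {x * x + a * x + b} h ≈-refl)) (sym (trans (∑-ext λ z → cong (_* ε (z + a)) (δ-no λ e → ub (linear-≈₂ (+ 1) (z - x) e h (lemma₃ x z b)))) (trans (∑-const (+ 0)) (ℤ.*-zeroʳ P))))
      where
      lemma₃ : ∀ x z b → b ≡ + 0 + + 1 * (x * x - z * x + b - + 0) + (z - x) * (x - + 0)
      lemma₃ = solve-∀
    ... | no ux = begin
      ε (x * (x * x + a * x + b)) ≡⟨ ε-cong _ _ (linear-≈ (- (x * b)) (inv-rightₚ ux) (lemma₄ x a b i)) ⟩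
      -- Up to the square, the summand depends on `x` only through `z = x + b / x`, the coordinate
      -- on the quotient by `x ↦ b / x`.
      ε (x * x * (x + b * i + a)) ≡⟨ ε-square* (x + b * i + a) ux ⟩
      ε (x + b * i + a) ≡⟨ sym (∑-δ (λ z → ε (z + a)) (x + b * i) (λ y z h → ε-cong _ _ (+-cong-≈ h (≈-refl {a})))) ⟩
      ∑ (λ z → δ (z - (x + b * i)) * ε (z + a)) ≡⟨ ∑-ext (λ z → cong (_* ε (z + a)) (δ-equivalent (to z) (from z))) ⟩
      ∑ (λ z → δ (x * x - z * x + b) * ε (z + a)) ∎
      where
      i = inv x
      lemma₄ : ∀ x a b i → x * (x * x + a * x + b) ≡ x * x * (x + b * i + a) + - (x * b) * (x * i - + 1)
      lemma₄ = solve-∀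
      lemma₅ : ∀ x z b i → x * x - z * x + b ≡ + 0 + - x * (z - (x + b * i) - + 0) + - b * (x * i - + 1)
      lemma₅ = solve-∀
      lemma₆ : ∀ x z b i → x * (z - (x + b * i)) ≡ x * + 0 + - + 1 * (x * x - z * x + b - + 0) + - b * (x * i - + 1)
      lemma₆ = solve-∀
      to : ∀ z → z - (x + b * i) ≈ + 0 [ P ] → x * x - z * x + b ≈ + 0 [ P ]
      to z h = linear-≈₂ (- x) (- b) h (inv-rightₚ ux) (lemma₅ x z b i)
      from : ∀ z → x * x - z * x + b ≈ + 0 [ P ] → z - (x + b * i) ≈ + 0 [ P ]
      from z h = cancel ux (linear-≈₂ (- + 1) (- b) h (inv-rightₚ ux) (lemma₆ x z b i))

  ∑-scale : ∀ f c → Periodic f → Unit c → ∑ (λ x → f (c * x)) ≡ ∑ f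
  ∑-scale f c per uc = trans (∑-ext λ x → cong f (sym (ℤ.+-identityʳ (c * x)))) (∑-affine f c (+ 0) per uc)

  cubic-periodic : ∀ a b → Periodic (λ x → ε (x * (x * x + a * x + b)))
  cubic-periodic a b x y h = ε-cong _ _ (*-cong-≈ h (+-cong-≈ (+-cong-≈ (*-cong-≈ h h) (*-cong-≈ {a} ≈-refl h)) (≈-refl {b})))

  -- The families of cubics

  -- `L` is the Legendre family, `M` the family whose nonzero roots have product `1`, and `A` the
  -- family to which the curves `Ecubic k` lead, with `w = 1 + k²`. Up to sign `L l` is
  -- `M ((l + 1) / (l - 1))` for `l ≠ 1`, and `A (s²)` is `M s` for `s ≠ 0`.
  L M A : ℤ → ℤ
  L l = ∑ (λ t → ε (t * (+ 1 - t) * (l - t)))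
  M s = ∑ (λ x → ε (x * (x * x + - (+ 2 * s) * x + + 1)))
  A w = ∑ (λ t → ε (t * (t * t + - (+ 2 * w) * t + w)))

  L-periodic : Periodic L
  L-periodic a b h = ∑-ext λ t → ε-cong _ _ (*-cong-≈ {t * (+ 1 - t)} ≈-refl (+-cong-≈ h (≈-refl { - t})))

  M-periodic : Periodic M
  M-periodic a b h = ∑-ext λ x → ε-cong _ _ (*-cong-≈ {x} ≈-refl (+-cong-≈ (+-cong-≈ (≈-refl {x * x}) (*-cong-≈ (-‿cong-≈ (*-cong-≈ {+ 2} ≈-refl h)) (≈-refl {x}))) (≈-refl {+ 1})))

  A-periodic : Periodic A
  A-periodic a b h = ∑-ext λ t → ε-cong _ _ (*-cong-≈ {t} ≈-refl (+-cong-≈ (+-cong-≈ (≈-refl {t * t}) (*-cong-≈ (-‿cong-≈ (*-cong-≈ {+ 2} ≈-refl h)) (≈-refl {t}))) h))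

  -- The curves `Fcubic k` written through `l = k²`: the roots `(k - 1)²` and `(k + 1)²` have sum
  -- `2 (l + 1)` and product `(l - 1)²`.
  legendre : ℤ → ℤ
  legendre l = ∑ (λ x → ε (x * (x * x + - (+ 2 * (l + + 1)) * x + (l - + 1) * (l - + 1))))

  -- Here `a² - 4b = 16 l`, so the isogenous cubic is `z (z + 4)(z + 4l)`. Putting `z = -4t` brings
  -- it to Legendre form; of the factor `-64` only the sign survives.
  legendre-L : ∀ l → Unit (l - + 1) → legendre l ≡ ε (- + 1) * L l
  legendre-L l ud = begin
    legendre l ≡⟨ isogeny (- (+ 2 * (l + + 1))) ((l - + 1) * (l - + 1)) (Unit-* ud ud) ⟩
    ∑ (λ z → ε (z * (z * z - + 2 * a * z + c))) ≡⟨ sym (∑-scale (λ z → ε (z * (z * z - + 2 * a * z + c))) (- (+ 2 * + 2))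
                                                        (λ x y h → ε-cong _ _ (*-cong-≈ h (+-cong-≈ (+-cong-≈ (*-cong-≈ h h) (-‿cong-≈ (*-cong-≈ {+ 2 * a} ≈-refl h))) (≈-refl {c})))) (neg-unit 4-unit)) ⟩
    ∑ (λ t → ε (- (+ 2 * + 2) * t * (- (+ 2 * + 2) * t * (- (+ 2 * + 2) * t) - + 2 * a * (- (+ 2 * + 2) * t) + c)))
      ≡⟨ ∑-ext (λ t → trans (cong ε (lemma l t)) (trans (ε-square* (- + 1 * (t * (+ 1 - t) * (l - t))) (Unit-* 4-unit 2-unit)) (ε-* (- + 1) (t * (+ 1 - t) * (l - t))))) ⟩
    ∑ (λ t → ε (- + 1) * ε (t * (+ 1 - t) * (l - t))) ≡⟨ ∑-*ˡ (ε (- + 1)) _ ⟩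
    ε (- + 1) * L l ∎
    where
    a = - (+ 2 * (l + + 1))
    c = a * a - + 4 * ((l - + 1) * (l - + 1))
    lemma : ∀ l t → - (+ 2 * + 2) * t * (- (+ 2 * + 2) * t * (- (+ 2 * + 2) * t) - + 2 * - (+ 2 * (l + + 1)) * (- (+ 2 * + 2) * t)
                    + (- (+ 2 * (l + + 1)) * - (+ 2 * (l + + 1)) - + 4 * ((l - + 1) * (l - + 1))))
                  ≡ + 2 * + 2 * + 2 * (+ 2 * + 2 * + 2) * (- + 1 * (t * (+ 1 - t) * (l - t)))
    lemma = solve-∀

  legendre-M : ∀ l → Unit (l - + 1) → legendre l ≡ ε (l - + 1) * M ((l + + 1) * inv (l - + 1))
  legendre-M l ud = begin
    legendre l ≡⟨ sym (∑-scale (λ x → ε (x * (x * x + - (+ 2 * (l + + 1)) * x + d * d))) d (cubic-periodic (- (+ 2 * (l + + 1))) (d * d)) ud) ⟩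
    ∑ (λ y → ε (d * y * (d * y * (d * y) + - (+ 2 * (l + + 1)) * (d * y) + d * d)))
      ≡⟨ ∑-ext (λ y → trans (ε-cong _ _ (linear-≈ (+ 2 * (d * d) * (l + + 1) * y * y) (inv-rightₚ ud) (lemma d (inv d) (l + + 1) y)))
           (trans (ε-square* (d * (y * (y * y + - (+ 2 * s) * y + + 1))) ud) (ε-* d (y * (y * y + - (+ 2 * s) * y + + 1))))) ⟩
    ∑ (λ y → ε d * ε (y * (y * y + - (+ 2 * s) * y + + 1))) ≡⟨ ∑-*ˡ (ε d) _ ⟩
    ε d * M s ∎
    where
    d = l - + 1
    s = (l + + 1) * inv d
    lemma : ∀ d i e y → d * y * (d * y * (d * y) + - (+ 2 * e) * (d * y) + d * d)
                      ≡ d * d * (d * (y * (y * y + - (+ 2 * (e * i)) * y + + 1))) + + 2 * (d * d) * e * y * y * (d * i - + 1)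
    lemma = solve-∀

  -- The relations between the families hold up to a value of the quadratic character, which
  -- disappears on squaring.
  sign-cancel : ∀ {s t x y} → Sign s → Sign t → s * x ≡ t * y → x * x ≡ y * y
  sign-cancel {s} {t} {x} {y} hs ht h = begin
    x * x ≡⟨ sym (ℤ.*-identityˡ (x * x)) ⟩
    + 1 * (x * x) ≡⟨ cong (_* (x * x)) (sym (sign-square hs)) ⟩
    s * s * (x * x) ≡⟨ lemma s x ⟩
    s * x * (s * x) ≡⟨ cong₂ _*_ h h ⟩
    t * y * (t * y) ≡⟨ sym (lemma t y) ⟩
    t * t * (y * y) ≡⟨ cong (_* (y * y)) (sign-square ht) ⟩
    + 1 * (y * y) ≡⟨ ℤ.*-identityˡ (y * y) ⟩
    y * y ∎
    where
    lemma : ∀ s x → s * s * (x * x) ≡ s * x * (s * x)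
    lemma = solve-∀

  -1-unit : Unit (- + 1)
  -1-unit = neg-unit 1-unit

  L²≡M² : ∀ l → Unit (l - + 1) → L l * L l ≡ M ((l + + 1) * inv (l - + 1)) * M ((l + + 1) * inv (l - + 1))
  L²≡M² l ud = sign-cancel (ε-unit -1-unit) (ε-unit ud) (trans (sym (legendre-L l ud)) (legendre-M l ud))

  A²≡M² : ∀ s → Unit s → A (s * s) * A (s * s) ≡ M s * M s
  A²≡M² s us = sign-cancel (inj₁ refl) (ε-unit us) (trans (ℤ.*-identityˡ (A (s * s))) (begin
    A (s * s) ≡⟨ sym (∑-scale (λ t → ε (t * (t * t + - (+ 2 * (s * s)) * t + s * s))) s (cubic-periodic (- (+ 2 * (s * s))) (s * s)) us) ⟩
    ∑ (λ y → ε (s * y * (s * y * (s * y) + - (+ 2 * (s * s)) * (s * y) + s * s)))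
      ≡⟨ ∑-ext (λ y → trans (cong ε (lemma s y)) (trans (ε-square* (s * (y * (y * y + - (+ 2 * s) * y + + 1))) us) (ε-* s (y * (y * y + - (+ 2 * s) * y + + 1))))) ⟩
    ∑ (λ y → ε s * ε (y * (y * y + - (+ 2 * s) * y + + 1))) ≡⟨ ∑-*ˡ (ε s) _ ⟩
    ε s * M s ∎))
    where
    lemma : ∀ s y → s * y * (s * y * (s * y) + - (+ 2 * (s * s)) * (s * y) + s * s) ≡ s * s * (s * (y * (y * y + - (+ 2 * s) * y + + 1)))
    lemma = solve-∀

  A-0 : ∀ {w} → w ≈ + 0 [ P ] → A w ≡ + 0
  A-0 {w} h = trans (A-periodic w (+ 0) h) (trans (∑-ext term) ∑ε)
    where
    lemma : ∀ t → t * (t * t + - (+ 2 * + 0) * t + + 0) ≡ t * t * t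
    lemma = solve-∀
    term : ∀ t → ε (t * (t * t + - (+ 2 * + 0) * t + + 0)) ≡ ε t
    term t with ≈0? t
    ... | yes h = trans (ε-zero (*-cong-≈ {_} {+ 0} {t * t + - (+ 2 * + 0) * t + + 0} h ≈-refl)) (sym (ε-zero h))
    ... | no ut = trans (cong ε (lemma t)) (ε-square* t ut)

  -- The parameter on the right is `w / (w - 1)`. The two-isogeny gives the quadratic factor
  -- `z² + 4wz + 4w(w - 1)`, and `z = -2(w - 1) t` brings it back to the shape of `A`.
  A²-involution : ∀ w → Unit (w - + 1) → A w * A w ≡ A (inv (w - + 1) + + 1) * A (inv (w - + 1) + + 1)
  A²-involution w ud with ≈0? w
  ... | yes h = trans (cong₂ _*_ (A-0 h) (A-0 h)) (sym (cong₂ _*_ (A-0 h′) (A-0 h′)))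
    where
    lemma : ∀ w i → i + + 1 ≡ + 0 + i * (w - + 0) + - + 1 * ((w - + 1) * i - + 1)
    lemma = solve-∀
    h′ : inv (w - + 1) + + 1 ≈ + 0 [ P ]
    h′ = linear-≈₂ (inv (w - + 1)) (- + 1) h (inv-rightₚ ud) (lemma w (inv (w - + 1)))
  ... | no uw = sign-cancel (inj₁ refl) (ε-unit uc) (trans (ℤ.*-identityˡ (A w)) (begin
    A w ≡⟨ isogeny a w uw ⟩
    ∑ (λ z → ε (z * (z * z - + 2 * a * z + (a * a - + 4 * w))))
      ≡⟨ sym (∑-scale (λ z → ε (z * (z * z - + 2 * a * z + (a * a - + 4 * w)))) c
           (λ x y h → ε-cong _ _ (*-cong-≈ h (+-cong-≈ (+-cong-≈ (*-cong-≈ h h) (-‿cong-≈ (*-cong-≈ {+ 2 * a} ≈-refl h))) (≈-refl {a * a - + 4 * w})))) uc) ⟩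
    ∑ (λ t → ε (c * t * (c * t * (c * t) - + 2 * a * (c * t) + (a * a - + 4 * w))))
      ≡⟨ ∑-ext (λ t → trans (ε-cong _ _ (linear-≈ (+ 2 * c * c * t * (+ 1 - + 2 * t)) (inv-rightₚ ud) (lemma w t (inv (w - + 1)))))
           (trans (ε-square* (c * (t * (t * t + - (+ 2 * w′) * t + w′))) uc) (ε-* c (t * (t * t + - (+ 2 * w′) * t + w′))))) ⟩
    ∑ (λ t → ε c * ε (t * (t * t + - (+ 2 * w′) * t + w′))) ≡⟨ ∑-*ˡ (ε c) _ ⟩
    ε c * A w′ ∎))
    where
    a = - (+ 2 * w)
    c = - + 2 * (w - + 1)
    w′ = inv (w - + 1) + + 1
    uc : Unit c
    uc = Unit-* (neg-unit 2-unit) ud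
    lemma : ∀ w t i → let d = w - + 1
                          c = - + 2 * d
                          a = - (+ 2 * w)
                          v = i + + 1 in
      c * t * (c * t * (c * t) - + 2 * a * (c * t) + (a * a - + 4 * w)) ≡ c * c * (c * (t * (t * t + - (+ 2 * v) * t + v))) + + 2 * c * c * t * (+ 1 - + 2 * t) * (d * i - + 1)
    lemma = solve-∀

-- Second moments of the three families

module FamilySums (m : ℕ) (pr : Prime (suc (m ℕ.+ m))) where
  open PrimeField m pr
  open CharacterSums m pr
  open Moments m pr
  open ≡-Reasoning

  ∑-- : ∀ f g → ∑ (λ x → f x - g x) ≡ ∑ f - ∑ g
  ∑-- f g = trans (∑-+ f (λ x → - g x)) (cong (_+_ (∑ f)) (∑-neg g))

  δ-zero : ∀ x → δ (x - + 0) ≡ δ x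
  δ-zero x = cong δ (ℤ.+-identityʳ x)

  δ-* : ∀ a b → ¬ (a ≈ + 0 [ P ] × b ≈ + 0 [ P ]) → δ (a * b) ≡ δ a + δ b
  δ-* a b disjoint with ≈0? a | ≈0? b
  ... | yes h | yes k = contradiction (h , k) disjoint
  ... | yes h | no ub = trans (δ-yes (*-cong-≈ {_} {+ 0} {b} h ≈-refl)) (sym (cong₂ _+_ (δ-yes h) (δ-no ub)))
  ... | no ua | yes k = trans (δ-yes (≈-trans (*-cong-≈ {a} ≈-refl k) (≡⇒≈ (ℤ.*-zeroʳ a)))) (sym (cong₂ _+_ (δ-no ua) (δ-yes k)))
  ... | no ua | no ub = trans (δ-no (Unit-* ua ub)) (sym (cong₂ _+_ (δ-no ua) (δ-no ub)))

  δ-or : ∀ a b → δ (a * b) ≡ δ a + δ b - δ a * δ b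
  δ-or a b with ≈0? a | ≈0? b
  ... | yes h | k? = trans (δ-yes (*-cong-≈ {_} {+ 0} {b} h ≈-refl)) (sym (trans (cong (λ d → d + δ b - d * δ b) (δ-yes h)) (lemma (δ b))))
    where
    lemma : ∀ d → + 1 + d - + 1 * d ≡ + 1
    lemma = solve-∀
  ... | no ua | yes k = trans (δ-yes (≈-trans (*-cong-≈ {a} ≈-refl k) (≡⇒≈ (ℤ.*-zeroʳ a)))) (sym (cong₂ (λ d e → d + e - d * e) (δ-no ua) (δ-yes k)))
  ... | no ua | no ub = trans (δ-no (Unit-* ua ub)) (sym (cong₂ (λ d e → d + e - d * e) (δ-no ua) (δ-no ub)))

  δ-associate : ∀ {a b} c → Unit c → c * a ≈ b [ P ] → δ a ≡ δ b
  δ-associate {a} {b} c uc h = δ-equivalent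
    (λ a≈0 → ≈-trans (≈-sym h) (≈-trans (*-cong-≈ {c} ≈-refl a≈0) (≡⇒≈ (ℤ.*-zeroʳ c))))
    (λ b≈0 → cancel {a} {+ 0} {c} uc (≈-trans h (≈-trans b≈0 (≡⇒≈ (sym (ℤ.*-zeroʳ c))))))

  δ*-substitute : ∀ f x a → Periodic f → δ (x - a) * f x ≡ δ (x - a) * f a
  δ*-substitute f x a per with ≈0? (x - a)
  ... | yes h = cong (_*_ (δ (x - a))) (per x a (-≈0⇒≈ {x} {a} h))
  ... | no u = trans (cong (_* f x) (δ-no u)) (sym (cong (_* f a) (δ-no u)))

  ε-δ : ∀ {a} x → a ≈ + 0 [ P ] → ε (a * x) ≡ + 0
  ε-δ {a} x h = ε-zero (*-cong-≈ {_} {+ 0} {x} h ≈-refl)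

  ∑-squares : ∀ f → Periodic f → ∑ (λ k → f (k * k)) ≡ ∑ (λ y → (+ 1 + ε y) * f y)
  ∑-squares f per = trans (∑-fibres f (λ k → k * k) per) (∑-ext λ y → cong (_* f y) (trans (∑-ext λ x → δ-neg y (x * x)) (roots y)))

  ∑ε-interval : ∑ (λ t → ε (t * (+ 1 - t))) ≡ - ε (- + 1)
  ∑ε-interval = begin
    ∑ (λ t → ε (t * (+ 1 - t))) ≡⟨ ∑-ext (λ t → trans (cong ε (lemma t)) (ε-* (- + 1) ((t - + 0) * (t - + 1)))) ⟩
    ∑ (λ t → ε (- + 1) * ε ((t - + 0) * (t - + 1))) ≡⟨ ∑-*ˡ (ε (- + 1)) (λ t → ε ((t - + 0) * (t - + 1))) ⟩
    ε (- + 1) * ∑ (λ t → ε ((t - + 0) * (t - + 1))) ≡⟨ cong (_*_ (ε (- + 1))) (trans (quadraticSum (+ 0) (+ 1)) (cong (λ d → P * d - + 1) (δ-no -1-unit))) ⟩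
    ε (- + 1) * (P * + 0 - + 1) ≡⟨ lemma′ (ε (- + 1)) P ⟩
    - ε (- + 1) ∎
    where
    lemma : ∀ t → t * (+ 1 - t) ≡ - + 1 * ((t - + 0) * (t - + 1))
    lemma = solve-∀
    lemma′ : ∀ e P → e * (P * + 0 - + 1) ≡ - e
    lemma′ = solve-∀

  sign-neg-square : ∀ {x} → Sign x → - x * - x ≡ + 1
  sign-neg-square {x} h = trans (lemma x) (sign-square h)
    where
    lemma : ∀ x → - x * - x ≡ x * x
    lemma = solve-∀

  -- `secondMoment` with `g` the identity: the collisions are the diagonal, which counts the `P - 2`
  -- residues with `t (1 - t) ≠ 0`.
  ∑L² : ∑ (λ l → L l * L l) ≡ P * P - + 2 * P - + 1
  ∑L² = begin
    ∑ (λ l → L l * L l) ≡⟨ ∑-ext (λ l → cong₂ _*_ (split l) (split l)) ⟩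
    ∑ (λ l → ∑ (λ x → c x * ε (l - x)) * ∑ (λ x → c x * ε (l - x))) ≡⟨ secondMoment c (λ x → x) ⟩
    P * ∑ (λ x → ∑ (λ y → c x * c y * δ (x - y))) - ∑ c * ∑ c
      ≡⟨ cong₂ (λ a b → P * a - b) (trans (∑-ext inner) diagonal-sum) (trans (cong₂ _*_ ∑ε-interval ∑ε-interval) (sign-neg-square (ε-unit -1-unit))) ⟩
    P * (P - + 2) - + 1 ≡⟨ lemma P ⟩
    P * P - + 2 * P - + 1 ∎
    where
    c : ℤ → ℤ
    c t = ε (t * (+ 1 - t))
    c-periodic : Periodic c
    c-periodic a b h = ε-cong _ _ (*-cong-≈ h (+-cong-≈ (≈-refl {+ 1}) (-‿cong-≈ h)))
    split : ∀ l → L l ≡ ∑ (λ x → c x * ε (l - x))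
    split l = ∑-ext λ t → ε-* (t * (+ 1 - t)) (l - t)
    inner : ∀ x → ∑ (λ y → c x * c y * δ (x - y)) ≡ + 1 - (δ x + δ (+ 1 - x))
    inner x = begin
      ∑ (λ y → c x * c y * δ (x - y)) ≡⟨ ∑-ext (λ y → trans (cong (_*_ (c x * c y)) (δ-neg x y)) (lemma₁ (c x) (c y) (δ (y - x)))) ⟩
      ∑ (λ y → δ (y - x) * (c x * c y)) ≡⟨ ∑-δ (λ y → c x * c y) x (λ a b h → cong (_*_ (c x)) (c-periodic a b h)) ⟩
      c x * c x ≡⟨ ε²-δ (x * (+ 1 - x)) ⟩
      + 1 - δ (x * (+ 1 - x)) ≡⟨ cong (_-_ (+ 1)) (δ-* x (+ 1 - x) λ { (h , k) → 1-unit (linear-≈₂ (+ 1) (+ 1) k h (lemma₂ x)) }) ⟩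
      + 1 - (δ x + δ (+ 1 - x)) ∎
      where
      lemma₁ : ∀ a b d → a * b * d ≡ d * (a * b)
      lemma₁ = solve-∀
      lemma₂ : ∀ x → + 1 ≡ + 0 + + 1 * (+ 1 - x - + 0) + + 1 * (x - + 0)
      lemma₂ = solve-∀
    diagonal-sum : ∑ (λ x → + 1 - (δ x + δ (+ 1 - x))) ≡ P - + 2
    diagonal-sum = trans (∑-- (λ _ → + 1) (λ x → δ x + δ (+ 1 - x))) (cong₂ _-_ ∑-1
      (trans (∑-+ δ (λ x → δ (+ 1 - x))) (cong₂ _+_ ∑-δ0 (trans (∑-ext λ x → δ-neg (+ 1) x) (∑-δ1 (+ 1))))))
    lemma : ∀ P → P * (P - + 2) - + 1 ≡ P * P - + 2 * P - + 1
    lemma = solve-∀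

  ½ : ℤ
  ½ = inv (+ 2)

  ½-right : + 2 * ½ ≈ + 1 [ P ]
  ½-right = inv-rightₚ 2-unit

  -- For `x ≠ 0` the cubic of `M s` is `-2x² (s - (x + 1/x)/2)`, so `secondMoment` applies with
  -- `g x = (x + 1/x)/2`. Its fibres are the pairs `x`, `1/x`, which degenerate for `x² = 1`.
  ∑M² : ∑ (λ s → M s * M s) ≡ P * P - + 2 * P - + 1
  ∑M² = begin
    ∑ (λ s → M s * M s) ≡⟨ ∑-ext (λ s → trans (cong₂ _*_ (split s) (split s)) (trans (lemma₀ (ε (- + 2)) (∑ (λ x → c x * ε (s - g x)))) (trans (cong (_* (∑ (λ x → c x * ε (s - g x)) * ∑ (λ x → c x * ε (s - g x)))) (ε² -2-unit)) (ℤ.*-identityˡ _)))) ⟩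
    ∑ (λ s → ∑ (λ x → c x * ε (s - g x)) * ∑ (λ x → c x * ε (s - g x))) ≡⟨ secondMoment c g ⟩
    P * ∑ (λ x → ∑ (λ y → c x * c y * δ (g x - g y))) - ∑ c * ∑ c
      ≡⟨ cong₂ (λ a b → P * a - b) (trans (∑-ext inner) total) (cong₂ _*_ ∑c ∑c) ⟩
    P * (+ 2 * (P - + 1) - + 2) - (P - + 1) * (P - + 1) ≡⟨ lemma P ⟩
    P * P - + 2 * P - + 1 ∎
    where
    c g : ℤ → ℤ
    c x = + 1 - δ x
    g x = (x + inv x) * ½
    -2-unit : Unit (- + 2)
    -2-unit = neg-unit 2-unit
    lemma₀ : ∀ e a → e * a * (e * a) ≡ e * e * (a * a)
    lemma₀ = solve-∀
    lemma : ∀ P → P * (+ 2 * (P - + 1) - + 2) - (P - + 1) * (P - + 1) ≡ P * P - + 2 * P - + 1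
    lemma = solve-∀
    ∑c : ∑ c ≡ P - + 1
    ∑c = trans (∑-ext λ x → cong (_-_ (+ 1)) (sym (δ-zero x))) (∑-1-δ (+ 0))
    split : ∀ s → M s ≡ ε (- + 2) * ∑ (λ x → c x * ε (s - g x))
    split s = trans (∑-ext term) (∑-*ˡ (ε (- + 2)) (λ x → c x * ε (s - g x)))
      where
      lemma₁ : ∀ x s i h → x * (x * x + - (+ 2 * s) * x + + 1) ≡ x * x * (- + 2 * (s - (x + i) * h)) + - x * (x * i - + 1) + - (x * x * (x + i)) * (+ 2 * h - + 1)
      lemma₁ = solve-∀
      term : ∀ x → ε (x * (x * x + - (+ 2 * s) * x + + 1)) ≡ ε (- + 2) * (c x * ε (s - g x))
      term x with ≈0? x
      ... | yes h = trans (ε-δ _ h) (sym (trans (cong (λ d → ε (- + 2) * ((+ 1 - d) * ε (s - g x))) (δ-yes h)) (ℤ.*-zeroʳ (ε (- + 2)))))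
      ... | no ux = trans (ε-cong _ _ (linear-≈₂ (- x) (- (x * x * (x + inv x))) (inv-rightₚ ux) ½-right (lemma₁ x s (inv x) ½)))
            (trans (ε-square* (- + 2 * (s - g x)) ux) (trans (ε-* (- + 2) (s - g x)) (cong (_*_ (ε (- + 2))) (sym (trans (cong (λ d → (+ 1 - d) * ε (s - g x)) (δ-no ux)) (ℤ.*-identityˡ _))))))
    -- for a unit x, the solutions of y + 1/y = x + 1/x are x and 1/x
    solutions : ∀ x y → Unit x → c y * δ (g x - g y) ≡ δ (y - x) + δ (y - inv x) - δ (y - x) * δ (x - inv x)
    solutions x y ux with ≈0? y
    ... | yes h = trans (cong (λ d → (+ 1 - d) * δ (g x - g y)) (δ-yes h)) (sym (trans (cong₂ (λ a b → a + b - a * δ (x - inv x))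
          (δ-no λ k → ux (≈-trans (≈-sym (-≈0⇒≈ {y} {x} k)) h)) (δ-no λ k → inv-unit ux (≈-trans (≈-sym (-≈0⇒≈ {y} {inv x} k)) h))) refl))
    ... | no uy = begin
      (+ 1 - δ y) * δ (g x - g y) ≡⟨ trans (cong (λ d → (+ 1 - d) * δ (g x - g y)) (δ-no uy)) (ℤ.*-identityˡ _) ⟩
      δ (g x - g y) ≡⟨ δ-associate (- + 2 * y) (Unit-* -2-unit uy) (linear-≈₃ (- + 1) (+ 1) (- (y * (x + i - y - j))) (inv-rightₚ ux) (inv-rightₚ uy) ½-right (lemma₂ x y i j ½)) ⟩
      δ ((y - x) * (y - inv x)) ≡⟨ δ-or (y - x) (y - inv x) ⟩
      δ (y - x) + δ (y - inv x) - δ (y - x) * δ (y - inv x) ≡⟨ cong (_-_ (δ (y - x) + δ (y - inv x))) (δ*-substitute (λ z → δ (z - inv x)) y x (λ a b h → δ-cong _ _ (+-cong-≈ h (≈-refl { - inv x})))) ⟩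
      δ (y - x) + δ (y - inv x) - δ (y - x) * δ (x - inv x) ∎
      where
      i = inv x
      j = inv y
      lemma₂ : ∀ x y i j h → - + 2 * y * ((x + i) * h - (y + j) * h)
             ≡ (y - x) * (y - i) + - + 1 * (x * i - + 1) + + 1 * (y * j - + 1) + - (y * (x + i - y - j)) * (+ 2 * h - + 1)
      lemma₂ = solve-∀
    inner : ∀ x → ∑ (λ y → c x * c y * δ (g x - g y)) ≡ + 2 * c x - δ (x * x - + 1)
    inner x with ≈0? x
    ... | yes h = trans (trans (∑-ext λ y → cong (λ d → (+ 1 - d) * c y * δ (g x - g y)) (δ-yes h)) (trans (∑-const (+ 0)) (ℤ.*-zeroʳ P)))
          (sym (cong₂ (λ d e → + 2 * (+ 1 - d) - e) (δ-yes h) (δ-no λ k → 1-unit (linear-≈₂ (- + 1) x k h (lemma₃ x)))))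
      where
      lemma₃ : ∀ x → + 1 ≡ + 0 + - + 1 * (x * x - + 1 - + 0) + x * (x - + 0)
      lemma₃ = solve-∀
    ... | no ux = begin
      ∑ (λ y → (+ 1 - δ x) * c y * δ (g x - g y))
        ≡⟨ ∑-ext (λ y → trans (cong (λ d → (+ 1 - d) * c y * δ (g x - g y)) (δ-no ux)) (trans (cong (_* δ (g x - g y)) (ℤ.*-identityˡ (c y))) (solutions x y ux))) ⟩
      ∑ (λ y → δ (y - x) + δ (y - inv x) - δ (y - x) * δ (x - inv x))
        ≡⟨ trans (∑-- (λ y → δ (y - x) + δ (y - inv x)) (λ y → δ (y - x) * δ (x - inv x))) (cong₂ _-_
             (trans (∑-+ (λ y → δ (y - x)) (λ y → δ (y - inv x))) (cong₂ _+_ (∑-δ1 x) (∑-δ1 (inv x))))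
             (trans (∑-*ʳ (λ y → δ (y - x)) (δ (x - inv x))) (trans (cong (_* δ (x - inv x)) (∑-δ1 x)) (ℤ.*-identityˡ _)))) ⟩
      + 2 - δ (x - inv x) ≡⟨ cong₂ (λ d e → + 2 * (+ 1 - d) - e) (sym (δ-no ux)) (δ-associate x ux (linear-≈ (- + 1) (inv-rightₚ ux) (lemma₄ x (inv x)))) ⟩
      + 2 * (+ 1 - δ x) - δ (x * x - + 1) ∎
      where
      lemma₄ : ∀ x i → x * (x - i) ≡ x * x - + 1 + - + 1 * (x * i - + 1)
      lemma₄ = solve-∀
    total : ∑ (λ x → + 2 * c x - δ (x * x - + 1)) ≡ + 2 * (P - + 1) - + 2
    total = trans (∑-- (λ x → + 2 * c x) (λ x → δ (x * x - + 1))) (cong₂ _-_ (trans (∑-*ˡ (+ 2) c) (cong (_*_ (+ 2)) ∑c)) (trans (roots (+ 1)) (cong (_+_ (+ 1)) ε-1)))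

  -- The cubic of `A w` has `t (1 - 2t)` as coefficient of `w`. This vanishes at `t = 0`, which
  -- contributes nothing, and at `½`, which contributes the constant `ε ½`. Elsewhere the cubic is
  -- `t (1 - 2t)(w - g t)`, and `g` takes the same value at `t` and at `σ t = -t / (1 - 2t)`.
  ∑A² : ∑ (λ w → A w * A w) ≡ P * P - + 2 * P - + 1 - P * ε (- + 1)
  ∑A² = begin
    ∑ (λ w → A w * A w) ≡⟨ ∑-ext (λ w → trans (cong₂ _*_ (split w) (split w)) (lemma₀ (ε ½) (B w))) ⟩
    ∑ (λ w → ε ½ * ε ½ + (+ 2 * ε ½ * B w + B w * B w))
      ≡⟨ trans (∑-+ (λ _ → ε ½ * ε ½) (λ w → + 2 * ε ½ * B w + B w * B w)) (cong₂ _+_ (trans (∑-const (ε ½ * ε ½)) (trans (cong (_*_ P) (ε² (inv-unit 2-unit))) (ℤ.*-identityʳ P)))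
           (trans (∑-+ (λ w → + 2 * ε ½ * B w) (λ w → B w * B w)) (cong₂ _+_ (trans (∑-*ˡ (+ 2 * ε ½) B) (trans (cong (_*_ (+ 2 * ε ½)) ∑B) (ℤ.*-zeroʳ (+ 2 * ε ½)))) (secondMoment c g)))) ⟩
    P + (+ 0 + (P * ∑ (λ t → ∑ (λ s → c t * c s * δ (g t - g s))) - ∑ c * ∑ c))
      ≡⟨ cong₂ (λ a b → P + (+ 0 + (P * a - b))) (trans (∑-ext inner) total) (trans (cong₂ _*_ ∑c ∑c) (sign-neg-square (ε-unit (Unit-* -1-unit 2-unit)))) ⟩
    P + (+ 0 + (P * (P - + 2 + (- ε (- + 1)) - + 1) - + 1)) ≡⟨ lemma P (ε (- + 1)) ⟩
    P * P - + 2 * P - + 1 - P * ε (- + 1) ∎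
    where
    η c g σ B : ℤ → ℤ
    η t = + 1 - + 2 * t
    c t = ε (t * η t)
    g t = - (t * t * inv (η t))
    σ t = - (t * inv (η t))
    B w = ∑ (λ t → c t * ε (w - g t))
    η-cong : ∀ {a b} → a ≈ b [ P ] → η a ≈ η b [ P ]
    η-cong h = +-cong-≈ (≈-refl {+ 1}) (-‿cong-≈ (*-cong-≈ {+ 2} ≈-refl h))
    c-periodic : Periodic c
    c-periodic a b h = ε-cong _ _ (*-cong-≈ h (η-cong h))
    lemma₀ : ∀ e b → (e + b) * (e + b) ≡ e * e + (+ 2 * e * b + b * b)
    lemma₀ = solve-∀
    lemma : ∀ P e → P + (+ 0 + (P * (P - + 2 + (- e) - + 1) - + 1)) ≡ P * P - + 2 * P - + 1 - P * e
    lemma = solve-∀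
    η-½ : ∀ {t} → η t ≈ + 0 [ P ] → t ≈ ½ [ P ]
    η-½ {t} h = cancel 2-unit (linear-≈₂ (- + 1) (- + 1) h ½-right (lemma₁ t ½))
      where
      lemma₁ : ∀ t h → + 2 * t ≡ + 2 * h + - + 1 * (+ 1 - + 2 * t - + 0) + - + 1 * (+ 2 * h - + 1)
      lemma₁ = solve-∀
    η-at-½ : η ½ ≈ + 0 [ P ]
    η-at-½ = linear-≈ (- + 1) ½-right (lemma₁ ½)
      where
      lemma₁ : ∀ h → + 1 - + 2 * h ≡ + 0 + - + 1 * (+ 2 * h - + 1)
      lemma₁ = solve-∀
    δη : ∀ t → δ (η t) ≡ δ (t - ½)
    δη t = δ-equivalent (λ h → ≈⇒-≈0 {t} {½} (η-½ {t} h)) (λ h → ≈-trans (η-cong (-≈0⇒≈ {t} {½} h)) η-at-½)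
    split : ∀ w → A w ≡ ε ½ + B w
    split w = trans (∑-ext term) (trans (∑-+ (λ t → δ (t - ½) * ε t) (λ t → c t * ε (w - g t))) (cong (_+ B w) (∑-δ ε ½ ε-cong)))
      where
      lemma₁ : ∀ t w i → let e = + 1 - + 2 * t in t * (t * t + - (+ 2 * w) * t + w) ≡ t * e * (w - - (t * t * i)) + - (t * t * t) * (e * i - + 1)
      lemma₁ = solve-∀
      lemma₂ : ∀ t w → t * (t * t + - (+ 2 * w) * t + w) ≡ t * t * t + t * w * (+ 1 - + 2 * t - + 0)
      lemma₂ = solve-∀
      term : ∀ t → ε (t * (t * t + - (+ 2 * w) * t + w)) ≡ δ (t - ½) * ε t + c t * ε (w - g t)
      term t with ≈0? (η t)
      ... | yes h = begin
        ε (t * (t * t + - (+ 2 * w) * t + w)) ≡⟨ ε-cong _ _ (linear-≈ (t * w) h (lemma₂ t w)) ⟩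
        ε (t * t * t) ≡⟨ ε-square* t t-unit ⟩
        ε t ≡⟨ sym (ℤ.+-identityʳ (ε t)) ⟩
        ε t + + 0 ≡⟨ cong₂ (λ a b → a + b * ε (w - g t)) (trans (sym (ℤ.*-identityˡ (ε t))) (cong (_* ε t) (sym (trans (sym (δη t)) (δ-yes h))))) (sym (ε-zero (≈-trans (*-cong-≈ {t} ≈-refl h) (≡⇒≈ (ℤ.*-zeroʳ t))))) ⟩
        δ (t - ½) * ε t + c t * ε (w - g t) ∎
        where
        t-unit : Unit t
        t-unit k = inv-unit 2-unit (≈-trans (≈-sym (η-½ {t} h)) k)
      ... | no ue = begin
        ε (t * (t * t + - (+ 2 * w) * t + w)) ≡⟨ ε-cong _ _ (linear-≈ (- (t * t * t)) (inv-rightₚ ue) (lemma₁ t w (inv (η t)))) ⟩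
        ε (t * η t * (w - g t)) ≡⟨ ε-* (t * η t) (w - g t) ⟩
        c t * ε (w - g t) ≡⟨ sym (ℤ.+-identityˡ _) ⟩
        + 0 * ε t + c t * ε (w - g t) ≡⟨ cong (λ d → d * ε t + c t * ε (w - g t)) (sym (trans (sym (δη t)) (δ-no ue))) ⟩
        δ (t - ½) * ε t + c t * ε (w - g t) ∎
    ∑B : ∑ B ≡ + 0
    ∑B = trans (∑-swap (λ w t → c t * ε (w - g t))) (trans (∑-ext λ t → trans (∑-*ˡ (c t) (λ w → ε (w - g t))) (trans (cong (_*_ (c t)) (∑ε-linear (g t))) (ℤ.*-zeroʳ (c t)))) (trans (∑-const (+ 0)) (ℤ.*-zeroʳ P)))
    ∑c : ∑ c ≡ - ε (- + 1 * + 2)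
    ∑c = begin
      ∑ (λ t → ε (t * (+ 1 - + 2 * t))) ≡⟨ ∑-ext (λ t → trans (ε-cong _ _ (linear-≈ (- t) ½-right (lemma₁ t ½))) (ε-* (- + 1 * + 2) ((t - + 0) * (t - ½)))) ⟩
      ∑ (λ t → ε (- + 1 * + 2) * ε ((t - + 0) * (t - ½))) ≡⟨ ∑-*ˡ (ε (- + 1 * + 2)) (λ t → ε ((t - + 0) * (t - ½))) ⟩
      ε (- + 1 * + 2) * ∑ (λ t → ε ((t - + 0) * (t - ½))) ≡⟨ cong (_*_ (ε (- + 1 * + 2))) (trans (quadraticSum (+ 0) ½) (cong (λ d → P * d - + 1) (δ-no (λ h → inv-unit 2-unit (≈-sym (-≈0⇒≈ {+ 0} {½} h)))))) ⟩
      ε (- + 1 * + 2) * (P * + 0 - + 1) ≡⟨ lemma₂ (ε (- + 1 * + 2)) P ⟩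
      - ε (- + 1 * + 2) ∎
      where
      lemma₁ : ∀ t h → t * (+ 1 - + 2 * t) ≡ - + 1 * + 2 * ((t - + 0) * (t - h)) + - t * (+ 2 * h - + 1)
      lemma₁ = solve-∀
      lemma₂ : ∀ e P → e * (P * + 0 - + 1) ≡ - e
      lemma₂ = solve-∀
    c-split : ∀ t → Unit (t * η t) → Unit t × Unit (η t)
    c-split t u = (λ h → u (*-cong-≈ {_} {+ 0} {η t} h ≈-refl)) , (λ h → u (≈-trans (*-cong-≈ {t} ≈-refl h) (≡⇒≈ (ℤ.*-zeroʳ t))))
    collision : ∀ t s → c t * c s * δ (g t - g s) ≡ c t * c s * (δ (s - t) + δ (s - σ t) - δ (s - t) * δ (t - σ t))
    collision t s with ≈0? (t * η t) | ≈0? (s * η s)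
    ... | yes h | _ = trans (cong (λ e → e * c s * δ (g t - g s)) (ε-zero h)) (sym (cong (λ e → e * c s * (δ (s - t) + δ (s - σ t) - δ (s - t) * δ (t - σ t))) (ε-zero h)))
    ... | no _ | yes h = trans (cong (λ e → c t * e * δ (g t - g s)) (ε-zero h)) (trans (cong (_* δ (g t - g s)) (ℤ.*-zeroʳ (c t))) (sym (trans (cong (λ e → c t * e * (δ (s - t) + δ (s - σ t) - δ (s - t) * δ (t - σ t))) (ε-zero h)) (cong (_* (δ (s - t) + δ (s - σ t) - δ (s - t) * δ (t - σ t))) (ℤ.*-zeroʳ (c t))))))
    ... | no ut | no us = cong (_*_ (c t * c s)) (begin
      δ (g t - g s) ≡⟨ δ-associate (η s) ue′ (linear-≈₂ (- (s * t)) (s * s) (inv-rightₚ ue) (inv-rightₚ ue′) (lemma₁ t s (inv (η t)) (inv (η s)))) ⟩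
      δ ((s - t) * (s - σ t)) ≡⟨ δ-or (s - t) (s - σ t) ⟩
      δ (s - t) + δ (s - σ t) - δ (s - t) * δ (s - σ t) ≡⟨ cong (_-_ (δ (s - t) + δ (s - σ t))) (δ*-substitute (λ z → δ (z - σ t)) s t (λ a b h → δ-cong _ _ (+-cong-≈ h (≈-refl { - σ t})))) ⟩
      δ (s - t) + δ (s - σ t) - δ (s - t) * δ (t - σ t) ∎)
      where
      ue = proj₂ (c-split t ut)
      ue′ = proj₂ (c-split s us)
      lemma₁ : ∀ t s i j → (+ 1 - + 2 * s) * (- (t * t * i) - - (s * s * j)) ≡ (s - t) * (s - - (t * i)) + - (s * t) * ((+ 1 - + 2 * t) * i - + 1) + s * s * ((+ 1 - + 2 * s) * j - + 1)
      lemma₁ = solve-∀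
    -- Since `η (σ t) = 1 / η t`, the product is the character of `- t² / η t`, that is of `- η t`;
    -- the second term removes `t = 0`.
    conjugate : ∀ t → c t * c (σ t) ≡ ε (+ 2 * t + - + 1) - δ t * ε (+ 2 * t + - + 1)
    conjugate t with ≈0? (t * η t)
    ... | yes h = trans (cong (_* c (σ t)) (ε-zero h)) (sym (vanish (euclid t (η t) h)))
      where
      lemma₁ : ∀ x → x - + 1 * x ≡ + 0
      lemma₁ = solve-∀
      lemma₂ : ∀ t → + 2 * t + - + 1 ≡ + 0 + - + 1 * (+ 1 - + 2 * t - + 0)
      lemma₂ = solve-∀
      vanish : t ≈ + 0 [ P ] ⊎ η t ≈ + 0 [ P ] → ε (+ 2 * t + - + 1) - δ t * ε (+ 2 * t + - + 1) ≡ + 0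
      vanish (inj₁ k) = trans (cong (λ d → ε (+ 2 * t + - + 1) - d * ε (+ 2 * t + - + 1)) (δ-yes k)) (lemma₁ (ε (+ 2 * t + - + 1)))
      vanish (inj₂ k) = trans (cong (λ e → e - δ t * e) (ε-zero {+ 2 * t + - + 1} (linear-≈ (- + 1) k (lemma₂ t)))) (cong (λ x → + 0 - x) (ℤ.*-zeroʳ (δ t)))
    ... | no u = begin
      c t * c (σ t) ≡⟨ sym (ε-* (t * η t) (σ t * η (σ t))) ⟩
      ε (t * η t * (σ t * η (σ t))) ≡⟨ ε-cong _ _ (linear-≈ (- (t * t * (+ 1 + + 2 * t * inv (η t)))) (inv-rightₚ ue) (lemma₁ t (inv (η t)))) ⟩
      ε (t * t * (- (+ 1 + + 2 * t * inv (η t)))) ≡⟨ ε-square* (- (+ 1 + + 2 * t * inv (η t))) ut ⟩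
      ε (- (+ 1 + + 2 * t * inv (η t))) ≡⟨ sym (ε-square* (- (+ 1 + + 2 * t * inv (η t))) ue) ⟩
      ε (η t * η t * - (+ 1 + + 2 * t * inv (η t))) ≡⟨ ε-cong _ _ (linear-≈ (- (+ 2 * t * η t)) (inv-rightₚ ue) (lemma₂ t (inv (η t)))) ⟩
      ε (+ 2 * t + - + 1) ≡⟨ sym (trans (cong (λ d → ε (+ 2 * t + - + 1) - d * ε (+ 2 * t + - + 1)) (δ-no ut)) (ℤ.+-identityʳ _)) ⟩
      ε (+ 2 * t + - + 1) - δ t * ε (+ 2 * t + - + 1) ∎
      where
      ut = proj₁ (c-split t u)
      ue = proj₂ (c-split t u)
      lemma₁ : ∀ t i → let e = + 1 - + 2 * t in t * e * (- (t * i) * (+ 1 - + 2 * - (t * i))) ≡ t * t * (- (+ 1 + + 2 * t * i)) + - (t * t * (+ 1 + + 2 * t * i)) * (e * i - + 1)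
      lemma₁ = solve-∀
      lemma₂ : ∀ t i → let e = + 1 - + 2 * t in e * e * - (+ 1 + + 2 * t * i) ≡ + 2 * t + - + 1 + - (+ 2 * t * e) * (e * i - + 1)
      lemma₂ = solve-∀
    -- Where `c` does not vanish, `t = σ t` means `1 - 2t = -1`.
    fixed : ∀ t → c t * c t * δ (t - σ t) ≡ δ (t - + 1)
    fixed t with ≈0? (t * η t)
    ... | yes h = trans (cong (λ e → e * e * δ (t - σ t)) (ε-zero h)) (sym (δ-no λ k → 1-unit (linear-≈₂ (- + 1) (- (+ 2 * t + + 1)) h k (lemma₁ t))))
      where
      lemma₁ : ∀ t → + 1 ≡ + 0 + - + 1 * (t * (+ 1 - + 2 * t) - + 0) + - (+ 2 * t + + 1) * (t - + 1 - + 0)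
      lemma₁ = solve-∀
    ... | no u = trans (cong (_* δ (t - σ t)) (ε² u)) (trans (ℤ.*-identityˡ _) (δ-associate (inv t * - ½ * η t) (Unit-* (Unit-* (inv-unit ut) (neg-unit (inv-unit 2-unit))) ue)
          (linear-≈₃ (inv t * - ½ * t) (- ½ * (+ 2 - + 2 * t)) (t - + 1) (inv-rightₚ ue) (inv-rightₚ ut) ½-right (lemma₁ t (inv (η t)) (inv t) ½))))
      where
      ut = proj₁ (c-split t u)
      ue = proj₂ (c-split t u)
      lemma₁ : ∀ t i j h → let e = + 1 - + 2 * t in j * - h * e * (t - - (t * i)) ≡ t - + 1 + j * - h * t * (e * i - + 1) + - h * (+ 2 - + 2 * t) * (t * j - + 1) + (t - + 1) * (+ 2 * h - + 1)
      lemma₁ = solve-∀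
    inner : ∀ t → ∑ (λ s → c t * c s * δ (g t - g s)) ≡ + 1 - (δ t + δ (η t)) + (ε (+ 2 * t + - + 1) - δ t * ε (+ 2 * t + - + 1)) - δ (t - + 1)
    inner t = begin
      ∑ (λ s → c t * c s * δ (g t - g s))
        ≡⟨ ∑-ext (λ s → trans (collision t s) (lemma₁ (c t) (c s) (δ (s - t)) (δ (s - σ t)) (δ (t - σ t)))) ⟩
      ∑ (λ s → δ (s - t) * (c t * c s) + δ (s - σ t) * (c t * c s) - δ (s - t) * (c t * c s * δ (t - σ t)))
        ≡⟨ trans (∑-- (λ s → δ (s - t) * (c t * c s) + δ (s - σ t) * (c t * c s)) (λ s → δ (s - t) * (c t * c s * δ (t - σ t)))) (cong₂ _-_
             (trans (∑-+ (λ s → δ (s - t) * (c t * c s)) (λ s → δ (s - σ t) * (c t * c s))) (cong₂ _+_ (∑-δ (λ s → c t * c s) t (λ a b h → cong (_*_ (c t)) (c-periodic a b h))) (∑-δ (λ s → c t * c s) (σ t) (λ a b h → cong (_*_ (c t)) (c-periodic a b h)))))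
             (∑-δ (λ s → c t * c s * δ (t - σ t)) t (λ a b h → cong (λ x → c t * x * δ (t - σ t)) (c-periodic a b h)))) ⟩
      c t * c t + c t * c (σ t) - c t * c t * δ (t - σ t)
        ≡⟨ cong₂ _-_ (cong₂ _+_ (trans (ε²-δ (t * η t)) (cong (_-_ (+ 1)) (δ-* t (η t) λ { (h , k) → 1-unit (linear-≈₂ (+ 1) (+ 2) k h (lemma₂ t)) }))) (conjugate t)) (fixed t) ⟩
      + 1 - (δ t + δ (η t)) + (ε (+ 2 * t + - + 1) - δ t * ε (+ 2 * t + - + 1)) - δ (t - + 1) ∎
      where
      lemma₁ : ∀ a b x y z → a * b * (x + y - x * z) ≡ x * (a * b) + y * (a * b) - x * (a * b * z)
      lemma₁ = solve-∀
      lemma₂ : ∀ t → + 1 ≡ + 0 + + 1 * (+ 1 - + 2 * t - + 0) + + 2 * (t - + 0)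
      lemma₂ = solve-∀
    total : ∑ (λ t → + 1 - (δ t + δ (η t)) + (ε (+ 2 * t + - + 1) - δ t * ε (+ 2 * t + - + 1)) - δ (t - + 1)) ≡ P - + 2 + (- ε (- + 1)) - + 1
    total = trans (∑-- (λ t → + 1 - (δ t + δ (η t)) + (ε (+ 2 * t + - + 1) - δ t * ε (+ 2 * t + - + 1))) (λ t → δ (t - + 1))) (cong₂ _-_
      (trans (∑-+ (λ t → + 1 - (δ t + δ (η t))) (λ t → ε (+ 2 * t + - + 1) - δ t * ε (+ 2 * t + - + 1))) (cong₂ _+_
        (trans (∑-- (λ _ → + 1) (λ t → δ t + δ (η t))) (cong₂ _-_ ∑-1 (trans (∑-+ δ (λ t → δ (η t))) (cong₂ _+_ ∑-δ0 (trans (∑-ext δη) (∑-δ1 ½))))))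
        (trans (∑-- (λ t → ε (+ 2 * t + - + 1)) (λ t → δ t * ε (+ 2 * t + - + 1))) (trans (cong₂ _-_ (trans (∑-affine ε (+ 2) (- + 1) ε-cong 2-unit) ∑ε)
          (trans (∑-ext λ t → cong (_* ε (+ 2 * t + - + 1)) (sym (δ-zero t))) (∑-δ (λ t → ε (+ 2 * t + - + 1)) (+ 0) (λ a b h → ε-cong _ _ (+-cong-≈ (*-cong-≈ {+ 2} ≈-refl h) (≈-refl { - + 1})))))) (ℤ.+-identityˡ _)))))
      (∑-δ1 (+ 1)))

-- The relation between `Z-A` and `Z-B`

module PointCounts (m : ℕ) (pr : Prime (suc (m ℕ.+ m))) where
  open PrimeField m pr
  open CharacterSums m pr
  open Moments m pr
  open FamilySums m pr
  open ≡-Reasoning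

  square-periodic : ∀ {f} → Periodic f → Periodic (λ x → f x * f x)
  square-periodic per a b h = cong₂ _*_ (per a b h) (per a b h)

  -- A double root at `a` leaves `ε t` for every `t ≠ a`, so the sum is `∑ ε` without its term at
  -- `a`.
  punctured : ∀ a (f : ℤ → ℤ) → ε a ≡ + 1 → (∀ t → f t ≡ (t - a) * (t - a) * t) → ∑ (λ t → ε (f t)) ≡ - + 1
  punctured a f εa eq = begin
    ∑ (λ t → ε (f t)) ≡⟨ ∑-ext term ⟩
    ∑ (λ t → ε t - δ (t - a) * ε t) ≡⟨ ∑-- ε (λ t → δ (t - a) * ε t) ⟩
    ∑ ε - ∑ (λ t → δ (t - a) * ε t) ≡⟨ cong₂ _-_ ∑ε (trans (∑-δ ε a ε-cong) εa) ⟩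
    - + 1 ∎
    where
    lemma : ∀ x → x - + 1 * x ≡ + 0
    lemma = solve-∀
    term : ∀ t → ε (f t) ≡ ε t - δ (t - a) * ε t
    term t with ≈0? (t - a)
    ... | yes h = trans (cong ε (eq t)) (trans (ε-zero (≈-trans (≡⇒≈ (ℤ.*-assoc (t - a) (t - a) t)) (*-cong-≈ {_} {+ 0} {(t - a) * t} h ≈-refl))) (sym (trans (cong (λ d → ε t - d * ε t) (δ-yes h)) (lemma (ε t)))))
    ... | no u = trans (cong ε (eq t)) (trans (ε-square* t u) (sym (trans (cong (λ d → ε t - d * ε t) (δ-no u)) (ℤ.+-identityʳ (ε t)))))

  L-1 : L (+ 1) ≡ - + 1
  L-1 = punctured (+ 1) (λ t → t * (+ 1 - t) * (+ 1 - t)) ε-1 lemma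
    where
    lemma : ∀ t → t * (+ 1 - t) * (+ 1 - t) ≡ (t - + 1) * (t - + 1) * t
    lemma = solve-∀

  M-1 : M (+ 1) ≡ - + 1
  M-1 = punctured (+ 1) (λ x → x * (x * x + - (+ 2 * + 1) * x + + 1)) ε-1 lemma
    where
    lemma : ∀ x → x * (x * x + - (+ 2 * + 1) * x + + 1) ≡ (x - + 1) * (x - + 1) * x
    lemma = solve-∀

  A-1 : A (+ 1) ≡ - + 1
  A-1 = M-1

  L-0 : L (+ 0) * L (+ 0) ≡ + 1
  L-0 = trans (cong₂ _*_ value value) (sign-neg-square (ε-unit -1-unit))
    where
    lemma : ∀ t → t * (+ 1 - t) * (+ 0 - t) ≡ t * t * (t + - + 1)
    lemma = solve-∀
    term : ∀ t → ε (t * (+ 1 - t) * (+ 0 - t)) ≡ ε (t + - + 1) - δ (t - + 0) * ε (t + - + 1)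
    term t with ≈0? t
    ... | yes h = trans (cong ε (lemma t)) (trans (ε-zero (*-cong-≈ {t * t} {+ 0} {t + - + 1} (*-cong-≈ {t} {+ 0} {t} {+ 0} h h) ≈-refl)) (sym (trans (cong (λ d → ε (t + - + 1) - d * ε (t + - + 1)) (trans (δ-zero t) (δ-yes h))) (lemma′ (ε (t + - + 1))))))
      where
      lemma′ : ∀ x → x - + 1 * x ≡ + 0
      lemma′ = solve-∀
    ... | no u = trans (cong ε (lemma t)) (trans (ε-square* (t + - + 1) u) (sym (trans (cong (λ d → ε (t + - + 1) - d * ε (t + - + 1)) (trans (δ-zero t) (δ-no u))) (ℤ.+-identityʳ _))))
    value : L (+ 0) ≡ - ε (- + 1)
    value = trans (∑-ext term) (trans (∑-- (λ t → ε (t + - + 1)) (λ t → δ (t - + 0) * ε (t + - + 1))) (trans (cong₂ _-_ (trans (∑-shift ε (- + 1) ε-cong) ∑ε)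
      (∑-δ (λ t → ε (t + - + 1)) (+ 0) (λ a b h → ε-cong _ _ (+-cong-≈ h (≈-refl { - + 1}))))) (ℤ.+-identityˡ _)))

  Z-A Z-B : ℤ
  Z-A = ∑ (λ k → A (+ 1 + k * k) * A (+ 1 + k * k))
  Z-B = ∑ (λ k → L (k * k) * L (k * k))

  Z-B-twisted : Z-B ≡ ∑ (λ l → (+ 1 + ε l) * (L l * L l))
  Z-B-twisted = ∑-squares (λ l → L l * L l) (square-periodic {L} L-periodic)

  -- This is `(x + 1) / (x - 1)` for `x ≠ 1`. The convention `inv 0 = 0` makes it fix its pole `1`,
  -- and so an involution of all residues.
  reflect : ℤ → ℤ
  reflect x = + 2 * inv (x - + 1) + + 1

  reflect-cong : ∀ {a b} → a ≈ b [ P ] → reflect a ≈ reflect b [ P ]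
  reflect-cong h = +-cong-≈ (*-cong-≈ {+ 2} ≈-refl (inv-cong (+-cong-≈ h (≈-refl { - + 1})))) (≈-refl {+ 1})

  inv-2inv : ∀ y → + 2 * inv (+ 2 * inv y) ≈ y [ P ]
  inv-2inv y with ≈0? y
  ... | yes h = ≈-trans (*-cong-≈ {+ 2} ≈-refl (inv-cong (*-cong-≈ {+ 2} ≈-refl (inv-zero h)))) (≈-trans (≡⇒≈ (cong (_*_ (+ 2)) inv-0)) (≈-sym h))
  ... | no uy = cancel {+ 2 * inv (+ 2 * inv y)} {y} {inv y} (inv-unit uy) (linear-≈₂ (+ 1) (- + 1) (inv-rightₚ (Unit-* 2-unit (inv-unit uy))) (inv-rightₚ uy) (lemma y (inv y) (inv (+ 2 * inv y))))
    where
    lemma : ∀ y i j → i * (+ 2 * j) ≡ i * y + + 1 * (+ 2 * i * j - + 1) + - + 1 * (y * i - + 1)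
    lemma = solve-∀

  reflect-involutive : ∀ x → reflect (reflect x) ≈ x [ P ]
  reflect-involutive x = ≈-trans (+-cong-≈ (≈-trans (≡⇒≈ (cong (λ y → + 2 * inv y) (lemma (+ 2 * inv (x - + 1))))) (inv-2inv (x - + 1))) (≈-refl {+ 1})) (≡⇒≈ (lemma′ x))
    where
    lemma : ∀ y → y + + 1 - + 1 ≡ y
    lemma = solve-∀
    lemma′ : ∀ x → x - + 1 + + 1 ≡ x
    lemma′ = solve-∀

  -- For `s = (l + 1) / (l - 1)` one has `s² - 1 = 4l / (l - 1)²`, so the weight `1 + ε l` becomes
  -- `1 + ε (s² - 1)`. At `l = 1`, which `reflect` fixes, the summands are `2` on the left and `1`
  -- on the right; hence the extra `1`.
  Z-B-M : Z-B ≡ + 1 + ∑ (λ s → (+ 1 + ε (s * s - + 1)) * (M s * M s))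
  Z-B-M = begin
    Z-B ≡⟨ Z-B-twisted ⟩
    ∑ (λ l → (+ 1 + ε l) * (L l * L l)) ≡⟨ ∑-ext term ⟩
    ∑ (λ l → δ (l - + 1) + h (reflect l)) ≡⟨ ∑-+ (λ l → δ (l - + 1)) (λ l → h (reflect l)) ⟩
    ∑ (λ l → δ (l - + 1)) + ∑ (λ l → h (reflect l)) ≡⟨ cong₂ _+_ (∑-δ1 (+ 1)) (∑-bijection h reflect reflect h-periodic reflect-cong reflect-cong reflect-involutive reflect-involutive) ⟩
    + 1 + ∑ h ∎
    where
    h : ℤ → ℤ
    h s = (+ 1 + ε (s * s - + 1)) * (M s * M s)
    h-periodic : Periodic h
    h-periodic a b e = cong₂ (λ x y → (+ 1 + x) * y) (ε-cong _ _ (+-cong-≈ (*-cong-≈ e e) (≈-refl { - + 1}))) (square-periodic {M} M-periodic a b e)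
    term : ∀ l → (+ 1 + ε l) * (L l * L l) ≡ δ (l - + 1) + h (reflect l)
    term l with ≈0? (l - + 1)
    ... | yes e = begin
      (+ 1 + ε l) * (L l * L l) ≡⟨ cong₂ (λ x y → (+ 1 + x) * y) (trans (ε-cong l (+ 1) (-≈0⇒≈ {l} {+ 1} e)) ε-1) (trans (square-periodic {L} L-periodic l (+ 1) (-≈0⇒≈ {l} {+ 1} e)) (cong₂ _*_ L-1 L-1)) ⟩
      + 2 ≡⟨ cong (_+_ (+ 1)) (sym (cong₂ (λ x y → (+ 1 + x) * y) (ε-zero {+ 0} ≈-refl) (cong₂ _*_ M-1 M-1))) ⟩
      + 1 + h (+ 1) ≡⟨ cong₂ _+_ (sym (δ-yes e)) (sym (h-periodic (reflect l) (+ 1) (+-cong-≈ (≈-trans (*-cong-≈ {+ 2} ≈-refl (≈-trans (inv-cong e) (≡⇒≈ inv-0))) (≡⇒≈ (ℤ.*-zeroʳ (+ 2)))) (≈-refl {+ 1})))) ⟩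
      δ (l - + 1) + h (reflect l) ∎
    ... | no ud = begin
      (+ 1 + ε l) * (L l * L l) ≡⟨ cong₂ (λ x y → (+ 1 + x) * y) (sym (trans (ε-cong _ _ (linear-≈ (- (+ 2 * + 2 * i)) (inv-rightₚ ud) (lemma l i))) (ε-square* l (Unit-* 2-unit (inv-unit ud)))))
                                               (trans (L²≡M² l ud) (square-periodic {M} M-periodic ((l + + 1) * i) (reflect l) (linear-≈ (+ 1) (inv-rightₚ ud) (lemma′ l i)))) ⟩
      h (reflect l) ≡⟨ sym (trans (cong (_+ h (reflect l)) (δ-no ud)) (ℤ.+-identityˡ _)) ⟩
      δ (l - + 1) + h (reflect l) ∎
      where
      i = inv (l - + 1)
      lemma : ∀ l i → (+ 2 * i + + 1) * (+ 2 * i + + 1) - + 1 ≡ + 2 * i * (+ 2 * i) * l + - (+ 2 * + 2 * i) * ((l - + 1) * i - + 1)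
      lemma = solve-∀
      lemma′ : ∀ l i → (l + + 1) * i ≡ + 2 * i + + 1 + + 1 * ((l - + 1) * i - + 1)
      lemma′ = solve-∀

  -- The substitution `w = s²` turns `M s` into `A w` up to sign, except at `s = 0`, where `A`
  -- vanishes and `M` need not.
  twist : ∀ g → Periodic g → ∑ (λ s → g (s * s) * (M s * M s)) ≡ g (+ 0) * (M (+ 0) * M (+ 0)) + ∑ (λ w → (+ 1 + ε w) * (g w * (A w * A w)))
  twist g per = begin
    ∑ (λ s → g (s * s) * (M s * M s)) ≡⟨ ∑-ext term ⟩
    ∑ (λ s → δ (s - + 0) * f s + g (s * s) * (A (s * s) * A (s * s)))
      ≡⟨ trans (∑-+ (λ s → δ (s - + 0) * f s) (λ s → g (s * s) * (A (s * s) * A (s * s)))) (cong₂ _+_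
           (∑-δ f (+ 0) (λ a b h → cong₂ _*_ (per _ _ (*-cong-≈ h h)) (square-periodic {M} M-periodic a b h)))
           (∑-squares (λ w → g w * (A w * A w)) (λ a b h → cong₂ _*_ (per a b h) (square-periodic {A} A-periodic a b h)))) ⟩
    f (+ 0) + ∑ (λ w → (+ 1 + ε w) * (g w * (A w * A w))) ∎
    where
    f : ℤ → ℤ
    f s = g (s * s) * (M s * M s)
    term : ∀ s → f s ≡ δ (s - + 0) * f s + g (s * s) * (A (s * s) * A (s * s))
    term s with ≈0? s
    ... | yes h = sym (trans (cong₂ (λ d x → d * f s + g (s * s) * (x * x)) (trans (δ-zero s) (δ-yes h)) (A-0 {s * s} (*-cong-≈ {s} {+ 0} {s} {+ 0} h h)))
                  (trans (cong₂ _+_ (ℤ.*-identityˡ (f s)) (ℤ.*-zeroʳ (g (s * s)))) (ℤ.+-identityʳ (f s))))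
    ... | no us = sym (trans (cong₂ (λ d x → d * f s + g (s * s) * x) (trans (δ-zero s) (δ-no us)) (A²≡M² s us)) (ℤ.+-identityˡ (f s)))

  -- The involution `ρ w = w / (w - 1)` preserves `A²` and turns `ε` into `ε w * ε (w - 1)`. It is
  -- extended by fixing `1`, where the summand is `0` on the left and `1` on the right; hence the
  -- `- 1`.
  ∑A²ε : ∑ (λ w → ε w * ε (w - + 1) * (A w * A w)) ≡ ∑ (λ w → ε w * (A w * A w)) - + 1
  ∑A²ε = begin
    ∑ (λ w → ε w * ε (w - + 1) * (A w * A w)) ≡⟨ ∑-ext term ⟩
    ∑ (λ w → k (ρ w) - δ (w - + 1)) ≡⟨ ∑-- (λ w → k (ρ w)) (λ w → δ (w - + 1)) ⟩
    ∑ (λ w → k (ρ w)) - ∑ (λ w → δ (w - + 1)) ≡⟨ cong₂ _-_ (∑-bijection k ρ ρ k-periodic ρ-cong ρ-cong ρ-involutive ρ-involutive) (∑-δ1 (+ 1)) ⟩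
    ∑ k - + 1 ∎
    where
    k ρ : ℤ → ℤ
    k w = ε w * (A w * A w)
    ρ w = inv (w - + 1) + + 1
    k-periodic : Periodic k
    k-periodic a b h = cong₂ _*_ (ε-cong a b h) (square-periodic {A} A-periodic a b h)
    ρ-cong : ∀ {a b} → a ≈ b [ P ] → ρ a ≈ ρ b [ P ]
    ρ-cong h = +-cong-≈ (inv-cong (+-cong-≈ h (≈-refl { - + 1}))) (≈-refl {+ 1})
    ρ-involutive : ∀ w → ρ (ρ w) ≈ w [ P ]
    ρ-involutive w = ≈-trans (+-cong-≈ (≈-trans (≡⇒≈ (cong inv (lemma (inv (w - + 1))))) (inv-involutive (w - + 1))) (≈-refl {+ 1})) (≡⇒≈ (lemma′ w))
      where
      lemma : ∀ y → y + + 1 - + 1 ≡ y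
      lemma = solve-∀
      lemma′ : ∀ x → x - + 1 + + 1 ≡ x
      lemma′ = solve-∀
    term : ∀ w → ε w * ε (w - + 1) * (A w * A w) ≡ k (ρ w) - δ (w - + 1)
    term w with ≈0? (w - + 1)
    ... | yes h = trans (cong (λ e → ε w * e * (A w * A w)) (ε-zero h)) (trans (cong (_* (A w * A w)) (ℤ.*-zeroʳ (ε w)))
          (sym (cong₂ _-_ (trans (k-periodic (ρ w) (+ 1) (+-cong-≈ (inv-zero h) (≈-refl {+ 1}))) (cong₂ (λ e x → e * (x * x)) ε-1 A-1)) (δ-yes h))))
    ... | no ud = begin
      ε w * ε (w - + 1) * (A w * A w) ≡⟨ cong₂ _*_ (sym (trans (ε-cong _ _ (linear-≈ (- + 1) (inv-rightₚ ud) (lemma w (inv (w - + 1))))) (trans (ε-* w (inv (w - + 1))) (cong (_*_ (ε w)) (ε-inv (w - + 1)))))) (A²-involution w ud) ⟩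
      ε (ρ w) * (A (ρ w) * A (ρ w)) ≡⟨ sym (trans (cong (_-_ (k (ρ w))) (δ-no ud)) (ℤ.+-identityʳ _)) ⟩
      k (ρ w) - δ (w - + 1) ∎
      where
      lemma : ∀ w i → i + + 1 ≡ w * i + - + 1 * ((w - + 1) * i - + 1)
      lemma = solve-∀

  Z-A-twisted : Z-A ≡ ∑ (λ w → A w * A w) + ∑ (λ w → ε (w - + 1) * (A w * A w))
  Z-A-twisted = begin
    Z-A ≡⟨ ∑-squares (λ y → A (+ 1 + y) * A (+ 1 + y)) (λ a b h → square-periodic {A} A-periodic (+ 1 + a) (+ 1 + b) (+-cong-≈ (≈-refl {+ 1}) h)) ⟩
    ∑ (λ y → (+ 1 + ε y) * (A (+ 1 + y) * A (+ 1 + y))) ≡⟨ ∑-ext (λ y → cong₂ (λ a b → (+ 1 + ε a) * (A b * A b)) (lemma y) (ℤ.+-comm (+ 1) y)) ⟩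
    ∑ (λ y → G (y + + 1)) ≡⟨ ∑-shift G (+ 1) (λ a b h → cong₂ (λ x y → (+ 1 + x) * y) (ε-cong _ _ (+-cong-≈ h (≈-refl { - + 1}))) (square-periodic {A} A-periodic a b h)) ⟩
    ∑ G ≡⟨ trans (∑-ext λ w → lemma′ (ε (w - + 1)) (A w * A w)) (∑-+ (λ w → A w * A w) (λ w → ε (w - + 1) * (A w * A w))) ⟩
    ∑ (λ w → A w * A w) + ∑ (λ w → ε (w - + 1) * (A w * A w)) ∎
    where
    G : ℤ → ℤ
    G w = (+ 1 + ε (w - + 1)) * (A w * A w)
    lemma : ∀ y → y ≡ y + + 1 - + 1
    lemma = solve-∀
    lemma′ : ∀ e x → (+ 1 + e) * x ≡ x + e * x
    lemma′ = solve-∀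

  -- `twist` expresses the sums over `M²` through the sums of `A²` against `1`, `ε w`, `ε (w - 1)`
  -- and `ε w * ε (w - 1)`; `∑A²ε` reduces the last of them to the second, and `untwisted`
  -- eliminates that one. What is left of `Z-B - Z-A` is `2 (∑M² - ∑A²)`.
  Z-relation : Z-B ≡ Z-A + + 2 * P * ε (- + 1)
  Z-relation = begin
    Z-B ≡⟨ Z-B-M ⟩
    + 1 + ∑ (λ s → (+ 1 + ε (s * s - + 1)) * (M s * M s))
      ≡⟨ cong (_+_ (+ 1)) (trans (∑-ext λ s → lemma₁ (ε (s * s - + 1)) (M s * M s)) (∑-+ (λ s → M s * M s) (λ s → ε (s * s - + 1) * (M s * M s)))) ⟩
    + 1 + (ΣM + ∑ (λ s → ε (s * s - + 1) * (M s * M s)))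
      ≡⟨ cong (λ x → + 1 + (ΣM + x)) (trans (twist (λ w → ε (w - + 1)) (λ a b h → ε-cong _ _ (+-cong-≈ h (≈-refl { - + 1})))) (cong (_+_ (ε (- + 1) * M₀²))
           (trans (∑-ext λ w → lemma₂ (ε w) (ε (w - + 1)) (A w * A w)) (∑-+ (λ w → ε (w - + 1) * (A w * A w)) (λ w → ε w * ε (w - + 1) * (A w * A w)))))) ⟩
    + 1 + (ΣM + (ε (- + 1) * M₀² + (ΣA-ε + ∑ (λ w → ε w * ε (w - + 1) * (A w * A w)))))
      ≡⟨ cong (λ x → + 1 + (ΣM + (ε (- + 1) * M₀² + (ΣA-ε + x)))) ∑A²ε ⟩
    + 1 + (ΣM + (ε (- + 1) * M₀² + (ΣA-ε + (Σε-A - + 1))))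
      ≡⟨ lemma₃ ΣM (ε (- + 1)) M₀² ΣA-ε Σε-A ΣA ⟩
    ΣA + ΣA-ε + (ε (- + 1) * M₀² - M₀²) + ((M₀² + (ΣA + Σε-A)) + ΣM - + 2 * ΣA)
      ≡⟨ cong₂ (λ x y → ΣA + ΣA-ε + (x - M₀²) + (y + ΣM - + 2 * ΣA)) odd (sym untwisted) ⟩
    ΣA + ΣA-ε + (M₀² - M₀²) + (ΣM + ΣM - + 2 * ΣA)
      ≡⟨ cong₂ (λ x y → ΣA + ΣA-ε + (M₀² - M₀²) + (x + x - + 2 * y)) ∑M² ∑A² ⟩
    ΣA + ΣA-ε + (M₀² - M₀²) + ((P * P - + 2 * P - + 1) + (P * P - + 2 * P - + 1) - + 2 * (P * P - + 2 * P - + 1 - P * ε (- + 1)))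
      ≡⟨ lemma₄ (ΣA + ΣA-ε) M₀² P (ε (- + 1)) ⟩
    ΣA + ΣA-ε + + 2 * P * ε (- + 1) ≡⟨ cong (_+ + 2 * P * ε (- + 1)) (sym Z-A-twisted) ⟩
    Z-A + + 2 * P * ε (- + 1) ∎
    where
    ΣM = ∑ (λ s → M s * M s)
    ΣA = ∑ (λ w → A w * A w)
    Σε-A = ∑ (λ w → ε w * (A w * A w))
    ΣA-ε = ∑ (λ w → ε (w - + 1) * (A w * A w))
    M₀² = M (+ 0) * M (+ 0)
    lemma₁ : ∀ e x → (+ 1 + e) * x ≡ x + e * x
    lemma₁ = solve-∀
    lemma₂ : ∀ e f x → (+ 1 + e) * (f * x) ≡ f * x + e * f * x
    lemma₂ = solve-∀
    lemma₃ : ∀ ΣM e M₀ u t a → + 1 + (ΣM + (e * M₀ + (u + (t - + 1)))) ≡ a + u + (e * M₀ - M₀) + ((M₀ + (a + t)) + ΣM - + 2 * a)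
    lemma₃ = solve-∀
    lemma₄ : ∀ z M P e → z + (M - M) + ((P * P - + 2 * P - + 1) + (P * P - + 2 * P - + 1) - + 2 * (P * P - + 2 * P - + 1 - P * e)) ≡ z + + 2 * P * e
    lemma₄ = solve-∀
    untwisted : ΣM ≡ M₀² + (ΣA + Σε-A)
    untwisted = trans (∑-ext λ s → sym (ℤ.*-identityˡ (M s * M s))) (trans (twist (λ _ → + 1) (λ _ _ _ → refl))
      (cong₂ _+_ (ℤ.*-identityˡ M₀²) (trans (∑-ext λ w → trans (cong (_*_ (+ 1 + ε w)) (ℤ.*-identityˡ (A w * A w))) (lemma₁ (ε w) (A w * A w))) (∑-+ (λ w → A w * A w) (λ w → ε w * (A w * A w))))))
    -- The cubic at `s = 0` is odd, and `x ↦ -x` permutes the residues.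
    M₀-odd : M (+ 0) ≡ ε (- + 1) * M (+ 0)
    M₀-odd = trans (sym (∑-scale (λ x → ε (x * (x * x + - (+ 2 * + 0) * x + + 1))) (- + 1) (cubic-periodic (- (+ 2 * + 0)) (+ 1)) -1-unit))
      (trans (∑-ext λ x → trans (cong ε (lemma₅ x)) (ε-* (- + 1) (x * (x * x + - (+ 2 * + 0) * x + + 1)))) (∑-*ˡ (ε (- + 1)) (λ x → ε (x * (x * x + - (+ 2 * + 0) * x + + 1)))))
      where
      lemma₅ : ∀ x → - + 1 * x * (- + 1 * x * (- + 1 * x) + - (+ 2 * + 0) * (- + 1 * x) + + 1) ≡ - + 1 * (x * (x * x + - (+ 2 * + 0) * x + + 1))
      lemma₅ = solve-∀
    odd : ε (- + 1) * M₀² ≡ M₀²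
    odd = trans (sym (ℤ.*-assoc (ε (- + 1)) (M (+ 0)) (M (+ 0)))) (cong (_* M (+ 0)) (sym M₀-odd))

-- From point counts to `Z-A` and `Z-B`; bounds and the residue of `Z-B` modulo 8

module Evaluation (m : ℕ) (pr : Prime (suc (m ℕ.+ m))) where
  open PrimeField m pr
  open CharacterSums m pr
  open Moments m pr
  open FamilySums m pr
  open PointCounts m pr
  open ≡-Reasoning

  affineCount-ε : ∀ (g : ℤ → ℤ) → affineCount p g ≡ P + ∑ (λ x → ε (g x))
  affineCount-ε g = begin
    affineCount p g ≡⟨ trans (sumℤ-residues p _) (sum-ext p λ x → sumℤ-residues p _) ⟩
    sum p (λ x → sum p (λ y → if (+ y * + y - g (+ x)) ≡[ p ]? then + 1 else + 0)) ≡⟨ sum-ext p (λ x → trans (sum-ext p λ y → sym (δ-def (+ y * + y - g (+ x)))) (trans (sym (∑-def (λ y → δ (y * y - g (+ x))))) (roots (g (+ x))))) ⟩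
    sum p (λ x → + 1 + ε (g (+ x))) ≡⟨ sym (∑-def (λ x → + 1 + ε (g x))) ⟩
    ∑ (λ x → + 1 + ε (g x)) ≡⟨ trans (∑-+ (λ _ → + 1) (λ x → ε (g x))) (cong (_+ ∑ (λ x → ε (g x))) ∑-1) ⟩
    P + ∑ (λ x → ε (g x)) ∎

  trace² : ∀ (g : ℤ → ℤ) → (+ p + + 1 - pointCount p g) * (+ p + + 1 - pointCount p g) ≡ ∑ (λ x → ε (g x)) * ∑ (λ x → ε (g x))
  trace² g = trans (cong (λ c → (P + + 1 - (+ 1 + c)) * (P + + 1 - (+ 1 + c))) (affineCount-ε g)) (lemma P (∑ (λ x → ε (g x))))
    where
    lemma : ∀ P s → (P + + 1 - (+ 1 + (P + s))) * (P + + 1 - (+ 1 + (P + s))) ≡ s * s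
    lemma = solve-∀

  if-δ : ∀ a y → (if a ≡[ p ]? then + 0 else y) ≡ (+ 1 - δ a) * y
  if-δ a y = trans (go (a ≡[ p ]?)) (cong (λ d → (+ 1 - d) * y) (sym (δ-def a)))
    where
    go : ∀ b → (if b then + 0 else y) ≡ (+ 1 - (if b then + 1 else + 0)) * y
    go true = refl
    go false = sym (ℤ.*-identityˡ y)

  Fcubic-legendre : ∀ k → ∑ (λ x → ε (Fcubic k x)) ≡ legendre (k * k)
  Fcubic-legendre k = ∑-ext λ x → cong ε (lemma k x)
    where
    lemma : ∀ k x → (x - (k - + 1) * (k - + 1)) * (x - (k + + 1) * (k + + 1)) * x ≡ x * (x * x + - (+ 2 * (k * k + + 1)) * x + (k * k - + 1) * (k * k - + 1))
    lemma = solve-∀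

  -- The excluded values `0`, `1`, `-1` of `k` contribute `1` each to `Z-B`, because `L` is `1` or
  -- `-1` at `0` and at `1`.
  sumB-Z : sumB p ≡ Z-B - + 3
  sumB-Z = begin
    sumB p ≡⟨ sumℤ-residues p _ ⟩
    sum p (λ k → if (+ k) ≡[ p ]? then + 0 else if (+ k - + 1) ≡[ p ]? then + 0 else if (+ k + + 1) ≡[ p ]? then + 0 else bCoeff p k * bCoeff p k)
      ≡⟨ sum-ext p (λ k → trans (unfold k) (term (+ k))) ⟩
    sum p (λ k → G (+ k)) ≡⟨ sym (∑-def G) ⟩
    ∑ G ≡⟨ ∑-- (λ k → L (k * k) * L (k * k)) (λ k → δ (k - + 0) + (δ (k - + 1) + δ (k - - + 1))) ⟩
    Z-B - ∑ (λ k → δ (k - + 0) + (δ (k - + 1) + δ (k - - + 1))) ≡⟨ cong (_-_ Z-B) (trans (∑-+ (λ k → δ (k - + 0)) (λ k → δ (k - + 1) + δ (k - - + 1))) (cong₂ _+_ (∑-δ1 (+ 0)) (trans (∑-+ (λ k → δ (k - + 1)) (λ k → δ (k - - + 1))) (cong₂ _+_ (∑-δ1 (+ 1)) (∑-δ1 (- + 1)))))) ⟩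
    Z-B - + 3 ∎
    where
    legendre² : ℤ → ℤ
    legendre² k = legendre (k * k) * legendre (k * k)
    G : ℤ → ℤ
    G k = L (k * k) * L (k * k) - (δ (k - + 0) + (δ (k - + 1) + δ (k - - + 1)))
    unfold : ∀ k → (if (+ k) ≡[ p ]? then + 0 else if (+ k - + 1) ≡[ p ]? then + 0 else if (+ k + + 1) ≡[ p ]? then + 0 else bCoeff p k * bCoeff p k)
                 ≡ (+ 1 - δ (+ k)) * ((+ 1 - δ (+ k - + 1)) * ((+ 1 - δ (+ k - - + 1)) * legendre² (+ k)))
    unfold k = trans (if-δ (+ k) _) (cong (_*_ (+ 1 - δ (+ k))) (trans (if-δ (+ k - + 1) _) (cong (_*_ (+ 1 - δ (+ k - + 1))) (trans (if-δ (+ k + + 1) _)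
      (cong (_*_ (+ 1 - δ (+ k - - + 1))) (trans (trace² (Fcubic (+ k))) (cong₂ _*_ (Fcubic-legendre (+ k)) (Fcubic-legendre (+ k)))))))))
    L²-at : ∀ {k} l → k * k ≈ l [ P ] → L l * L l ≡ + 1 → L (k * k) * L (k * k) ≡ + 1
    L²-at {k} l h e = trans (square-periodic {L} L-periodic (k * k) l h) e
    term : ∀ k → (+ 1 - δ k) * ((+ 1 - δ (k - + 1)) * ((+ 1 - δ (k - - + 1)) * legendre² k)) ≡ G k
    term k with ≈0? k | ≈0? (k - + 1) | ≈0? (k - - + 1)
    ... | yes h | _ | _ = trans (cong (λ d → (+ 1 - d) * ((+ 1 - δ (k - + 1)) * ((+ 1 - δ (k - - + 1)) * legendre² k))) (δ-yes h))
          (sym (cong₂ _-_ (L²-at {k} (+ 0) (*-cong-≈ {k} {+ 0} {k} {+ 0} h h) L-0) (cong₂ _+_ (trans (δ-zero k) (δ-yes h)) (cong₂ _+_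
            (trans (δ-cong (k - + 1) (- + 1) (+-cong-≈ h (≈-refl { - + 1}))) (δ-no -1-unit)) (trans (δ-cong (k - - + 1) (+ 1) (+-cong-≈ h (≈-refl {+ 1}))) (δ-no 1-unit))))))
    ... | no uk | yes h | _ = trans (cong (λ d → (+ 1 - δ k) * ((+ 1 - d) * ((+ 1 - δ (k - - + 1)) * legendre² k))) (δ-yes h)) (trans (ℤ.*-zeroʳ (+ 1 - δ k))
          (sym (cong₂ _-_ (L²-at {k} (+ 1) (*-cong-≈ k≈1 k≈1) (cong₂ _*_ L-1 L-1)) (cong₂ _+_ (trans (δ-zero k) (δ-no uk)) (cong₂ _+_ (δ-yes h)
            (trans (δ-cong (k - - + 1) (+ 2) (+-cong-≈ k≈1 (≈-refl {+ 1}))) (δ-no 2-unit)))))))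
      where
      k≈1 : k ≈ + 1 [ P ]
      k≈1 = -≈0⇒≈ {k} {+ 1} h
    ... | no uk | no uk′ | yes h = trans (cong (λ d → (+ 1 - δ k) * ((+ 1 - δ (k - + 1)) * ((+ 1 - d) * legendre² k))) (δ-yes h)) (trans (cong (_*_ (+ 1 - δ k)) (ℤ.*-zeroʳ (+ 1 - δ (k - + 1)))) (trans (ℤ.*-zeroʳ (+ 1 - δ k))
          (sym (cong₂ _-_ (L²-at {k} (+ 1) (*-cong-≈ k≈-1 k≈-1) (cong₂ _*_ L-1 L-1)) (cong₂ _+_ (trans (δ-zero k) (δ-no uk)) (cong₂ _+_ (δ-no uk′) (δ-yes h)))))))
      where
      k≈-1 : k ≈ - + 1 [ P ]
      k≈-1 = -≈0⇒≈ {k} { - + 1} h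
    ... | no u₀ | no u₁ | no u₂ = trans (cong₂ (λ a b → (+ 1 - a) * ((+ 1 - b) * ((+ 1 - δ (k - - + 1)) * legendre² k))) (δ-no u₀) (δ-no u₁))
          (trans (cong (λ c → + 1 * (+ 1 * ((+ 1 - c) * legendre² k))) (δ-no u₂)) (trans (lemma (legendre² k)) (trans (sign-cancel (inj₁ refl) (ε-unit -1-unit) (trans (ℤ.*-identityˡ (legendre (k * k))) (legendre-L (k * k) unit)))
            (sym (trans (cong (_-_ (L (k * k) * L (k * k))) (cong₂ _+_ (trans (δ-zero k) (δ-no u₀)) (cong₂ _+_ (δ-no u₁) (δ-no u₂)))) (ℤ.+-identityʳ _))))))
      where
      lemma : ∀ x → + 1 * (+ 1 * (+ 1 * x)) ≡ x
      lemma = solve-∀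
      lemma′ : ∀ k → (k - + 1) * (k - - + 1) ≡ k * k - + 1
      lemma′ = solve-∀
      unit : Unit (k * k - + 1)
      unit = subst Unit (lemma′ k) (Unit-* u₁ u₂)

  -- Scaling by `w = 1 + k²` leaves the quadratic factor `y² + 2wy + w k²`. For it
  -- `a² - 4b = 4w (w - k²) = 4w`, and this coincidence makes the isogenous curve, after `z = 2t`, a
  -- twist of that of `A w`.
  Ecubic-A : ∀ k → Unit k → Unit (+ 1 + k * k) → ∑ (λ x → ε (Ecubic k x)) * ∑ (λ x → ε (Ecubic k x)) ≡ A (+ 1 + k * k) * A (+ 1 + k * k)
  Ecubic-A k uk uw = sign-cancel (inj₁ refl) (ε-unit (Unit-* uw 2-unit)) (trans (ℤ.*-identityˡ _) (begin
    ∑ (λ x → ε (Ecubic k x)) ≡⟨ ∑-ext (λ x → cong ε (lemma₀ k x)) ⟩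
    ∑ (λ x → ε (x * (x * x + + 2 * (w * w) * x + k * k * (w * w * w))))
      ≡⟨ sym (∑-scale (λ x → ε (x * (x * x + + 2 * (w * w) * x + k * k * (w * w * w)))) w (cubic-periodic (+ 2 * (w * w)) (k * k * (w * w * w))) uw) ⟩
    ∑ (λ y → ε (w * y * (w * y * (w * y) + + 2 * (w * w) * (w * y) + k * k * (w * w * w))))
      ≡⟨ ∑-ext (λ y → trans (cong ε (lemma₁ w k y)) (trans (ε-square* (w * (y * (y * y + + 2 * w * y + w * (k * k)))) uw) (ε-* w (y * (y * y + + 2 * w * y + w * (k * k)))))) ⟩
    ∑ (λ y → ε w * ε (y * (y * y + + 2 * w * y + w * (k * k)))) ≡⟨ ∑-*ˡ (ε w) (λ y → ε (y * (y * y + + 2 * w * y + w * (k * k)))) ⟩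
    ε w * ∑ (λ y → ε (y * (y * y + + 2 * w * y + w * (k * k)))) ≡⟨ cong (_*_ (ε w)) (isogeny (+ 2 * w) (w * (k * k)) (Unit-* uw (Unit-* uk uk))) ⟩
    ε w * ∑ (λ z → ε (z * (z * z - + 2 * (+ 2 * w) * z + (+ 2 * w * (+ 2 * w) - + 4 * (w * (k * k))))))
      ≡⟨ cong (_*_ (ε w)) (sym (∑-scale (λ z → ε (z * (z * z - + 2 * (+ 2 * w) * z + (+ 2 * w * (+ 2 * w) - + 4 * (w * (k * k)))))) (+ 2)
           (λ x y h → ε-cong _ _ (*-cong-≈ h (+-cong-≈ (+-cong-≈ (*-cong-≈ h h) (-‿cong-≈ (*-cong-≈ {+ 2 * (+ 2 * w)} ≈-refl h))) (≈-refl {+ 2 * w * (+ 2 * w) - + 4 * (w * (k * k))})))) 2-unit)) ⟩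
    ε w * ∑ (λ t → ε (+ 2 * t * (+ 2 * t * (+ 2 * t) - + 2 * (+ 2 * w) * (+ 2 * t) + (+ 2 * w * (+ 2 * w) - + 4 * (w * (k * k))))))
      ≡⟨ cong (_*_ (ε w)) (trans (∑-ext λ t → trans (cong ε (lemma₂ k t)) (trans (ε-square* (+ 2 * (t * (t * t + - (+ 2 * w) * t + w))) 2-unit) (ε-* (+ 2) (t * (t * t + - (+ 2 * w) * t + w))))) (∑-*ˡ (ε (+ 2)) (λ t → ε (t * (t * t + - (+ 2 * w) * t + w))))) ⟩
    ε w * (ε (+ 2) * A w) ≡⟨ trans (sym (ℤ.*-assoc (ε w) (ε (+ 2)) (A w))) (cong (_* A w) (sym (ε-* w (+ 2)))) ⟩
    ε (w * + 2) * A w ∎))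
    where
    w = + 1 + k * k
    lemma₀ : ∀ k x → let w = + 1 + k * k in x * (k * k * (w * w * w) + + 2 * (w * w) * x + x * x) ≡ x * (x * x + + 2 * (w * w) * x + k * k * (w * w * w))
    lemma₀ = solve-∀
    lemma₁ : ∀ w k y → w * y * (w * y * (w * y) + + 2 * (w * w) * (w * y) + k * k * (w * w * w)) ≡ w * w * (w * (y * (y * y + + 2 * w * y + w * (k * k))))
    lemma₁ = solve-∀
    lemma₂ : ∀ k t → let w = + 1 + k * k in + 2 * t * (+ 2 * t * (+ 2 * t) - + 2 * (+ 2 * w) * (+ 2 * t) + (+ 2 * w * (+ 2 * w) - + 4 * (w * (k * k)))) ≡ + 2 * + 2 * (+ 2 * (t * (t * t + - (+ 2 * w) * t + w)))
    lemma₂ = solve-∀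

  -- Of the excluded values of `k`, zero contributes `A 1 ² = 1` to `Z-A`, and the roots of
  -- `k² = -1` contribute nothing because `A 0 = 0`.
  sumA-Z : sumA p ≡ Z-A - + 1
  sumA-Z = begin
    sumA p ≡⟨ sumℤ-residues p _ ⟩
    sum p (λ k → if ((+ k) * (+ k)) ≡[ p ]? then + 0 else if ((+ k) * (+ k) + + 1) ≡[ p ]? then + 0 else aCoeff p k * aCoeff p k)
      ≡⟨ sum-ext p (λ k → trans (unfold k) (term (+ k))) ⟩
    sum p (λ k → G (+ k)) ≡⟨ sym (∑-def G) ⟩
    ∑ G ≡⟨ ∑-- (λ k → A (+ 1 + k * k) * A (+ 1 + k * k)) (λ k → δ (k - + 0)) ⟩
    Z-A - ∑ (λ k → δ (k - + 0)) ≡⟨ cong (_-_ Z-A) (∑-δ1 (+ 0)) ⟩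
    Z-A - + 1 ∎
    where
    E² G : ℤ → ℤ
    E² k = ∑ (λ x → ε (Ecubic k x)) * ∑ (λ x → ε (Ecubic k x))
    G k = A (+ 1 + k * k) * A (+ 1 + k * k) - δ (k - + 0)
    unfold : ∀ k → (if ((+ k) * (+ k)) ≡[ p ]? then + 0 else if ((+ k) * (+ k) + + 1) ≡[ p ]? then + 0 else aCoeff p k * aCoeff p k)
                 ≡ (+ 1 - δ (+ k * + k)) * ((+ 1 - δ (+ k * + k + + 1)) * E² (+ k))
    unfold k = trans (if-δ ((+ k) * (+ k)) _) (cong (_*_ (+ 1 - δ (+ k * + k))) (trans (if-δ ((+ k) * (+ k) + + 1) _) (cong (_*_ (+ 1 - δ (+ k * + k + + 1))) (trace² (Ecubic (+ k))))))
    term : ∀ k → (+ 1 - δ (k * k)) * ((+ 1 - δ (k * k + + 1)) * E² k) ≡ G k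
    term k with ≈0? k | ≈0? (k * k + + 1)
    ... | yes h | _ = trans (cong (λ d → (+ 1 - d) * ((+ 1 - δ (k * k + + 1)) * E² k)) (δ-yes (*-cong-≈ {k} {+ 0} {k} {+ 0} h h)))
          (sym (cong₂ _-_ (trans (square-periodic {A} A-periodic (+ 1 + k * k) (+ 1) (+-cong-≈ (≈-refl {+ 1}) (*-cong-≈ {k} {+ 0} {k} {+ 0} h h))) (cong₂ _*_ A-1 A-1)) (trans (δ-zero k) (δ-yes h))))
    ... | no uk | yes h = trans (cong (λ d → (+ 1 - δ (k * k)) * ((+ 1 - d) * E² k)) (δ-yes h)) (trans (ℤ.*-zeroʳ (+ 1 - δ (k * k)))
          (sym (cong₂ _-_ (cong₂ _*_ A0 A0) (trans (δ-zero k) (δ-no uk)))))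
      where
      A0 : A (+ 1 + k * k) ≡ + 0
      A0 = A-0 {+ 1 + k * k} (≈-trans (≡⇒≈ (ℤ.+-comm (+ 1) (k * k))) h)
    ... | no uk | no uw = trans (cong₂ (λ a b → (+ 1 - a) * ((+ 1 - b) * E² k)) (δ-no (Unit-* uk uk)) (δ-no uw)) (trans (lemma (E² k)) (trans (Ecubic-A k uk (subst Unit (ℤ.+-comm (k * k) (+ 1)) uw))
          (sym (trans (cong (_-_ (A (+ 1 + k * k) * A (+ 1 + k * k))) (trans (δ-zero k) (δ-no uk))) (ℤ.+-identityʳ _)))))
      where
      lemma : ∀ x → + 1 * (+ 1 * x) ≡ x
      lemma = solve-∀

  ∑-nonneg : ∀ (f : ℤ → ℤ) → (∀ x → + 0 ℤ.≤ f x) → + 0 ℤ.≤ ∑ f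
  ∑-nonneg f h = subst (+ 0 ℤ.≤_) (sym (∑-def f)) (go p)
    where
    go : ∀ n → + 0 ℤ.≤ sum n (λ i → f (+ i))
    go zero = ℤ.≤-refl
    go (suc n) = ℤ.+-mono-≤ (go n) (h (+ n))

  square-nonneg : ∀ x → + 0 ℤ.≤ x * x
  square-nonneg (+ n) = subst (+ 0 ℤ.≤_) (ℤ.pos-* n n) (ℤ.+≤+ z≤n)
  square-nonneg ℤ.-[1+ n ] = ℤ.+≤+ z≤n

  1±ε : ∀ l x → (+ 0 ℤ.≤ (+ 1 + ε l) * (x * x)) × (+ 0 ℤ.≤ (+ 1 - ε l) * (x * x))
  1±ε l x with trit-ε l
  ... | inj₁ e = subst (λ e → (+ 0 ℤ.≤ (+ 1 + e) * (x * x)) × (+ 0 ℤ.≤ (+ 1 - e) * (x * x))) (sym e)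
        (subst (+ 0 ℤ.≤_) (sym (ℤ.*-identityˡ _)) (square-nonneg x) , subst (+ 0 ℤ.≤_) (sym (ℤ.*-identityˡ _)) (square-nonneg x))
  ... | inj₂ (inj₁ e) = subst (λ e → (+ 0 ℤ.≤ (+ 1 + e) * (x * x)) × (+ 0 ℤ.≤ (+ 1 - e) * (x * x))) (sym e)
        (subst (+ 0 ℤ.≤_) (lemma (x * x)) (ℤ.+-mono-≤ (square-nonneg x) (square-nonneg x)) , ℤ.≤-refl)
    where
    lemma : ∀ y → y + y ≡ + 2 * y
    lemma = solve-∀
  ... | inj₂ (inj₂ e) = subst (λ e → (+ 0 ℤ.≤ (+ 1 + e) * (x * x)) × (+ 0 ℤ.≤ (+ 1 - e) * (x * x))) (sym e)
        (ℤ.≤-refl , subst (+ 0 ℤ.≤_) (lemma (x * x)) (ℤ.+-mono-≤ (square-nonneg x) (square-nonneg x)))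
    where
    lemma : ∀ y → y + y ≡ + 2 * y
    lemma = solve-∀

  Z-B-nonneg : + 0 ℤ.≤ Z-B
  Z-B-nonneg = ∑-nonneg (λ k → L (k * k) * L (k * k)) λ k → square-nonneg (L (k * k))

  -- The weights satisfy `1 + ε l ≤ 2`, so `Z-B` is at most twice the second moment of `L`.
  Z-B-upper : + 0 ℤ.≤ + 2 * (P * P - + 2 * P - + 1) - Z-B
  Z-B-upper = subst (+ 0 ℤ.≤_) complement (∑-nonneg (λ l → (+ 1 - ε l) * (L l * L l)) λ l → proj₂ (1±ε l (L l)))
    where
    lemma : ∀ e x → (+ 1 - e) * x ≡ + 2 * x - (+ 1 + e) * x
    lemma = solve-∀
    complement : ∑ (λ l → (+ 1 - ε l) * (L l * L l)) ≡ + 2 * (P * P - + 2 * P - + 1) - Z-B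
    complement = trans (∑-ext λ l → lemma (ε l) (L l * L l)) (trans (∑-- (λ l → + 2 * (L l * L l)) (λ l → (+ 1 + ε l) * (L l * L l)))
      (cong₂ _-_ (trans (∑-*ˡ (+ 2) (λ l → L l * L l)) (cong (_*_ (+ 2)) ∑L²)) (sym Z-B-twisted)))

  ε-parity : ∀ a → ε a ≈ + 1 - δ a [ + 2 ]
  ε-parity a with trit-ε a | ε²-δ a
  ... | inj₁ e | d = ≈-trans (≡⇒≈ (trans e (cong (λ x → x * x) (sym e)))) (≡⇒≈ d)
  ... | inj₂ (inj₁ e) | d = ≈-trans (≡⇒≈ (trans e (cong (λ x → x * x) (sym e)))) (≡⇒≈ d)
  ... | inj₂ (inj₂ e) | d = ≈-trans (≈-trans (≡⇒≈ e) (by (- + 1) refl)) (≡⇒≈ (trans (cong (λ x → x * x) (sym e)) d))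

  -- Modulo `2` the character is `1` on units, and the cubic has three distinct roots; so `L l` has
  -- the parity of `P - 3`.
  L-even : ∀ l → Unit l → Unit (+ 1 - l) → ∃ λ q → L l ≡ + 2 * q
  L-even l ul ud = halve (≈-trans (∑-cong-≈ {+ 2} λ t → ≈-trans (ε-parity (t * (+ 1 - t) * (l - t))) (≡⇒≈ (cong (_-_ (+ 1)) (separate t)))) (≡⇒≈ total))
    where
    separate : ∀ t → δ (t * (+ 1 - t) * (l - t)) ≡ δ t + δ (+ 1 - t) + δ (l - t)
    separate t = trans (δ-* (t * (+ 1 - t)) (l - t) λ { (h , k) → clash (euclid t (+ 1 - t) h) (-≈0⇒≈ {l} {t} k) })
                       (cong (_+ δ (l - t)) (δ-* t (+ 1 - t) λ { (h , k) → 1-unit (≈-trans (-≈0⇒≈ {+ 1} {t} k) h) }))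
      where
      clash : t ≈ + 0 [ P ] ⊎ + 1 - t ≈ + 0 [ P ] → l ≈ t [ P ] → ⊥
      clash (inj₁ h) k = ul (≈-trans k h)
      clash (inj₂ h) k = ud (≈-trans (+-cong-≈ (≈-refl {+ 1}) (-‿cong-≈ k)) h)
    total : ∑ (λ t → + 1 - (δ t + δ (+ 1 - t) + δ (l - t))) ≡ P - + 3
    total = trans (∑-- (λ _ → + 1) (λ t → δ t + δ (+ 1 - t) + δ (l - t))) (cong₂ _-_ ∑-1
      (trans (∑-+ (λ t → δ t + δ (+ 1 - t)) (λ t → δ (l - t))) (cong₂ _+_ (trans (∑-+ δ (λ t → δ (+ 1 - t))) (cong₂ _+_ ∑-δ0 (trans (∑-ext λ t → δ-neg (+ 1) t) (∑-δ1 (+ 1))))) (trans (∑-ext λ t → δ-neg l t) (∑-δ1 l)))))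
    halve : ∀ {x} → x ≈ P - + 3 [ + 2 ] → ∃ λ q → x ≡ + 2 * q
    halve (by q eq) = + m - + 1 + q , trans eq (lemma (+ m) q)
      where
      lemma : ∀ m q → + 1 + (m + m) - + 3 + q * + 2 ≡ + 2 * (m - + 1 + q)
      lemma = solve-∀

  -- The terms of `k` and `-k` agree. Those of `0` and `1` are `1`, and for `1 < k ≤ m` the term is
  -- the square of an even number, so the total is `1 + 2 * (1 + 4 * _)`.
  Z-B-mod8 : Z-B ≈ + 3 [ + 8 ]
  Z-B-mod8 = ≈-trans (≡⇒≈ folded) (≈-trans (+-cong-≈ (≡⇒≈ L-0) (≈-scaled (tail-sum m 0<m ℕ.≤-refl))) ≈-refl)
    where
    f : ℕ → ℤ
    f k = L (+ k * + k) * L (+ k * + k)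
    ≈-scaled : ∀ {a} → a ≈ + 1 [ + 4 ] → a + a ≈ + 2 [ + 8 ]
    ≈-scaled (by q refl) = by q (lemma q)
      where
      lemma : ∀ q → + 1 + q * + 4 + (+ 1 + q * + 4) ≡ + 2 + q * + 8
      lemma = solve-∀
    mirrored : ∀ i → suc i ≤ 2m → f (2m ∸ i) ≡ f (suc i)
    mirrored i i< = square-periodic {L} L-periodic _ _ (*-cong-≈′ (-≈ i i<))
      where
      *-cong-≈′ : ∀ {a b} → a ≈ - b [ P ] → a * a ≈ b * b [ P ]
      *-cong-≈′ {a} {b} h = ≈-trans (*-cong-≈ h h) (≡⇒≈ (lemma b))
        where
        lemma : ∀ b → - b * - b ≡ b * b
        lemma = solve-∀
      -≈ : ∀ i → suc i ≤ 2m → + (2m ∸ i) ≈ - + suc i [ P ]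
      -≈ i i< = by (+ 1) (trans (trans (sym (ℤ.⊖-≥ (ℕ.<⇒≤ i<))) (sym (ℤ.m-n≡m⊖n 2m i))) (lemma (+ 2m) (+ i)))
        where
        lemma : ∀ n i → n - i ≡ - (+ 1 + i) + + 1 * (+ 1 + n)
        lemma = solve-∀
    half : ∀ n → n ≡ m → sum n (λ i → f (suc (m ℕ.+ i))) ≡ sum n (f ∘ suc)
    half zero _ = refl
    half (suc n) eq = trans (sum-rev n (λ i → f (suc (m ℕ.+ i)))) (sum-cong (suc n) λ i i< →
      trans (cong f (index i (ℕ.≤-pred i<))) (mirrored i (ℕ.≤-trans i< (ℕ.≤-trans (ℕ.≤-reflexive eq) (ℕ.m≤m+n m m)))))
      where
      index : ∀ i → i ≤ n → suc (m ℕ.+ (n ∸ i)) ≡ 2m ∸ i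
      index i i≤n = trans (sym (ℕ.+-suc m (n ∸ i))) (trans (cong (m ℕ.+_) (trans (sym (ℕ.+-∸-assoc 1 i≤n)) (cong (_∸ i) eq))) (sym (ℕ.+-∸-assoc m (ℕ.≤-trans (ℕ.m≤n⇒m≤1+n i≤n) (ℕ.≤-reflexive eq)))))
    folded : Z-B ≡ L (+ 0) * L (+ 0) + (sum m (f ∘ suc) + sum m (f ∘ suc))
    folded = trans (∑-def (λ k → L (k * k) * L (k * k))) (trans (sum-suc 2m f) (cong (_+_ (f 0)) (trans (sum-++ m m (f ∘ suc)) (cong (_+_ (sum m (f ∘ suc))) (half m refl)))))
    even-square : ∀ k → 1 < k → k ≤ m → f k ≈ + 0 [ + 4 ]
    even-square k 1<k k≤m = squared (L (+ k * + k)) (L-even (+ k * + k) (Unit-* k-unit k-unit) other)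
      where
      squared : ∀ x → (∃ λ q → x ≡ + 2 * q) → x * x ≈ + 0 [ + 4 ]
      squared x (q , refl) = by (q * q) (lemma q)
        where
        lemma : ∀ q → + 2 * q * (+ 2 * q) ≡ + 0 + q * q * + 4
        lemma = solve-∀
      k<p : k < p
      k<p = s≤s (ℕ.≤-trans k≤m (ℕ.m≤m+n m m))
      k-unit : Unit (+ k)
      k-unit = unit-small k (ℕ.<-trans (s≤s z≤n) 1<k) k<p
      lemma : ∀ k → + 1 - k * k ≡ (+ 1 - k) * (+ 1 + k)
      lemma = solve-∀
      other : Unit (+ 1 - + k * + k)
      other = subst Unit (sym (lemma (+ k))) (Unit-* {+ 1 - + k} {+ 1 + + k} (λ h → ℕ.<⇒≢ 1<k (≈-small {1} {k} (s≤s 0<2m) k<p (-≈0⇒≈ {+ 1} {+ k} h)))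
        (unit-small (suc k) (s≤s z≤n) (s≤s (ℕ.+-mono-≤ 0<m k≤m))))
    tail-sum : ∀ n → 0 < n → n ≤ m → sum n (f ∘ suc) ≈ + 1 [ + 4 ]
    tail-sum (suc zero) _ _ = ≡⇒≈ (trans (ℤ.+-identityˡ _) (cong₂ _*_ L-1 L-1))
    tail-sum (suc (suc n)) _ n≤m = +-cong-≈ (tail-sum (suc n) (s≤s z≤n) (ℕ.≤-trans (ℕ.n≤1+n _) n≤m)) (even-square (suc (suc n)) (s≤s (s≤s z≤n)) n≤m)

-- Teichmüller representatives and the expansion of `L` modulo p²

module PrimeSquare (m : ℕ) (pr : Prime (suc (m ℕ.+ m))) where
  open PrimeField m pr
  open CharacterSums m pr
  open Moments m pr
  open FamilySums m pr

  -- A function that is periodic only modulo `N` is first composed with `residue`, which makes it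
  -- periodic in the strict sense that `∑-bijection` asks for.
  ∑-bijection-≈ : ∀ {N} (f σ σ⁻¹ : ℤ → ℤ) → (∀ {a b} → a ≈ b [ P ] → f a ≈ f b [ N ]) → (∀ {a b} → a ≈ b [ P ] → σ a ≈ σ b [ P ]) →
                  (∀ {a b} → a ≈ b [ P ] → σ⁻¹ a ≈ σ⁻¹ b [ P ]) → (∀ x → σ⁻¹ (σ x) ≈ x [ P ]) → (∀ y → σ (σ⁻¹ y) ≈ y [ P ]) →
                  ∑ (λ x → f (σ x)) ≈ ∑ f [ N ]
  ∑-bijection-≈ {N} f σ σ⁻¹ per σ-cong σ⁻¹-cong left right = begin
    ∑ (λ x → f (σ x)) ≈⟨ ∑-cong-≈ (λ x → per (residue-≈ (σ x))) ⟩
    ∑ (λ x → f̂ (σ x)) ≡⟨ ∑-bijection f̂ σ σ⁻¹ f̂-periodic σ-cong σ⁻¹-cong left right ⟩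
    ∑ f̂ ≈⟨ ∑-cong-≈ (λ x → ≈-sym (per (residue-≈ x))) ⟩
    ∑ f ∎
    where
    open ≈-Reasoning N
    f̂ : ℤ → ℤ
    f̂ x = f (+ residue x)
    f̂-periodic : Periodic f̂
    f̂-periodic a b h = cong (λ i → f (+ i)) (≈-small (residue< a) (residue< b) (≈-trans (≈-sym (residue-≈ a)) (≈-trans h (residue-≈ b))))

  υ : ℤ → ℤ
  υ t = + 1 - δ t

  υ-cong : Periodic υ
  υ-cong a b h = cong (_-_ (+ 1)) (δ-cong a b h)

  υ-zero : ∀ {t} x → t ≈ + 0 [ P ] → υ t * x ≡ + 0
  υ-zero x h = cong (λ d → (+ 1 - d) * x) (δ-yes h)

  υ-unit : ∀ {t} x → Unit t → υ t * x ≡ x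
  υ-unit x u = trans (cong (λ d → (+ 1 - d) * x) (δ-no u)) (ℤ.*-identityˡ x)

  υ-restrict : ∀ {N t x y} → (Unit t → x ≈ y [ N ]) → υ t * x ≈ υ t * y [ N ]
  υ-restrict {N} {t} {x} {y} h with ≈0? t
  ... | yes z = ≡⇒≈ (trans (υ-zero x z) (sym (υ-zero y z)))
  ... | no u = ≈-trans (≡⇒≈ (υ-unit x u)) (≈-trans (h u) (≡⇒≈ (sym (υ-unit y u))))

  ∑υ : ∑ υ ≡ P - + 1
  ∑υ = trans (∑-ext λ x → cong (_-_ (+ 1)) (sym (δ-zero x))) (∑-1-δ (+ 0))

  τ-cong : ∀ {a b} → a ≈ b [ P ] → τ a ≈ τ b [ PP ]
  τ-cong = lift

  τ-P : ∀ x → τ x ≈ x [ P ]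
  τ-P = fermat

  cancel-P : ∀ {a b c} → Unit c → c * a ≈ c * b [ PP ] → a ≈ b [ PP ]
  cancel-P {a} {b} {c} u h = linear-≈₂ (inv c) (b - a) h (inv-right u) (lemma a b c (inv c))
    where
    lemma : ∀ a b c i → a ≡ b + i * (c * a - c * b) + (b - a) * (c * i - + 1)
    lemma = solve-∀

  -- Multiplication by a unit `g` permutes the units, so `τ g ^ n * S ≈ S`; summing this over `g`
  -- gives `S * S ≈ (P - 1) * S`. As `S` vanishes modulo `P`, the factor `S - (P - 1)` is a unit and
  -- can be cancelled.
  powerSum-τ : ∀ n → 0 < n → n < 2m → ∑ (λ t → υ t * τ t ^ n) ≈ + 0 [ PP ]
  powerSum-τ n 0<n n<2m = cancel-P unit (begin
    (S - (P - + 1)) * S ≡⟨ lemma S (P - + 1) ⟩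
    S * S - (P - + 1) * S ≈⟨ +-cong-≈ product (≈-refl { - ((P - + 1) * S)}) ⟩
    (P - + 1) * S - (P - + 1) * S ≡⟨ ℤ.+-inverseʳ ((P - + 1) * S) ⟩
    + 0 ≡⟨ sym (ℤ.*-zeroʳ (S - (P - + 1))) ⟩
    (S - (P - + 1)) * + 0 ∎)
    where
    open ≈-Reasoning PP
    S = ∑ (λ t → υ t * τ t ^ n)
    lemma : ∀ s x → (s - x) * s ≡ s * s - x * s
    lemma = solve-∀
    f : ℤ → ℤ
    f t = υ t * τ t ^ n
    f-cong : ∀ {a b} → a ≈ b [ P ] → f a ≈ f b [ PP ]
    f-cong {a} {b} h = *-cong-≈ (≡⇒≈ {N = PP} (υ-cong a b h)) (^-cong-≈ n (τ-cong h))
    scaled : ∀ g → Unit g → τ g ^ n * S ≈ S [ PP ]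
    scaled g u = begin
      τ g ^ n * S ≡⟨ sym (∑-*ˡ (τ g ^ n) f) ⟩
      ∑ (λ t → τ g ^ n * f t) ≡⟨ ∑-ext (λ t → trans (lemma′ (τ g ^ n) (υ t) (τ t ^ n)) (cong₂ _*_ (cong (_-_ (+ 1)) (δ-associate g u ≈-refl)) (trans (sym (^-distrib-* (τ g) (τ t) n)) (cong (_^ n) (sym (τ-* g t)))))) ⟩
      ∑ (λ t → f (g * t)) ≈⟨ ∑-bijection-≈ f (λ t → g * t) (λ t → inv g * t) f-cong (λ h → *-cong-≈ {g} ≈-refl h) (λ h → *-cong-≈ {inv g} ≈-refl h)
                                           (λ t → linear-≈ t (inv-rightₚ u) (lemma₁ g (inv g) t)) (λ t → linear-≈ t (inv-rightₚ u) (lemma₂ g (inv g) t)) ⟩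
      S ∎
      where
      lemma′ : ∀ a b c → a * (b * c) ≡ b * (a * c)
      lemma′ = solve-∀
      lemma₁ : ∀ g i t → i * (g * t) ≡ t + t * (g * i - + 1)
      lemma₁ = solve-∀
      lemma₂ : ∀ g i t → g * (i * t) ≡ t + t * (g * i - + 1)
      lemma₂ = solve-∀
    product : S * S ≈ (P - + 1) * S [ PP ]
    product = begin
      S * S ≡⟨ sym (∑-*ʳ f S) ⟩
      ∑ (λ g → f g * S) ≈⟨ ∑-cong-≈ (λ g → ≈-trans (≡⇒≈ (ℤ.*-assoc (υ g) (τ g ^ n) S)) (υ-restrict (scaled g))) ⟩
      ∑ (λ g → υ g * S) ≡⟨ trans (∑-*ʳ υ S) (cong (_* S) ∑υ) ⟩
      (P - + 1) * S ∎
    S≈0 : S ≈ + 0 [ P ]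
    S≈0 = ≈-trans (∑-cong-≈ (λ t → reduce t)) (≈-trans (≡⇒≈ (∑-def (λ t → t ^ n))) (powerSum-zero n n<2m))
      where
      reduce : ∀ t → υ t * τ t ^ n ≈ t ^ n [ P ]
      reduce t with ≈0? t
      ... | yes h = ≈-trans (≡⇒≈ (υ-zero (τ t ^ n) h)) (≈-sym (≈-trans (^-cong-≈ n h) (≡⇒≈ (zero-power n 0<n))))
      ... | no u = ≈-trans (≡⇒≈ (υ-unit (τ t ^ n) u)) (^-cong-≈ n (τ-P t))
    unit : Unit (S - (P - + 1))
    unit h = 1-unit (≈-trans (≈-sym (linear-≈₂ (+ 1) (- + 1) S≈0 P≈0 (lemma₄ S P))) h)
      where
      lemma₄ : ∀ S P → S - (P - + 1) ≡ + 1 + + 1 * (S - + 0) + - + 1 * (P - + 0)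
      lemma₄ = solve-∀

  τ-inverse : ∀ {t} → Unit t → τ t * τ (inv t) ≈ + 1 [ PP ]
  τ-inverse {t} u = ≈-trans (≡⇒≈ (sym (τ-* t (inv t)))) (≈-trans (τ-cong (inv-rightₚ u)) (≡⇒≈ (ℤ.^-zeroˡ p)))

  ∑υ-inv : ∀ {N} (f : ℤ → ℤ) → (∀ {a b} → a ≈ b [ P ] → f a ≈ f b [ N ]) → ∑ (λ t → υ t * f (inv t)) ≈ ∑ (λ t → υ t * f t) [ N ]
  ∑υ-inv {N} f per = ≈-trans (≡⇒≈ (∑-ext λ t → cong (λ d → (+ 1 - d) * f (inv t)) (δ-inv t)))
    (∑-bijection-≈ (λ t → υ t * f t) inv inv (λ {a} {b} h → *-cong-≈ (≡⇒≈ {N = N} (υ-cong a b h)) (per h)) inv-cong inv-cong inv-involutive inv-involutive)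
    where
    δ-inv : ∀ t → δ t ≡ δ (inv t)
    δ-inv t with ≈0? t
    ... | yes h = trans (δ-yes h) (sym (δ-yes (inv-zero h)))
    ... | no u = trans (δ-no u) (sym (δ-no (inv-unit u)))

  split-powers : ∀ {t} k d → Unit t → τ t ^ (k ℕ.+ d) * τ (inv t) ^ k ≈ τ t ^ d [ PP ]
  split-powers {t} k d u = begin
    τ t ^ (k ℕ.+ d) * τ (inv t) ^ k ≡⟨ trans (cong (_* τ (inv t) ^ k) (ℤ.^-distribˡ-+-* (τ t) k d)) (lemma (τ t ^ k) (τ t ^ d) (τ (inv t) ^ k)) ⟩
    τ t ^ k * τ (inv t) ^ k * τ t ^ d ≡⟨ cong (_* τ t ^ d) (sym (^-distrib-* (τ t) (τ (inv t)) k)) ⟩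
    (τ t * τ (inv t)) ^ k * τ t ^ d ≈⟨ *-cong-≈ (≈-trans (^-cong-≈ k (τ-inverse u)) (≡⇒≈ (ℤ.^-zeroˡ k))) (≈-refl {τ t ^ d}) ⟩
    + 1 * τ t ^ d ≡⟨ ℤ.*-identityˡ (τ t ^ d) ⟩
    τ t ^ d ∎
    where
    open ≈-Reasoning PP
    lemma : ∀ a b c → a * b * c ≡ a * c * b
    lemma = solve-∀

  orthogonality-≡ : ∀ k → ∑ (λ t → υ t * (τ t ^ k * τ (inv t) ^ k)) ≈ P - + 1 [ PP ]
  orthogonality-≡ k = ≈-trans (∑-cong-≈ λ t → υ-restrict λ u → ≈-trans (≡⇒≈ (cong (λ n → τ t ^ n * τ (inv t) ^ k) (sym (ℕ.+-identityʳ k)))) (split-powers k 0 u))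
    (≡⇒≈ (trans (∑-ext λ t → ℤ.*-identityʳ (υ t)) ∑υ))

  orthogonality-> : ∀ k d → 0 < d → d < 2m → ∑ (λ t → υ t * (τ t ^ (k ℕ.+ d) * τ (inv t) ^ k)) ≈ + 0 [ PP ]
  orthogonality-> k d 0<d d< = ≈-trans (∑-cong-≈ λ t → υ-restrict (split-powers k d)) (powerSum-τ d 0<d d<)

  orthogonality-< : ∀ k d → 0 < d → d < 2m → ∑ (λ t → υ t * (τ t ^ k * τ (inv t) ^ (k ℕ.+ d))) ≈ + 0 [ PP ]
  orthogonality-< k d 0<d d< = ≈-trans (∑-cong-≈ λ t → υ-restrict λ u → ≈-trans (swapped u) (split-powers {inv t} k d (inv-unit u)))
    (≈-trans (∑υ-inv (λ t → τ t ^ d) (λ h → ^-cong-≈ d (τ-cong h))) (powerSum-τ d 0<d d<))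
    where
    swapped : ∀ {t} → Unit t → τ t ^ k * τ (inv t) ^ (k ℕ.+ d) ≈ τ (inv t) ^ (k ℕ.+ d) * τ (inv (inv t)) ^ k [ PP ]
    swapped {t} u = ≈-trans (≡⇒≈ (ℤ.*-comm (τ t ^ k) (τ (inv t) ^ (k ℕ.+ d)))) (*-cong-≈ {τ (inv t) ^ (k ℕ.+ d)} ≈-refl (^-cong-≈ k (τ-cong (≈-sym (inv-involutive t)))))

  orthogonality-≢ : ∀ j k → j ≢ k → j ≤ 2m → k ≤ 2m → (0 < j ⊎ k < 2m) → (0 < k ⊎ j < 2m) → ∑ (λ t → υ t * (τ t ^ j * τ (inv t) ^ k)) ≈ + 0 [ PP ]
  orthogonality-≢ j k j≢k j≤ k≤ h₁ h₂ with ℕ.<-cmp j k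
  ... | tri≈ _ j≡k _ = contradiction j≡k j≢k
  ... | tri< j<k _ _ = subst (λ n → ∑ (λ t → υ t * (τ t ^ j * τ (inv t) ^ n)) ≈ + 0 [ PP ]) (ℕ.m+[n∸m]≡n (ℕ.<⇒≤ j<k)) (orthogonality-< j (k ∸ j) (ℕ.m<n⇒0<n∸m j<k) (small h₁))
    where
    small : 0 < j ⊎ k < 2m → k ∸ j < 2m
    small (inj₁ 0<j) = ℕ.<-≤-trans (ℕ.∸-monoʳ-< 0<j (ℕ.<⇒≤ j<k)) k≤
    small (inj₂ k<) = ℕ.≤-<-trans (ℕ.m∸n≤m k j) k<
  ... | tri> _ _ k<j = subst (λ n → ∑ (λ t → υ t * (τ t ^ n * τ (inv t) ^ k)) ≈ + 0 [ PP ]) (ℕ.m+[n∸m]≡n (ℕ.<⇒≤ k<j)) (orthogonality-> k (j ∸ k) (ℕ.m<n⇒0<n∸m k<j) (small h₂))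
    where
    small : 0 < k ⊎ j < 2m → j ∸ k < 2m
    small (inj₁ 0<k) = ℕ.<-≤-trans (ℕ.∸-monoʳ-< 0<k (ℕ.<⇒≤ k<j)) j≤
    small (inj₂ j<) = ℕ.≤-<-trans (ℕ.m∸n≤m j k) j<

  -- The quadratic character modulo p²

  -- Distinct exponents up to `2m` are distinct modulo `2m`, except for `0` and `2m`; the last two
  -- hypotheses rule out this pair in either order.
  orthogonality : ∀ j k → j ≤ 2m → k ≤ 2m → (0 < j ⊎ k < 2m) → (0 < k ⊎ j < 2m) →
                  ∑ (λ t → υ t * (τ t ^ j * τ (inv t) ^ k)) ≈ (P - + 1) * kronecker j k [ PP ]
  orthogonality j k j≤ k≤ h h′ with j ℕ.≟ k
  ... | yes refl = ≈-trans (orthogonality-≡ j) (≡⇒≈ (sym (ℤ.*-identityʳ (P - + 1))))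
  ... | no j≢k = ≈-trans (orthogonality-≢ j k j≢k j≤ k≤ h h′) (≡⇒≈ (sym (ℤ.*-zeroʳ (P - + 1))))

  sign-power : ∀ {x} → Trit x → x ^ p ≡ x
  sign-power (inj₁ refl) = refl
  sign-power (inj₂ (inj₁ refl)) = ℤ.^-zeroˡ p
  sign-power (inj₂ (inj₂ refl)) = cong (_*_ (- + 1)) (trans (ℤ.^-distribˡ-+-* (- + 1) m m) (signPower² m))

  -- The values `0`, `1`, `-1` are their own `p`-th powers, so the `p`-th power of Euler's criterion
  -- lifts it to `PP`.
  ε-lift : ∀ a → ε a ≈ τ a ^ m [ PP ]
  ε-lift a = ≈-trans (≡⇒≈ (sym (sign-power (trit-ε a)))) (≈-trans (lift (euler a)) (≡⇒≈ (^-swap a m p)))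

  -- The series of `- log (1 - z)`, cut off after `z^(p-1)`.
  logPoly : ℤ → ℤ
  logPoly z = sum 2m (λ k → inv (+ suc k) * z ^ suc k)

  binom-p : ∀ k → k < 2m → binom p (suc k) ≈ P * (inv (+ suc k) * signPower k) [ PP ]
  binom-p k k< = linear-≈₂ (inv (+ suc k)) (- binom p (suc k)) absorbed (inv-right (unit-small (suc k) (s≤s z≤n) (s≤s k<))) (lemma (binom p (suc k)) P (inv (+ suc k)) (signPower k) (+ suc k))
    where
    absorbed : + suc k * binom p (suc k) ≈ P * signPower k [ PP ]
    absorbed = ≈-trans (≡⇒≈ (binom-absorb 2m k)) (≈-scale P (binom-sign k (ℕ.<⇒≤ k<)))
    lemma : ∀ b P i s k → b ≡ P * (i * s) + i * (k * b - P * s) + - b * (k * i - + 1)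
    lemma = solve-∀

  -- The inner binomial coefficients are `P * (-1)^k / (k + 1)` modulo `PP`, so the inner terms add
  -- up to the truncated logarithm. The last term is again `- τ z` because `τ` is idempotent.
  frobenius-P² : ∀ z → (+ 1 - τ z) ^ p ≈ + 1 - τ z + - (P * logPoly (τ z)) [ PP ]
  frobenius-P² z = begin
    (+ 1 - ζ) ^ p ≡⟨ binomial (- ζ) p ⟩
    sum p (λ k → binom p k * (- ζ) ^ k) + binom p p * (- ζ) ^ p ≡⟨ cong (_+ binom p p * (- ζ) ^ p) (sum-suc 2m (λ k → binom p k * (- ζ) ^ k)) ⟩
    binom p 0 * + 1 + sum 2m (λ k → binom p (suc k) * (- ζ) ^ suc k) + binom p p * (- ζ) ^ p
      ≈⟨ +-cong-≈ (+-cong-≈ (≡⇒≈ {N = PP} (cong (_* + 1) (binom-0 p))) (sum-cong-≈ 2m term)) last ⟩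
    + 1 + sum 2m (λ k → - P * (inv (+ suc k) * ζ ^ suc k)) + - ζ ≡⟨ cong (λ x → + 1 + x + - ζ) (sum-*ˡ 2m (- P) (λ k → inv (+ suc k) * ζ ^ suc k)) ⟩
    + 1 + - P * logPoly ζ + - ζ ≡⟨ lemma P (logPoly ζ) ζ ⟩
    + 1 - ζ + - (P * logPoly ζ) ∎
    where
    open ≈-Reasoning PP
    ζ = τ z
    lemma : ∀ P l z → + 1 + - P * l + - z ≡ + 1 - z + - (P * l)
    lemma = solve-∀
    lemma₁ : ∀ P i s x → P * (i * s) * (- + 1 * s * x) ≡ - P * (i * x) * (s * s)
    lemma₁ = solve-∀
    term : ∀ k → k < 2m → binom p (suc k) * (- ζ) ^ suc k ≈ - P * (inv (+ suc k) * ζ ^ suc k) [ PP ]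
    term k k< = ≈-trans (*-cong-≈ (binom-p k k<) (≡⇒≈ {N = PP} (neg-power ζ (suc k)))) (≡⇒≈ (trans (lemma₁ P (inv (+ suc k)) (signPower k) (ζ ^ suc k))
      (trans (cong (_*_ (- P * (inv (+ suc k) * ζ ^ suc k))) (signPower² k)) (ℤ.*-identityʳ _))))
    last : binom p p * (- ζ) ^ p ≈ - ζ [ PP ]
    last = begin
      binom p p * (- ζ) ^ p ≡⟨ trans (cong (_* (- ζ) ^ p) (binom-n p)) (trans (ℤ.*-identityˡ ((- ζ) ^ p)) (neg-power ζ p)) ⟩
      signPower p * ζ ^ p ≈⟨ *-cong-≈ (≡⇒≈ {N = PP} (sign-power (inj₂ (inj₂ refl)))) (τ-idem z) ⟩
      - + 1 * ζ ≡⟨ ℤ.-1*i≡-i ζ ⟩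
      - ζ ∎

  m₁ : ℕ
  m₁ = ℕ.pred m

  m≡ : suc m₁ ≡ m
  m≡ = ℕ.suc-pred m {{ℕ.>-nonZero 0<m}}

  -- The coefficient of `P` in `(1 - z - P * logPoly z) ^ m`.
  correction : ℤ → ℤ
  correction z = - (+ m * (+ 1 - z) ^ m₁ * logPoly z)

  h-expansion : ∀ z → ε (+ 1 - z) ≈ (+ 1 - τ z) ^ m + P * correction (τ z) [ PP ]
  h-expansion z = begin
    ε (+ 1 - z) ≡⟨ ε-cong (+ 1 - z) (+ 1 - ζ) (+-cong-≈ (≈-refl {+ 1}) (-‿cong-≈ (≈-sym (τ-P z)))) ⟩
    ε (+ 1 - ζ) ≈⟨ ε-lift (+ 1 - ζ) ⟩
    τ (+ 1 - ζ) ^ m ≈⟨ ^-cong-≈ m (frobenius-P² z) ⟩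
    (+ 1 - ζ + - (P * logPoly ζ)) ^ m ≡⟨ cong ((+ 1 - ζ + - (P * logPoly ζ)) ^_) (sym m≡) ⟩
    (+ 1 - ζ + - (P * logPoly ζ)) ^ suc m₁ ≈⟨ widen (power-perturb (+ 1 - ζ) (- (P * logPoly ζ)) m₁) ⟩
    (+ 1 - ζ) ^ suc m₁ + + suc m₁ * (+ 1 - ζ) ^ m₁ * - (P * logPoly ζ)
      ≡⟨ trans (cong (λ n → (+ 1 - ζ) ^ n + + n * (+ 1 - ζ) ^ m₁ * - (P * logPoly ζ)) m≡) (lemma ((+ 1 - ζ) ^ m) (+ m) ((+ 1 - ζ) ^ m₁) P (logPoly ζ)) ⟩
    (+ 1 - ζ) ^ m + P * correction ζ ∎
    where
    open ≈-Reasoning PP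
    ζ = τ z
    lemma : ∀ a n b P l → a + n * b * - (P * l) ≡ a + P * - (n * b * l)
    lemma = solve-∀
    widen : ∀ {x y} → x ≈ y [ - (P * logPoly ζ) * - (P * logPoly ζ) ] → x ≈ y [ PP ]
    widen h = ≈-weaken (logPoly ζ * logPoly ζ) (subst (_ ≈ _ [_]) (lemma₁ P (logPoly ζ)) h)
      where
      lemma₁ : ∀ P l → - (P * l) * - (P * l) ≡ l * l * (P * P)
      lemma₁ = solve-∀

  c : ℕ → ℤ
  c i = binom m i * signPower i

  c-expansion : ∀ z → (+ 1 - z) ^ m ≡ sum (suc m) (λ i → c i * z ^ i)
  c-expansion z = trans (binomial (- z) m) (sum-ext (suc m) λ i → trans (cong (_*_ (binom m i)) (neg-power z i)) (sym (ℤ.*-assoc (binom m i) (signPower i) (z ^ i))))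

  -- For `t ≠ 0` the cubic is `- t² (1 - t)(1 - l / t)`. So `L` is a multiplicative convolution of
  -- `ε (1 - t)` with itself, and expanding in powers of `τ t` diagonalises it.
  L-convolution : ∀ l → L l ≡ ε (- + 1) * ∑ (λ t → υ t * (ε (+ 1 - t) * ε (+ 1 - l * inv t)))
  L-convolution l = trans (∑-ext term) (∑-*ˡ (ε (- + 1)) (λ t → υ t * (ε (+ 1 - t) * ε (+ 1 - l * inv t))))
    where
    lemma : ∀ t l i → t * (+ 1 - t) * (l - t) ≡ t * t * (- + 1 * ((+ 1 - t) * (+ 1 - l * i))) + - (t * (+ 1 - t) * l) * (t * i - + 1)
    lemma = solve-∀
    term : ∀ t → ε (t * (+ 1 - t) * (l - t)) ≡ ε (- + 1) * (υ t * (ε (+ 1 - t) * ε (+ 1 - l * inv t)))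
    term t with ≈0? t
    ... | yes h = trans (ε-zero (*-cong-≈ {t * (+ 1 - t)} {+ 0} {l - t} (*-cong-≈ {t} {+ 0} {+ 1 - t} h ≈-refl) ≈-refl)) (sym (trans (cong (_*_ (ε (- + 1))) (υ-zero _ h)) (ℤ.*-zeroʳ (ε (- + 1)))))
    ... | no u = trans (ε-cong _ _ (linear-≈ (- (t * (+ 1 - t) * l)) (inv-rightₚ u) (lemma t l (inv t))))
          (trans (ε-square* (- + 1 * ((+ 1 - t) * (+ 1 - l * inv t))) u) (trans (ε-* (- + 1) ((+ 1 - t) * (+ 1 - l * inv t))) (cong (_*_ (ε (- + 1))) (trans (ε-* (+ 1 - t) (+ 1 - l * inv t)) (sym (υ-unit _ u))))))

  moment : ℕ → ℤ
  moment i = ∑ (λ t → υ t * (correction (τ t) * τ (inv t) ^ i))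

  -- The main terms of the two factors multiply by orthogonality. The `P`-correction of either
  -- factor meets the main term of the other; the substitution `t ↦ l / t` exchanges the two, so the
  -- same `moment i` occurs twice. The product of the corrections has a factor `PP`.
  L-expansion : ∀ l → Unit l → L l ≈ ε (- + 1) * sum (suc m) (λ i → c i * (c i * (P - + 1) + + 2 * P * moment i) * τ l ^ i) [ PP ]
  L-expansion l ul = ≈-trans (≡⇒≈ (L-convolution l)) (*-cong-≈ {ε (- + 1)} ≈-refl (begin
    ∑ (λ t → υ t * (h t * h (l * inv t)))
      ≈⟨ ∑-cong-≈ (λ t → expand t) ⟩
    ∑ (λ t → sum (suc m) (λ i → c i * (υ t * (τ t ^ i * h (l * inv t)))) + P * sum (suc m) (λ i → c i * τ l ^ i * (υ t * (correction (τ t) * τ (inv t) ^ i))))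
      ≡⟨ trans (∑-+ (λ t → sum (suc m) (λ i → c i * (υ t * (τ t ^ i * h (l * inv t))))) (λ t → P * sum (suc m) (λ i → c i * τ l ^ i * (υ t * (correction (τ t) * τ (inv t) ^ i)))))
           (cong₂ _+_ (trans (∑-sum-swap (suc m) (λ t i → c i * (υ t * (τ t ^ i * h (l * inv t))))) (sum-ext (suc m) λ i → ∑-*ˡ (c i) (λ t → υ t * (τ t ^ i * h (l * inv t)))))
              (trans (∑-*ˡ P (λ t → sum (suc m) (λ i → c i * τ l ^ i * (υ t * (correction (τ t) * τ (inv t) ^ i))))) (cong (_*_ P) (trans (∑-sum-swap (suc m) (λ t i → c i * τ l ^ i * (υ t * (correction (τ t) * τ (inv t) ^ i)))) (sum-ext (suc m) λ i → ∑-*ˡ (c i * τ l ^ i) (λ t → υ t * (correction (τ t) * τ (inv t) ^ i))))))) ⟩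
    sum (suc m) (λ i → c i * ∑ (λ t → υ t * (τ t ^ i * h (l * inv t)))) + P * sum (suc m) (λ i → c i * τ l ^ i * moment i)
      ≈⟨ +-cong-≈ (sum-cong-≈ (suc m) λ i i< → *-cong-≈ {c i} ≈-refl (≈-trans (reindexed i) (*-cong-≈ {τ l ^ i} ≈-refl (gauss i (ℕ.≤-pred i<))))) (≈-refl {P * sum (suc m) (λ i → c i * τ l ^ i * moment i)}) ⟩
    sum (suc m) (λ i → c i * (τ l ^ i * (c i * (P - + 1) + P * moment i))) + P * sum (suc m) (λ i → c i * τ l ^ i * moment i)
      ≡⟨ trans (cong (_+_ (sum (suc m) (λ i → c i * (τ l ^ i * (c i * (P - + 1) + P * moment i))))) (sym (sum-*ˡ (suc m) P (λ i → c i * τ l ^ i * moment i)))) (trans (sym (sum-+ (suc m) (λ i → c i * (τ l ^ i * (c i * (P - + 1) + P * moment i))) (λ i → P * (c i * τ l ^ i * moment i)))) (sum-ext (suc m) λ i → lemma (c i) (τ l ^ i) P (moment i))) ⟩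
    sum (suc m) (λ i → c i * (c i * (P - + 1) + + 2 * P * moment i) * τ l ^ i) ∎))
    where
    open ≈-Reasoning PP
    h : ℤ → ℤ
    h z = ε (+ 1 - z)
    h-cong : Periodic h
    h-cong a b e = ε-cong (+ 1 - a) (+ 1 - b) (+-cong-≈ (≈-refl {+ 1}) (-‿cong-≈ e))
    lemma : ∀ c t P b → c * (t * (c * (P - + 1) + P * b)) + P * (c * t * b) ≡ c * (c * (P - + 1) + + 2 * P * b) * t
    lemma = solve-∀
    h-mod-P : ∀ z → h z ≈ sum (suc m) (λ i → c i * τ z ^ i) [ P ]
    h-mod-P z = ≈-trans (P²⇒P (h-expansion z)) (≈-trans (by (correction (τ z)) (cong (_+_ ((+ 1 - τ z) ^ m)) (ℤ.*-comm P (correction (τ z))))) (≡⇒≈ (c-expansion (τ z))))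
    expand : ∀ t → υ t * (h t * h (l * inv t)) ≈ sum (suc m) (λ i → c i * (υ t * (τ t ^ i * h (l * inv t)))) + P * sum (suc m) (λ i → c i * τ l ^ i * (υ t * (correction (τ t) * τ (inv t) ^ i))) [ PP ]
    expand t = begin
      υ t * (h t * k) ≈⟨ *-cong-≈ {υ t} ≈-refl (*-cong-≈ (≈-trans (h-expansion t) (+-cong-≈ (≡⇒≈ {N = PP} (c-expansion (τ t))) (≈-refl {P * correction (τ t)}))) (≈-refl {k})) ⟩
      υ t * ((s + P * b) * k) ≡⟨ lemma₁ (υ t) s P b k ⟩
      -- Behind the factor `P` the second character may be replaced by its polynomial modulo `P`.
      s * (υ t * k) + P * (υ t * b * k) ≈⟨ +-cong-≈ (≈-refl {s * (υ t * k)}) (≈-scale P (*-cong-≈ {υ t * b} ≈-refl (h-mod-P (l * inv t)))) ⟩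
      s * (υ t * k) + P * (υ t * b * sum (suc m) (λ i → c i * τ (l * inv t) ^ i))
        ≡⟨ cong₂ (λ x y → x + P * y) (trans (sym (sum-*ʳ (suc m) (υ t * k) (λ i → c i * τ t ^ i))) (sum-ext (suc m) λ i → lemma₂ (c i) (τ t ^ i) (υ t) k))
             (trans (sym (sum-*ˡ (suc m) (υ t * b) (λ i → c i * τ (l * inv t) ^ i))) (sum-ext (suc m) λ i → trans (cong (λ x → υ t * b * (c i * x)) (trans (cong (_^ i) (τ-* l (inv t))) (^-distrib-* (τ l) (τ (inv t)) i))) (lemma₃ (υ t) b (c i) (τ l ^ i) (τ (inv t) ^ i)))) ⟩
      sum (suc m) (λ i → c i * (υ t * (τ t ^ i * k))) + P * sum (suc m) (λ i → c i * τ l ^ i * (υ t * (b * τ (inv t) ^ i))) ∎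
      where
      k = h (l * inv t)
      s = sum (suc m) (λ i → c i * τ t ^ i)
      b = correction (τ t)
      lemma₁ : ∀ u s P b k → u * ((s + P * b) * k) ≡ s * (u * k) + P * (u * b * k)
      lemma₁ = solve-∀
      lemma₂ : ∀ c t u k → c * t * (u * k) ≡ c * (u * (t * k))
      lemma₂ = solve-∀
      lemma₃ : ∀ u b c x y → u * b * (c * (x * y)) ≡ c * x * (u * (b * y))
      lemma₃ = solve-∀
    reindexed : ∀ i → ∑ (λ t → υ t * (τ t ^ i * h (l * inv t))) ≈ τ l ^ i * ∑ (λ t → υ t * (τ (inv t) ^ i * h t)) [ PP ]
    reindexed i = begin
      ∑ f ≈⟨ ≈-sym (∑-bijection-≈ f σ σ f-cong σ-cong σ-cong σ-involutive σ-involutive) ⟩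
      ∑ (λ t → f (σ t)) ≈⟨ ∑-cong-≈ (λ t → ≈-trans (≡⇒≈ (cong (λ d → (+ 1 - d) * (τ (σ t) ^ i * h (l * inv (σ t)))) (sym (δ-σ t)))) (υ-restrict (inner t))) ⟩
      ∑ (λ t → υ t * (τ l ^ i * (τ (inv t) ^ i * h t))) ≡⟨ trans (∑-ext λ t → lemma₁ (υ t) (τ l ^ i) (τ (inv t) ^ i * h t)) (∑-*ˡ (τ l ^ i) (λ t → υ t * (τ (inv t) ^ i * h t))) ⟩
      τ l ^ i * ∑ (λ t → υ t * (τ (inv t) ^ i * h t)) ∎
      where
      σ f : ℤ → ℤ
      σ t = l * inv t
      f t = υ t * (τ t ^ i * h (l * inv t))
      lemma₁ : ∀ a b c → a * (b * c) ≡ b * (a * c)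
      lemma₁ = solve-∀
      σ-cong : ∀ {a b} → a ≈ b [ P ] → σ a ≈ σ b [ P ]
      σ-cong e = *-cong-≈ {l} ≈-refl (inv-cong e)
      f-cong : ∀ {a b} → a ≈ b [ P ] → f a ≈ f b [ PP ]
      f-cong {a} {b} e = *-cong-≈ (≡⇒≈ {N = PP} (υ-cong a b e)) (*-cong-≈ (^-cong-≈ i (τ-cong e)) (≡⇒≈ {N = PP} (h-cong (l * inv a) (l * inv b) (σ-cong e))))
      δ-σ : ∀ t → δ t ≡ δ (σ t)
      δ-σ t with ≈0? t
      ... | yes e = trans (δ-yes e) (sym (δ-yes (≈-trans (*-cong-≈ {l} ≈-refl (≈-trans (inv-cong e) (≡⇒≈ inv-0))) (≡⇒≈ (ℤ.*-zeroʳ l)))))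
      ... | no u = trans (δ-no u) (sym (δ-no (Unit-* ul (inv-unit u))))
      σ-unit : ∀ t → Unit t → l * inv (σ t) ≈ t [ P ]
      σ-unit t u = linear-≈₂ (t) (- (l * inv (σ t))) (inv-rightₚ (Unit-* ul (inv-unit u))) (inv-rightₚ u) (lemma₂ l t (inv t) (inv (σ t)))
        where
        lemma₂ : ∀ l t i j → l * j ≡ t + t * (l * i * j - + 1) + - (l * j) * (t * i - + 1)
        lemma₂ = solve-∀
      σ-involutive : ∀ t → σ (σ t) ≈ t [ P ]
      σ-involutive t with ≈0? t
      ... | yes e = ≈-trans (*-cong-≈ {l} ≈-refl (≈-trans (inv-cong (≈-trans (*-cong-≈ {l} ≈-refl (≈-trans (inv-cong e) (≡⇒≈ inv-0))) (≡⇒≈ (ℤ.*-zeroʳ l)))) (≡⇒≈ inv-0))) (≈-trans (≡⇒≈ (ℤ.*-zeroʳ l)) (≈-sym e))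
      ... | no u = σ-unit t u
      inner : ∀ t → Unit t → τ (σ t) ^ i * h (l * inv (σ t)) ≈ τ l ^ i * (τ (inv t) ^ i * h t) [ PP ]
      inner t u = ≈-trans (*-cong-≈ (≡⇒≈ {N = PP} (trans (cong (_^ i) (τ-* l (inv t))) (^-distrib-* (τ l) (τ (inv t)) i))) (≡⇒≈ {N = PP} (h-cong (l * inv (σ t)) t (σ-unit t u)))) (≡⇒≈ (ℤ.*-assoc (τ l ^ i) (τ (inv t) ^ i) (h t)))
    gauss : ∀ i → i ≤ m → ∑ (λ t → υ t * (τ (inv t) ^ i * h t)) ≈ c i * (P - + 1) + P * moment i [ PP ]
    gauss i i≤m = begin
      ∑ (λ t → υ t * (τ (inv t) ^ i * h t))
        ≈⟨ ∑-cong-≈ (λ t → *-cong-≈ {υ t} ≈-refl (*-cong-≈ {τ (inv t) ^ i} ≈-refl (≈-trans (h-expansion t) (+-cong-≈ (≡⇒≈ {N = PP} (c-expansion (τ t))) (≈-refl {P * correction (τ t)}))))) ⟩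
      ∑ (λ t → υ t * (τ (inv t) ^ i * (sum (suc m) (λ j → c j * τ t ^ j) + P * correction (τ t))))
        ≡⟨ ∑-ext (λ t → trans (lemma₁ (υ t) (τ (inv t) ^ i) (sum (suc m) (λ j → c j * τ t ^ j)) P (correction (τ t))) (cong (_+ P * (υ t * (correction (τ t) * τ (inv t) ^ i))) (trans (sym (sum-*ʳ (suc m) (υ t * τ (inv t) ^ i) (λ j → c j * τ t ^ j))) (sum-ext (suc m) λ j → lemma₂ (c j) (τ t ^ j) (υ t) (τ (inv t) ^ i))))) ⟩
      ∑ (λ t → sum (suc m) (λ j → c j * (υ t * (τ t ^ j * τ (inv t) ^ i))) + P * (υ t * (correction (τ t) * τ (inv t) ^ i)))
        ≡⟨ trans (∑-+ (λ t → sum (suc m) (λ j → c j * (υ t * (τ t ^ j * τ (inv t) ^ i)))) (λ t → P * (υ t * (correction (τ t) * τ (inv t) ^ i)))) (cong₂ _+_ (trans (∑-sum-swap (suc m) (λ t j → c j * (υ t * (τ t ^ j * τ (inv t) ^ i)))) (sum-ext (suc m) λ j → ∑-*ˡ (c j) (λ t → υ t * (τ t ^ j * τ (inv t) ^ i)))) (∑-*ˡ P (λ t → υ t * (correction (τ t) * τ (inv t) ^ i)))) ⟩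
      sum (suc m) (λ j → c j * ∑ (λ t → υ t * (τ t ^ j * τ (inv t) ^ i))) + P * moment i
        ≈⟨ +-cong-≈ (≈-trans (sum-cong-≈ (suc m) λ j j< → *-cong-≈ {c j} ≈-refl (orthogonal j (ℕ.≤-pred j<))) (≡⇒≈ (trans (sum-ext (suc m) λ j → sym (ℤ.*-assoc (c j) (P - + 1) (kronecker j i))) (sum-kronecker (suc m) i (λ j → c j * (P - + 1)) (s≤s i≤m))))) (≈-refl {P * moment i}) ⟩
      c i * (P - + 1) + P * moment i ∎
      where
      lemma₁ : ∀ u w s P b → u * (w * (s + P * b)) ≡ s * (u * w) + P * (u * (b * w))
      lemma₁ = solve-∀
      lemma₂ : ∀ c t u w → c * t * (u * w) ≡ c * (u * (t * w))
      lemma₂ = solve-∀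
      m<2m : m < 2m
      m<2m = ℕ.+-monoˡ-≤ m 0<m
      orthogonal : ∀ j → j ≤ m → ∑ (λ t → υ t * (τ t ^ j * τ (inv t) ^ i)) ≈ (P - + 1) * kronecker j i [ PP ]
      orthogonal j j≤m = orthogonality j i (ℕ.≤-trans j≤m (ℕ.<⇒≤ m<2m)) (ℕ.≤-trans i≤m (ℕ.<⇒≤ m<2m)) (inj₂ (ℕ.≤-<-trans i≤m m<2m)) (inj₂ (ℕ.≤-<-trans j≤m m<2m))

-- Alternating binomial sums with reciprocals, modulo p

binom-absorb′ : ∀ n k → + suc n * binom n k ≡ (+ suc n - + k) * binom (suc n) k
binom-absorb′ n zero = cong₂ _*_ (sym (ℤ.+-identityʳ (+ suc n))) (trans (binom-0 n) (sym (binom-0 (suc n))))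
binom-absorb′ n (suc k) = begin
  + suc n * binom n (suc k) ≡⟨ lemma (+ suc n) (binom n k) (binom n (suc k)) ⟩
  + suc n * (binom n k + binom n (suc k)) - + suc n * binom n k ≡⟨ cong₂ (λ x y → + suc n * x - y) (sym (pascal n k)) (sym (binom-absorb n k)) ⟩
  + suc n * binom (suc n) (suc k) - + suc k * binom (suc n) (suc k) ≡⟨ lemma′ (+ suc n) (+ suc k) (binom (suc n) (suc k)) ⟩
  (+ suc n - + suc k) * binom (suc n) (suc k) ∎
  where
  open ≡-Reasoning
  lemma : ∀ n a b → n * b ≡ n * (a + b) - n * a
  lemma = solve-∀
  lemma′ : ∀ n k b → n * b - k * b ≡ (n - k) * b
  lemma′ = solve-∀

pos-∸ : ∀ {i n} → i ≤ n → + (n ∸ i) ≡ + n - + i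
pos-∸ {i} {n} i≤n = trans (sym (ℤ.⊖-≥ i≤n)) (sym (ℤ.m-n≡m⊖n n i))

module HarmonicSums (m : ℕ) (pr : Prime (suc (m ℕ.+ m))) where
  open PrimeField m pr
  open CharacterSums m pr

  inv-complement : ∀ a b → 0 < a → 0 < b → a ℕ.+ b ≡ p → inv (+ a) ≈ - inv (+ b) [ P ]
  inv-complement a b 0<a 0<b eq = cancel {_} {_} {+ a * + b} (Unit-* ua ub) (linear-≈₃ (+ b) (+ a) (+ 1) (inv-rightₚ ua) (inv-rightₚ ub) P≈0
      (trans (lemma (+ a) (+ b) (inv (+ a)) (inv (+ b))) (cong (λ n → + a * + b * - inv (+ b) + + b * (+ a * inv (+ a) - + 1) + + a * (+ b * inv (+ b) - + 1) + + 1 * (+ n - + 0)) eq)))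
    where
    ua : Unit (+ a)
    ua = unit-small a 0<a (subst (a <_) eq (ℕ.m<m+n a 0<b))
    ub : Unit (+ b)
    ub = unit-small b 0<b (subst (b <_) eq (ℕ.m<n+m b 0<a))
    lemma : ∀ a D i j → a * D * i ≡ a * D * - j + D * (a * i - + 1) + a * (D * j - + 1) + + 1 * (a + D - + 0)
    lemma = solve-∀

  H : ℕ → ℤ
  H n = sum n (λ k → inv (+ suc k))

  altBinom : ℕ → ℕ → ℤ
  altBinom n i = binom n i * signPower i

  altBinom-pascal : ∀ n i → altBinom (suc n) (suc i) ≡ altBinom n (suc i) - altBinom n i
  altBinom-pascal n i = trans (cong (_* signPower (suc i)) (pascal n i)) (lemma (binom n i) (binom n (suc i)) (signPower i))
    where
    lemma : ∀ a b s → (a + b) * (- + 1 * s) ≡ b * (- + 1 * s) - a * s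
    lemma = solve-∀

  altBinom-0 : ∀ n → altBinom n 0 ≡ + 1
  altBinom-0 n = cong (_* + 1) (binom-0 n)

  altBinom-expansion : ∀ n z → (+ 1 - z) ^ n ≡ sum (suc n) (λ i → altBinom n i * z ^ i)
  altBinom-expansion n z = trans (binomial (- z) n) (sum-ext (suc n) λ i → trans (cong (_*_ (binom n i)) (neg-power z i)) (sym (ℤ.*-assoc (binom n i) (signPower i) (z ^ i))))

  altBinom-total : ∀ n → 0 < n → sum (suc n) (altBinom n) ≡ + 0
  altBinom-total (suc n) _ = trans (sum-ext (suc (suc n)) λ i → sym (trans (cong (_*_ (altBinom (suc n) i)) (ℤ.^-zeroˡ i)) (ℤ.*-identityʳ _))) (sym (altBinom-expansion (suc n) (+ 1)))

  harmonicX : ℕ → ℕ → ℤ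
  harmonicX n i = sum i (λ s → altBinom n s * inv (+ (i ∸ s)))

  harmonicX-pascal : ∀ n i → harmonicX (suc n) (suc i) ≡ harmonicX n (suc i) - harmonicX n i
  harmonicX-pascal n i = begin
    harmonicX (suc n) (suc i) ≡⟨ sum-suc i (λ s → altBinom (suc n) s * inv (+ (suc i ∸ s))) ⟩
    altBinom (suc n) 0 * inv (+ suc i) + sum i (λ s → altBinom (suc n) (suc s) * inv (+ (i ∸ s)))
      ≡⟨ cong₂ _+_ (cong (_* inv (+ suc i)) (trans (altBinom-0 (suc n)) (sym (altBinom-0 n)))) (sum-ext i λ s → trans (cong (_* inv (+ (i ∸ s))) (altBinom-pascal n s)) (lemma (altBinom n (suc s)) (altBinom n s) (inv (+ (i ∸ s))))) ⟩
    altBinom n 0 * inv (+ suc i) + sum i (λ s → altBinom n (suc s) * inv (+ (i ∸ s)) + - (altBinom n s * inv (+ (i ∸ s))))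
      ≡⟨ cong (_+_ (altBinom n 0 * inv (+ suc i))) (trans (sum-+ i (λ s → altBinom n (suc s) * inv (+ (i ∸ s))) (λ s → - (altBinom n s * inv (+ (i ∸ s))))) (cong (_+_ (sum i (λ s → altBinom n (suc s) * inv (+ (i ∸ s))))) (sum-neg i (λ s → altBinom n s * inv (+ (i ∸ s)))))) ⟩
    altBinom n 0 * inv (+ suc i) + (sum i (λ s → altBinom n (suc s) * inv (+ (i ∸ s))) - harmonicX n i)
      ≡⟨ sym (ℤ.+-assoc (altBinom n 0 * inv (+ suc i)) (sum i (λ s → altBinom n (suc s) * inv (+ (i ∸ s)))) (- harmonicX n i)) ⟩
    altBinom n 0 * inv (+ suc i) + sum i (λ s → altBinom n (suc s) * inv (+ (i ∸ s))) - harmonicX n i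
      ≡⟨ cong (_- harmonicX n i) (sym (sum-suc i (λ s → altBinom n s * inv (+ (suc i ∸ s))))) ⟩
    harmonicX n (suc i) - harmonicX n i ∎
    where
    open ≡-Reasoning
    lemma : ∀ a b i → (a - b) * i ≡ a * i + - (b * i)
    lemma = solve-∀

  -- This value lies just outside the range of `harmonicX-closed`, and the induction there meets it
  -- at `i = n`. The weights become those of row `n + 1` divided by `n + 1`, and that alternating
  -- row sums to zero.
  harmonicX-edge : ∀ n → suc n < p → harmonicX n (suc n) ≈ signPower n * inv (+ suc n) [ P ]
  harmonicX-edge n n<p = begin
    sum (suc n) (λ s → altBinom n s * inv (+ (suc n ∸ s))) ≈⟨ sum-cong-≈ (suc n) term ⟩
    sum (suc n) (λ s → altBinom (suc n) s * inv (+ suc n)) ≡⟨ sum-*ʳ (suc n) (inv (+ suc n)) (altBinom (suc n)) ⟩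
    sum (suc n) (altBinom (suc n)) * inv (+ suc n) ≡⟨ cong (_* inv (+ suc n)) partial ⟩
    signPower n * inv (+ suc n) ∎
    where
    open ≈-Reasoning P
    partial : sum (suc n) (altBinom (suc n)) ≡ signPower n
    partial = trans (lemma (sum (suc n) (altBinom (suc n))) (altBinom (suc n) (suc n))) (trans (cong₂ _-_ (altBinom-total (suc n) (s≤s z≤n)) (cong (_* signPower (suc n)) (binom-n (suc n)))) (lemma′ (signPower n)))
      where
      lemma : ∀ a b → a ≡ a + b - b
      lemma = solve-∀
      lemma′ : ∀ s → + 0 - + 1 * (- + 1 * s) ≡ s
      lemma′ = solve-∀
    term : ∀ s → s < suc n → altBinom n s * inv (+ (suc n ∸ s)) ≈ altBinom (suc n) s * inv (+ suc n) [ P ]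
    term s s<1+n = cancel {_} {_} {+ suc n * + (suc n ∸ s)} (Unit-* u v) (begin
      + suc n * d * (binom n s * σ * inv d) ≡⟨ lemma₁ (+ suc n) d (binom n s) σ (inv d) ⟩
      + suc n * binom n s * σ * (d * inv d) ≡⟨ cong (λ x → x * σ * (d * inv d)) (trans (binom-absorb′ n s) (cong (_* binom (suc n) s) (sym (pos-∸ (ℕ.<⇒≤ s<1+n))))) ⟩
      d * binom (suc n) s * σ * (d * inv d) ≈⟨ *-cong-≈ {d * binom (suc n) s * σ} ≈-refl (≈-trans (inv-rightₚ v) (≈-sym (inv-rightₚ u))) ⟩
      d * binom (suc n) s * σ * (+ suc n * inv (+ suc n)) ≡⟨ lemma₂ d (binom (suc n) s) σ (+ suc n) (inv (+ suc n)) ⟩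
      + suc n * d * (binom (suc n) s * σ * inv (+ suc n)) ∎)
      where
      d = + (suc n ∸ s)
      σ = signPower s
      u : Unit (+ suc n)
      u = unit-small (suc n) (s≤s z≤n) n<p
      v : Unit d
      v = unit-small (suc n ∸ s) (ℕ.m<n⇒0<n∸m s<1+n) (ℕ.≤-<-trans (ℕ.m∸n≤m (suc n) s) n<p)
      lemma₁ : ∀ a d b s i → a * d * (b * s * i) ≡ a * b * s * (d * i)
      lemma₁ = solve-∀
      lemma₂ : ∀ d b s a i → d * b * s * (a * i) ≡ a * d * (b * s * i)
      lemma₂ = solve-∀

  -- Induction along Pascal's rule. The two harmonic numbers change by `1 / (n + 1)` and
  -- `1 / (n - i)`, and absorption, in the form `exchange`, balances these changes.
  harmonicX-closed : ∀ n i → n < p → i ≤ n → harmonicX n i ≈ - (altBinom n i * (H n - H (n ∸ i))) [ P ]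
  harmonicX-closed n zero _ _ = ≡⇒≈ (sym (trans (cong (λ x → - (altBinom n 0 * x)) (ℤ.+-inverseʳ (H n))) (cong -_ (ℤ.*-zeroʳ (altBinom n 0)))))
  harmonicX-closed (suc n) (suc i) n<p (s≤s i≤n) = ≈-trans (≡⇒≈ (harmonicX-pascal n i)) (step (ℕ.m≤n⇒m<n∨m≡n i≤n))
    where
    previous : harmonicX n i ≈ - (altBinom n i * (H n - H (n ∸ i))) [ P ]
    previous = harmonicX-closed n i (ℕ.<-trans (ℕ.n<1+n n) n<p) i≤n
    step : i < n ⊎ i ≡ n → harmonicX n (suc i) - harmonicX n i ≈ - (altBinom (suc n) (suc i) * (H (suc n) - H (n ∸ i))) [ P ]
    step (inj₂ refl) = linear-≈₂ (+ 1) (- + 1) (harmonicX-edge n n<p) previous (trans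
        (lemma (harmonicX n (suc n)) (harmonicX n n) (signPower n) (inv (+ suc n)) (H n) (H (n ∸ n)))
        (cong₂ (λ a b → - (a * (- + 1 * signPower n) * (H n + inv (+ suc n) - H (n ∸ n))) + + 1 * (harmonicX n (suc n) - signPower n * inv (+ suc n)) + - + 1 * (harmonicX n n - - (b * signPower n * (H n - H (n ∸ n)))))
          (sym (binom-n (suc n))) (sym (binom-n n))))
      where
      lemma : ∀ x y s i h g → x - y ≡ - (+ 1 * (- + 1 * s) * (h + i - g)) + + 1 * (x - s * i) + - + 1 * (y - - (+ 1 * s * (h - g)))
      lemma = solve-∀
    step (inj₁ i<n) = ≈-trans (+-cong-≈ (harmonicX-closed n (suc i) (ℕ.<-trans (ℕ.n<1+n n) n<p) i<n) (-‿cong-≈ previous)) (≈-trans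
        (≡⇒≈ (trans (cong (λ x → - (altBinom n (suc i) * (H n - H (n ∸ suc i))) - - (altBinom n i * (H n - x))) H-step) (lemma₁ (altBinom n (suc i)) (altBinom n i) (H n) (H (n ∸ suc i)) (inv (+ suc n)) (inv d))))
        (linear-≈ (+ 1) exchange (trans (lemma₂ (altBinom n (suc i) - altBinom n i) (H n) (H (n ∸ suc i)) (inv (+ suc n)) (inv d) (altBinom n (suc i)))
          (cong₂ (λ a b → - (a * (H (suc n) - b)) + + 1 * ((altBinom n (suc i) - altBinom n i) * inv (+ suc n) - altBinom n (suc i) * inv d)) (sym (altBinom-pascal n i)) (sym H-step)))))
      where
      d = + (n ∸ i)
      d-suc : suc (n ∸ suc i) ≡ n ∸ i
      d-suc = sym (ℕ.+-∸-assoc 1 i<n)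
      H-step : H (n ∸ i) ≡ H (n ∸ suc i) + inv d
      H-step = trans (cong H (sym d-suc)) (cong (λ x → H (n ∸ suc i) + inv (+ x)) d-suc)
      lemma₁ : ∀ a b h g e f → - (a * (h - g)) - - (b * (h - (g + f))) ≡ - ((a - b) * (h + e - (g + f))) + ((a - b) * e - a * f)
      lemma₁ = solve-∀
      lemma₂ : ∀ x h g e f a → - (x * (h + e - (g + f))) + (x * e - a * f) ≡ - (x * (h + e - (g + f))) + + 1 * (x * e - a * f)
      lemma₂ = solve-∀
      u : Unit (+ suc n)
      u = unit-small (suc n) (s≤s z≤n) n<p
      v : Unit d
      v = unit-small (n ∸ i) (ℕ.m<n⇒0<n∸m i<n) (ℕ.≤-<-trans (ℕ.m∸n≤m n i) (ℕ.<-trans (ℕ.n<1+n n) n<p))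
      exchange : (altBinom n (suc i) - altBinom n i) * inv (+ suc n) ≈ altBinom n (suc i) * inv d [ P ]
      exchange = cancel {_} {_} {+ suc n * d} (Unit-* u v) (begin
        + suc n * d * ((altBinom n (suc i) - altBinom n i) * inv (+ suc n)) ≡⟨ cong (λ x → + suc n * d * (x * inv (+ suc n))) (sym (altBinom-pascal n i)) ⟩
        + suc n * d * (binom (suc n) (suc i) * σ * inv (+ suc n)) ≡⟨ lemma₃ (+ suc n) d (binom (suc n) (suc i)) σ (inv (+ suc n)) ⟩
        d * binom (suc n) (suc i) * σ * (+ suc n * inv (+ suc n)) ≈⟨ *-cong-≈ {d * binom (suc n) (suc i) * σ} ≈-refl (≈-trans (inv-rightₚ u) (≈-sym (inv-rightₚ v))) ⟩
        d * binom (suc n) (suc i) * σ * (d * inv d) ≡⟨ cong (λ x → x * σ * (d * inv d)) (sym (trans (binom-absorb′ n (suc i)) (cong (_* binom (suc n) (suc i)) (sym (pos-∸ {suc i} {suc n} (s≤s i≤n)))))) ⟩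
        + suc n * binom n (suc i) * σ * (d * inv d) ≡⟨ lemma₄ (+ suc n) (binom n (suc i)) σ d (inv d) ⟩
        + suc n * d * (binom n (suc i) * σ * inv d) ∎)
        where
        open ≈-Reasoning P
        σ = signPower (suc i)
        lemma₃ : ∀ a d b s i → a * d * (b * s * i) ≡ d * b * s * (a * i)
        lemma₃ = solve-∀
        lemma₄ : ∀ a b s d i → a * b * s * (d * i) ≡ a * d * (b * s * i)
        lemma₄ = solve-∀

-- The corrections `moment i` in closed form

module SumOfSquares (m : ℕ) (pr : Prime (suc (m ℕ.+ m))) where
  open PrimeField m pr
  open CharacterSums m pr
  open Moments m pr
  open FamilySums m pr
  open PointCounts m pr
  open PrimeSquare m pr
  open HarmonicSums m pr

  logMoment : ℕ → ℕ → ℤ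
  logMoment s i = ∑ (λ t → υ t * (τ t ^ s * logPoly (τ t) * τ (inv t) ^ i))

  -- Orthogonality picks one coefficient of the truncated logarithm. `D` represents `i - s` modulo
  -- `2m` in the range from `1` to `2m`, which is the range of exponents in `logPoly`.
  log-moment : ∀ s i D → 0 < D → D ≤ 2m → (∀ {t} → Unit t → τ t ^ s * τ (inv t) ^ i ≈ τ (inv t) ^ D [ PP ]) →
               logMoment s i ≈ inv (+ D) * (P - + 1) [ PP ]
  log-moment s i (suc D) 0<D D≤ h = begin
    logMoment s i
      ≈⟨ ∑-cong-≈ (λ t → υ-restrict λ u → ≈-trans (≡⇒≈ (lemma₁ (τ t ^ s) (logPoly (τ t)) (τ (inv t) ^ i))) (*-cong-≈ {logPoly (τ t)} ≈-refl (h u))) ⟩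
    ∑ (λ t → υ t * (logPoly (τ t) * τ (inv t) ^ suc D))
      ≡⟨ ∑-ext (λ t → trans (lemma₂ (υ t) (logPoly (τ t)) (τ (inv t) ^ suc D)) (trans (sym (sum-*ʳ 2m (υ t * τ (inv t) ^ suc D) (λ k → inv (+ suc k) * τ t ^ suc k))) (sum-ext 2m λ k → lemma₃ (inv (+ suc k)) (τ t ^ suc k) (υ t) (τ (inv t) ^ suc D)))) ⟩
    ∑ (λ t → sum 2m (λ k → inv (+ suc k) * (υ t * (τ t ^ suc k * τ (inv t) ^ suc D))))
      ≡⟨ trans (∑-sum-swap 2m (λ t k → inv (+ suc k) * (υ t * (τ t ^ suc k * τ (inv t) ^ suc D)))) (sum-ext 2m λ k → ∑-*ˡ (inv (+ suc k)) (λ t → υ t * (τ t ^ suc k * τ (inv t) ^ suc D))) ⟩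
    sum 2m (λ k → inv (+ suc k) * ∑ (λ t → υ t * (τ t ^ suc k * τ (inv t) ^ suc D)))
      ≈⟨ sum-cong-≈ 2m (λ k k< → *-cong-≈ {inv (+ suc k)} ≈-refl (≈-trans (orthogonality (suc k) (suc D) k< D≤ (inj₁ (s≤s z≤n)) (inj₁ (s≤s z≤n))) (≡⇒≈ (cong (_*_ (P - + 1)) (kronecker-suc k D))))) ⟩
    sum 2m (λ k → inv (+ suc k) * ((P - + 1) * kronecker k D))
      ≡⟨ trans (sum-ext 2m λ k → sym (ℤ.*-assoc (inv (+ suc k)) (P - + 1) (kronecker k D))) (sum-kronecker 2m D (λ k → inv (+ suc k) * (P - + 1)) D≤) ⟩
    inv (+ suc D) * (P - + 1) ∎
    where
    open ≈-Reasoning PP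
    lemma₁ : ∀ a l b → a * l * b ≡ l * (a * b)
    lemma₁ = solve-∀
    lemma₂ : ∀ u l b → u * (l * b) ≡ l * (u * b)
    lemma₂ = solve-∀
    lemma₃ : ∀ i t u b → i * t * (u * b) ≡ i * (u * (t * b))
    lemma₃ = solve-∀

  a₁ : ℕ → ℤ
  a₁ = altBinom m₁

  -- Used for `s < i`, where `m - s = (i - s) + (m - i)` is split against the denominator `i - s`.
  -- The companion `m*a₁′` serves `s = i + d`, where `s + 1 = (d + 1) + i` is split against `d + 1`.
  m*a₁ : ∀ s → + m * a₁ s ≡ (+ m - + s) * c s
  m*a₁ s = trans (sym (ℤ.*-assoc (+ m) (binom m₁ s) (signPower s))) (trans (cong (_* signPower s) (subst (λ n → + n * binom m₁ s ≡ (+ n - + s) * binom n s) m≡ (binom-absorb′ m₁ s))) (ℤ.*-assoc (+ m - + s) (binom m s) (signPower s)))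

  m*a₁′ : ∀ s → + m * a₁ s ≡ - (+ suc s * c (suc s))
  m*a₁′ s = trans (sym (ℤ.*-assoc (+ m) (binom m₁ s) (signPower s))) (trans (cong (_* signPower s) (sym (subst (λ n → + suc s * binom n (suc s) ≡ + n * binom m₁ s) m≡ (binom-absorb m₁ s)))) (lemma (+ suc s) (binom m (suc s)) (signPower s)))
    where
    lemma : ∀ a b s → a * b * s ≡ - (a * (b * (- + 1 * s)))
    lemma = solve-∀

  moment-expansion : ∀ i → moment i ≡ - sum m (λ s → + m * a₁ s * logMoment s i)
  moment-expansion i = begin
    ∑ (λ t → υ t * (correction (τ t) * τ (inv t) ^ i)) ≡⟨ ∑-ext term ⟩
    ∑ (λ t → - sum m (λ s → + m * a₁ s * (υ t * (τ t ^ s * logPoly (τ t) * τ (inv t) ^ i))))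
      ≡⟨ trans (∑-neg (λ t → sum m (λ s → + m * a₁ s * (υ t * (τ t ^ s * logPoly (τ t) * τ (inv t) ^ i))))) (cong -_ (trans (∑-sum-swap m (λ t s → + m * a₁ s * (υ t * (τ t ^ s * logPoly (τ t) * τ (inv t) ^ i)))) (sum-ext m λ s → ∑-*ˡ (+ m * a₁ s) (λ t → υ t * (τ t ^ s * logPoly (τ t) * τ (inv t) ^ i))))) ⟩
    - sum m (λ s → + m * a₁ s * logMoment s i) ∎
    where
    open ≡-Reasoning
    lemma₁ : ∀ u n A l b → u * (- (n * A * l) * b) ≡ - (A * (n * (u * (l * b))))
    lemma₁ = solve-∀
    lemma₂ : ∀ a t n u l b → a * t * (n * (u * (l * b))) ≡ n * a * (u * (t * l * b))
    lemma₂ = solve-∀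
    term : ∀ t → υ t * (correction (τ t) * τ (inv t) ^ i) ≡ - sum m (λ s → + m * a₁ s * (υ t * (τ t ^ s * logPoly (τ t) * τ (inv t) ^ i)))
    term t = begin
      υ t * (- (+ m * (+ 1 - τ t) ^ m₁ * logPoly (τ t)) * τ (inv t) ^ i) ≡⟨ lemma₁ (υ t) (+ m) ((+ 1 - τ t) ^ m₁) (logPoly (τ t)) (τ (inv t) ^ i) ⟩
      - ((+ 1 - τ t) ^ m₁ * (+ m * (υ t * (logPoly (τ t) * τ (inv t) ^ i)))) ≡⟨ cong (λ x → - (x * (+ m * (υ t * (logPoly (τ t) * τ (inv t) ^ i))))) (trans (altBinom-expansion m₁ (τ t)) (cong (λ n → sum n (λ s → a₁ s * τ t ^ s)) m≡)) ⟩
      - (sum m (λ s → a₁ s * τ t ^ s) * (+ m * (υ t * (logPoly (τ t) * τ (inv t) ^ i)))) ≡⟨ cong -_ (trans (sym (sum-*ʳ m (+ m * (υ t * (logPoly (τ t) * τ (inv t) ^ i))) (λ s → a₁ s * τ t ^ s))) (sum-ext m λ s → lemma₂ (a₁ s) (τ t ^ s) (+ m) (υ t) (logPoly (τ t)) (τ (inv t) ^ i))) ⟩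
      - sum m (λ s → + m * a₁ s * (υ t * (τ t ^ s * logPoly (τ t) * τ (inv t) ^ i))) ∎

  m≤2m : m ≤ 2m
  m≤2m = ℕ.m≤m+n m m

  log-moment-low : ∀ s i → s < i → i ≤ m → logMoment s i ≈ - inv (+ (i ∸ s)) [ P ]
  log-moment-low s i s<i i≤m = ≈-trans (P²⇒P (log-moment s i (i ∸ s) (ℕ.m<n⇒0<n∸m s<i) (ℕ.≤-trans (ℕ.m∸n≤m i s) (ℕ.≤-trans i≤m m≤2m)) shifted)) (by (inv (+ (i ∸ s))) (lemma (inv (+ (i ∸ s))) P))
    where
    lemma : ∀ i P → i * (P - + 1) ≡ - i + i * P
    lemma = solve-∀
    shifted : ∀ {t} → Unit t → τ t ^ s * τ (inv t) ^ i ≈ τ (inv t) ^ (i ∸ s) [ PP ]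
    shifted {t} u = ≈-trans (*-cong-≈ (^-cong-≈ s (τ-cong (≈-sym (inv-involutive t)))) (≡⇒≈ {N = PP} (cong (τ (inv t) ^_) (sym (ℕ.m+[n∸m]≡n (ℕ.<⇒≤ s<i))))))
      (≈-trans (≡⇒≈ (ℤ.*-comm (τ (inv (inv t)) ^ s) (τ (inv t) ^ (s ℕ.+ (i ∸ s))))) (split-powers {inv t} s (i ∸ s) (inv-unit u)))

  -- The exponent `- d` is represented by `D = 2m - d`, and `D ≈ - (d + 1)` modulo `P` turns
  -- `- 1 / D` into `1 / (d + 1)`.
  log-moment-high : ∀ i d → i ℕ.+ d < m → logMoment (i ℕ.+ d) i ≈ inv (+ suc d) [ P ]
  log-moment-high i d s<m = ≈-trans (P²⇒P (log-moment (i ℕ.+ d) i D (ℕ.m<n⇒0<n∸m d<2m) (ℕ.m∸n≤m 2m d) shifted)) (≈-trans (by (inv (+ D)) (lemma (inv (+ D)) P)) (≈-sym (inv-complement (suc d) D (s≤s z≤n) (ℕ.m<n⇒0<n∸m d<2m) (cong suc (ℕ.m+[n∸m]≡n (ℕ.<⇒≤ d<2m))))))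
    where
    D = 2m ∸ d
    d<2m : d < 2m
    d<2m = ℕ.<-≤-trans (ℕ.≤-<-trans (ℕ.m≤n+m d i) s<m) m≤2m
    lemma : ∀ i P → i * (P - + 1) ≡ - i + i * P
    lemma = solve-∀
    shifted : ∀ {t} → Unit t → τ t ^ (i ℕ.+ d) * τ (inv t) ^ i ≈ τ (inv t) ^ D [ PP ]
    shifted {t} u = ≈-trans (split-powers i d u) (≈-sym (begin
      τ (inv t) ^ D ≡⟨ sym (ℤ.*-identityˡ (τ (inv t) ^ D)) ⟩
      + 1 * τ (inv t) ^ D ≈⟨ *-cong-≈ (≈-sym (τ-unit u)) (≈-refl {τ (inv t) ^ D}) ⟩
      τ t ^ 2m * τ (inv t) ^ D ≡⟨ cong (λ n → τ t ^ n * τ (inv t) ^ D) (sym (ℕ.m∸n+n≡m (ℕ.<⇒≤ d<2m))) ⟩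
      τ t ^ (D ℕ.+ d) * τ (inv t) ^ D ≈⟨ split-powers D d u ⟩
      τ t ^ d ∎))
      where open ≈-Reasoning PP

  E : ℕ → ℕ → ℤ
  E i j = + j * (H m - H j) + + i * (H m - H i)

  signPower-+ : ∀ a b → signPower (a ℕ.+ b) ≡ signPower a * signPower b
  signPower-+ a b = ℤ.^-distribˡ-+-* (- + 1) a b

  binom-mirror : ∀ a b → a ℕ.+ b ≡ m → binom m a ≡ binom m b
  binom-mirror a b eq = trans (binom-sym (subst (a ≤_) eq (ℕ.m≤m+n a b))) (cong (binom m) (trans (cong (_∸ a) (sym eq)) (ℕ.m+n∸m≡n a b)))

  c-mirror : ∀ a b → a ℕ.+ b ≡ m → c a ≡ signPower m * c b
  c-mirror a b eq = begin
    binom m a * signPower a ≡⟨ cong (_* signPower a) (binom-mirror a b eq) ⟩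
    binom m b * signPower a ≡⟨ sym (ℤ.*-identityʳ (binom m b * signPower a)) ⟩
    binom m b * signPower a * + 1 ≡⟨ cong (_*_ (binom m b * signPower a)) (sym (signPower² b)) ⟩
    binom m b * signPower a * (signPower b * signPower b) ≡⟨ lemma (binom m b) (signPower a) (signPower b) ⟩
    signPower a * signPower b * (binom m b * signPower b) ≡⟨ cong (_* (binom m b * signPower b)) (trans (sym (signPower-+ a b)) (cong signPower eq)) ⟩
    signPower m * c b ∎
    where
    open ≡-Reasoning
    lemma : ∀ b s t → b * s * (t * t) ≡ s * t * (b * t)
    lemma = solve-∀

  m<p : m < p
  m<p = s≤s m≤2m

  -- The symmetry of row `m`, in the form `c-mirror`, reverses the range and turns the sum into
  -- `harmonicX m j`.
  harmonicY : ∀ i j → i ℕ.+ j ≡ m → sum j (λ d → c (suc i ℕ.+ d) * inv (+ suc d)) ≈ - (c i * (H m - H i)) [ P ]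
  harmonicY i zero eq = ≡⇒≈ (sym (trans (cong (λ n → - (c i * (H m - H n))) (trans (sym (ℕ.+-identityʳ i)) eq)) (trans (cong (λ x → - (c i * x)) (ℤ.+-inverseʳ (H m))) (cong -_ (ℤ.*-zeroʳ (c i))))))
  harmonicY i (suc j) eq = begin
    sum (suc j) (λ d → c (suc i ℕ.+ d) * inv (+ suc d)) ≡⟨ sum-rev j (λ d → c (suc i ℕ.+ d) * inv (+ suc d)) ⟩
    sum (suc j) (λ s → c (suc i ℕ.+ (j ∸ s)) * inv (+ suc (j ∸ s))) ≡⟨ sum-cong (suc j) (λ s s< → trans (cong₂ _*_ (c-mirror (suc i ℕ.+ (j ∸ s)) s (index s (ℕ.≤-pred s<))) (cong (λ n → inv (+ n)) (sym (ℕ.+-∸-assoc 1 (ℕ.≤-pred s<))))) (ℤ.*-assoc (signPower m) (c s) (inv (+ (suc j ∸ s))))) ⟩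
    sum (suc j) (λ s → signPower m * (c s * inv (+ (suc j ∸ s)))) ≡⟨ sum-*ˡ (suc j) (signPower m) (λ s → c s * inv (+ (suc j ∸ s))) ⟩
    signPower m * harmonicX m (suc j) ≈⟨ *-cong-≈ {signPower m} ≈-refl (harmonicX-closed m (suc j) m<p (subst (suc j ≤_) eq (ℕ.m≤n+m (suc j) i))) ⟩
    signPower m * - (c (suc j) * (H m - H (m ∸ suc j))) ≡⟨ trans (lemma (signPower m) (c (suc j)) (H m - H (m ∸ suc j))) (cong₂ (λ x n → - (x * (H m - H n))) (sym (c-mirror i (suc j) eq)) (trans (cong (_∸ suc j) (sym eq)) (ℕ.m+n∸n≡m i (suc j)))) ⟩
    - (c i * (H m - H i)) ∎
    where
    open ≈-Reasoning P
    lemma : ∀ s c h → s * - (c * h) ≡ - (s * c * h)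
    lemma = solve-∀
    index : ∀ s → s ≤ j → suc i ℕ.+ (j ∸ s) ℕ.+ s ≡ m
    index s s≤j = trans (ℕ.+-assoc (suc i) (j ∸ s) s) (trans (cong (suc i ℕ.+_) (ℕ.m∸n+n≡m s≤j)) (trans (sym (ℕ.+-suc i j)) eq))

  -- Each summand splits into an entry of the alternating row and a harmonic part. The entries that
  -- occur are all except `c i`, so they add up to `- c i`; the harmonic parts are `harmonicX` with
  -- weight `j` and `harmonicY` with weight `i`.
  moment-closed : ∀ i j → i ℕ.+ j ≡ m → moment i ≈ - (c i * (+ 1 + E i j)) [ P ]
  moment-closed i j eq = begin
    moment i ≡⟨ trans (moment-expansion i) (cong (λ n → - sum n (λ s → + m * a₁ s * W s)) (sym eq)) ⟩
    - sum (i ℕ.+ j) (λ s → + m * a₁ s * W s) ≡⟨ cong -_ (sum-++ i j (λ s → + m * a₁ s * W s)) ⟩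
    - (sum i (λ s → + m * a₁ s * W s) + sum j (λ d → + m * a₁ (i ℕ.+ d) * W (i ℕ.+ d)))
      ≈⟨ -‿cong-≈ (+-cong-≈ (sum-cong-≈ i low) (sum-cong-≈ j high)) ⟩
    - (sum i (λ s → - (c s + + j * (c s * inv (+ (i ∸ s))))) + sum j (λ d → - (c (suc i ℕ.+ d) + + i * (c (suc i ℕ.+ d) * inv (+ suc d)))))
      ≡⟨ cong -_ (cong₂ _+_ (trans (sum-neg i (λ s → c s + + j * (c s * inv (+ (i ∸ s))))) (cong -_ (trans (sum-+ i c (λ s → + j * (c s * inv (+ (i ∸ s))))) (cong (_+_ (sum i c)) (sum-*ˡ i (+ j) (λ s → c s * inv (+ (i ∸ s))))))))
           (trans (sum-neg j (λ d → c (suc i ℕ.+ d) + + i * (c (suc i ℕ.+ d) * inv (+ suc d)))) (cong -_ (trans (sum-+ j (λ d → c (suc i ℕ.+ d)) (λ d → + i * (c (suc i ℕ.+ d) * inv (+ suc d)))) (cong (_+_ (sum j (λ d → c (suc i ℕ.+ d)))) (sum-*ˡ j (+ i) (λ d → c (suc i ℕ.+ d) * inv (+ suc d)))))))) ⟩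
    - (- (sum i c + + j * harmonicX m i) + - (sum j (λ d → c (suc i ℕ.+ d)) + + i * sum j (λ d → c (suc i ℕ.+ d) * inv (+ suc d))))
      ≈⟨ -‿cong-≈ (+-cong-≈ (-‿cong-≈ (+-cong-≈ (≈-refl {sum i c}) (*-cong-≈ {+ j} ≈-refl (≈-trans (harmonicX-closed m i m<p i≤m) (≡⇒≈ (cong (λ n → - (c i * (H m - H n))) m∸i≡j))))))
           (-‿cong-≈ (+-cong-≈ (≈-refl {sum j (λ d → c (suc i ℕ.+ d))}) (*-cong-≈ {+ i} ≈-refl (harmonicY i j eq))))) ⟩
    - (- (sum i c + + j * - (c i * (H m - H j))) + - (sum j (λ d → c (suc i ℕ.+ d)) + + i * - (c i * (H m - H i))))
      ≡⟨ trans (lemma (sum i c) (sum j (λ d → c (suc i ℕ.+ d))) (c i) (+ i) (+ j) (H m - H i) (H m - H j)) (cong (_- c i * (+ 1 + E i j)) total) ⟩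
    + 0 - c i * (+ 1 + E i j) ≡⟨ ℤ.+-identityˡ _ ⟩
    - (c i * (+ 1 + E i j)) ∎
    where
    open ≈-Reasoning P
    i≤m : i ≤ m
    i≤m = subst (i ≤_) eq (ℕ.m≤m+n i j)
    m∸i≡j : m ∸ i ≡ j
    m∸i≡j = trans (cong (_∸ i) (sym eq)) (ℕ.m+n∸m≡n i j)
    W : ℕ → ℤ
    W s = logMoment s i
    lemma : ∀ A B c i j x y → - (- (A + j * - (c * y)) + - (B + i * - (c * x))) ≡ A + c + B - c * (+ 1 + (j * y + i * x))
    lemma = solve-∀
    total : sum i c + c i + sum j (λ d → c (suc i ℕ.+ d)) ≡ + 0
    total = trans (sym (sum-++ (suc i) j c)) (trans (cong (λ n → sum (suc n) c) eq) (altBinom-total m 0<m))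
    low : ∀ s → s < i → + m * a₁ s * W s ≈ - (c s + + j * (c s * inv (+ (i ∸ s)))) [ P ]
    low s s<i = ≈-trans (*-cong-≈ (≡⇒≈ {N = P} (trans (m*a₁ s) (cong (_* c s) split))) (log-moment-low s i s<i i≤m))
        (linear-≈ (- c s) (inv-rightₚ unit) (lemma₁ (+ (i ∸ s)) (+ j) (c s) (inv (+ (i ∸ s)))))
      where
      split : + m - + s ≡ + (i ∸ s) + + j
      split = trans (cong (λ n → + n - + s) (sym eq)) (trans (lemma₂ (+ i) (+ j) (+ s)) (cong (_+ + j) (sym (pos-∸ (ℕ.<⇒≤ s<i)))))
        where
        lemma₂ : ∀ i j s → i + j - s ≡ i - s + j
        lemma₂ = solve-∀
      unit : Unit (+ (i ∸ s))
      unit = unit-small (i ∸ s) (ℕ.m<n⇒0<n∸m s<i) (ℕ.≤-<-trans (ℕ.m∸n≤m i s) (ℕ.≤-<-trans i≤m m<p))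
      lemma₁ : ∀ d j c v → (d + j) * c * - v ≡ - (c + j * (c * v)) + - c * (d * v - + 1)
      lemma₁ = solve-∀
    high : ∀ d → d < j → + m * a₁ (i ℕ.+ d) * W (i ℕ.+ d) ≈ - (c (suc i ℕ.+ d) + + i * (c (suc i ℕ.+ d) * inv (+ suc d))) [ P ]
    high d d<j = ≈-trans (*-cong-≈ (≡⇒≈ {N = P} (m*a₁′ (i ℕ.+ d))) (log-moment-high i d (subst (i ℕ.+ d <_) eq (ℕ.+-monoʳ-< i d<j))))
        (linear-≈ (- c (suc i ℕ.+ d)) (inv-rightₚ unit) (lemma₁ (+ i) (+ d) (c (suc i ℕ.+ d)) (inv (+ suc d))))
      where
      unit : Unit (+ suc d)
      unit = unit-small (suc d) (s≤s z≤n) (ℕ.≤-<-trans (ℕ.≤-trans d<j (subst (j ≤_) eq (ℕ.m≤n+m j i))) m<p)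
      lemma₁ : ∀ i d c v → - ((+ 1 + (i + d)) * c) * v ≡ - (c + i * (c * v)) + - c * ((+ 1 + d) * v - + 1)
      lemma₁ = solve-∀

  -- The sum of squares modulo p²

  w : ℕ → ℤ
  w i = (P - + 1) * (binom m i * binom m i * (+ 1 + + 2 * P * (+ 1 + E i (m ∸ i))))

  L-closed : ∀ l → Unit l → L l ≈ ε (- + 1) * sum (suc m) (λ i → w i * τ l ^ i) [ PP ]
  L-closed l ul = ≈-trans (L-expansion l ul) (*-cong-≈ {ε (- + 1)} ≈-refl (sum-cong-≈ (suc m) λ i i< → *-cong-≈ (coefficient i (ℕ.≤-pred i<)) (≈-refl {τ l ^ i})))
    where
    open ≈-Reasoning PP
    coefficient : ∀ i → i ≤ m → c i * (c i * (P - + 1) + + 2 * P * moment i) ≈ w i [ PP ]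
    coefficient i i≤m = begin
      c i * (c i * (P - + 1) + + 2 * P * moment i) ≡⟨ lemma₁ (c i) P (moment i) ⟩
      c i * (c i * (P - + 1)) + P * (+ 2 * c i * moment i) ≈⟨ +-cong-≈ (≈-refl {c i * (c i * (P - + 1))}) (≈-scale P (*-cong-≈ {+ 2 * c i} ≈-refl (moment-closed i (m ∸ i) (ℕ.m+[n∸m]≡n i≤m)))) ⟩
      c i * (c i * (P - + 1)) + P * (+ 2 * c i * - (c i * (+ 1 + e))) ≈⟨ by (- (+ 2 * (c i * c i) * (+ 1 + e))) (lemma₂ (c i) P e) ⟩
      (P - + 1) * (c i * c i * (+ 1 + + 2 * P * (+ 1 + e))) ≡⟨ cong (λ x → (P - + 1) * (x * (+ 1 + + 2 * P * (+ 1 + e)))) (trans (lemma₃ (binom m i) (signPower i)) (trans (cong (_*_ (binom m i * binom m i)) (signPower² i)) (ℤ.*-identityʳ (binom m i * binom m i)))) ⟩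
      w i ∎
      where
      e = E i (m ∸ i)
      lemma₁ : ∀ c P b → c * (c * (P - + 1) + + 2 * P * b) ≡ c * (c * (P - + 1)) + P * (+ 2 * c * b)
      lemma₁ = solve-∀
      lemma₂ : ∀ c P e → c * (c * (P - + 1)) + P * (+ 2 * c * - (c * (+ 1 + e))) ≡ (P - + 1) * (c * c * (+ 1 + + 2 * P * (+ 1 + e))) + - (+ 2 * (c * c) * (+ 1 + e)) * (P * P)
      lemma₂ = solve-∀
      lemma₃ : ∀ b s → b * s * (b * s) ≡ b * b * (s * s)
      lemma₃ = solve-∀

  doublePower : ℕ → ℕ → ℤ
  doublePower i j = ∑ (λ k → υ k * τ k ^ (i ℕ.+ i ℕ.+ (j ℕ.+ j)))

  Z-B-double : Z-B ≈ + 1 + sum (suc m) (λ i → sum (suc m) (λ j → w i * w j * doublePower i j)) [ PP ]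
  Z-B-double = begin
    Z-B ≡⟨ trans (∑-ext λ k → split k) (∑-+ (λ k → δ (k - + 0) * (L (k * k) * L (k * k))) (λ k → υ k * (L (k * k) * L (k * k)))) ⟩
    ∑ (λ k → δ (k - + 0) * (L (k * k) * L (k * k))) + ∑ (λ k → υ k * (L (k * k) * L (k * k)))
      ≈⟨ +-cong-≈ (≡⇒≈ {N = PP} (trans (∑-δ (λ k → L (k * k) * L (k * k)) (+ 0) (λ a b h → square-periodic {L} L-periodic (a * a) (b * b) (*-cong-≈ h h))) L-0)) (∑-cong-≈ λ k → υ-restrict (squared k)) ⟩
    + 1 + ∑ (λ k → υ k * sum (suc m) (λ i → sum (suc m) (λ j → w i * w j * τ k ^ (i ℕ.+ i ℕ.+ (j ℕ.+ j)))))
      ≡⟨ cong (_+_ (+ 1)) (trans (∑-ext distribute) (trans (∑-sum-swap (suc m) (λ k i → sum (suc m) (λ j → w i * w j * (υ k * τ k ^ (i ℕ.+ i ℕ.+ (j ℕ.+ j)))))) (sum-ext (suc m) λ i → trans (∑-sum-swap (suc m) (λ k j → w i * w j * (υ k * τ k ^ (i ℕ.+ i ℕ.+ (j ℕ.+ j))))) (sum-ext (suc m) λ j → ∑-*ˡ (w i * w j) (λ k → υ k * τ k ^ (i ℕ.+ i ℕ.+ (j ℕ.+ j))))))) ⟩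
    + 1 + sum (suc m) (λ i → sum (suc m) (λ j → w i * w j * doublePower i j)) ∎
    where
    open ≈-Reasoning PP
    lemma₁ : ∀ d x → x ≡ d * x + (+ 1 - d) * x
    lemma₁ = solve-∀
    split : ∀ k → L (k * k) * L (k * k) ≡ δ (k - + 0) * (L (k * k) * L (k * k)) + υ k * (L (k * k) * L (k * k))
    split k = trans (lemma₁ (δ k) (L (k * k) * L (k * k))) (cong (λ d → d * (L (k * k) * L (k * k)) + υ k * (L (k * k) * L (k * k))) (sym (δ-zero k)))
    distribute : ∀ k → υ k * sum (suc m) (λ i → sum (suc m) (λ j → w i * w j * τ k ^ (i ℕ.+ i ℕ.+ (j ℕ.+ j)))) ≡ sum (suc m) (λ i → sum (suc m) (λ j → w i * w j * (υ k * τ k ^ (i ℕ.+ i ℕ.+ (j ℕ.+ j)))))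
    distribute k = trans (sym (sum-*ˡ (suc m) (υ k) (λ i → sum (suc m) (λ j → w i * w j * τ k ^ (i ℕ.+ i ℕ.+ (j ℕ.+ j)))))) (sum-ext (suc m) λ i → trans (sym (sum-*ˡ (suc m) (υ k) (λ j → w i * w j * τ k ^ (i ℕ.+ i ℕ.+ (j ℕ.+ j))))) (sum-ext (suc m) λ j → lemma₂ (υ k) (w i * w j) (τ k ^ (i ℕ.+ i ℕ.+ (j ℕ.+ j)))))
      where
      lemma₂ : ∀ u a b → u * (a * b) ≡ a * (u * b)
      lemma₂ = solve-∀
    squared : ∀ k → Unit k → L (k * k) * L (k * k) ≈ sum (suc m) (λ i → sum (suc m) (λ j → w i * w j * τ k ^ (i ℕ.+ i ℕ.+ (j ℕ.+ j)))) [ PP ]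
    squared k u = ≈-trans (*-cong-≈ (L-closed (k * k) (Unit-* u u)) (L-closed (k * k) (Unit-* u u))) (≡⇒≈ (trans (lemma₃ (ε (- + 1)) s) (trans (cong (_* (s * s)) (ε² -1-unit)) (trans (ℤ.*-identityˡ (s * s))
        (trans (sum-product (suc m) (suc m) (λ i → w i * τ (k * k) ^ i) (λ i → w i * τ (k * k) ^ i)) (sum-ext (suc m) λ i → sum-ext (suc m) λ j → trans (lemma₄ (w i) (τ (k * k) ^ i) (w j) (τ (k * k) ^ j)) (cong (_*_ (w i * w j)) (trans (cong₂ _*_ (powers i) (powers j)) (sym (ℤ.^-distribˡ-+-* (τ k) (i ℕ.+ i) (j ℕ.+ j)))))))))))
      where
      s = sum (suc m) (λ i → w i * τ (k * k) ^ i)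
      powers : ∀ i → τ (k * k) ^ i ≡ τ k ^ (i ℕ.+ i)
      powers i = trans (cong (_^ i) (τ-* k k)) (trans (^-distrib-* (τ k) (τ k) i) (sym (ℤ.^-distribˡ-+-* (τ k) i i)))
      lemma₃ : ∀ e s → e * s * (e * s) ≡ e * e * (s * s)
      lemma₃ = solve-∀
      lemma₄ : ∀ a b c d → a * b * (c * d) ≡ a * c * (b * d)
      lemma₄ = solve-∀

  -- On units the power is trivial exactly when `2m` divides `2s`, which in the range `s ≤ 2m`
  -- leaves three values.
  evenPower : ∀ s → s ≤ 2m → ∑ (λ k → υ k * τ k ^ (s ℕ.+ s)) ≈ (P - + 1) * (kronecker s 0 + kronecker s m + kronecker s 2m) [ PP ]
  evenPower s s≤ with ℕ.<-cmp s m
  ... | tri< s<m s≢m _ = ≈-trans (low s s<m) (≡⇒≈ (cong (_*_ (P - + 1)) (sym (trans (cong₂ (λ x y → kronecker s 0 + x + y) (kronecker-≢ s≢m) (kronecker-≢ (ℕ.<⇒≢ (ℕ.<-≤-trans s<m m≤2m)))) (drop₃ (kronecker s 0))))))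
    where
    drop₃ : ∀ x → x + + 0 + + 0 ≡ x
    drop₃ = solve-∀
    low : ∀ s → s < m → ∑ (λ k → υ k * τ k ^ (s ℕ.+ s)) ≈ (P - + 1) * kronecker s 0 [ PP ]
    low zero _ = ≡⇒≈ (trans (∑-ext λ k → ℤ.*-identityʳ (υ k)) (trans ∑υ (sym (ℤ.*-identityʳ (P - + 1)))))
    low (suc s) s<m = ≈-trans (powerSum-τ (suc s ℕ.+ suc s) (s≤s z≤n) (ℕ.+-mono-< s<m s<m)) (≡⇒≈ (sym (ℤ.*-zeroʳ (P - + 1))))
  ... | tri≈ _ refl _ = ≈-trans (∑-cong-≈ λ k → υ-restrict {PP} {k} {τ k ^ 2m} {+ 1} τ-unit) (≡⇒≈ (trans (∑-ext λ k → ℤ.*-identityʳ (υ k)) (trans ∑υ (trans (sym (ℤ.*-identityʳ (P - + 1))) (cong (_*_ (P - + 1)) (sym (trans (cong₂ (λ x y → x + kronecker s m + y) (kronecker-≢ (ℕ.>⇒≢ 0<m)) (kronecker-≢ (ℕ.<⇒≢ (ℕ.m<m+n m 0<m)))) (cong (λ x → + 0 + x + + 0) (kronecker-≡ m)))))))))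
  ... | tri> _ s≢m m<s = ≈-trans (reduce (s ∸ m) (ℕ.m+[n∸m]≡n (ℕ.<⇒≤ m<s)) (ℕ.m<n⇒0<n∸m m<s)) (≡⇒≈ (cong (_*_ (P - + 1)) (sym (trans (cong₂ (λ x y → x + y + kronecker s 2m) (kronecker-≢ (ℕ.>⇒≢ (ℕ.≤-<-trans z≤n m<s))) (kronecker-≢ s≢m)) (drop₁ (kronecker s 2m))))))
    where
    drop₁ : ∀ x → + 0 + + 0 + x ≡ x
    drop₁ = solve-∀
    reduce : ∀ r → m ℕ.+ r ≡ s → 0 < r → ∑ (λ k → υ k * τ k ^ (s ℕ.+ s)) ≈ (P - + 1) * kronecker s 2m [ PP ]
    reduce r eq 0<r = ≈-trans (∑-cong-≈ (λ k → υ-restrict (shifted k))) (high r eq 0<r)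
      where
      shifted : ∀ k → Unit k → τ k ^ (s ℕ.+ s) ≈ τ k ^ (r ℕ.+ r) [ PP ]
      shifted k u = ≈-trans (≡⇒≈ (trans (cong (τ k ^_) (trans (cong (λ n → n ℕ.+ n) (sym eq)) (sym (double-+ m r)))) (ℤ.^-distribˡ-+-* (τ k) 2m (r ℕ.+ r)))) (≈-trans (*-cong-≈ (τ-unit u) (≈-refl {τ k ^ (r ℕ.+ r)})) (≡⇒≈ (ℤ.*-identityˡ (τ k ^ (r ℕ.+ r)))))
      high : ∀ r → m ℕ.+ r ≡ s → 0 < r → ∑ (λ k → υ k * τ k ^ (r ℕ.+ r)) ≈ (P - + 1) * kronecker s 2m [ PP ]
      high r refl 0<r with ℕ.<-cmp r m
      ... | tri< r<m r≢m _ = ≈-trans (powerSum-τ (r ℕ.+ r) (ℕ.<-≤-trans 0<r (ℕ.m≤m+n r r)) (ℕ.+-mono-< r<m r<m)) (≡⇒≈ (sym (trans (cong (_*_ (P - + 1)) (kronecker-≢ (r≢m ∘ ℕ.+-cancelˡ-≡ m r m))) (ℤ.*-zeroʳ (P - + 1)))))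
      ... | tri≈ _ refl _ = ≈-trans (∑-cong-≈ λ k → υ-restrict {PP} {k} {τ k ^ 2m} {+ 1} τ-unit) (≡⇒≈ (trans (∑-ext λ k → ℤ.*-identityʳ (υ k)) (trans ∑υ (trans (sym (ℤ.*-identityʳ (P - + 1))) (cong (_*_ (P - + 1)) (sym (kronecker-≡ 2m)))))))
      ... | tri> _ _ m<r = contradiction s≤ (ℕ.<⇒≱ (ℕ.+-monoʳ-< m m<r))

  -- `evenPower` keeps the pairs with `i + j = m` and the corners `(0, 0)` and `(m, m)`. The
  -- corners, together with the term `1` of `k = 0`, give `- 1 - 2P`; for the other pairs `(P - 1)³
  -- (1 + 2P (1 + E))² ≈ - (1 + P + 4P E)`.
  Z-B-mod-P² : Z-B ≈ - + 1 - + 2 * P - sum (suc m) (λ i → binom m i ^ 4 * (+ 1 + P + + 4 * P * E i (m ∸ i))) [ PP ]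
  Z-B-mod-P² = begin
    Z-B ≈⟨ Z-B-double ⟩
    + 1 + sum (suc m) (λ i → sum (suc m) (λ j → w i * w j * doublePower i j))
      ≈⟨ +-cong-≈ (≈-refl {+ 1}) (sum-cong-≈ (suc m) λ i i< → sum-cong-≈ (suc m) λ j j< → *-cong-≈ {w i * w j} ≈-refl (≈-trans (≡⇒≈ (∑-ext λ k → cong (λ n → υ k * τ k ^ n) (double-+ i j))) (≈-trans (evenPower (i ℕ.+ j) (ℕ.+-mono-≤ (ℕ.≤-pred i<) (ℕ.≤-pred j<))) (≡⇒≈ (cong (_*_ (P - + 1)) (supports i j (ℕ.≤-pred i<) (ℕ.≤-pred j<))))))) ⟩
    + 1 + sum (suc m) (λ i → sum (suc m) (λ j → w i * w j * ((P - + 1) * (kronecker i 0 * kronecker j 0 + kronecker j (m ∸ i) + kronecker i m * kronecker j m))))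
      ≡⟨ cong (_+_ (+ 1)) (trans (sum-cong (suc m) λ i i< → inner i (ℕ.≤-pred i<)) outer) ⟩
    + 1 + (P - + 1) * (w 0 * w 0 + sum (suc m) (λ i → w i * w (m ∸ i)) + w m * w m)
      ≡⟨ cong₂ (λ x y → + 1 + (P - + 1) * (x * x + sum (suc m) (λ i → w i * w (m ∸ i)) + y * y)) w-0 w-m ⟩
    + 1 + (P - + 1) * (w₀ * w₀ + sum (suc m) (λ i → w i * w (m ∸ i)) + w₀ * w₀)
      ≡⟨ trans (lemma₁ P w₀ (sum (suc m) (λ i → w i * w (m ∸ i)))) (cong (_+_ (+ 1 + + 2 * (P - + 1) * (w₀ * w₀))) (sym (sum-*ˡ (suc m) (P - + 1) (λ i → w i * w (m ∸ i))))) ⟩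
    + 1 + + 2 * (P - + 1) * (w₀ * w₀) + sum (suc m) (λ i → (P - + 1) * (w i * w (m ∸ i)))
      ≈⟨ +-cong-≈ {+ 1 + + 2 * (P - + 1) * (w₀ * w₀)} { - + 1 - + 2 * P} (by (+ 8 * P * P * P - + 16 * P * P + + 2 * P + + 10) (lemma₂ P)) (sum-cong-≈ (suc m) λ i i< → term i (ℕ.≤-pred i<)) ⟩
    - + 1 - + 2 * P + sum (suc m) (λ i → - (binom m i ^ 4 * (+ 1 + P + + 4 * P * E i (m ∸ i))))
      ≡⟨ cong (_+_ (- + 1 - + 2 * P)) (sum-neg (suc m) (λ i → binom m i ^ 4 * (+ 1 + P + + 4 * P * E i (m ∸ i)))) ⟩
    - + 1 - + 2 * P - sum (suc m) (λ i → binom m i ^ 4 * (+ 1 + P + + 4 * P * E i (m ∸ i))) ∎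
    where
    open ≈-Reasoning PP
    w₀ = (P - + 1) * (+ 1 + + 2 * P)
    lemma₁ : ∀ P w s → + 1 + (P - + 1) * (w * w + s + w * w) ≡ + 1 + + 2 * (P - + 1) * (w * w) + (P - + 1) * s
    lemma₁ = solve-∀
    lemma₂ : ∀ P → + 1 + + 2 * (P - + 1) * ((P - + 1) * (+ 1 + + 2 * P) * ((P - + 1) * (+ 1 + + 2 * P))) ≡ - + 1 - + 2 * P + (+ 8 * P * P * P - + 16 * P * P + + 2 * P + + 10) * (P * P)
    lemma₂ = solve-∀
    w-0 : w 0 ≡ w₀
    w-0 = trans (cong₂ (λ b h → (P - + 1) * (b * b * (+ 1 + + 2 * P * (+ 1 + h)))) (binom-0 m) (trans (cong (λ x → + m * x + + 0 * (H m - H 0)) (ℤ.+-inverseʳ (H m))) (lemma (+ m) (H m - H 0)))) (lemma′ P)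
      where
      lemma : ∀ m x → m * + 0 + + 0 * x ≡ + 0
      lemma = solve-∀
      lemma′ : ∀ P → (P - + 1) * (+ 1 * + 1 * (+ 1 + + 2 * P * (+ 1 + + 0))) ≡ (P - + 1) * (+ 1 + + 2 * P)
      lemma′ = solve-∀
    E-sym : ∀ i j → E i j ≡ E j i
    E-sym i j = ℤ.+-comm (+ j * (H m - H j)) (+ i * (H m - H i))
    w-sym : ∀ i → i ≤ m → w (m ∸ i) ≡ w i
    w-sym i i≤m = cong₂ (λ b h → (P - + 1) * (b * b * (+ 1 + + 2 * P * (+ 1 + h)))) (sym (binom-sym i≤m)) (trans (cong (E (m ∸ i)) (ℕ.m∸[m∸n]≡n i≤m)) (E-sym (m ∸ i) i))
    w-m : w m ≡ w₀
    w-m = trans (w-sym 0 z≤n) w-0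
    term : ∀ i → i ≤ m → (P - + 1) * (w i * w (m ∸ i)) ≈ - (binom m i ^ 4 * (+ 1 + P + + 4 * P * E i (m ∸ i))) [ PP ]
    term i i≤m = ≈-trans (≡⇒≈ (cong (λ x → (P - + 1) * (w i * x)) (w-sym i i≤m))) (by (quotient P (binom m i) (E i (m ∸ i))) (lemma P (binom m i) (E i (m ∸ i))))
      where
      quotient : ℤ → ℤ → ℤ → ℤ
      quotient P b e = b * b * b * b * ((P - + 3) * (+ 1 + + 2 * P * (+ 1 + e)) * (+ 1 + + 2 * P * (+ 1 + e)) + + 3 * (+ 4 * (+ 1 + e) + + 4 * P * (+ 1 + e) * (+ 1 + e)) - + 4 * (+ 1 + e) * (+ 1 + e))
      lemma : ∀ P b e → (P - + 1) * ((P - + 1) * (b * b * (+ 1 + + 2 * P * (+ 1 + e))) * ((P - + 1) * (b * b * (+ 1 + + 2 * P * (+ 1 + e))))) ≡ - (b * (b * (b * (b * + 1))) * (+ 1 + P + + 4 * P * e)) + (b * b * b * b * ((P - + 3) * (+ 1 + + 2 * P * (+ 1 + e)) * (+ 1 + + 2 * P * (+ 1 + e)) + + 3 * (+ 4 * (+ 1 + e) + + 4 * P * (+ 1 + e) * (+ 1 + e)) - + 4 * (+ 1 + e) * (+ 1 + e))) * (P * P)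
      lemma = solve-∀
    supports : ∀ i j → i ≤ m → j ≤ m → kronecker (i ℕ.+ j) 0 + kronecker (i ℕ.+ j) m + kronecker (i ℕ.+ j) 2m ≡ kronecker i 0 * kronecker j 0 + kronecker j (m ∸ i) + kronecker i m * kronecker j m
    supports i j i≤m j≤m = cong₂ _+_ (cong₂ _+_ (bottom i j) (kronecker-+ j i≤m)) top
      where
      bottom : ∀ i j → kronecker (i ℕ.+ j) 0 ≡ kronecker i 0 * kronecker j 0
      bottom zero j = sym (ℤ.*-identityˡ (kronecker j 0))
      bottom (suc i) j = refl
      top : kronecker (i ℕ.+ j) 2m ≡ kronecker i m * kronecker j m
      top with i ℕ.≟ m | j ℕ.≟ m
      ... | yes refl | yes refl = kronecker-≡ (i ℕ.+ j)
      ... | yes refl | no j≢m = kronecker-≢ (j≢m ∘ ℕ.+-cancelˡ-≡ i j m)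
      ... | no i≢m | _ = kronecker-≢ (ℕ.<⇒≢ (ℕ.+-mono-<-≤ (ℕ.≤∧≢⇒< i≤m i≢m) j≤m))
    inner : ∀ i → i ≤ m → sum (suc m) (λ j → w i * w j * ((P - + 1) * (kronecker i 0 * kronecker j 0 + kronecker j (m ∸ i) + kronecker i m * kronecker j m))) ≡ (P - + 1) * w i * w 0 * kronecker i 0 + (P - + 1) * (w i * w (m ∸ i)) + (P - + 1) * w i * w m * kronecker i m
    inner i i≤m = trans (sum-ext (suc m) λ j → lemma (P - + 1) (w i) (w j) (kronecker i 0) (kronecker j 0) (kronecker j (m ∸ i)) (kronecker i m) (kronecker j m))
      (trans (sum-+ (suc m) (λ j → f₁ j * kronecker j 0 + f₂ j * kronecker j (m ∸ i)) (λ j → f₃ j * kronecker j m)) (cong₂ _+_ (trans (sum-+ (suc m) (λ j → f₁ j * kronecker j 0) (λ j → f₂ j * kronecker j (m ∸ i))) (cong₂ _+_ (sum-kronecker (suc m) 0 f₁ (s≤s z≤n)) (sum-kronecker (suc m) (m ∸ i) f₂ (s≤s (ℕ.m∸n≤m m i))))) (sum-kronecker (suc m) m f₃ (ℕ.n<1+n m))))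
      where
      f₁ f₂ f₃ : ℕ → ℤ
      f₁ j = (P - + 1) * w i * w j * kronecker i 0
      f₂ j = (P - + 1) * (w i * w j)
      f₃ j = (P - + 1) * w i * w j * kronecker i m
      lemma : ∀ q a b x y z s t → a * b * (q * (x * y + z + s * t)) ≡ q * a * b * x * y + q * (a * b) * z + q * a * b * s * t
      lemma = solve-∀
    outer : sum (suc m) (λ i → (P - + 1) * w i * w 0 * kronecker i 0 + (P - + 1) * (w i * w (m ∸ i)) + (P - + 1) * w i * w m * kronecker i m) ≡ (P - + 1) * (w 0 * w 0 + sum (suc m) (λ i → w i * w (m ∸ i)) + w m * w m)
    outer = trans (sum-+ (suc m) (λ i → g₁ i * kronecker i 0 + g₂ i) (λ i → g₃ i * kronecker i m)) (trans (cong₂ _+_ (trans (sum-+ (suc m) (λ i → g₁ i * kronecker i 0) g₂) (cong₂ _+_ (sum-kronecker (suc m) 0 g₁ (s≤s z≤n)) (sum-*ˡ (suc m) (P - + 1) (λ i → w i * w (m ∸ i))))) (sum-kronecker (suc m) m g₃ (ℕ.n<1+n m))) (lemma (P - + 1) (w 0) (w m) (sum (suc m) (λ i → w i * w (m ∸ i)))))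
      where
      g₁ g₂ g₃ : ℕ → ℤ
      g₁ i = (P - + 1) * w i * w 0
      g₂ i = (P - + 1) * (w i * w (m ∸ i))
      g₃ i = (P - + 1) * w i * w m
      lemma : ∀ q a b s → q * a * a + q * s + q * b * b ≡ q * (a * a + s + b * b)
      lemma = solve-∀

-- Polynomials with known leading coefficient, and rising products

record Polynomial (n : ℕ) (c : ℤ) (f : ℤ → ℤ) : Set where
  field
    coefficients : ℕ → ℤ
    leadingTerm : coefficients n ≡ c
    beyondDegree : ∀ k → n < k → coefficients k ≡ + 0
    evaluated : ∀ x → f x ≡ sum (suc n) (λ k → coefficients k * x ^ k)
open Polynomial

poly-const : ∀ c → Polynomial 0 c (λ _ → c)
poly-const c = record { coefficients = λ { zero → c ; (suc _) → + 0 } ; leadingTerm = refl ; beyondDegree = λ { (suc k) _ → refl } ; evaluated = λ x → sym (trans (ℤ.+-identityˡ (c * + 1)) (ℤ.*-identityʳ c)) }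

poly-linear : ∀ {n c f} b a → Polynomial n c f → Polynomial (suc n) (b * c) (λ x → (b * x + a) * f x)
poly-linear {n} {c} {f} b a q = record
  { coefficients = g
  ; leadingTerm = trans (cong₂ (λ x y → b * x + a * y) (leadingTerm q) (beyondDegree q (suc n) (ℕ.n<1+n n))) (lemma₁ (b * c) a)
  ; beyondDegree = λ { (suc k) (s≤s n<k) → trans (cong₂ (λ x y → b * x + a * y) (beyondDegree q k n<k) (beyondDegree q (suc k) (ℕ.m<n⇒m<1+n n<k))) (lemma₂ b a) }
  ; evaluated = λ x → begin
      (b * x + a) * f x ≡⟨ cong (_*_ (b * x + a)) (evaluated q x) ⟩
      (b * x + a) * sum (suc n) (λ k → d k * x ^ k) ≡⟨ lemma₃ b x a (sum (suc n) (λ k → d k * x ^ k)) ⟩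
      b * x * sum (suc n) (λ k → d k * x ^ k) + a * (sum (suc n) (λ k → d k * x ^ k) + + 0)
        ≡⟨ cong₂ _+_ (trans (sym (sum-*ˡ (suc n) (b * x) (λ k → d k * x ^ k))) (trans (sum-ext (suc n) λ k → lemma₄ b x (d k) (x ^ k)) (sym (trans (sum-suc (suc n) (λ k → b * s k * x ^ k)) (trans (cong (_+ sum (suc n) (λ k → b * d k * x ^ suc k)) (lemma₆ b)) (ℤ.+-identityˡ _))))))
             (trans (cong (λ y → a * (sum (suc n) (λ k → d k * x ^ k) + y)) (sym (cong (_* x ^ suc n) (beyondDegree q (suc n) (ℕ.n<1+n n))))) (sym (sum-*ˡ (suc (suc n)) a (λ k → d k * x ^ k)))) ⟩
      sum (suc (suc n)) (λ k → b * s k * x ^ k) + sum (suc (suc n)) (λ k → a * (d k * x ^ k))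
        ≡⟨ trans (sym (sum-+ (suc (suc n)) (λ k → b * s k * x ^ k) (λ k → a * (d k * x ^ k)))) (sum-ext (suc (suc n)) λ k → lemma₅ (b * s k) a (d k) (x ^ k)) ⟩
      sum (suc (suc n)) (λ k → g k * x ^ k) ∎ }
  where
  open ≡-Reasoning
  d s g : ℕ → ℤ
  d = coefficients q
  s zero = + 0
  s (suc k) = d k
  g k = b * s k + a * d k
  lemma₁ : ∀ x a → x + a * + 0 ≡ x
  lemma₁ = solve-∀
  lemma₂ : ∀ b a → b * + 0 + a * + 0 ≡ + 0
  lemma₂ = solve-∀
  lemma₃ : ∀ b x a t → (b * x + a) * t ≡ b * x * t + a * (t + + 0)
  lemma₃ = solve-∀
  lemma₄ : ∀ b x d y → b * x * (d * y) ≡ b * d * (x * y)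
  lemma₄ = solve-∀
  lemma₅ : ∀ s a d y → s * y + a * (d * y) ≡ (s + a * d) * y
  lemma₅ = solve-∀
  lemma₆ : ∀ b → b * + 0 * + 1 ≡ + 0
  lemma₆ = solve-∀

poly-cong : ∀ {n n′ c c′ f f′} → n ≡ n′ → c ≡ c′ → (∀ x → f′ x ≡ f x) → Polynomial n c f → Polynomial n′ c′ f′
poly-cong refl refl h q = record { coefficients = coefficients q ; leadingTerm = leadingTerm q ; beyondDegree = beyondDegree q ; evaluated = λ x → trans (h x) (evaluated q x) }

-- The product begins at `x + 1`, so that `rise (+ 0)` is the factorial and `rise (+ r) n` is
-- `(r + n)! / r!`.
rise : ℤ → ℕ → ℤ
rise x zero = + 1
rise x (suc n) = (x + + suc n) * rise x n

rise-+ : ∀ x a b → rise x (a ℕ.+ b) ≡ rise x a * rise (x + + a) b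
rise-+ x a zero = trans (cong (rise x) (ℕ.+-identityʳ a)) (sym (ℤ.*-identityʳ (rise x a)))
rise-+ x a (suc b) = trans (cong (rise x) (ℕ.+-suc a b)) (trans (cong₂ _*_ (shuffle x (+ a) (+ b)) (rise-+ x a b)) (lemma (rise x a) (x + + a + + suc b) (rise (x + + a) b)))
  where
  shuffle : ∀ x a b → x + (+ 1 + (a + b)) ≡ x + a + (+ 1 + b)
  shuffle = solve-∀
  lemma : ∀ r y t → y * (r * t) ≡ r * (y * t)
  lemma = solve-∀

fact : ℕ → ℤ
fact = rise (+ 0)

rise-binom : ∀ r n → rise (+ r) n ≡ fact n * binom (n ℕ.+ r) n
rise-binom r zero = sym (trans (ℤ.*-identityˡ (binom r 0)) (binom-0 r))
rise-binom r (suc n) = begin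
  (+ r + + suc n) * rise (+ r) n ≡⟨ cong ((+ r + + suc n) *_) (rise-binom r n) ⟩
  (+ r + + suc n) * (fact n * binom (n ℕ.+ r) n) ≡⟨ lemma₁ (+ r) (+ n) (fact n) (binom (n ℕ.+ r) n) ⟩
  fact n * (+ suc (n ℕ.+ r) * binom (n ℕ.+ r) n) ≡⟨ cong (fact n *_) (sym (binom-absorb (n ℕ.+ r) n)) ⟩
  fact n * (+ suc n * binom (suc (n ℕ.+ r)) (suc n)) ≡⟨ lemma₂ (+ suc n) (fact n) (binom (suc (n ℕ.+ r)) (suc n)) ⟩
  fact (suc n) * binom (suc n ℕ.+ r) (suc n) ∎
  where
  open ≡-Reasoning
  lemma₁ : ∀ r n f b → (r + (+ 1 + n)) * (f * b) ≡ f * ((+ 1 + (n + r)) * b)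
  lemma₁ = solve-∀
  lemma₂ : ∀ n f b → f * (n * b) ≡ (+ 0 + n) * f * b
  lemma₂ = solve-∀

fact-binom : ∀ a b → fact (a ℕ.+ b) ≡ fact a * fact b * binom (b ℕ.+ a) b
fact-binom a b = trans (rise-+ (+ 0) a b) (trans (cong (fact a *_) (rise-binom a b)) (sym (ℤ.*-assoc (fact a) (fact b) (binom (b ℕ.+ a) b))))

poly-rise : ∀ {d c f} n → Polynomial d c f → Polynomial (n ℕ.+ d) c (λ x → rise x n * f x)
poly-rise zero q = poly-cong refl refl (λ x → ℤ.*-identityˡ _) q
poly-rise {d} {c} {f} (suc n) q = poly-cong refl (ℤ.*-identityˡ c) (λ x → lemma x (+ suc n) (rise x n) (f x)) (poly-linear (+ 1) (+ suc n) (poly-rise n q))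
  where
  lemma : ∀ x n r f → (x + n) * r * f ≡ (+ 1 * x + n) * (r * f)
  lemma = solve-∀

binom-next : ∀ n k → + suc k * binom n (suc k) ≡ (+ n - + k) * binom n k
binom-next n k = begin
  + suc k * binom n (suc k) ≡⟨ lemma₁ (+ suc k) (binom n k) (binom n (suc k)) ⟩
  + suc k * (binom n k + binom n (suc k)) - + suc k * binom n k ≡⟨ cong (_- + suc k * binom n k) (trans (cong (_*_ (+ suc k)) (sym (pascal n k))) (binom-absorb n k)) ⟩
  + suc n * binom n k - + suc k * binom n k ≡⟨ lemma₂ (+ n) (+ k) (binom n k) ⟩
  (+ n - + k) * binom n k ∎
  where
  open ≡-Reasoning
  lemma₁ : ∀ k a b → k * b ≡ k * (a + b) - k * a
  lemma₁ = solve-∀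
  lemma₂ : ∀ n k a → (+ 1 + n) * a - (+ 1 + k) * a ≡ (n - k) * a
  lemma₂ = solve-∀

-- Central binomial coefficients

centralBinom : ℕ → ℤ
centralBinom n = binom (n ℕ.+ n) n

centralBinom-suc : ∀ n → + suc n * centralBinom (suc n) ≡ + 2 * + suc (n ℕ.+ n) * centralBinom n
centralBinom-suc n = begin
  + suc n * binom (suc (n ℕ.+ suc n)) (suc n) ≡⟨ cong (λ k → + suc n * binom (suc k) (suc n)) (ℕ.+-suc n n) ⟩
  + suc n * binom (suc (suc (n ℕ.+ n))) (suc n) ≡⟨ binom-absorb (suc (n ℕ.+ n)) n ⟩
  + suc (suc (n ℕ.+ n)) * binom (suc (n ℕ.+ n)) n ≡⟨ cong₂ _*_ (lemma₁ (+ n)) (trans (binom-sym (ℕ.m≤n⇒m≤1+n (ℕ.m≤m+n n n))) (cong (binom (suc (n ℕ.+ n))) (trans (ℕ.+-∸-assoc 1 (ℕ.m≤m+n n n)) (cong suc (ℕ.m+n∸n≡m n n))))) ⟩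
  + 2 * + suc n * binom (suc (n ℕ.+ n)) (suc n) ≡⟨ trans (ℤ.*-assoc (+ 2) (+ suc n) (binom (suc (n ℕ.+ n)) (suc n))) (cong (_*_ (+ 2)) (binom-absorb (n ℕ.+ n) n)) ⟩
  + 2 * (+ suc (n ℕ.+ n) * centralBinom n) ≡⟨ sym (ℤ.*-assoc (+ 2) (+ suc (n ℕ.+ n)) (centralBinom n)) ⟩
  + 2 * + suc (n ℕ.+ n) * centralBinom n ∎
  where
  open ≡-Reasoning
  lemma₁ : ∀ n → + 2 + (n + n) ≡ + 2 * (+ 1 + n)
  lemma₁ = solve-∀

-- These will be the coefficients of `F` in powers of `u²`.
g₀ : ℕ → ℤ
g₀ i = centralBinom i * centralBinom i

-- The harmonic identity obtained by summing a derivative over the residues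

module HarmonicIdentity (m : ℕ) (pr : Prime (suc (m ℕ.+ m))) where
  open PrimeField m pr
  open CharacterSums m pr using (signPower; signPower²; binom-sign)
  open PrimeSquare m pr using (cancel-P)
  open HarmonicSums m pr using (H; inv-complement)

  divide-P : ∀ {a b} → P * a ≈ P * b [ PP ] → a ≈ b [ P ]
  divide-P {a} {b} (by q eq) = by q (ℤ.*-cancelˡ-≡ P a (b + q * P) (trans eq (lemma P b q)))
    where
    lemma : ∀ P b q → P * b + q * (P * P) ≡ P * (b + q * P)
    lemma = solve-∀

  -- An instance of `H (p - 1 - a) ≈ H a`: moving away from the middle index `m`, the reciprocal
  -- added on one side is the negative of the one removed on the other.
  H-reflect : ∀ a d → a ℕ.+ d ≡ m → H (m ℕ.+ d) ≈ H a [ P ]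
  H-reflect a zero eq = ≡⇒≈ (cong H (trans (ℕ.+-identityʳ m) (trans (sym eq) (ℕ.+-identityʳ a))))
  H-reflect a (suc d) eq = linear-≈₂ (+ 1) (+ 1) (H-reflect (suc a) d (trans (sym (ℕ.+-suc a d)) eq)) (inv-complement (suc (m ℕ.+ d)) (suc a) (s≤s z≤n) (s≤s z≤n) total)
      (trans (cong H (ℕ.+-suc m d)) (lemma (H (m ℕ.+ d)) (inv (+ suc (m ℕ.+ d))) (H a) (inv (+ suc a))))
    where
    lemma : ∀ x i y j → x + i ≡ y + + 1 * (x - (y + j)) + + 1 * (i - - j)
    lemma = solve-∀
    total : suc (m ℕ.+ d) ℕ.+ suc a ≡ p
    total = cong suc (trans (shuffle m d a) (cong (m ℕ.+_) eq))
      where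
      shuffle : ∀ m d a → m ℕ.+ d ℕ.+ suc a ≡ m ℕ.+ (a ℕ.+ suc d)
      shuffle = ℕ-Solver.solve-∀

  powerSum-high : ∀ n → powerSum (2m ℕ.+ suc n) ≈ powerSum (suc n) [ P ]
  powerSum-high n = sum-cong-≈ p λ x _ → ≈-trans (≡⇒≈ (trans (cong ((+ x) ^_) (ℕ.+-suc 2m n)) (ℤ.^-distribˡ-+-* (+ x) p n))) (*-cong-≈ (fermat (+ x)) (≈-refl {(+ x) ^ n}))

  poly-sum : ∀ {c f} → Polynomial 2m c f → sum p (λ x → f (+ x)) ≈ - c [ P ]
  poly-sum {c} {f} q = begin
    sum p (λ x → f (+ x)) ≡⟨ trans (sum-ext p λ x → evaluated q (+ x)) (trans (sum-swap p (suc 2m) (λ x k → d k * (+ x) ^ k)) (sum-ext (suc 2m) λ k → sum-*ˡ p (d k) (λ x → (+ x) ^ k))) ⟩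
    sum 2m (λ k → d k * powerSum k) + d 2m * powerSum 2m
      ≈⟨ +-cong-≈ (≈-trans (sum-cong-≈ 2m λ k k< → *-cong-≈ {d k} ≈-refl (powerSum-zero k k<)) (≡⇒≈ (sum-zero 2m λ k _ → ℤ.*-zeroʳ (d k)))) (*-cong-≈ (≡⇒≈ {N = P} (leadingTerm q)) powerSum-top) ⟩
    + 0 + c * - + 1 ≡⟨ lemma c ⟩
    - c ∎
    where
    open ≈-Reasoning P
    d = coefficients q
    lemma : ∀ c → + 0 + c * - + 1 ≡ - c
    lemma = solve-∀

  -- A polynomial of degree 2p - 1: summing its derivative over 𝔽_p only sees the top
  -- coefficient, since the coefficient of x^(p-1) in a derivative is divisible by p.
  poly-difference : ∀ {c f} → Polynomial (suc (2m ℕ.+ 2m)) c f → sum p (λ x → f (+ x + P) - f (+ x)) ≈ P * c [ PP ]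
  poly-difference {c} {f} q = begin
    sum p (λ x → f (+ x + P) - f (+ x))
      ≡⟨ sum-ext p (λ x → trans (cong₂ _-_ (evaluated q (+ x + P)) (evaluated q (+ x))) (trans (cong (_+_ (sum (suc n) (λ k → d k * (+ x + P) ^ k))) (sym (sum-neg (suc n) (λ k → d k * (+ x) ^ k)))) (sym (sum-+ (suc n) (λ k → d k * (+ x + P) ^ k) (λ k → - (d k * (+ x) ^ k)))))) ⟩
    sum p (λ x → sum (suc n) (λ k → d k * (+ x + P) ^ k + - (d k * (+ x) ^ k)))
      ≡⟨ trans (sum-swap p (suc n) (λ x k → d k * (+ x + P) ^ k + - (d k * (+ x) ^ k))) (sum-suc n (λ k → sum p (λ x → d k * (+ x + P) ^ k + - (d k * (+ x) ^ k)))) ⟩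
    sum p (λ x → d 0 * + 1 + - (d 0 * + 1)) + sum n (λ k → sum p (λ x → d (suc k) * (+ x + P) ^ suc k + - (d (suc k) * (+ x) ^ suc k)))
      ≈⟨ +-cong-≈ (≡⇒≈ {N = PP} (sum-zero p λ x _ → ℤ.+-inverseʳ (d 0 * + 1))) (sum-cong-≈ n λ k k< → monomial k (ℕ.≤-pred k<)) ⟩
    + 0 + sum n (λ k → P * - (d (suc k) * kronecker k (2m ℕ.+ 2m) * (+ suc k)))
      ≡⟨ cong (_+_ (+ 0)) (trans (sum-ext n λ k → lemma₁ P (d (suc k)) (kronecker k top) (+ suc k)) (sum-kronecker n top (λ k → P * - (d (suc k) * + suc k)) (ℕ.n<1+n top))) ⟩
    + 0 + P * - (d n * + n)
      ≈⟨ ≈-trans (≡⇒≈ (cong (λ x → + 0 + P * - (x * + n)) (leadingTerm q))) (by (- (+ 2 * c)) (lemma₂ c (+ 2m))) ⟩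
    P * c ∎
    where
    open ≈-Reasoning PP
    top = 2m ℕ.+ 2m
    n = suc top
    d = coefficients q
    lemma₁ : ∀ P d k s → P * - (d * k * s) ≡ P * - (d * s) * k
    lemma₁ = solve-∀
    lemma₂ : ∀ c x → + 0 + (+ 1 + x) * - (c * (+ 1 + (x + x))) ≡ (+ 1 + x) * c + - (+ 2 * c) * ((+ 1 + x) * (+ 1 + x))
    lemma₂ = solve-∀
    weighted : ∀ k → k ≤ top → + suc k * powerSum k ≈ - (kronecker k top * + suc k) [ P ]
    weighted k k≤ with ℕ.<-cmp k 2m
    ... | tri< k< _ _ = ≈-trans (*-cong-≈ {+ suc k} ≈-refl (powerSum-zero k k<)) (≡⇒≈ (trans (ℤ.*-zeroʳ (+ suc k)) (sym (cong (λ x → - (x * + suc k)) (kronecker-≢ (ℕ.<⇒≢ (ℕ.<-≤-trans k< (ℕ.m≤m+n 2m 2m))))))))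
    ... | tri≈ _ refl _ = by (powerSum k) (trans (lemma (+ suc k) (powerSum k)) (cong (λ x → - (x * + suc k) + powerSum k * + suc k) (sym (kronecker-≢ (ℕ.<⇒≢ (ℕ.m<m+n 2m (ℕ.<-≤-trans 0<m (ℕ.m≤m+n m m))))))))
      where
      lemma : ∀ P s → P * s ≡ - (+ 0 * P) + s * P
      lemma = solve-∀
    ... | tri> _ _ k> = go (k ∸ suc 2m) (trans (ℕ.+-suc 2m _) (ℕ.m+[n∸m]≡n k>))
      where
      go : ∀ j → 2m ℕ.+ suc j ≡ k → + suc k * powerSum k ≈ - (kronecker k top * + suc k) [ P ]
      go j refl with suc j ℕ.≟ 2m
      ... | yes eq = ≈-trans (*-cong-≈ {+ suc k} ≈-refl (≈-trans (powerSum-high j) (≈-trans (≡⇒≈ (cong powerSum eq)) powerSum-top))) (≡⇒≈ (trans (lemma (+ suc k)) (cong (λ x → - (x * + suc k)) (sym (trans (cong (λ t → kronecker (2m ℕ.+ t) top) eq) (kronecker-≡ top))))))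
        where
        lemma : ∀ k → k * - + 1 ≡ - (+ 1 * k)
        lemma = solve-∀
      ... | no j≢ = ≈-trans (*-cong-≈ {+ suc k} ≈-refl (≈-trans (powerSum-high j) (powerSum-zero (suc j) (ℕ.≤∧≢⇒< (ℕ.+-cancelˡ-≤ 2m (suc j) 2m k≤) j≢)))) (≡⇒≈ (trans (ℤ.*-zeroʳ (+ suc k)) (sym (cong (λ x → - (x * + suc k)) (kronecker-≢ (j≢ ∘ ℕ.+-cancelˡ-≡ 2m (suc j) 2m))))))
    monomial : ∀ k → k ≤ top → sum p (λ x → d (suc k) * (+ x + P) ^ suc k + - (d (suc k) * (+ x) ^ suc k)) ≈ P * - (d (suc k) * kronecker k top * + suc k) [ PP ]
    monomial k k≤ = begin
      sum p (λ x → d (suc k) * (+ x + P) ^ suc k + - (d (suc k) * (+ x) ^ suc k))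
        ≈⟨ sum-cong-≈ p (λ x _ → linear-≈ (d (suc k)) (power-perturb (+ x) P k) (lemma₃ (d (suc k)) ((+ x + P) ^ suc k) ((+ x) ^ suc k) (+ suc k) ((+ x) ^ k) P)) ⟩
      sum p (λ x → P * d (suc k) * + suc k * (+ x) ^ k) ≡⟨ trans (sum-*ˡ p (P * d (suc k) * + suc k) (λ x → (+ x) ^ k)) (lemma₄ P (d (suc k)) (+ suc k) (powerSum k)) ⟩
      P * (d (suc k) * (+ suc k * powerSum k)) ≈⟨ ≈-scale P (*-cong-≈ {d (suc k)} ≈-refl (weighted k k≤)) ⟩
      P * (d (suc k) * - (kronecker k top * + suc k)) ≡⟨ lemma₅ P (d (suc k)) (kronecker k top) (+ suc k) ⟩
      P * - (d (suc k) * kronecker k top * + suc k) ∎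
      where
      lemma₃ : ∀ d y x s t P → d * y + - (d * x) ≡ P * d * s * t + d * (y - (x + s * t * P))
      lemma₃ = solve-∀
      lemma₄ : ∀ P d s w → P * d * s * w ≡ P * (d * (s * w))
      lemma₄ = solve-∀
      lemma₅ : ∀ P d k s → P * (d * - (k * s)) ≡ P * - (d * k * s)
      lemma₅ = solve-∀

  rise-zero : ∀ x l n → 0 < l → l ≤ n → x + + l ≈ + 0 [ P ] → rise x n ≈ + 0 [ P ]
  rise-zero x l zero 0<l l≤n h = contradiction (ℕ.<-≤-trans 0<l l≤n) (ℕ.n≮n 0)
  rise-zero x l (suc n) 0<l l≤n h with l ℕ.≟ suc n
  ... | yes refl = ≈-trans (*-cong-≈ h (≈-refl {rise x n})) (≡⇒≈ (ℤ.*-zeroˡ (rise x n)))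
  ... | no l≢n = ≈-trans (*-cong-≈ {x + + suc n} ≈-refl (rise-zero x l n 0<l (ℕ.≤-pred (ℕ.≤∧≢⇒< l≤n l≢n)) h)) (≡⇒≈ (ℤ.*-zeroʳ (x + + suc n)))

  complement≈0 : ∀ a b → a ℕ.+ b ≡ p → + a + + b ≈ + 0 [ P ]
  complement≈0 a b eq = ≈-trans (≡⇒≈ (cong +_ eq)) P≈0

  -- `poly-sum` for `(x + 1) ... (x + 2m)`, which is monic of degree `p - 1` and vanishes at every
  -- residue except `0`.
  wilson : fact 2m ≈ - + 1 [ P ]
  wilson = begin
    fact 2m ≡⟨ sym (ℤ.+-identityʳ (fact 2m)) ⟩
    fact 2m + + 0 ≈⟨ +-cong-≈ (≈-refl {fact 2m}) (≈-sym (≈-trans (sum-cong-≈ 2m zeros) (≡⇒≈ (sum-0 2m)))) ⟩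
    fact 2m + sum 2m (λ k → rise (+ suc k) 2m) ≡⟨ sym (sum-suc 2m (λ k → rise (+ k) 2m)) ⟩
    sum p (λ k → rise (+ k) 2m) ≈⟨ poly-sum (poly-cong (ℕ.+-identityʳ 2m) refl (λ x → sym (ℤ.*-identityʳ (rise x 2m))) (poly-rise 2m (poly-const (+ 1)))) ⟩
    - + 1 ∎
    where
    open ≈-Reasoning P
    zeros : ∀ k → k < 2m → rise (+ suc k) 2m ≈ + 0 [ P ]
    zeros k k< = rise-zero (+ suc k) (2m ∸ k) 2m (ℕ.m<n⇒0<n∸m k<) (ℕ.m∸n≤m 2m k) (complement≈0 (suc k) (2m ∸ k) (cong suc (ℕ.m+[n∸m]≡n (ℕ.<⇒≤ k<))))

  -- Wilson's theorem and `(2m)! = m!² C(2m, m)` with `C(2m, m) ≈ (-1)^m` give `m!² ≈ - (-1)^m`.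
  fact⁴ : fact m ^ 4 ≈ + 1 [ P ]
  fact⁴ = ≈-trans (linear-≈ (- (f * f * (f * f))) (≡⇒≈ {N = P} (signPower² m)) (lemma₁ f s)) (linear-≈ (f * f * s - + 1) squared (lemma₂ f s))
    where
    f = fact m
    s = signPower m
    squared : f * f * s ≈ - + 1 [ P ]
    squared = ≈-trans (*-cong-≈ {f * f} ≈-refl (≈-sym (binom-sign m (ℕ.m≤m+n m m)))) (≈-trans (≡⇒≈ (sym (fact-binom m m))) wilson)
    lemma₁ : ∀ f s → f * (f * (f * (f * + 1))) ≡ f * f * (f * f) * (s * s) + - (f * f * (f * f)) * (s * s - + 1)
    lemma₁ = solve-∀
    lemma₂ : ∀ f s → f * f * (f * f) * (s * s) ≡ + 1 + (f * f * s - + 1) * (f * f * s - - + 1)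
    lemma₂ = solve-∀

  -- Up to the sign `(-1)^r`, `C(m + r, r)` is `C(- m - 1, r)`, and `- m - 1 ≈ m` modulo `P`.
  binom-reflect : ∀ r → r ≤ m → binom (m ℕ.+ r) r ≈ signPower r * binom m r [ P ]
  binom-reflect zero _ = ≡⇒≈ (trans (binom-0 (m ℕ.+ 0)) (sym (trans (ℤ.*-identityˡ (binom m 0)) (binom-0 m))))
  binom-reflect (suc r) r<m = cancel {_} {_} {+ suc r} (unit-small (suc r) (s≤s z≤n) (s≤s (ℕ.≤-trans r<m (ℕ.m≤m+n m m)))) (begin
    + suc r * binom (m ℕ.+ suc r) (suc r) ≡⟨ trans (cong (λ n → + suc r * binom n (suc r)) (ℕ.+-suc m r)) (binom-absorb (m ℕ.+ r) r) ⟩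
    + suc (m ℕ.+ r) * binom (m ℕ.+ r) r ≈⟨ *-cong-≈ {+ suc (m ℕ.+ r)} ≈-refl (binom-reflect r (ℕ.<⇒≤ r<m)) ⟩
    + suc (m ℕ.+ r) * (signPower r * binom m r) ≈⟨ by (signPower r * binom m r) (lemma₁ (+ m) (+ r) (signPower r * binom m r)) ⟩
    - ((+ m - + r) * (signPower r * binom m r)) ≡⟨ lemma₂ (+ m - + r) (signPower r) (binom m r) ⟩
    signPower (suc r) * ((+ m - + r) * binom m r) ≡⟨ trans (cong (_*_ (signPower (suc r))) (sym (binom-next m r))) (lemma₃ (signPower (suc r)) (+ suc r) (binom m (suc r))) ⟩
    + suc r * (signPower (suc r) * binom m (suc r)) ∎)
    where
    open ≈-Reasoning P
    lemma₁ : ∀ m r x → (+ 1 + (m + r)) * x ≡ - ((m - r) * x) + x * (+ 1 + (m + m))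
    lemma₁ = solve-∀
    lemma₂ : ∀ d s b → - (d * (s * b)) ≡ - + 1 * s * (d * b)
    lemma₂ = solve-∀
    lemma₃ : ∀ s r b → s * (r * b) ≡ r * (s * b)
    lemma₃ = solve-∀

  -- The logarithmic derivative of the product is a difference of harmonic numbers, as long as no
  -- factor is divisible by `p`.
  rise-perturb : ∀ r n → r ℕ.+ n < p → rise (+ r + P) n ≈ rise (+ r) n * (+ 1 + P * (H (r ℕ.+ n) - H r)) [ PP ]
  rise-perturb r zero r< = ≡⇒≈ (sym (trans (cong (λ k → + 1 * (+ 1 + P * (H k - H r))) (ℕ.+-identityʳ r)) (lemma P (H r))))
    where
    lemma : ∀ P x → + 1 * (+ 1 + P * (x - x)) ≡ + 1
    lemma = solve-∀
  rise-perturb r (suc n) r< = linear-≈₃ (+ r + P + + suc n) (- (P * rise (+ r) n)) (rise (+ r) n * Δ) (rise-perturb r n (ℕ.<-trans (ℕ.n<1+n (r ℕ.+ n)) s<)) (inv-right (unit-small (suc (r ℕ.+ n)) (s≤s z≤n) s<)) PP≈0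
      (trans (lemma (+ r) (+ n) P (rise (+ r + P) n) (rise (+ r) n) (H (r ℕ.+ n)) (H r) (inv (+ suc (r ℕ.+ n)))) (cong (λ k → (+ r + + suc n) * rise (+ r) n * (+ 1 + P * (H k - H r)) + (+ r + P + + suc n) * (rise (+ r + P) n - rise (+ r) n * (+ 1 + P * Δ)) + - (P * rise (+ r) n) * (+ suc (r ℕ.+ n) * inv (+ suc (r ℕ.+ n)) - + 1) + rise (+ r) n * Δ * (PP - + 0)) (sym (ℕ.+-suc r n))))
    where
    Δ = H (r ℕ.+ n) - H r
    s< : suc (r ℕ.+ n) < p
    s< = subst (_< p) (ℕ.+-suc r n) r<
    lemma : ∀ r n P R′ R A B i → (r + P + (+ 1 + n)) * R′ ≡ (r + (+ 1 + n)) * R * (+ 1 + P * (A + i - B)) + (r + P + (+ 1 + n)) * (R′ - R * (+ 1 + P * (A - B))) + - (P * R) * ((+ 1 + (r + n)) * i - + 1) + R * (A - B) * (P * P - + 0)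
    lemma = solve-∀

  -- `G (x + P) - G x` is summed over the residues in two ways; `G` has degree `4m + 1 = 2p - 1`, so
  -- `poly-difference` gives `4P`. For `m < x < p` the product `Q` is divisible by `P` at both
  -- arguments and its fourth power drops out. For `r ≤ m`, `Q r` is `m! C(m + r, r)`, whose fourth
  -- power is `C(m, r)^4` modulo `P`, and its logarithmic derivative is
  -- `H (m + r) - H r ≈ H (m - r) - H r`.
  harmonic-identity : sum (suc m) (λ r → binom m r ^ 4 * (+ 1 + (+ 4 * + r + + 1) * (H (m ∸ r) - H r))) ≈ + 1 [ P ]
  harmonic-identity = begin
    sum (suc m) (λ r → binom m r ^ 4 * (+ 1 + (+ 4 * + r + + 1) * (H (m ∸ r) - H r))) ≈⟨ sum-cong-≈ (suc m) (λ r r< → term r (ℕ.≤-pred r<)) ⟩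
    sum (suc m) T ≈⟨ cancel {_} {_} {+ 4} 4-unit (divide-P total) ⟩
    + 1 ∎
    where
    open ≈-Reasoning P
    module R = ≈-Reasoning PP
    4-unit : Unit (+ 4)
    4-unit = Unit-* 2-unit 2-unit
    Δ : ℕ → ℤ
    Δ r = H (r ℕ.+ m) - H r
    Q G : ℤ → ℤ
    Q x = rise x m
    G x = (+ 4 * x + + 1) * Q x ^ 4
    T : ℕ → ℤ
    T r = Q (+ r) ^ 4 * (+ 1 + (+ 4 * + r + + 1) * Δ r)
    G-polynomial : Polynomial (suc (2m ℕ.+ 2m)) (+ 4) G
    G-polynomial = poly-cong (cong suc (shuffle m)) refl (λ x → refl) (poly-linear (+ 4) (+ 1) (poly-rise m (poly-rise m (poly-rise m (poly-rise m (poly-const (+ 1)))))))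
      where
      shuffle : ∀ m → m ℕ.+ (m ℕ.+ (m ℕ.+ (m ℕ.+ 0))) ≡ m ℕ.+ m ℕ.+ (m ℕ.+ m)
      shuffle = ℕ-Solver.solve-∀
    term : ∀ r → r ≤ m → binom m r ^ 4 * (+ 1 + (+ 4 * + r + + 1) * (H (m ∸ r) - H r)) ≈ T r [ P ]
    term r r≤m = *-cong-≈ (≈-sym power) (+-cong-≈ (≈-refl {+ 1}) (*-cong-≈ {+ 4 * + r + + 1} ≈-refl (+-cong-≈ (≈-sym (≈-trans (≡⇒≈ (cong H (ℕ.+-comm r m))) (H-reflect (m ∸ r) r (ℕ.m∸n+n≡m r≤m)))) (≈-refl { - H r}))))
      where
      s = signPower r
      power : Q (+ r) ^ 4 ≈ binom m r ^ 4 [ P ]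
      power = begin
        Q (+ r) ^ 4 ≈⟨ ^-cong-≈ 4 (≈-trans (≡⇒≈ (trans (rise-binom r m) (cong (fact m *_) (trans (binom-sym (ℕ.m≤m+n m r)) (cong (binom (m ℕ.+ r)) (ℕ.m+n∸m≡n m r)))))) (*-cong-≈ {fact m} ≈-refl (binom-reflect r r≤m))) ⟩
        (fact m * (s * binom m r)) ^ 4 ≡⟨ lemma₁ (fact m) s (binom m r) ⟩
        fact m ^ 4 * (s * s * (s * s) * binom m r ^ 4) ≈⟨ *-cong-≈ fact⁴ (≡⇒≈ {N = P} (cong (λ x → x * x * binom m r ^ 4) (signPower² r))) ⟩
        + 1 * (+ 1 * + 1 * binom m r ^ 4) ≡⟨ lemma₂ (binom m r ^ 4) ⟩
        binom m r ^ 4 ∎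
        where
        lemma₁ : ∀ f s b → f * (s * b) * (f * (s * b) * (f * (s * b) * (f * (s * b) * + 1))) ≡ f * (f * (f * (f * + 1))) * (s * s * (s * s) * (b * (b * (b * (b * + 1)))))
        lemma₁ = solve-∀
        lemma₂ : ∀ x → + 1 * (+ 1 * + 1 * x) ≡ x
        lemma₂ = solve-∀
    fourth : ∀ {x} → x ≈ + 0 [ P ] → x ^ 4 ≈ + 0 [ PP ]
    fourth {x} (by q refl) = by (q * q * q * q * (P * P)) (lemma q P)
      where
      lemma : ∀ q P → (+ 0 + q * P) * ((+ 0 + q * P) * ((+ 0 + q * P) * ((+ 0 + q * P) * + 1))) ≡ + 0 + q * q * q * q * (P * P) * (P * P)
      lemma = solve-∀
    low : ∀ r → r ≤ m → G (+ r + P) - G (+ r) ≈ P * (+ 4 * T r) [ PP ]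
    low r r≤m = ≈-trans (linear-≈ (+ 4 * (+ r + P) + + 1) (≈-trans (^-cong-≈ 4 (rise-perturb r m (s≤s (ℕ.+-monoˡ-≤ m r≤m)))) (power-perturb′ (Q (+ r)) (Δ r))) (lemma₁ (+ r) P (Q (+ r + P) ^ 4) (Q (+ r)) (Δ r))) (by (+ 16 * Q (+ r) ^ 4 * Δ r) (lemma₂ (+ r) P (Q (+ r)) (Δ r)))
      where
      power-perturb′ : ∀ q d → (q * (+ 1 + P * d)) ^ 4 ≈ q ^ 4 * (+ 1 + + 4 * P * d) [ PP ]
      power-perturb′ q d = by (q ^ 4 * (d * d) * (+ 6 + + 4 * P * d + P * P * (d * d))) (lemma q P d)
        where
        lemma : ∀ q P d → q * (+ 1 + P * d) * (q * (+ 1 + P * d) * (q * (+ 1 + P * d) * (q * (+ 1 + P * d) * + 1))) ≡ q * (q * (q * (q * + 1))) * (+ 1 + + 4 * P * d) + q * (q * (q * (q * + 1))) * (d * d) * (+ 6 + + 4 * P * d + P * P * (d * d)) * (P * P)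
        lemma = solve-∀
      lemma₁ : ∀ r P x q d → (+ 4 * (r + P) + + 1) * x - (+ 4 * r + + 1) * (q * (q * (q * (q * + 1)))) ≡ (+ 4 * (r + P) + + 1) * (q * (q * (q * (q * + 1))) * (+ 1 + + 4 * P * d)) - (+ 4 * r + + 1) * (q * (q * (q * (q * + 1)))) + (+ 4 * (r + P) + + 1) * (x - q * (q * (q * (q * + 1))) * (+ 1 + + 4 * P * d))
      lemma₁ = solve-∀
      lemma₂ : ∀ r P q d → (+ 4 * (r + P) + + 1) * (q * (q * (q * (q * + 1))) * (+ 1 + + 4 * P * d)) - (+ 4 * r + + 1) * (q * (q * (q * (q * + 1)))) ≡ P * (+ 4 * (q * (q * (q * (q * + 1))) * (+ 1 + (+ 4 * r + + 1) * d))) + + 16 * (q * (q * (q * (q * + 1)))) * d * (P * P)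
      lemma₂ = solve-∀
    high : ∀ i → i < m → G (+ (suc m ℕ.+ i) + P) - G (+ (suc m ℕ.+ i)) ≈ + 0 [ PP ]
    high i i<m = linear-≈₂ (+ 4 * (x + P) + + 1) (- (+ 4 * x + + 1)) (fourth (rise-zero (x + P) (m ∸ i) m l>0 l≤m (≈-trans (≡⇒≈ (lemma₂ x P (+ (m ∸ i)))) (+-cong-≈ root P≈0)))) (fourth (rise-zero x (m ∸ i) m l>0 l≤m root)) (lemma₁ (+ 4 * (x + P) + + 1) (Q (x + P) ^ 4) (+ 4 * x + + 1) (Q x ^ 4))
      where
      x = + (suc m ℕ.+ i)
      l>0 : 0 < m ∸ i
      l>0 = ℕ.m<n⇒0<n∸m i<m
      l≤m : m ∸ i ≤ m
      l≤m = ℕ.m∸n≤m m i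
      root : x + + (m ∸ i) ≈ + 0 [ P ]
      root = complement≈0 (suc m ℕ.+ i) (m ∸ i) (trans (ℕ.+-assoc (suc m) i (m ∸ i)) (cong (suc m ℕ.+_) (ℕ.m+[n∸m]≡n (ℕ.<⇒≤ i<m))))
      lemma₁ : ∀ a y b z → a * y - b * z ≡ + 0 + a * (y - + 0) + - b * (z - + 0)
      lemma₁ = solve-∀
      lemma₂ : ∀ x P l → x + P + l ≡ x + l + P
      lemma₂ = solve-∀
    total : P * (+ 4 * sum (suc m) T) ≈ P * (+ 4 * + 1) [ PP ]
    total = R.begin
      P * (+ 4 * sum (suc m) T) R.≡⟨ trans (cong (_*_ P) (sym (sum-*ˡ (suc m) (+ 4) T))) (sym (sum-*ˡ (suc m) P (λ r → + 4 * T r))) ⟩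
      sum (suc m) (λ r → P * (+ 4 * T r)) R.≡⟨ sym (ℤ.+-identityʳ _) ⟩
      sum (suc m) (λ r → P * (+ 4 * T r)) + + 0 R.≈⟨ +-cong-≈ (≈-sym (sum-cong-≈ (suc m) λ r r< → low r (ℕ.≤-pred r<))) (≈-sym (≈-trans (sum-cong-≈ m high) (≡⇒≈ (sum-0 m)))) ⟩
      sum (suc m) (λ r → G (+ r + P) - G (+ r)) + sum m (λ i → G (+ (suc m ℕ.+ i) + P) - G (+ (suc m ℕ.+ i))) R.≡⟨ sym (sum-++ (suc m) m (λ r → G (+ r + P) - G (+ r))) ⟩
      sum p (λ r → G (+ r + P) - G (+ r)) R.≈⟨ poly-difference G-polynomial ⟩
      P * + 4 R.∎

-- Products of central binomial coefficients modulo p²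

module BinomialSums (m : ℕ) (pr : Prime (suc (m ℕ.+ m))) where
  open PrimeField m pr using (2m; P; PP; PP≈0; Unit; Unit-*; unit-small; inv; inv-right; 1-unit)
  open CharacterSums m pr using (signPower; signPower²)
  open PrimeSquare m pr using (cancel-P)
  open HarmonicSums m pr using (H)
  open SumOfSquares m pr using (E)
  open HarmonicIdentity m pr using (H-reflect; harmonic-identity)

  H-mirror : ∀ a b → a ℕ.+ b ≡ 2m → H a ≈ H b [ P ]
  H-mirror a b eq with ℕ.≤-total a m
  ... | inj₁ a≤m = ≈-sym (≈-trans (≡⇒≈ (cong H (ℕ.+-cancelˡ-≡ a b (m ℕ.+ (m ∸ a)) (trans eq (sym split))))) (H-reflect a (m ∸ a) (ℕ.m+[n∸m]≡n a≤m)))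
    where
    split : a ℕ.+ (m ℕ.+ (m ∸ a)) ≡ 2m
    split = trans (shuffle a m (m ∸ a)) (cong (m ℕ.+_) (ℕ.m+[n∸m]≡n a≤m))
      where
      shuffle : ∀ a m d → a ℕ.+ (m ℕ.+ d) ≡ m ℕ.+ (a ℕ.+ d)
      shuffle = ℕ-Solver.solve-∀
  ... | inj₂ m≤a = ≈-trans (≡⇒≈ (cong H (sym (ℕ.m+[n∸m]≡n m≤a)))) (H-reflect b (a ∸ m) (ℕ.+-cancelˡ-≡ m (b ℕ.+ (a ∸ m)) m (trans (shuffle m b (a ∸ m)) (trans (cong (ℕ._+ b) (ℕ.m+[n∸m]≡n m≤a)) eq))))
    where
    shuffle : ∀ m b d → m ℕ.+ (b ℕ.+ d) ≡ m ℕ.+ d ℕ.+ b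
    shuffle = ℕ-Solver.solve-∀

  binom-[p-1] : ∀ k → k ≤ 2m → binom 2m k ≈ signPower k * (+ 1 - P * H k) [ PP ]
  binom-[p-1] zero _ = ≡⇒≈ (trans (binom-0 2m) (sym (lemma P)))
    where
    lemma : ∀ P → + 1 * (+ 1 - P * + 0) ≡ + 1
    lemma = solve-∀
  binom-[p-1] (suc k) k< = cancel-P {_} {_} {+ suc k} unit (≈-trans (≡⇒≈ (binom-next 2m k)) (linear-≈₃ (+ 2m - + k) (- (s * P)) (- (s * H k)) (binom-[p-1] k (ℕ.<⇒≤ k<)) (inv-right unit) PP≈0
      (lemma (+ 2m) (+ k) (binom 2m k) s (H k) (inv (+ suc k)))))
    where
    s = signPower k
    unit : Unit (+ suc k)
    unit = unit-small (suc k) (s≤s z≤n) (s≤s k<)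
    lemma : ∀ n k b s h i → (n - k) * b ≡ (+ 1 + k) * (- + 1 * s * (+ 1 - (+ 1 + n) * (h + i))) + (n - k) * (b - s * (+ 1 - (+ 1 + n) * h)) + - (s * (+ 1 + n)) * ((+ 1 + k) * i - + 1) + - (s * h) * ((+ 1 + n) * (+ 1 + n) - + 0)
    lemma = solve-∀

  fact-unit : ∀ n → n ≤ 2m → Unit (fact n)
  fact-unit zero _ = 1-unit
  fact-unit (suc n) n< = Unit-* (unit-small (suc n) (s≤s z≤n) (s≤s n<)) (fact-unit n (ℕ.<⇒≤ n<))

  -- Both sides are `(2m)! / (i! j!)²`.
  central-product : ∀ i j → i ℕ.+ j ≡ m → centralBinom i * centralBinom j * binom 2m (i ℕ.+ i) ≈ binom 2m m * (binom m i * binom m i) [ PP ]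
  central-product i j eq = cancel-P {_} {_} {x * x} (Unit-* units units) (≡⇒≈ (begin
    x * x * (centralBinom i * centralBinom j * binom 2m (i ℕ.+ i)) ≡⟨ lemma₁ (fact i) (fact j) (centralBinom i) (centralBinom j) (binom 2m (i ℕ.+ i)) ⟩
    fact j * fact j * centralBinom j * (fact i * fact i * centralBinom i) * binom 2m (i ℕ.+ i)
      ≡⟨ cong₂ (λ a b → a * b * binom 2m (i ℕ.+ i)) (sym (fact-binom j j)) (sym (fact-binom i i)) ⟩
    fact (j ℕ.+ j) * fact (i ℕ.+ i) * binom 2m (i ℕ.+ i) ≡⟨ cong (λ n → fact (j ℕ.+ j) * fact (i ℕ.+ i) * binom n (i ℕ.+ i)) (sym total) ⟩
    fact (j ℕ.+ j) * fact (i ℕ.+ i) * binom (i ℕ.+ i ℕ.+ (j ℕ.+ j)) (i ℕ.+ i) ≡⟨ sym (fact-binom (j ℕ.+ j) (i ℕ.+ i)) ⟩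
    fact (j ℕ.+ j ℕ.+ (i ℕ.+ i)) ≡⟨ trans (cong fact (trans (ℕ.+-comm (j ℕ.+ j) (i ℕ.+ i)) total)) (fact-binom m m) ⟩
    fact m * fact m * binom 2m m ≡⟨ cong (λ f → f * f * binom 2m m) (trans (cong fact (trans (sym eq) (ℕ.+-comm i j))) (trans (fact-binom j i) (cong (λ n → fact j * fact i * binom n i) eq))) ⟩
    fact j * fact i * binom m i * (fact j * fact i * binom m i) * binom 2m m ≡⟨ lemma₂ (fact i) (fact j) (binom m i) (binom 2m m) ⟩
    x * x * (binom 2m m * (binom m i * binom m i)) ∎))
    where
    open ≡-Reasoning
    x = fact i * fact j
    i≤ : i ≤ 2m
    i≤ = ℕ.≤-trans (subst (i ≤_) eq (ℕ.m≤m+n i j)) (ℕ.m≤m+n m m)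
    j≤ : j ≤ 2m
    j≤ = ℕ.≤-trans (subst (j ≤_) eq (ℕ.m≤n+m j i)) (ℕ.m≤m+n m m)
    units : Unit x
    units = Unit-* (fact-unit i i≤) (fact-unit j j≤)
    total : i ℕ.+ i ℕ.+ (j ℕ.+ j) ≡ 2m
    total = trans (double-+ i j) (cong₂ ℕ._+_ eq eq)
    lemma₁ : ∀ i j a b c → i * j * (i * j) * (a * b * c) ≡ j * j * b * (i * i * a) * c
    lemma₁ = solve-∀
    lemma₂ : ∀ i j c b → j * i * c * (j * i * c) * b ≡ i * j * (i * j) * (b * (c * c))
    lemma₂ = solve-∀

  -- Squaring `central-product` and expanding the entries of row `p - 1` by `binom-[p-1]` gives
  -- `C(m, i)^4` with the factor `1 - 2P (H m - H (2i))`. As `H (2i) ≈ H (2j)`, the factor on the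
  -- left carries this on from `H (2i)` to `H j`.
  g₀-product : ∀ i j → i ℕ.+ j ≡ m → g₀ i * g₀ j * (+ 1 - + 2 * P * (H (j ℕ.+ j) - H j)) ≈ binom m i ^ 4 * (+ 1 - + 2 * P * (H m - H j)) [ PP ]
  g₀-product i j eq = begin
    g₀ i * g₀ j * (+ 1 - + 2 * P * (H (j ℕ.+ j) - H j)) ≈⟨ *-cong-≈ squared (≈-trans (≡⇒≈ (lemma₁ P (H (j ℕ.+ j)) (H j))) (≈-trans (+-cong-≈ (≈-refl {+ 1}) (-‿cong-≈ (≈-scale P (*-cong-≈ {+ 2} ≈-refl (+-cong-≈ (≈-sym (H-mirror (i ℕ.+ i) (j ℕ.+ j) total)) (≈-refl { - H j})))))) (≡⇒≈ (sym (lemma₁ P (H (i ℕ.+ i)) (H j)))))) ⟩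
    binom m i ^ 4 * (+ 1 - + 2 * P * (H m - H (i ℕ.+ i))) * (+ 1 - + 2 * P * (H (i ℕ.+ i) - H j))
      ≈⟨ by (binom m i ^ 4 * (+ 4 * (H m - H (i ℕ.+ i)) * (H (i ℕ.+ i) - H j))) (lemma₂ (binom m i ^ 4) P (H m) (H (i ℕ.+ i)) (H j)) ⟩
    binom m i ^ 4 * (+ 1 - + 2 * P * (H m - H j)) ∎
    where
    open ≈-Reasoning PP
    lemma₁ : ∀ P x y → + 1 - + 2 * P * (x - y) ≡ + 1 - P * (+ 2 * (x - y))
    lemma₁ = solve-∀
    lemma₂ : ∀ c P x y z → c * (+ 1 - + 2 * P * (x - y)) * (+ 1 - + 2 * P * (y - z)) ≡ c * (+ 1 - + 2 * P * (x - z)) + c * (+ 4 * (x - y) * (y - z)) * (P * P)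
    lemma₂ = solve-∀
    total : i ℕ.+ i ℕ.+ (j ℕ.+ j) ≡ 2m
    total = trans (double-+ i j) (cong₂ ℕ._+_ eq eq)
    2i≤ : i ℕ.+ i ≤ 2m
    2i≤ = subst (i ℕ.+ i ≤_) total (ℕ.m≤m+n (i ℕ.+ i) (j ℕ.+ j))
    x = centralBinom i * centralBinom j
    c = binom m i
    s = signPower (i ℕ.+ i)
    t = signPower m
    y = H (i ℕ.+ i)
    z = H m
    root : x * (s * (+ 1 - P * y)) ≈ t * (+ 1 - P * z) * (c * c) [ PP ]
    root = ≈-trans (*-cong-≈ {x} ≈-refl (≈-sym (binom-[p-1] (i ℕ.+ i) 2i≤))) (≈-trans (central-product i j eq) (*-cong-≈ (binom-[p-1] m (ℕ.m≤m+n m m)) (≈-refl {c * c})))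
    squared : g₀ i * g₀ j ≈ c ^ 4 * (+ 1 - + 2 * P * (H m - H (i ℕ.+ i))) [ PP ]
    squared = begin
      g₀ i * g₀ j ≡⟨ lemma₃ (centralBinom i) (centralBinom j) ⟩
      x * x * (+ 1 * + 1) ≡⟨ cong (λ u → x * x * (u * + 1)) (sym (signPower² (i ℕ.+ i))) ⟩
      x * x * (s * s * + 1) ≈⟨ ≈-sym (by (x * x * (s * s) * (- + 3 * (y * y) + + 2 * P * (y * y * y))) (lemma₄ x s P y)) ⟩
      x * (s * (+ 1 - P * y)) * (x * (s * (+ 1 - P * y))) * (+ 1 + + 2 * P * y) ≈⟨ *-cong-≈ (*-cong-≈ root root) (≈-refl {+ 1 + + 2 * P * y}) ⟩
      t * (+ 1 - P * z) * (c * c) * (t * (+ 1 - P * z) * (c * c)) * (+ 1 + + 2 * P * y)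
        ≡⟨ trans (lemma₅ t P z c y) (cong (λ u → u * (c ^ 4 * ((+ 1 - P * z) * (+ 1 - P * z) * (+ 1 + + 2 * P * y)))) (signPower² m)) ⟩
      + 1 * (c ^ 4 * ((+ 1 - P * z) * (+ 1 - P * z) * (+ 1 + + 2 * P * y))) ≈⟨ by (c ^ 4 * (z * z * (+ 1 + + 2 * P * y) - + 4 * z * y)) (lemma₆ (c ^ 4) P z y) ⟩
      c ^ 4 * (+ 1 - + 2 * P * (z - y)) ∎
      where
      lemma₃ : ∀ a b → a * a * (b * b) ≡ a * b * (a * b) * (+ 1 * + 1)
      lemma₃ = solve-∀
      lemma₄ : ∀ x s P y → x * (s * (+ 1 - P * y)) * (x * (s * (+ 1 - P * y))) * (+ 1 + + 2 * P * y) ≡ x * x * (s * s * + 1) + x * x * (s * s) * (- + 3 * (y * y) + + 2 * P * (y * y * y)) * (P * P)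
      lemma₄ = solve-∀
      lemma₅ : ∀ t P z c y → t * (+ 1 - P * z) * (c * c) * (t * (+ 1 - P * z) * (c * c)) * (+ 1 + + 2 * P * y) ≡ t * t * (c * (c * (c * (c * + 1))) * ((+ 1 - P * z) * (+ 1 - P * z) * (+ 1 + + 2 * P * y)))
      lemma₅ = solve-∀
      lemma₆ : ∀ c P z y → + 1 * (c * ((+ 1 - P * z) * (+ 1 - P * z) * (+ 1 + + 2 * P * y))) ≡ c * (+ 1 - + 2 * P * (z - y)) + c * (z * z * (+ 1 + + 2 * P * y) - + 4 * z * y) * (P * P)
      lemma₆ = solve-∀

  -- Since `4m ≈ -2`, the bracket is `1 + 4i (H (m - i) - H i)` modulo `P`. It differs from that of
  -- `harmonic-identity` by `H i - H (m - i)`, which changes sign under `i ↦ m - i` and cancels in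
  -- the sum.
  balanced : sum (suc m) (λ i → binom m i ^ 4 * (+ 1 + + 4 * E i (m ∸ i) + + 2 * (H m - H (m ∸ i)))) ≈ + 1 [ P ]
  balanced = begin
    sum (suc m) (λ i → binom m i ^ 4 * (+ 1 + + 4 * E i (m ∸ i) + + 2 * (H m - H (m ∸ i))))
      ≈⟨ sum-cong-≈ (suc m) (λ i i< → term i (ℕ.≤-pred i<)) ⟩
    sum (suc m) (λ i → binom m i ^ 4 * (+ 1 + (+ 4 * + i + + 1) * (H (m ∸ i) - H i)) + (V i + - W i))
      ≡⟨ trans (sum-+ (suc m) (λ i → binom m i ^ 4 * (+ 1 + (+ 4 * + i + + 1) * (H (m ∸ i) - H i))) (λ i → V i + - W i)) (cong (_+_ (sum (suc m) (λ i → binom m i ^ 4 * (+ 1 + (+ 4 * + i + + 1) * (H (m ∸ i) - H i))))) antisymmetric) ⟩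
    sum (suc m) (λ i → binom m i ^ 4 * (+ 1 + (+ 4 * + i + + 1) * (H (m ∸ i) - H i))) + + 0
      ≈⟨ +-cong-≈ harmonic-identity (≈-refl {+ 0}) ⟩
    + 1 ∎
    where
    open ≈-Reasoning P
    V W : ℕ → ℤ
    V i = binom m i ^ 4 * (H m - H (m ∸ i))
    W i = binom m i ^ 4 * (H m - H i)
    antisymmetric : sum (suc m) (λ i → V i + - W i) ≡ + 0
    antisymmetric = trans (sum-+ (suc m) V (λ i → - W i)) (trans (cong₂ _+_ reversed (sum-neg (suc m) W)) (ℤ.+-inverseʳ (sum (suc m) W)))
      where
      reversed : sum (suc m) V ≡ sum (suc m) W
      reversed = trans (sum-cong (suc m) λ i i< → cong (λ b → b ^ 4 * (H m - H (m ∸ i))) (binom-sym (ℕ.≤-pred i<))) (sym (sum-rev m W))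
    term : ∀ i → i ≤ m → binom m i ^ 4 * (+ 1 + + 4 * E i (m ∸ i) + + 2 * (H m - H (m ∸ i))) ≈ binom m i ^ 4 * (+ 1 + (+ 4 * + i + + 1) * (H (m ∸ i) - H i)) + (V i + - W i) [ P ]
    term i i≤m = ≈-trans (≡⇒≈ (cong (λ j → binom m i ^ 4 * (+ 1 + + 4 * (j * (H m - H (m ∸ i)) + + i * (H m - H i)) + + 2 * (H m - H (m ∸ i)))) (pos-∸ i≤m)))
      (by (+ 2 * (binom m i ^ 4 * (H m - H (m ∸ i)))) (lemma (binom m i ^ 4) (+ m) (+ i) (H m) (H (m ∸ i)) (H i)))
      where
      lemma : ∀ c m i x y z → c * (+ 1 + + 4 * ((m - i) * (x - y) + i * (x - z)) + + 2 * (x - y)) ≡ c * (+ 1 + (+ 4 * i + + 1) * (y - z)) + (c * (x - y) + - (c * (x - z))) + + 2 * (c * (x - y)) * (+ 1 + (m + m))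
      lemma = solve-∀

-- Both sides lie in an interval of length less than 8p².
rigidity : ∀ p Z c k l → 0 < p → let P = + p in + 0 ℤ.≤ Z → + 0 ℤ.≤ + 2 * (P * P - + 2 * P - + 1) - Z → c ≡ + k - + l → k ℕ.+ l ≡ p ℕ.* suc p →
           Z ≈ P * P - + 3 * P - + 1 - c [ + 8 * (P * P) ] → Z ≡ P * P - + 3 * P - + 1 - c
rigidity p Z c k l 0<p Z≥0 Z≤ refl k+l cong-Z = trans (lemma₁ Z (+ k) P) (trans (cong (_- (+ k + + 3 * P + + 1)) (trans (sym +A) (trans (cong +_ A≡B) +B))) (lemma₂ (+ k) (+ l) P))
  where
  P = + p
  z A B : ℕ
  z = ∣ Z ∣
  -- Adding `k + 3p + 1` to both sides makes them natural numbers: `Z` becomes `A` and the target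
  -- `p² + l = B`.
  A = z ℕ.+ (k ℕ.+ 3 ℕ.* p ℕ.+ 1)
  B = p ℕ.* p ℕ.+ l
  z≡ : + z ≡ Z
  z≡ = ℤ.0≤i⇒+∣i∣≡i Z≥0
  lemma₁ : ∀ z k P → z ≡ z + (k + + 3 * P + + 1) - (k + + 3 * P + + 1)
  lemma₁ = solve-∀
  lemma₂ : ∀ k l P → P * P + l - (k + + 3 * P + + 1) ≡ P * P - + 3 * P - + 1 - (k - l)
  lemma₂ = solve-∀
  lemma₃ : ∀ k l P → P * P - + 3 * P - + 1 - (k - l) + (k + + 3 * P + + 1) ≡ P * P + l
  lemma₃ = solve-∀
  lemma₄ : ∀ z P → z + (+ 4 * P + + 2) + (+ 2 * (P * P - + 2 * P - + 1) - z) ≡ + 2 * (P * P)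
  lemma₄ = solve-∀
  +A : + A ≡ Z + (+ k + + 3 * P + + 1)
  +A = cong₂ (λ x y → x + (+ k + y + + 1)) z≡ (ℤ.pos-* 3 p)
  +B : + B ≡ P * P + + l
  +B = cong (_+ + l) (ℤ.pos-* p p)
  gap : ℕ
  gap = ∣ + 2 * (P * P - + 2 * P - + 1) - Z ∣
  upper : z ℕ.+ (4 ℕ.* p ℕ.+ 2) ≤ 2 ℕ.* (p ℕ.* p)
  upper = subst (z ℕ.+ (4 ℕ.* p ℕ.+ 2) ≤_) (ℤ.+-injective (trans (cong₂ _+_ (cong₂ (λ x y → x + (y + + 2)) z≡ (ℤ.pos-* 4 p)) (ℤ.0≤i⇒+∣i∣≡i Z≤)) (trans (lemma₄ Z P) (sym (trans (ℤ.pos-* 2 (p ℕ.* p)) (cong (_*_ (+ 2)) (ℤ.pos-* p p))))))) (ℕ.m≤m+n (z ℕ.+ (4 ℕ.* p ℕ.+ 2)) gap)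
  A< : A < 8 ℕ.* (p ℕ.* p)
  A< = begin
    suc (z ℕ.+ (k ℕ.+ 3 ℕ.* p ℕ.+ 1)) ≤⟨ s≤s (ℕ.+-monoʳ-≤ z (ℕ.+-monoˡ-≤ 1 (ℕ.+-monoˡ-≤ (3 ℕ.* p) (ℕ.≤-trans (ℕ.m≤m+n k l) (ℕ.≤-reflexive k+l))))) ⟩
    suc (z ℕ.+ (p ℕ.* suc p ℕ.+ 3 ℕ.* p ℕ.+ 1)) ≡⟨ lemma z p ⟩
    z ℕ.+ (4 ℕ.* p ℕ.+ 2) ℕ.+ p ℕ.* p ≤⟨ ℕ.+-monoˡ-≤ (p ℕ.* p) upper ⟩
    2 ℕ.* (p ℕ.* p) ℕ.+ p ℕ.* p ≤⟨ ℕ.m≤m+n (2 ℕ.* (p ℕ.* p) ℕ.+ p ℕ.* p) (5 ℕ.* (p ℕ.* p)) ⟩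
    2 ℕ.* (p ℕ.* p) ℕ.+ p ℕ.* p ℕ.+ 5 ℕ.* (p ℕ.* p) ≡⟨ lemma′ (p ℕ.* p) ⟩
    8 ℕ.* (p ℕ.* p) ∎
    where
    open ℕ.≤-Reasoning
    lemma : ∀ z p → suc (z ℕ.+ (p ℕ.* suc p ℕ.+ 3 ℕ.* p ℕ.+ 1)) ≡ z ℕ.+ (4 ℕ.* p ℕ.+ 2) ℕ.+ p ℕ.* p
    lemma = ℕ-Solver.solve-∀
    lemma′ : ∀ q → 2 ℕ.* q ℕ.+ q ℕ.+ 5 ℕ.* q ≡ 8 ℕ.* q
    lemma′ = ℕ-Solver.solve-∀
  B< : B < 8 ℕ.* (p ℕ.* p)
  B< = begin
    suc (p ℕ.* p ℕ.+ l) ≤⟨ s≤s (ℕ.+-monoʳ-≤ (p ℕ.* p) (ℕ.≤-trans (ℕ.m≤n+m l k) (ℕ.≤-reflexive (trans k+l (ℕ.*-suc p p))))) ⟩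
    suc (p ℕ.* p ℕ.+ (p ℕ.+ p ℕ.* p)) ≤⟨ ℕ.+-mono-≤ (ℕ.*-mono-≤ 0<p 0<p) (ℕ.+-monoʳ-≤ (p ℕ.* p) (ℕ.+-monoˡ-≤ (p ℕ.* p) (ℕ.m≤m*n p p {{ℕ.>-nonZero 0<p}}))) ⟩
    p ℕ.* p ℕ.+ (p ℕ.* p ℕ.+ (p ℕ.* p ℕ.+ p ℕ.* p)) ≤⟨ ℕ.m≤m+n _ (4 ℕ.* (p ℕ.* p)) ⟩
    p ℕ.* p ℕ.+ (p ℕ.* p ℕ.+ (p ℕ.* p ℕ.+ p ℕ.* p)) ℕ.+ 4 ℕ.* (p ℕ.* p) ≡⟨ lemma (p ℕ.* p) ⟩
    8 ℕ.* (p ℕ.* p) ∎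
    where
    open ℕ.≤-Reasoning
    lemma : ∀ q → q ℕ.+ (q ℕ.+ (q ℕ.+ q)) ℕ.+ 4 ℕ.* q ≡ 8 ℕ.* q
    lemma = ℕ-Solver.solve-∀
  modulus≡ : + (8 ℕ.* (p ℕ.* p)) ≡ + 8 * (P * P)
  modulus≡ = trans (ℤ.pos-* 8 (p ℕ.* p)) (cong (_*_ (+ 8)) (ℤ.pos-* p p))
  A≡B : A ≡ B
  A≡B = ≈⇒≡ A< B< (subst (+ A ≈ + B [_]) (sym modulus≡) (≈-trans (≡⇒≈ +A) (≈-trans (+-cong-≈ cong-Z (≈-refl {+ k + + 3 * P + + 1})) (≡⇒≈ (trans (lemma₃ (+ k) (+ l) P) (sym +B))))))

-- Formal power series in q

Series : Set
Series = ℕ → ℤ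

tail : Series → Series
tail f n = f (suc n)

infixl 6 _⊕_
infixl 7 _⊛_
infix 8 ⊖_

_⊕_ : Series → Series → Series
(f ⊕ g) n = f n + g n

⊖_ : Series → Series
(⊖ f) n = - f n

-- The Cauchy product unrolled along the first factor, so that its laws follow by induction on the
-- index with `tail f` in place of `f`.
_⊛_ : Series → Series → Series
(f ⊛ g) zero = f 0 * g 0
(f ⊛ g) (suc n) = f 0 * g (suc n) + (tail f ⊛ g) n

κ : ℤ → Series
κ c zero = c
κ c (suc n) = + 0

⊛-cong-≈ : ∀ {N f f′ g g′} n → (∀ k → k ≤ n → f k ≈ f′ k [ N ]) → (∀ k → k ≤ n → g k ≈ g′ k [ N ]) →
           (f ⊛ g) n ≈ (f′ ⊛ g′) n [ N ]
⊛-cong-≈ zero h₁ h₂ = *-cong-≈ (h₁ 0 z≤n) (h₂ 0 z≤n)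
⊛-cong-≈ (suc n) h₁ h₂ = +-cong-≈ (*-cong-≈ (h₁ 0 z≤n) (h₂ (suc n) ℕ.≤-refl))
  (⊛-cong-≈ n (λ k k≤n → h₁ (suc k) (s≤s k≤n)) (λ k k≤n → h₂ k (ℕ.m≤n⇒m≤1+n k≤n)))

⊛-zeroˡ : ∀ g n → ((λ _ → + 0) ⊛ g) n ≡ + 0
⊛-zeroˡ g zero = refl
⊛-zeroˡ g (suc n) = trans (ℤ.+-identityˡ _) (⊛-zeroˡ g n)

⊛-scaleˡ : ∀ c f g n → ((λ k → c * f k) ⊛ g) n ≡ c * (f ⊛ g) n
⊛-scaleˡ c f g zero = ℤ.*-assoc c (f 0) (g 0)
⊛-scaleˡ c f g (suc n) = trans (cong (_+_ (c * f 0 * g (suc n))) (⊛-scaleˡ c (tail f) g n)) (lemma c (f 0) (g (suc n)) _)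
  where
  lemma : ∀ c x y z → c * x * y + c * z ≡ c * (x * y + z)
  lemma = solve-∀

⊛-distribʳ : ∀ h f g n → ((f ⊕ g) ⊛ h) n ≡ (f ⊛ h) n + (g ⊛ h) n
⊛-distribʳ h f g zero = ℤ.*-distribʳ-+ (h 0) (f 0) (g 0)
⊛-distribʳ h f g (suc n) = trans (cong (_+_ ((f 0 + g 0) * h (suc n))) (⊛-distribʳ h (tail f) (tail g) n))
                               (lemma (f 0) (g 0) (h (suc n)) _ _)
  where
  lemma : ∀ a b c x y → (a + b) * c + (x + y) ≡ a * c + x + (b * c + y)
  lemma = solve-∀

⊛-sucʳ : ∀ f g n → (f ⊛ g) (suc n) ≡ (f ⊛ tail g) n + f (suc n) * g 0
⊛-sucʳ f g zero = refl
⊛-sucʳ f g (suc n) = trans (cong (_+_ (f 0 * g (suc (suc n)))) (⊛-sucʳ (tail f) g n)) (sym (ℤ.+-assoc (f 0 * g (suc (suc n))) ((tail f ⊛ tail g) n) (f (suc (suc n)) * g 0)))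

⊛-comm : ∀ f g n → (f ⊛ g) n ≡ (g ⊛ f) n
⊛-comm f g zero = ℤ.*-comm (f 0) (g 0)
⊛-comm f g (suc n) = begin
  f 0 * g (suc n) + (tail f ⊛ g) n ≡⟨ cong₂ _+_ (ℤ.*-comm (f 0) _) (⊛-comm (tail f) g n) ⟩
  g (suc n) * f 0 + (g ⊛ tail f) n ≡⟨ ℤ.+-comm (g (suc n) * f 0) ((g ⊛ tail f) n) ⟩
  (g ⊛ tail f) n + g (suc n) * f 0 ≡⟨ sym (⊛-sucʳ g f n) ⟩
  (g ⊛ f) (suc n) ∎
  where open ≡-Reasoning

⊛-assoc : ∀ f g h n → ((f ⊛ g) ⊛ h) n ≡ (f ⊛ (g ⊛ h)) n
⊛-assoc f g h zero = ℤ.*-assoc (f 0) (g 0) (h 0)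
⊛-assoc f g h (suc n) = begin
  f 0 * g 0 * h (suc n) + (((λ k → f 0 * tail g k) ⊕ tail f ⊛ g) ⊛ h) n
    ≡⟨ cong (_+_ (f 0 * g 0 * h (suc n))) (⊛-distribʳ h (λ k → f 0 * tail g k) (tail f ⊛ g) n) ⟩
  f 0 * g 0 * h (suc n) + (((λ k → f 0 * tail g k) ⊛ h) n + ((tail f ⊛ g) ⊛ h) n)
    ≡⟨ cong₂ (λ x y → f 0 * g 0 * h (suc n) + (x + y)) (⊛-scaleˡ (f 0) (tail g) h n) (⊛-assoc (tail f) g h n) ⟩
  f 0 * g 0 * h (suc n) + (f 0 * (tail g ⊛ h) n + (tail f ⊛ (g ⊛ h)) n)
    ≡⟨ lemma (f 0) (g 0) (h (suc n)) _ _ ⟩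
  f 0 * (g 0 * h (suc n) + (tail g ⊛ h) n) + (tail f ⊛ (g ⊛ h)) n ∎
  where
  open ≡-Reasoning
  lemma : ∀ a b c x y → a * b * c + (a * x + y) ≡ a * (b * c + x) + y
  lemma = solve-∀

κ-⊛ : ∀ c f n → (κ c ⊛ f) n ≡ c * f n
κ-⊛ c f zero = refl
κ-⊛ c f (suc n) = trans (cong (_+_ (c * f (suc n))) (⊛-zeroˡ f n)) (ℤ.+-identityʳ _)

-- One relation on series covers equality (modulus `0`, all indices), equality up to `q^M`, and
-- congruence modulo `N` up to `q^M`. The indices have to be closed downwards for multiplication to
-- respect the relation; each precision then has its ring and its ring solver.
record Precision : Set₁ where
  field
    modulus : ℤ
    Index : ℕ → Set
    down : ∀ {m n} → m ≤ n → Index n → Index m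

infix 4 _≋_at_
record _≋_at_ (f g : Series) (π : Precision) : Set where
  constructor at
  open Precision π
  field coeffs : ∀ n → Index n → f n ≈ g n [ modulus ]
open _≋_at_ public

ptw : ∀ {f g π} → (∀ n → f n ≡ g n) → f ≋ g at π
ptw h = at λ n _ → ≡⇒≈ (h n)

seriesRing : Precision → CommutativeRing 0ℓ 0ℓ
seriesRing π = record
  { Carrier = Series ; _≈_ = _≋_at π ; _+_ = _⊕_ ; _*_ = _⊛_ ; -_ = ⊖_ ; 0# = κ (+ 0) ; 1# = κ (+ 1)
  ; isCommutativeRing = record
    { isRing = record
      { +-isAbelianGroup = record
        { isGroup = record
          { isMonoid = record
            { isSemigroup = record
              { isMagma = record
                { isEquivalence = record
                  { refl = ptw λ _ → refl
                  ; sym = λ h → at λ n i → ≈-sym (coeffs h n i)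
                  ; trans = λ h k → at λ n i → ≈-trans (coeffs h n i) (coeffs k n i) }
                ; ∙-cong = λ h k → at λ n i → +-cong-≈ (coeffs h n i) (coeffs k n i) }
              ; assoc = λ f g h → ptw λ n → ℤ.+-assoc (f n) (g n) (h n) }
            ; identity = (λ f → ptw λ n → trans (cong (_+ f n) (κ0 n)) (ℤ.+-identityˡ (f n)))
                       , (λ f → ptw λ n → trans (cong (_+_ (f n)) (κ0 n)) (ℤ.+-identityʳ (f n))) }
          ; inverse = (λ f → ptw λ n → trans (ℤ.+-inverseˡ (f n)) (sym (κ0 n)))
                    , (λ f → ptw λ n → trans (ℤ.+-inverseʳ (f n)) (sym (κ0 n)))
          ; ⁻¹-cong = λ h → at λ n i → -‿cong-≈ (coeffs h n i) }
        ; comm = λ f g → ptw λ n → ℤ.+-comm (f n) (g n) }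
      ; *-cong = λ h k → at λ n i → ⊛-cong-≈ n (λ j j≤n → coeffs h j (down j≤n i)) (λ j j≤n → coeffs k j (down j≤n i))
      ; *-assoc = λ f g h → ptw (⊛-assoc f g h)
      ; *-identity = (λ f → ptw λ n → trans (κ-⊛ (+ 1) f n) (ℤ.*-identityˡ (f n)))
                   , (λ f → ptw λ n → trans (⊛-comm f (κ (+ 1)) n) (trans (κ-⊛ (+ 1) f n) (ℤ.*-identityˡ (f n))))
      ; distrib = (λ f g h → ptw λ n → trans (⊛-comm f (g ⊕ h) n) (trans (⊛-distribʳ f g h n)
                              (cong₂ _+_ (⊛-comm g f n) (⊛-comm h f n))))
                , (λ h f g → ptw (⊛-distribʳ h f g)) }
    ; *-comm = λ f g → ptw (⊛-comm f g) } }
  where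
  open Precision π
  κ0 : ∀ n → κ (+ 0) n ≡ + 0
  κ0 zero = refl
  κ0 (suc n) = refl

κ-homomorphism : ∀ π → ℤ.+-*-rawRing -Raw-AlmostCommutative⟶ fromCommutativeRing (seriesRing π)
κ-homomorphism π = record
  { ⟦_⟧ = κ ; +-homo = λ a b → ptw (plus a b) ; *-homo = λ a b → ptw (times a b) ; -‿homo = λ a → ptw (minus a)
  ; 0-homo = ptw λ _ → refl ; 1-homo = ptw λ _ → refl }
  where
  plus : ∀ a b n → κ (a + b) n ≡ κ a n + κ b n
  plus a b zero = refl
  plus a b (suc n) = refl
  minus : ∀ a n → κ (- a) n ≡ - κ a n
  minus a zero = refl
  minus a (suc n) = refl
  times : ∀ a b n → κ (a * b) n ≡ (κ a ⊛ κ b) n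
  times a b zero = refl
  times a b (suc n) = sym (trans (κ-⊛ a (κ b) (suc n)) (ℤ.*-zeroʳ a))

module Ser (π : Precision) where
  open CommutativeRing (seriesRing π) public
    using () renaming (refl to ≋-refl; sym to ≋-sym; trans to ≋-trans; *-cong to ⊛-cong; +-cong to ⊕-cong; -‿cong to ⊖-cong)
  open SetoidReasoning (CommutativeRing.setoid (seriesRing π)) public
  private
    test : ∀ a b → Maybe (κ a ≋ κ b at π)
    test a b with a ℤ.≟ b
    ... | yes refl = just ≋-refl
    ... | no _ = nothing
  open RingSolver ℤ.+-*-rawRing (fromCommutativeRing (seriesRing π)) (κ-homomorphism π) test public
    using (solve; _:+_; _:*_; :-_; _:=_; con)

exact : Precision
exact = record { modulus = + 0 ; Index = λ _ → ⊤ ; down = λ _ _ → tt }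

≈0⇒≡ : ∀ {a b} → a ≈ b [ + 0 ] → a ≡ b
≈0⇒≡ {_} {b} (by q refl) = trans (cong (_+_ b) (ℤ.*-zeroʳ q)) (ℤ.+-identityʳ b)

infix 4 _≐_
_≐_ : Series → Series → Set
f ≐ g = f ≋ g at exact

_‼_ : ∀ {f g} → f ≐ g → ∀ n → f n ≡ g n
h ‼ n = ≈0⇒≡ (coeffs h n tt)

≐⇒≋ : ∀ {f g π} → f ≐ g → f ≋ g at π
≐⇒≋ h = ptw (h ‼_)

-- D = q d/dq, S : q ↦ q², N : q ↦ -q

D : Series → Series
D f n = + n * f n

S : Series → Series
S f zero = f 0
S f (suc zero) = + 0
S f (suc (suc n)) = S (tail f) n

N : Series → Series
N f zero = f 0
N f (suc n) = - N (tail f) n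

D-cong : ∀ {f g π} → f ≋ g at π → D f ≋ D g at π
D-cong h = at λ n i → *-cong-≈ {+ n} {+ n} ≈-refl (coeffs h n i)

D-⊕ : ∀ {π} f g → D (f ⊕ g) ≋ D f ⊕ D g at π
D-⊕ f g = ptw λ n → ℤ.*-distribˡ-+ (+ n) (f n) (g n)

D-⊖ : ∀ {π} f → D (⊖ f) ≋ ⊖ D f at π
D-⊖ f = ptw λ n → sym (ℤ.neg-distribʳ-* (+ n) (f n))

D-κ : ∀ {π} c → D (κ c) ≋ κ (+ 0) at π
D-κ c = ptw λ { zero → refl ; (suc n) → ℤ.*-zeroʳ (+ suc n) }

D-⊛ : ∀ {π} f g → D (f ⊛ g) ≋ D f ⊛ g ⊕ f ⊛ D g at π
D-⊛ f g = ptw (leibniz f g)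
  where
  leibniz : ∀ f g n → D (f ⊛ g) n ≡ (D f ⊛ g) n + (f ⊛ D g) n
  leibniz f g zero = sym (trans (cong (λ x → + 0 + x) (ℤ.*-zeroʳ (f 0))) refl)
  leibniz f g (suc n) = begin
    + suc n * (f 0 * g (suc n) + (tail f ⊛ g) n)
      ≡⟨ lemma₁ (+ n) (f 0) (g (suc n)) _ ⟩
    f 0 * (+ suc n * g (suc n)) + ((tail f ⊛ g) n + + n * (tail f ⊛ g) n)
      ≡⟨ cong (λ x → f 0 * (+ suc n * g (suc n)) + ((tail f ⊛ g) n + x)) (leibniz (tail f) g n) ⟩
    f 0 * (+ suc n * g (suc n)) + ((tail f ⊛ g) n + ((D (tail f) ⊛ g) n + (tail f ⊛ D g) n))
      ≡⟨ lemma₂ (f 0 * (+ suc n * g (suc n))) ((tail f ⊛ g) n) ((D (tail f) ⊛ g) n) ((tail f ⊛ D g) n) ⟩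
    (tail f ⊛ g) n + (D (tail f) ⊛ g) n + (f 0 * (+ suc n * g (suc n)) + (tail f ⊛ D g) n)
      ≡⟨ cong (_+ (f ⊛ D g) (suc n)) (sym (⊛-distribʳ g (tail f) (D (tail f)) n)) ⟩
    ((tail f ⊕ D (tail f)) ⊛ g) n + (f ⊛ D g) (suc n)
      ≡⟨ cong (_+ (f ⊛ D g) (suc n)) (trans (≈0⇒≡ (⊛-cong-≈ {g′ = g} n (λ k _ → ≡⇒≈ (lemma₃ (+ k) (f (suc k)))) (λ _ _ → ≈-refl)))
                                            (sym (ℤ.+-identityˡ _))) ⟩
    (D f ⊛ g) (suc n) + (f ⊛ D g) (suc n) ∎
    where
    open ≡-Reasoning
    lemma₁ : ∀ n x y z → (+ 1 + n) * (x * y + z) ≡ x * ((+ 1 + n) * y) + (z + n * z)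
    lemma₁ = solve-∀
    lemma₂ : ∀ x y z t → x + (y + (z + t)) ≡ y + z + (x + t)
    lemma₂ = solve-∀
    lemma₃ : ∀ k x → x + k * x ≡ (+ 1 + k) * x
    lemma₃ = solve-∀

S-ext : ∀ {f g} → (∀ n → f n ≡ g n) → ∀ n → S f n ≡ S g n
S-ext h zero = h 0
S-ext h (suc zero) = refl
S-ext h (suc (suc n)) = S-ext (h ∘ suc) n

S-cong : ∀ {f g} → f ≐ g → S f ≐ S g
S-cong h = ptw (S-ext (h ‼_))

S-⊕ : ∀ f g → S (f ⊕ g) ≐ S f ⊕ S g
S-⊕ f g = ptw (go f g)
  where
  go : ∀ f g n → S (f ⊕ g) n ≡ S f n + S g n
  go f g zero = refl
  go f g (suc zero) = refl
  go f g (suc (suc n)) = go (tail f) (tail g) n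

S-⊖ : ∀ f → S (⊖ f) ≐ ⊖ S f
S-⊖ f = ptw (go f)
  where
  go : ∀ f n → S (⊖ f) n ≡ - S f n
  go f zero = refl
  go f (suc zero) = refl
  go f (suc (suc n)) = go (tail f) n

S-scale : ∀ c f n → S (λ k → c * f k) n ≡ c * S f n
S-scale c f zero = refl
S-scale c f (suc zero) = sym (ℤ.*-zeroʳ c)
S-scale c f (suc (suc n)) = S-scale c (tail f) n

S-κ : ∀ c → S (κ c) ≐ κ c
S-κ c = ptw λ { zero → refl ; (suc zero) → refl ; (suc (suc n)) → zeros n }
  where
  zeros : ∀ n → S (λ _ → + 0) n ≡ + 0
  zeros zero = refl
  zeros (suc zero) = refl
  zeros (suc (suc n)) = zeros n

S-⊛ : ∀ f g → S (f ⊛ g) ≐ S f ⊛ S g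
S-⊛ f g = ptw (go f g)
  where
  go : ∀ f g n → S (f ⊛ g) n ≡ (S f ⊛ S g) n
  go f g zero = refl
  go f g (suc zero) = sym (trans (ℤ.+-identityʳ (f 0 * + 0)) (ℤ.*-zeroʳ (f 0)))
  go f g (suc (suc n)) = begin
    S ((λ k → f 0 * tail g k) ⊕ tail f ⊛ g) n ≡⟨ S-⊕ (λ k → f 0 * tail g k) (tail f ⊛ g) ‼ n ⟩
    S (λ k → f 0 * tail g k) n + S (tail f ⊛ g) n ≡⟨ cong₂ _+_ (S-scale (f 0) (tail g) n) (go (tail f) g n) ⟩
    f 0 * S (tail g) n + (S (tail f) ⊛ S g) n ≡⟨ cong (_+_ (f 0 * S (tail g) n)) (sym (ℤ.+-identityˡ _)) ⟩
    (S f ⊛ S g) (suc (suc n)) ∎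
    where open ≡-Reasoning

S-even : ∀ f n → S f (n ℕ.+ n) ≡ f n
S-even f zero = refl
S-even f (suc n) rewrite ℕ.+-suc n n = S-even (tail f) n

S-injective : ∀ {f g} → S f ≐ S g → f ≐ g
S-injective {f} {g} h = ptw λ n → trans (sym (S-even f n)) (trans (h ‼ (n ℕ.+ n)) (S-even g n))

-- This doubling of the order drives the uniqueness arguments below: an equation that ties a series
-- to its image under `S` with less than a doubling of the order forces the series to vanish.
S-vanishing : ∀ {f} n → (∀ k → k < n → f k ≡ + 0) → ∀ k → k < n ℕ.+ n → S f k ≡ + 0
S-vanishing (suc n) h zero k< = h 0 (s≤s z≤n)
S-vanishing (suc n) h (suc zero) k< = refl
S-vanishing (suc n) h (suc (suc k)) (s≤s k<) rewrite ℕ.+-suc n n =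
  S-vanishing n (λ j j<n → h (suc j) (s≤s j<n)) k (ℕ.≤-pred k<)

D-S : ∀ f → D (S f) ≐ κ (+ 2) ⊛ S (D f)
D-S f = ptw λ n → trans (go f n) (sym (κ-⊛ (+ 2) (S (D f)) n))
  where
  go : ∀ f n → D (S f) n ≡ + 2 * S (D f) n
  go f zero = refl
  go f (suc zero) = refl
  go f (suc (suc n)) = begin
    + suc (suc n) * S (tail f) n ≡⟨ lemma (+ n) (S (tail f) n) ⟩
    + 2 * S (tail f) n + + n * S (tail f) n ≡⟨ cong (_+_ (+ 2 * S (tail f) n)) (go (tail f) n) ⟩
    + 2 * S (tail f) n + + 2 * S (D (tail f)) n ≡⟨ sym (ℤ.*-distribˡ-+ (+ 2) (S (tail f) n) _) ⟩
    + 2 * (S (tail f) n + S (D (tail f)) n) ≡⟨ cong (_*_ (+ 2)) (sym (S-⊕ (tail f) (D (tail f)) ‼ n)) ⟩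
    + 2 * S (tail f ⊕ D (tail f)) n ≡⟨ cong (_*_ (+ 2)) (S-ext (λ k → lemma′ (+ k) (f (suc k))) n) ⟩
    + 2 * S (tail (D f)) n ∎
    where
    open ≡-Reasoning
    lemma : ∀ n x → (+ 2 + n) * x ≡ + 2 * x + n * x
    lemma = solve-∀
    lemma′ : ∀ k x → x + k * x ≡ (+ 1 + k) * x
    lemma′ = solve-∀

N-ext : ∀ {f g} → (∀ n → f n ≡ g n) → ∀ n → N f n ≡ N g n
N-ext h zero = h 0
N-ext h (suc n) = cong -_ (N-ext (h ∘ suc) n)

N-cong : ∀ {f g} → f ≐ g → N f ≐ N g
N-cong h = ptw (N-ext (h ‼_))

N-⊕ : ∀ f g → N (f ⊕ g) ≐ N f ⊕ N g
N-⊕ f g = ptw (go f g)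
  where
  go : ∀ f g n → N (f ⊕ g) n ≡ N f n + N g n
  go f g zero = refl
  go f g (suc n) = trans (cong -_ (go (tail f) (tail g) n)) (ℤ.neg-distrib-+ (N (tail f) n) _)

N-scale : ∀ c f n → N (λ k → c * f k) n ≡ c * N f n
N-scale c f zero = refl
N-scale c f (suc n) = trans (cong -_ (N-scale c (tail f) n)) (ℤ.neg-distribʳ-* c _)

N-κ : ∀ c → N (κ c) ≐ κ c
N-κ c = ptw λ { zero → refl ; (suc n) → cong -_ (zeros n) }
  where
  zeros : ∀ n → N (λ _ → + 0) n ≡ + 0
  zeros zero = refl
  zeros (suc n) = cong -_ (zeros n)

⊛-negˡ : ∀ f g n → ((⊖ f) ⊛ g) n ≡ - (f ⊛ g) n
⊛-negˡ f g n = trans (≈0⇒≡ (⊛-cong-≈ {g′ = g} n (λ k _ → ≡⇒≈ (sym (ℤ.-1*i≡-i (f k)))) (λ _ _ → ≈-refl)))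
                     (trans (⊛-scaleˡ (- + 1) f g n) (ℤ.-1*i≡-i _))

N-⊛ : ∀ f g → N (f ⊛ g) ≐ N f ⊛ N g
N-⊛ f g = ptw (go f g)
  where
  go : ∀ f g n → N (f ⊛ g) n ≡ (N f ⊛ N g) n
  go f g zero = refl
  go f g (suc n) = begin
    - N ((λ k → f 0 * tail g k) ⊕ tail f ⊛ g) n ≡⟨ cong -_ (N-⊕ (λ k → f 0 * tail g k) (tail f ⊛ g) ‼ n) ⟩
    - (N (λ k → f 0 * tail g k) n + N (tail f ⊛ g) n) ≡⟨ cong -_ (cong₂ _+_ (N-scale (f 0) (tail g) n) (go (tail f) g n)) ⟩
    - (f 0 * N (tail g) n + (N (tail f) ⊛ N g) n) ≡⟨ lemma (f 0) (N (tail g) n) _ ⟩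
    f 0 * - N (tail g) n + - (N (tail f) ⊛ N g) n ≡⟨ cong (_+_ (f 0 * - N (tail g) n)) (sym (⊛-negˡ (N (tail f)) (N g) n)) ⟩
    (N f ⊛ N g) (suc n) ∎
    where
    open ≡-Reasoning
    lemma : ∀ a b c → - (a * b + c) ≡ a * - b + - c
    lemma = solve-∀

N-S : ∀ f → N (S f) ≐ S f
N-S f = ptw (go f)
  where
  go : ∀ f n → N (S f) n ≡ S f n
  go f zero = refl
  go f (suc zero) = refl
  go f (suc (suc n)) = trans (ℤ.neg-involutive _) (go (tail f) n)

shift : Series → Series
shift f zero = + 0
shift f (suc n) = f n

private
  -- Iterates of `g ↦ 1 - q * tail f * g`, whose fixed point is `1 / f` when `f 0 = 1`; the `k`-th
  -- iterate is correct up to `q^k`.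
  approx : Series → ℕ → Series
  approx f zero = κ (+ 1)
  approx f (suc k) = κ (+ 1) ⊕ ⊖ shift (tail f ⊛ approx f k)

  approx-stable : ∀ f k n → n ≤ k → approx f (suc k) n ≡ approx f k n
  approx-stable f k zero _ with k
  ... | zero = refl
  ... | suc _ = refl
  approx-stable f (suc k) (suc n) (s≤s n≤k) = cong (λ x → + 0 + - x)
    (≈0⇒≡ (⊛-cong-≈ {f = tail f} n (λ _ _ → ≈-refl) (λ j j≤n → ≡⇒≈ (approx-stable f k j (ℕ.≤-trans j≤n n≤k)))))

  approx-limit : ∀ f d n → approx f (d ℕ.+ n) n ≡ approx f n n
  approx-limit f zero n = refl
  approx-limit f (suc d) n = trans (approx-stable f (d ℕ.+ n) n (ℕ.m≤n+m n d)) (approx-limit f d n)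

recip : Series → Series
recip f n = approx f n n

recip-inverse : ∀ f → f 0 ≡ + 1 → f ⊛ recip f ≐ κ (+ 1)
recip-inverse f f0 = ptw λ
  { zero → trans (ℤ.*-identityʳ (f 0)) f0
  ; (suc n) → trans (cong (λ x → x * recip f (suc n) + (tail f ⊛ recip f) n) f0) (trans
      (cong (λ x → + 1 * (+ 0 + - x) + (tail f ⊛ recip f) n)
        (≈0⇒≡ (⊛-cong-≈ {f = tail f} n (λ _ _ → ≈-refl) (λ k k≤n →
           ≡⇒≈ (trans (cong (λ j → approx f j k) (sym (ℕ.m∸n+n≡m k≤n))) (approx-limit f (n ∸ k) k))))))
      (lemma ((tail f ⊛ recip f) n))) }
  where
  lemma : ∀ x → + 1 * (+ 0 + - x) + x ≡ + 0
  lemma = solve-∀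

module _ {π : Precision} where
  open Ser π

  -- The analogue of `linear-≈` for series: identities between theta series are proved by naming the
  -- cofactors of the known relations.
  linear₁ : ∀ {l r a b} c → a ≋ b at π → l ≋ r ⊕ c ⊛ (a ⊕ ⊖ b) at π → l ≋ r at π
  linear₁ {l} {r} {a} {b} c h e = begin
    l ≈⟨ e ⟩
    r ⊕ c ⊛ (a ⊕ ⊖ b) ≈⟨ ⊕-cong (≋-refl {r}) (⊛-cong (≋-refl {c}) (⊕-cong h (≋-refl {⊖ b}))) ⟩
    r ⊕ c ⊛ (b ⊕ ⊖ b) ≈⟨ solve 3 (λ r c b → r :+ c :* (b :+ (:- b)) := r) ≋-refl r c b ⟩
    r ∎

  linear₂ : ∀ {l r a b a′ b′} c c′ → a ≋ b at π → a′ ≋ b′ at π →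
            l ≋ r ⊕ c ⊛ (a ⊕ ⊖ b) ⊕ c′ ⊛ (a′ ⊕ ⊖ b′) at π → l ≋ r at π
  linear₂ c c′ h h′ e = linear₁ c h (linear₁ c′ h′ e)

  linear₃ : ∀ {l r a b a′ b′ a″ b″} c c′ c″ → a ≋ b at π → a′ ≋ b′ at π → a″ ≋ b″ at π →
            l ≋ r ⊕ c ⊛ (a ⊕ ⊖ b) ⊕ c′ ⊛ (a′ ⊕ ⊖ b′) ⊕ c″ ⊛ (a″ ⊕ ⊖ b″) at π → l ≋ r at π
  linear₃ c c′ c″ h h′ h″ e = linear₁ c h (linear₂ c′ c″ h′ h″ e)

  ⊛-cancelʳ : ∀ {f g} h → h 0 ≡ + 1 → f ⊛ h ≋ g ⊛ h at π → f ≋ g at π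
  ⊛-cancelʳ {f} {g} h h0 e = linear₂ (g ⊕ ⊖ f) (recip h) (≐⇒≋ (recip-inverse h h0)) e
    (solve 4 (λ f g h r → f := g :+ (g :+ (:- f)) :* (h :* r :+ (:- con (+ 1))) :+ r :* (f :* h :+ (:- (g :* h)))) ≋-refl f g h (recip h))

-- Truncation and monomials

truncated : ℕ → Precision
truncated M = record { modulus = + 0 ; Index = _≤ M ; down = ℕ.≤-trans }

weaken : ∀ {f g m n} → m ≤ n → f ≋ g at truncated n → f ≋ g at truncated m
weaken m≤n h = at λ k k≤m → coeffs h k (ℕ.≤-trans k≤m m≤n)

limit : ∀ {f g} → (∀ n → f ≋ g at truncated n) → f ≐ g
limit h = ptw λ n → ≈0⇒≡ (coeffs (h n) n ℕ.≤-refl)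

S-cong-truncated : ∀ {f g} M → f ≋ g at truncated M → S f ≋ S g at truncated M
S-cong-truncated {f} {g} M h = at λ n n≤M → ≡⇒≈ (go f g n λ k k≤n → ≈0⇒≡ (coeffs h k (ℕ.≤-trans k≤n n≤M)))
  where
  go : ∀ f g n → (∀ k → k ≤ n → f k ≡ g k) → S f n ≡ S g n
  go f g zero h = h 0 z≤n
  go f g (suc zero) h = refl
  go f g (suc (suc n)) h = go (tail f) (tail g) n λ k k≤n → h (suc k) (s≤s (ℕ.m≤n⇒m≤1+n k≤n))

sign : ℕ → ℤ
sign zero = + 1
sign (suc n) = - sign n

N-coeff : ∀ f n → N f n ≡ sign n * f n
N-coeff f zero = sym (ℤ.*-identityˡ (f 0))
N-coeff f (suc n) = trans (cong -_ (N-coeff (tail f) n)) (ℤ.neg-distribˡ-* (sign n) (f (suc n)))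

X : ℕ → Series
X zero = κ (+ 1)
X (suc k) = shift (X k)

shift-X : ∀ {π} f → shift f ≋ X 1 ⊛ f at π
shift-X f = ptw λ { zero → refl ; (suc n) → sym (trans (ℤ.+-identityˡ _) (trans (κ-⊛ (+ 1) f n) (ℤ.*-identityˡ (f n)))) }

shift-cong : ∀ {f g} → f ≐ g → shift f ≐ shift g
shift-cong h = ptw λ { zero → refl ; (suc n) → h ‼ n }

shift-⊛ : ∀ f g → shift f ⊛ g ≐ shift (f ⊛ g)
shift-⊛ f g = ptw λ { zero → refl ; (suc n) → ℤ.+-identityˡ _ }

X-+ : ∀ a b → X (a ℕ.+ b) ≐ X a ⊛ X b
X-+ zero b = ptw λ n → sym (trans (κ-⊛ (+ 1) (X b) n) (ℤ.*-identityˡ (X b n)))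
X-+ (suc a) b = ptw λ n → trans (shift-cong (X-+ a b) ‼ n) (sym (shift-⊛ (X a) (X b) ‼ n))

X-suc : ∀ a → X (suc a) ≐ X 1 ⊛ X a
X-suc a = shift-X (X a)

X-coeff-≡ : ∀ k → X k k ≡ + 1
X-coeff-≡ zero = refl
X-coeff-≡ (suc k) = X-coeff-≡ k

X-coeff-≢ : ∀ k n → n ≢ k → X k n ≡ + 0
X-coeff-≢ zero zero n≢k = contradiction refl n≢k
X-coeff-≢ zero (suc n) n≢k = refl
X-coeff-≢ (suc k) zero n≢k = refl
X-coeff-≢ (suc k) (suc n) n≢k = X-coeff-≢ k n (n≢k ∘ cong suc)

S-shift : ∀ f → S (shift f) ≐ shift (shift (S f))
S-shift f = ptw λ { zero → refl ; (suc zero) → refl ; (suc (suc n)) → refl }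

S-X : ∀ k → S (X k) ≐ X (k ℕ.+ k)
S-X zero = S-κ (+ 1)
S-X (suc k) rewrite ℕ.+-suc k k = ptw λ n → trans (S-shift (X k) ‼ n) (shift-cong (shift-cong (S-X k)) ‼ n)

N-X : ∀ k → N (X k) ≐ κ (sign k) ⊛ X k
N-X k = ptw λ n → trans (N-coeff (X k) n) (trans (lemma n) (sym (κ-⊛ (sign k) (X k) n)))
  where
  lemma : ∀ n → sign n * X k n ≡ sign k * X k n
  lemma n with n ℕ.≟ k
  ... | yes refl = refl
  ... | no n≢k rewrite X-coeff-≢ k n n≢k = trans (ℤ.*-zeroʳ (sign n)) (sym (ℤ.*-zeroʳ (sign k)))

D-X : ∀ {π} k → D (X k) ≋ κ (+ k) ⊛ X k at π
D-X k = ptw λ n → trans (lemma n) (sym (κ-⊛ (+ k) (X k) n))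
  where
  lemma : ∀ n → + n * X k n ≡ + k * X k n
  lemma n with n ℕ.≟ k
  ... | yes refl = refl
  ... | no n≢k rewrite X-coeff-≢ k n n≢k = trans (ℤ.*-zeroʳ (+ n)) (sym (ℤ.*-zeroʳ (+ k)))

X⊛-vanishes : ∀ k f {M} → M < k → X k ⊛ f ≋ κ (+ 0) at truncated M
X⊛-vanishes k f {M} M<k = at λ n n≤M → ≡⇒≈ (trans (go k f n (ℕ.≤-<-trans n≤M M<k)) (sym (κ0 n)))
  where
  κ0 : ∀ n → κ (+ 0) n ≡ + 0
  κ0 zero = refl
  κ0 (suc n) = refl
  go : ∀ k f n → n < k → (X k ⊛ f) n ≡ + 0
  go (suc k) f zero n<k = refl
  go (suc k) f (suc n) (s≤s n<k) = trans (ℤ.+-identityˡ _) (go k f n n<k)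

-- Gauss's product for Σ (-1)ⁿ q^(n²)

open Ser exact

prod⁻ prod⁺ : ℕ → Series
prod⁻ zero = κ (+ 1)
prod⁻ (suc n) = prod⁻ n ⊛ (κ (+ 1) ⊕ ⊖ X (suc n))
prod⁺ zero = κ (+ 1)
prod⁺ (suc n) = prod⁺ n ⊛ (κ (+ 1) ⊕ X (suc n))

square : ℕ → ℕ
square n = n ℕ.* n

thetaSum : ℕ → Series
thetaSum zero = κ (+ 1)
thetaSum (suc n) = thetaSum n ⊕ κ (+ 2 * sign (suc n)) ⊛ X (square (suc n))

private
  -- For `s ≥ 1`, `τ s d` is `2 (-1)^s q^(s(s+1) + sd)` times `prod⁺ (s - 1)` times the product of
  -- `1 - q^j` over `s < j ≤ s + d`; `τ₀` is the case `d = 0`.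
  τ₀ : ℕ → Series
  τ₀ zero = κ (+ 1)
  τ₀ (suc s) = κ (+ 2 * sign (suc s)) ⊛ X (suc s ℕ.* suc (suc s)) ⊛ prod⁺ s

  τ : ℕ → ℕ → Series
  τ s zero = τ₀ s
  τ s (suc d) = τ s d ⊛ (X s ⊛ (κ (+ 1) ⊕ ⊖ X (suc (s ℕ.+ d))))

  -- The sum of `τ s (k - s + d)` over `s ≤ k`, where `τ 0 d` is `prod⁻ d`. It interpolates between
  -- the two sides of Gauss's identity: `V k d` agrees with `prod⁻ (k + d)` up to `q^(k + d)`, since
  -- the terms with `s ≥ 1` have higher order, while `V k 0` is exactly `thetaSum k ⊛ prod⁺ k`.
  V : ℕ → ℕ → Series
  V zero d = prod⁻ d
  V (suc k) d = V k (suc d) ⊕ τ (suc k) d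

  τ₀-double : ∀ s → τ₀ s ⊛ (κ (+ 1) ⊕ X s) ≐ κ (+ 2 * sign s) ⊛ X (s ℕ.* suc s) ⊛ prod⁺ s
  τ₀-double zero = solve 0 (con (+ 1) :* (con (+ 1) :+ con (+ 1)) := con (+ 2) :* con (+ 1) :* con (+ 1)) ≋-refl
  τ₀-double (suc s) = solve 4 (λ c x b y → c :* x :* b :* (con (+ 1) :+ y) := c :* x :* (b :* (con (+ 1) :+ y))) ≋-refl
    (κ (+ 2 * sign (suc s))) (X (suc s ℕ.* suc (suc s))) (prod⁺ s) (X (suc s))

  κ-neg : ∀ c → κ (+ 2 * - c) ≐ ⊖ κ (+ 2 * c)
  κ-neg c = ptw λ { zero → lemma c ; (suc n) → refl }
    where
    lemma : ∀ c → + 2 * - c ≡ - (+ 2 * c)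
    lemma = solve-∀

  τ-step : ∀ s d → τ (suc s) d ⊛ (κ (+ 1) ⊕ ⊖ X (suc s)) ≐ ⊖ (τ s (suc d) ⊛ X (suc (suc (s ℕ.+ d))) ⊛ (κ (+ 1) ⊕ X s))
  τ-step s zero rewrite ℕ.+-identityʳ s = begin
    κ (+ 2 * sign (suc s)) ⊛ X (suc s ℕ.* suc (suc s)) ⊛ prod⁺ s ⊛ (κ (+ 1) ⊕ ⊖ X (suc s))
      ≈⟨ ⊛-cong (⊛-cong (⊛-cong (κ-neg (sign s)) exponent) ≋-refl) ≋-refl ⟩
    (⊖ κ (+ 2 * sign s)) ⊛ (X (s ℕ.* suc s) ⊛ (X s ⊛ X (suc (suc s)))) ⊛ prod⁺ s ⊛ (κ (+ 1) ⊕ ⊖ X (suc s))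
      ≈⟨ solve 6 (λ c x y z b w → (:- c) :* (x :* (y :* z)) :* b :* w := :- (c :* x :* b :* (y :* w) :* z)) ≋-refl
           (κ (+ 2 * sign s)) (X (s ℕ.* suc s)) (X s) (X (suc (suc s))) (prod⁺ s) (κ (+ 1) ⊕ ⊖ X (suc s)) ⟩
    ⊖ (κ (+ 2 * sign s) ⊛ X (s ℕ.* suc s) ⊛ prod⁺ s ⊛ (X s ⊛ (κ (+ 1) ⊕ ⊖ X (suc s))) ⊛ X (suc (suc s)))
      ≈⟨ ⊖-cong (⊛-cong (⊛-cong (≋-sym (τ₀-double s)) ≋-refl) ≋-refl) ⟩
    ⊖ (τ₀ s ⊛ (κ (+ 1) ⊕ X s) ⊛ (X s ⊛ (κ (+ 1) ⊕ ⊖ X (suc s))) ⊛ X (suc (suc s)))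
      ≈⟨ solve 4 (λ t a b c → :- (t :* a :* b :* c) := :- (t :* b :* c :* a)) ≋-refl
           (τ₀ s) (κ (+ 1) ⊕ X s) (X s ⊛ (κ (+ 1) ⊕ ⊖ X (suc s))) (X (suc (suc s))) ⟩
    ⊖ (τ₀ s ⊛ (X s ⊛ (κ (+ 1) ⊕ ⊖ X (suc s))) ⊛ X (suc (suc s)) ⊛ (κ (+ 1) ⊕ X s)) ∎
    where
    exponent : X (suc s ℕ.* suc (suc s)) ≐ X (s ℕ.* suc s) ⊛ (X s ⊛ X (suc (suc s)))
    exponent = begin
      X (suc s ℕ.* suc (suc s)) ≡⟨ cong X (lemma s) ⟩
      X (s ℕ.* suc s ℕ.+ (s ℕ.+ suc (suc s))) ≈⟨ X-+ (s ℕ.* suc s) (s ℕ.+ suc (suc s)) ⟩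
      X (s ℕ.* suc s) ⊛ X (s ℕ.+ suc (suc s)) ≈⟨ ⊛-cong ≋-refl (X-+ s (suc (suc s))) ⟩
      X (s ℕ.* suc s) ⊛ (X s ⊛ X (suc (suc s))) ∎
      where
      lemma : ∀ s → suc s ℕ.* suc (suc s) ≡ s ℕ.* suc s ℕ.+ (s ℕ.+ suc (suc s))
      lemma = ℕ-Solver.solve-∀
  τ-step s (suc d) rewrite ℕ.+-suc s d = begin
    τ (suc s) d ⊛ (X (suc s) ⊛ F) ⊛ G
      ≈⟨ solve 4 (λ t x f g → t :* (x :* f) :* g := (t :* g) :* (x :* f)) ≋-refl (τ (suc s) d) (X (suc s)) F G ⟩
    (τ (suc s) d ⊛ G) ⊛ (X (suc s) ⊛ F)
      ≈⟨ ⊛-cong (τ-step s d) (⊛-cong (X-suc s) ≋-refl) ⟩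
    (⊖ (τ s (suc d) ⊛ X (suc (suc (s ℕ.+ d))) ⊛ H)) ⊛ (X 1 ⊛ X s ⊛ F)
      ≈⟨ solve 6 (λ t y h x z f → (:- (t :* y :* h)) :* (x :* z :* f) := :- (t :* (z :* f) :* (x :* y) :* h)) ≋-refl
           (τ s (suc d)) (X (suc (suc (s ℕ.+ d)))) H (X 1) (X s) F ⟩
    ⊖ (τ s (suc d) ⊛ (X s ⊛ F) ⊛ (X 1 ⊛ X (suc (suc (s ℕ.+ d)))) ⊛ H)
      ≈⟨ ⊖-cong (⊛-cong (⊛-cong ≋-refl (≋-sym (X-suc (suc (suc (s ℕ.+ d)))))) ≋-refl) ⟩
    ⊖ (τ s (suc d) ⊛ (X s ⊛ F) ⊛ X (suc (suc (suc (s ℕ.+ d)))) ⊛ H) ∎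
    where
    F = κ (+ 1) ⊕ ⊖ X (suc (suc (s ℕ.+ d)))
    G = κ (+ 1) ⊕ ⊖ X (suc s)
    H = κ (+ 1) ⊕ X s

  τ0≡prod : ∀ d → τ 0 d ≐ prod⁻ d
  τ0≡prod zero = ≋-refl
  τ0≡prod (suc d) = begin
    τ 0 d ⊛ (κ (+ 1) ⊛ (κ (+ 1) ⊕ ⊖ X (suc d))) ≈⟨ ⊛-cong (τ0≡prod d) ≋-refl ⟩
    prod⁻ d ⊛ (κ (+ 1) ⊛ (κ (+ 1) ⊕ ⊖ X (suc d)))
      ≈⟨ solve 2 (λ a x → a :* (con (+ 1) :* x) := a :* x) ≋-refl (prod⁻ d) (κ (+ 1) ⊕ ⊖ X (suc d)) ⟩
    prod⁻ d ⊛ (κ (+ 1) ⊕ ⊖ X (suc d)) ∎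

  -- Lengthening by one multiplies by `1 + q^(k+d+1)` up to a boundary term, and `τ-step` is the
  -- identity that moves this boundary term from index `k` to index `k + 1`.
  V-step : ∀ k d → V k (suc d) ≐ (κ (+ 1) ⊕ X (suc (k ℕ.+ d))) ⊛ V k d ⊕ ⊖ (τ k d ⊛ X (suc (k ℕ.+ d)) ⊛ (κ (+ 1) ⊕ X k))
  V-step zero d = linear₁ (X (suc d) ⊛ κ (+ 2)) (τ0≡prod d)
    (solve 3 (λ a t x → a :* (con (+ 1) :+ (:- x)) :=
        (con (+ 1) :+ x) :* a :+ (:- (t :* x :* (con (+ 1) :+ con (+ 1)))) :+ (x :* con (+ 2)) :* (t :+ (:- a)))
      ≋-refl (prod⁻ d) (τ 0 d) (X (suc d)))
  V-step (suc k) d = linear₂ (κ (+ 1)) (κ (- + 1)) previous (τ-step k d)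
    (solve 7 (λ W V₀ t x y z u → W :+ t :* (y :* (con (+ 1) :+ (:- x))) :=
        ((con (+ 1) :+ x) :* (V₀ :+ t) :+ (:- (t :* x :* (con (+ 1) :+ y)))
         :+ con (+ 1) :* (W :+ (:- ((con (+ 1) :+ x) :* V₀ :+ (:- (u :* x :* (con (+ 1) :+ z))))))
         :+ con (- + 1) :* (t :* (con (+ 1) :+ (:- y)) :+ (:- (:- (u :* x :* (con (+ 1) :+ z)))))))
      ≋-refl (V k (suc (suc d))) (V k (suc d)) (τ (suc k) d) (X (suc (suc (k ℕ.+ d)))) (X (suc k)) (X k) (τ k (suc d)))
    where
    previous : V k (suc (suc d)) ≐ (κ (+ 1) ⊕ X (suc (suc (k ℕ.+ d)))) ⊛ V k (suc d)
                                     ⊕ ⊖ (τ k (suc d) ⊛ X (suc (suc (k ℕ.+ d))) ⊛ (κ (+ 1) ⊕ X k))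
    previous = subst (λ j → V k (suc (suc d)) ≐ (κ (+ 1) ⊕ X (suc j)) ⊛ V k (suc d)
                                     ⊕ ⊖ (τ k (suc d) ⊛ X (suc j) ⊛ (κ (+ 1) ⊕ X k))) (ℕ.+-suc k d) (V-step k (suc d))

  τ-factor : ∀ s d → ∃ λ g → τ (suc s) d ≐ X (suc (suc (s ℕ.+ d))) ⊛ g
  τ-factor s zero = κ (+ 2 * sign (suc s)) ⊛ X (s ℕ.* suc (suc s)) ⊛ prod⁺ s , (begin
    κ (+ 2 * sign (suc s)) ⊛ X (suc s ℕ.* suc (suc s)) ⊛ prod⁺ s
      ≈⟨ ⊛-cong (⊛-cong ≋-refl (X-+ (suc (suc s)) (s ℕ.* suc (suc s)))) ≋-refl ⟩
    κ (+ 2 * sign (suc s)) ⊛ (X (suc (suc s)) ⊛ X (s ℕ.* suc (suc s))) ⊛ prod⁺ s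
      ≈⟨ solve 4 (λ c x y b → c :* (x :* y) :* b := x :* (c :* y :* b)) ≋-refl
           (κ (+ 2 * sign (suc s))) (X (suc (suc s))) (X (s ℕ.* suc (suc s))) (prod⁺ s) ⟩
    X (suc (suc s)) ⊛ (κ (+ 2 * sign (suc s)) ⊛ X (s ℕ.* suc (suc s)) ⊛ prod⁺ s)
      ≡⟨ cong (λ j → X (suc (suc j)) ⊛ (κ (+ 2 * sign (suc s)) ⊛ X (s ℕ.* suc (suc s)) ⊛ prod⁺ s)) (sym (ℕ.+-identityʳ s)) ⟩
    X (suc (suc (s ℕ.+ 0))) ⊛ (κ (+ 2 * sign (suc s)) ⊛ X (s ℕ.* suc (suc s)) ⊛ prod⁺ s) ∎)
  τ-factor s (suc d) with τ-factor s d
  ... | g , h = g ⊛ X s ⊛ F , (begin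
    τ (suc s) d ⊛ (X (suc s) ⊛ F) ≈⟨ ⊛-cong h (⊛-cong (X-suc s) ≋-refl) ⟩
    X (suc (suc (s ℕ.+ d))) ⊛ g ⊛ (X 1 ⊛ X s ⊛ F)
      ≈⟨ solve 5 (λ x g y z f → x :* g :* (y :* z :* f) := y :* x :* (g :* z :* f)) ≋-refl
           (X (suc (suc (s ℕ.+ d)))) g (X 1) (X s) F ⟩
    X 1 ⊛ X (suc (suc (s ℕ.+ d))) ⊛ (g ⊛ X s ⊛ F) ≈⟨ ⊛-cong (≋-sym (X-suc (suc (suc (s ℕ.+ d))))) ≋-refl ⟩
    X (suc (suc (suc (s ℕ.+ d)))) ⊛ (g ⊛ X s ⊛ F) ≡⟨ cong (λ j → X (suc (suc j)) ⊛ (g ⊛ X s ⊛ F)) (sym (ℕ.+-suc s d)) ⟩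
    X (suc (suc (s ℕ.+ suc d))) ⊛ (g ⊛ X s ⊛ F) ∎)
    where
    F = κ (+ 1) ⊕ ⊖ X (suc (suc s ℕ.+ d))

  V-telescoped : ∀ n → V n 0 ≐ thetaSum n ⊛ prod⁺ n
  V-telescoped zero = solve 0 (con (+ 1) := con (+ 1) :* con (+ 1)) ≋-refl
  V-telescoped (suc n) =
    linear₃ (κ (+ 1)) (κ (+ 1) ⊕ X (suc n)) (⊖ X (suc n)) step (V-telescoped n) (τ₀-double n) (
    linear₃ (⊖ (κ (+ 2 * sign (suc n)) ⊛ prod⁺ n)) (⊖ (X (suc n) ⊛ X (n ℕ.* suc n) ⊛ prod⁺ n)) (κ (+ 2 * sign (suc n)) ⊛ prod⁺ n)
      exponent₁ (κ-neg (sign n)) exponent₂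
    (solve 12 (λ W V₀ θ B x y t s z b c c′ → W :+ c′ :* b :* B :=
       (((θ :+ c′ :* s) :* (B :* (con (+ 1) :+ x))
        :+ con (+ 1) :* (W :+ (:- ((con (+ 1) :+ x) :* V₀ :+ (:- (t :* x :* (con (+ 1) :+ y))))))
        :+ (con (+ 1) :+ x) :* (V₀ :+ (:- (θ :* B)))
        :+ (:- x) :* (t :* (con (+ 1) :+ y) :+ (:- (c :* z :* B))))
        :+ (:- (c′ :* B)) :* (s :+ (:- (z :* x)))
        :+ (:- (x :* z :* B)) :* (c′ :+ (:- (:- c)))
        :+ (c′ :* B) :* (b :+ (:- (s :* x)))))
      ≋-refl (V n 1) (V n 0) (thetaSum n) (prod⁺ n) (X (suc n)) (X n) (τ₀ n) (X (square (suc n))) (X (n ℕ.* suc n))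
      (X (suc n ℕ.* suc (suc n))) (κ (+ 2 * sign n)) (κ (+ 2 * sign (suc n)))))
    where
    step : V n 1 ≐ (κ (+ 1) ⊕ X (suc n)) ⊛ V n 0 ⊕ ⊖ (τ n 0 ⊛ X (suc n) ⊛ (κ (+ 1) ⊕ X n))
    step = subst (λ j → V n 1 ≐ (κ (+ 1) ⊕ X (suc j)) ⊛ V n 0 ⊕ ⊖ (τ n 0 ⊛ X (suc j) ⊛ (κ (+ 1) ⊕ X n))) (ℕ.+-identityʳ n) (V-step n 0)

    exponent₁ : X (square (suc n)) ≐ X (n ℕ.* suc n) ⊛ X (suc n)
    exponent₁ = ≋-trans (ptw λ k → cong (λ j → X j k) (ℕ.+-comm (suc n) (n ℕ.* suc n))) (X-+ (n ℕ.* suc n) (suc n))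
    exponent₂ : X (suc n ℕ.* suc (suc n)) ≐ X (square (suc n)) ⊛ X (suc n)
    exponent₂ = ≋-trans (ptw λ k → cong (λ j → X j k) (lemma n)) (X-+ (square (suc n)) (suc n))
      where
      lemma : ∀ n → suc n ℕ.* suc (suc n) ≡ square (suc n) ℕ.+ suc n
      lemma = unfolded
        where
        unfolded : ∀ n → suc n ℕ.* suc (suc n) ≡ suc n ℕ.* suc n ℕ.+ suc n
        unfolded = ℕ-Solver.solve-∀

  V-truncated : ∀ k d → V k d ≋ prod⁻ (k ℕ.+ d) at truncated (k ℕ.+ d)
  V-truncated zero d = ptw λ _ → refl
  V-truncated (suc k) d with τ-factor k d
  ... | g , h = T.begin
    V k (suc d) ⊕ τ (suc k) d T.≈⟨ T.⊕-cong previous (T.≋-trans (≐⇒≋ h) (X⊛-vanishes (suc (suc (k ℕ.+ d))) g ℕ.≤-refl)) ⟩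
    prod⁻ (suc (k ℕ.+ d)) ⊕ κ (+ 0) T.≈⟨ T.solve 1 (λ a → a T.:+ T.con (+ 0) T.:= a) T.≋-refl (prod⁻ (suc (k ℕ.+ d))) ⟩
    prod⁻ (suc (k ℕ.+ d)) T.∎
    where
    module T = Ser (truncated (suc (k ℕ.+ d)))
    previous : V k (suc d) ≋ prod⁻ (suc (k ℕ.+ d)) at truncated (suc (k ℕ.+ d))
    previous = subst (λ j → V k (suc d) ≋ prod⁻ j at truncated j) (ℕ.+-suc k d) (V-truncated k (suc d))

thetaSum-prod⁺ : ∀ n → thetaSum n ⊛ prod⁺ n ≋ prod⁻ n at truncated n
thetaSum-prod⁺ n = subst (λ j → thetaSum n ⊛ prod⁺ n ≋ prod⁻ j at truncated j) (ℕ.+-identityʳ n)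
  (CommutativeRing.trans (seriesRing (truncated (n ℕ.+ 0))) (≐⇒≋ (≋-sym (V-telescoped n))) (V-truncated n 0))

-- Theta functions

-- The limit of a sequence whose coefficient at `q^k` no longer changes from the `k`-th member on.
diagonal : (ℕ → Series) → Series
diagonal G n = G n n

Stable : (ℕ → Series) → Set
Stable G = ∀ k → G (suc k) ≋ G k at truncated k

diagonal-truncated : ∀ {G} → Stable G → ∀ n → diagonal G ≋ G n at truncated n
diagonal-truncated {G} stable n = at λ k k≤n → ≡⇒≈ (trans (sym (go (n ∸ k) k)) (cong (λ j → G j k) (ℕ.m∸n+n≡m k≤n)))
  where
  go : ∀ d k → G (d ℕ.+ k) k ≡ G k k
  go zero k = refl
  go (suc d) k = trans (≈0⇒≡ (coeffs (stable (d ℕ.+ k)) k (ℕ.m≤n+m k d))) (go d k)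

N-diagonal : ∀ {G H} → (∀ n → N (G n) ≐ H n) → N (diagonal G) ≐ diagonal H
N-diagonal {G} h = ptw λ n → trans (N-coeff (diagonal G) n) (trans (sym (N-coeff (G n) n)) (h n ‼ n))

stable-⊕ : ∀ f c k e → k < e → f ⊕ c ⊛ X e ≋ f at truncated k
stable-⊕ f c k e k<e = T.begin
  f ⊕ c ⊛ X e T.≈⟨ T.⊕-cong (T.≋-refl {f}) (ptw (⊛-comm c (X e))) ⟩
  f ⊕ X e ⊛ c T.≈⟨ T.⊕-cong (T.≋-refl {f}) (X⊛-vanishes e c k<e) ⟩
  f ⊕ κ (+ 0) T.≈⟨ T.solve 1 (λ f → f T.:+ T.con (+ 0) T.:= f) T.≋-refl f ⟩
  f T.∎
  where module T = Ser (truncated k)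

stable-⊛ : ∀ f c k e → k < e → f ⊛ (κ (+ 1) ⊕ c ⊛ X e) ≋ f at truncated k
stable-⊛ f c k e k<e = T.≋-trans (T.solve 3 (λ f c x → f T.:* (T.con (+ 1) T.:+ c T.:* x) T.:= f T.:+ (f T.:* c) T.:* x) T.≋-refl f c (X e))
                                 (stable-⊕ f (f ⊛ c) k e k<e)
  where module T = Ser (truncated k)

n<[1+n]² : ∀ n → n < square (suc n)
n<[1+n]² n = s≤s (ℕ.m≤m+n n _)

triangle : ℕ → ℕ
triangle zero = 0
triangle (suc n) = triangle n ℕ.+ suc n

phiSum psiSum : ℕ → Series
phiSum zero = κ (+ 1)
phiSum (suc n) = phiSum n ⊕ κ (+ 2) ⊛ X (square (suc n))
psiSum zero = κ (+ 1)
psiSum (suc n) = psiSum n ⊕ κ (+ 1) ⊛ X (triangle (suc n))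

odd⁻ odd⁺ : ℕ → Series
odd⁻ zero = κ (+ 1)
odd⁻ (suc n) = odd⁻ n ⊛ (κ (+ 1) ⊕ κ (- + 1) ⊛ X (suc (n ℕ.+ n)))
odd⁺ zero = κ (+ 1)
odd⁺ (suc n) = odd⁺ n ⊛ (κ (+ 1) ⊕ κ (+ 1) ⊛ X (suc (n ℕ.+ n)))

-- Classically `φ = Σ q^(n²)` over all integers, `Θ = φ(-q)`, and `ψ = Σ q^(n(n+1)/2)` over `n ≥ 0`.
-- The products are those of `1 - q^n`, `1 + q^n`, `1 - q^(2n-1)` and `1 + q^(2n-1)` over `n ≥ 1`.
Θ φ ψ P⁻ P⁺ O⁻ O⁺ : Series
Θ = diagonal thetaSum
φ = diagonal phiSum
ψ = diagonal psiSum
P⁻ = diagonal prod⁻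
P⁺ = diagonal prod⁺
O⁻ = diagonal odd⁻
O⁺ = diagonal odd⁺

Θ-truncated : ∀ n → Θ ≋ thetaSum n at truncated n
Θ-truncated = diagonal-truncated λ k → stable-⊕ (thetaSum k) (κ (+ 2 * sign (suc k))) k (square (suc k)) (n<[1+n]² k)

φ-truncated : ∀ n → φ ≋ phiSum n at truncated n
φ-truncated = diagonal-truncated λ k → stable-⊕ (phiSum k) (κ (+ 2)) k (square (suc k)) (n<[1+n]² k)

ψ-truncated : ∀ n → ψ ≋ psiSum n at truncated n
ψ-truncated = diagonal-truncated λ k → stable-⊕ (psiSum k) (κ (+ 1)) k (triangle (suc k)) (ℕ.m≤n+m (suc k) (triangle k))

P⁻-truncated : ∀ n → P⁻ ≋ prod⁻ n at truncated n
P⁻-truncated = diagonal-truncated stable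
  where
  stable : Stable prod⁻
  stable k = T.≋-trans (T.⊛-cong (T.≋-refl {prod⁻ k}) (T.solve 1 (λ x → T.con (+ 1) T.:+ T.:- x T.:= T.con (+ 1) T.:+ T.con (- + 1) T.:* x) T.≋-refl (X (suc k))))
                       (stable-⊛ (prod⁻ k) (κ (- + 1)) k (suc k) ℕ.≤-refl)
    where module T = Ser (truncated k)

P⁺-truncated : ∀ n → P⁺ ≋ prod⁺ n at truncated n
P⁺-truncated = diagonal-truncated stable
  where
  stable : Stable prod⁺
  stable k = T.≋-trans (T.⊛-cong (T.≋-refl {prod⁺ k}) (T.solve 1 (λ x → T.con (+ 1) T.:+ x T.:= T.con (+ 1) T.:+ T.con (+ 1) T.:* x) T.≋-refl (X (suc k))))
                       (stable-⊛ (prod⁺ k) (κ (+ 1)) k (suc k) ℕ.≤-refl)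
    where module T = Ser (truncated k)

O⁻-truncated : ∀ n → O⁻ ≋ odd⁻ n at truncated n
O⁻-truncated = diagonal-truncated λ k → stable-⊛ (odd⁻ k) (κ (- + 1)) k (suc (k ℕ.+ k)) (s≤s (ℕ.m≤m+n k k))

O⁺-truncated : ∀ n → O⁺ ≋ odd⁺ n at truncated n
O⁺-truncated = diagonal-truncated λ k → stable-⊛ (odd⁺ k) (κ (+ 1)) k (suc (k ℕ.+ k)) (s≤s (ℕ.m≤m+n k k))

Gauss : Θ ⊛ P⁺ ≐ P⁻
Gauss = limit λ n → let module T = Ser (truncated n) in
  T.≋-trans (T.⊛-cong (Θ-truncated n) (P⁺-truncated n)) (T.≋-trans (thetaSum-prod⁺ n) (T.≋-sym (P⁻-truncated n)))

prod⁻prod⁺ : ∀ n → prod⁻ n ⊛ prod⁺ n ≐ S (prod⁻ n)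
prod⁻prod⁺ zero = ≋-trans (solve 0 (con (+ 1) :* con (+ 1) := con (+ 1)) ≋-refl) (≋-sym (S-κ (+ 1)))
prod⁻prod⁺ (suc n) = begin
  prod⁻ n ⊛ (κ (+ 1) ⊕ ⊖ X (suc n)) ⊛ (prod⁺ n ⊛ (κ (+ 1) ⊕ X (suc n)))
    ≈⟨ solve 3 (λ a b x → a :* (con (+ 1) :+ :- x) :* (b :* (con (+ 1) :+ x)) := a :* b :* (con (+ 1) :+ :- (x :* x))) ≋-refl (prod⁻ n) (prod⁺ n) (X (suc n)) ⟩
  prod⁻ n ⊛ prod⁺ n ⊛ (κ (+ 1) ⊕ ⊖ (X (suc n) ⊛ X (suc n)))
    ≈⟨ ⊛-cong (prod⁻prod⁺ n) (⊕-cong (≋-sym (S-κ (+ 1))) (⊖-cong (≋-sym (≋-trans (S-X (suc n)) (X-+ (suc n) (suc n)))))) ⟩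
  S (prod⁻ n) ⊛ (S (κ (+ 1)) ⊕ ⊖ S (X (suc n)))
    ≈⟨ ⊛-cong ≋-refl (≋-sym (≋-trans (S-⊕ (κ (+ 1)) (⊖ X (suc n))) (⊕-cong (≋-refl {S (κ (+ 1))}) (S-⊖ (X (suc n)))))) ⟩
  S (prod⁻ n) ⊛ S (κ (+ 1) ⊕ ⊖ X (suc n))
    ≈⟨ ≋-sym (S-⊛ (prod⁻ n) (κ (+ 1) ⊕ ⊖ X (suc n))) ⟩
  S (prod⁻ (suc n)) ∎

P⁻P⁺ : P⁻ ⊛ P⁺ ≐ S P⁻
P⁻P⁺ = limit λ n → let module T = Ser (truncated n) in
  T.≋-trans (T.⊛-cong (P⁻-truncated n) (P⁺-truncated n)) (T.≋-trans (≐⇒≋ (prod⁻prod⁺ n)) (S-cong-truncated n (T.≋-sym (P⁻-truncated n))))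

split⁻ : ∀ n → prod⁻ (n ℕ.+ n) ≐ odd⁻ n ⊛ S (prod⁻ n)
split⁻ zero = ≋-sym (≋-trans (⊛-cong ≋-refl (S-κ (+ 1))) (solve 0 (con (+ 1) :* con (+ 1) := con (+ 1)) ≋-refl))
split⁻ (suc n) rewrite ℕ.+-suc n n = begin
  prod⁻ (n ℕ.+ n) ⊛ (κ (+ 1) ⊕ ⊖ x) ⊛ (κ (+ 1) ⊕ ⊖ X (suc (suc (n ℕ.+ n))))
    ≈⟨ ⊛-cong (⊛-cong (split⁻ n) ≋-refl) (⊕-cong (≋-refl {κ (+ 1)}) (⊖-cong exponent)) ⟩
  odd⁻ n ⊛ S (prod⁻ n) ⊛ (κ (+ 1) ⊕ ⊖ x) ⊛ (κ (+ 1) ⊕ ⊖ S (X (suc n)))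
    ≈⟨ solve 4 (λ o p x y → o :* p :* (con (+ 1) :+ :- x) :* (con (+ 1) :+ :- y) := o :* (con (+ 1) :+ con (- + 1) :* x) :* (p :* (con (+ 1) :+ :- y)))
         ≋-refl (odd⁻ n) (S (prod⁻ n)) x (S (X (suc n))) ⟩
  odd⁻ (suc n) ⊛ (S (prod⁻ n) ⊛ (κ (+ 1) ⊕ ⊖ S (X (suc n))))
    ≈⟨ ⊛-cong ≋-refl (⊛-cong ≋-refl (≋-sym (≋-trans (S-⊕ (κ (+ 1)) (⊖ X (suc n))) (⊕-cong (S-κ (+ 1)) (S-⊖ (X (suc n))))))) ⟩
  odd⁻ (suc n) ⊛ (S (prod⁻ n) ⊛ S (κ (+ 1) ⊕ ⊖ X (suc n)))
    ≈⟨ ⊛-cong ≋-refl (≋-sym (S-⊛ (prod⁻ n) (κ (+ 1) ⊕ ⊖ X (suc n)))) ⟩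
  odd⁻ (suc n) ⊛ S (prod⁻ (suc n)) ∎
  where
  x = X (suc (n ℕ.+ n))
  exponent : X (suc (suc (n ℕ.+ n))) ≐ S (X (suc n))
  exponent = ≋-trans (ptw λ k → cong (λ j → X (suc j) k) (sym (ℕ.+-suc n n))) (≋-sym (S-X (suc n)))

split⁺ : ∀ n → prod⁺ (n ℕ.+ n) ≐ odd⁺ n ⊛ S (prod⁺ n)
split⁺ zero = ≋-sym (≋-trans (⊛-cong ≋-refl (S-κ (+ 1))) (solve 0 (con (+ 1) :* con (+ 1) := con (+ 1)) ≋-refl))
split⁺ (suc n) rewrite ℕ.+-suc n n = begin
  prod⁺ (n ℕ.+ n) ⊛ (κ (+ 1) ⊕ x) ⊛ (κ (+ 1) ⊕ X (suc (suc (n ℕ.+ n))))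
    ≈⟨ ⊛-cong (⊛-cong (split⁺ n) ≋-refl) (⊕-cong (≋-refl {κ (+ 1)}) exponent) ⟩
  odd⁺ n ⊛ S (prod⁺ n) ⊛ (κ (+ 1) ⊕ x) ⊛ (κ (+ 1) ⊕ S (X (suc n)))
    ≈⟨ solve 4 (λ o p x y → o :* p :* (con (+ 1) :+ x) :* (con (+ 1) :+ y) := o :* (con (+ 1) :+ con (+ 1) :* x) :* (p :* (con (+ 1) :+ y)))
         ≋-refl (odd⁺ n) (S (prod⁺ n)) x (S (X (suc n))) ⟩
  odd⁺ (suc n) ⊛ (S (prod⁺ n) ⊛ (κ (+ 1) ⊕ S (X (suc n))))
    ≈⟨ ⊛-cong ≋-refl (⊛-cong ≋-refl (≋-sym (≋-trans (S-⊕ (κ (+ 1)) (X (suc n))) (⊕-cong (S-κ (+ 1)) ≋-refl)))) ⟩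
  odd⁺ (suc n) ⊛ (S (prod⁺ n) ⊛ S (κ (+ 1) ⊕ X (suc n)))
    ≈⟨ ⊛-cong ≋-refl (≋-sym (S-⊛ (prod⁺ n) (κ (+ 1) ⊕ X (suc n)))) ⟩
  odd⁺ (suc n) ⊛ S (prod⁺ (suc n)) ∎
  where
  x = X (suc (n ℕ.+ n))
  exponent : X (suc (suc (n ℕ.+ n))) ≐ S (X (suc n))
  exponent = ≋-trans (ptw λ k → cong (λ j → X (suc j) k) (sym (ℕ.+-suc n n))) (≋-sym (S-X (suc n)))

P⁻-split : P⁻ ≐ O⁻ ⊛ S P⁻
P⁻-split = limit λ n → let module T = Ser (truncated n) in
  T.≋-trans (weaken (ℕ.m≤m+n n n) (P⁻-truncated (n ℕ.+ n))) (T.≋-trans (≐⇒≋ (split⁻ n))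
    (T.⊛-cong (T.≋-sym (O⁻-truncated n)) (S-cong-truncated n (T.≋-sym (P⁻-truncated n)))))

P⁺-split : P⁺ ≐ O⁺ ⊛ S P⁺
P⁺-split = limit λ n → let module T = Ser (truncated n) in
  T.≋-trans (weaken (ℕ.m≤m+n n n) (P⁺-truncated (n ℕ.+ n))) (T.≋-trans (≐⇒≋ (split⁺ n))
    (T.⊛-cong (T.≋-sym (O⁺-truncated n)) (S-cong-truncated n (T.≋-sym (P⁺-truncated n)))))

sign-double : ∀ n → sign (n ℕ.+ n) ≡ + 1
sign-double zero = refl
sign-double (suc n) rewrite ℕ.+-suc n n = trans (ℤ.neg-involutive _) (sign-double n)

sign-square : ∀ n → sign (square n) ≡ sign n
sign-square zero = refl
sign-square (suc n) = trans (cong sign (lemma n)) (trans (shift-sign (square n)) (cong -_ (sign-square n)))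
  where
  lemma : ∀ n → suc n ℕ.* suc n ≡ suc (n ℕ.+ n ℕ.+ n ℕ.* n)
  lemma = ℕ-Solver.solve-∀
  sign-+ : ∀ a b → sign (a ℕ.+ a ℕ.+ b) ≡ sign b
  sign-+ zero b = refl
  sign-+ (suc a) b rewrite ℕ.+-suc a a = trans (ℤ.neg-involutive _) (sign-+ a b)
  shift-sign : ∀ b → sign (suc (n ℕ.+ n ℕ.+ b)) ≡ - sign b
  shift-sign b = cong -_ (sign-+ n b)

N-term : ∀ c e → N (κ c ⊛ X e) ≐ κ (c * sign e) ⊛ X e
N-term c e = begin
  N (κ c ⊛ X e) ≈⟨ N-⊛ (κ c) (X e) ⟩
  N (κ c) ⊛ N (X e) ≈⟨ ⊛-cong (N-κ c) (N-X e) ⟩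
  κ c ⊛ (κ (sign e) ⊛ X e) ≈⟨ ≋-sym (ptw (⊛-assoc (κ c) (κ (sign e)) (X e))) ⟩
  κ c ⊛ κ (sign e) ⊛ X e ≈⟨ ⊛-cong (≋-sym (_-Raw-AlmostCommutative⟶_.*-homo (κ-homomorphism exact) c (sign e))) ≋-refl ⟩
  κ (c * sign e) ⊛ X e ∎

N-factor : ∀ c e → N (κ (+ 1) ⊕ κ c ⊛ X e) ≐ κ (+ 1) ⊕ κ (c * sign e) ⊛ X e
N-factor c e = begin
  N (κ (+ 1) ⊕ κ c ⊛ X e) ≈⟨ N-⊕ (κ (+ 1)) (κ c ⊛ X e) ⟩
  N (κ (+ 1)) ⊕ N (κ c ⊛ X e) ≈⟨ ⊕-cong (N-κ (+ 1)) (N-term c e) ⟩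
  κ (+ 1) ⊕ κ (c * sign e) ⊛ X e ∎

N-Θ : N Θ ≐ φ
N-Θ = N-diagonal go
  where
  sign² : ∀ n → sign n * sign n ≡ + 1
  sign² zero = refl
  sign² (suc n) = trans (lemma (sign n)) (sign² n)
    where
    lemma : ∀ x → - x * - x ≡ x * x
    lemma = solve-∀
  coefficient : ∀ n → + 2 * sign n * sign (square n) ≡ + 2
  coefficient n = trans (cong (_*_ (+ 2 * sign n)) (sign-square n)) (trans (ℤ.*-assoc (+ 2) (sign n) (sign n)) (cong (_*_ (+ 2)) (sign² n)))
  go : ∀ n → N (thetaSum n) ≐ phiSum n
  go zero = N-κ (+ 1)
  go (suc n) = ≋-trans (N-⊕ (thetaSum n) (κ (+ 2 * sign (suc n)) ⊛ X (square (suc n)))) (⊕-cong (go n)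
    (≋-trans (N-term (+ 2 * sign (suc n)) (square (suc n))) (ptw λ k → cong (λ c → (κ c ⊛ X (square (suc n))) k) (coefficient (suc n)))))

N-φ : N φ ≐ Θ
N-φ = ptw λ n → trans (N-cong (≋-sym N-Θ) ‼ n) (involutive Θ n)
  where
  involutive : ∀ f n → N (N f) n ≡ f n
  involutive f zero = refl
  involutive f (suc n) = trans (cong -_ (trans (N-coeff (λ k → - N (tail f) k) n) (sym (ℤ.neg-distribʳ-* (sign n) _))))
    (trans (ℤ.neg-involutive _) (trans (sym (N-coeff (N (tail f)) n)) (involutive (tail f) n)))

N-O⁻ : N O⁻ ≐ O⁺
N-O⁻ = N-diagonal go
  where
  go : ∀ n → N (odd⁻ n) ≐ odd⁺ n
  go zero = N-κ (+ 1)
  go (suc n) = ≋-trans (N-⊛ (odd⁻ n) _) (⊛-cong (go n) (≋-trans (N-factor (- + 1) (suc (n ℕ.+ n)))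
    (ptw λ k → cong (λ c → (κ (+ 1) ⊕ κ c ⊛ X (suc (n ℕ.+ n))) k) (cong (λ s → - + 1 * - s) (sign-double n)))))

N-O⁺ : N O⁺ ≐ O⁻
N-O⁺ = N-diagonal go
  where
  go : ∀ n → N (odd⁺ n) ≐ odd⁻ n
  go zero = N-κ (+ 1)
  go (suc n) = ≋-trans (N-⊛ (odd⁺ n) _) (⊛-cong (go n) (≋-trans (N-factor (+ 1) (suc (n ℕ.+ n)))
    (ptw λ k → cong (λ c → (κ (+ 1) ⊕ κ c ⊛ X (suc (n ℕ.+ n))) k) (cong (λ s → + 1 * - s) (sign-double n)))))

Θ-product : Θ ⊛ O⁺ ⊛ S P⁺ ≐ O⁻ ⊛ S P⁻
Θ-product = linear₃ (κ (+ 1)) (⊖ Θ) (κ (+ 1)) Gauss P⁺-split P⁻-split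
  (solve 7 (λ t o p q r s u → t :* o :* p := r :* s :+ con (+ 1) :* (t :* q :+ :- u) :+ (:- t) :* (q :+ :- (o :* p)) :+ con (+ 1) :* (u :+ :- (r :* s)))
    ≋-refl Θ O⁺ (S P⁺) P⁺ O⁻ (S P⁻) P⁻)

φ-product : φ ⊛ O⁻ ⊛ S P⁺ ≐ O⁺ ⊛ S P⁻
φ-product = begin
  φ ⊛ O⁻ ⊛ S P⁺ ≈⟨ ⊛-cong (⊛-cong (≋-sym N-Θ) (≋-sym N-O⁺)) (≋-sym (N-S P⁺)) ⟩
  N Θ ⊛ N O⁺ ⊛ N (S P⁺) ≈⟨ ⊛-cong (≋-sym (N-⊛ Θ O⁺)) ≋-refl ⟩
  N (Θ ⊛ O⁺) ⊛ N (S P⁺) ≈⟨ ≋-sym (N-⊛ (Θ ⊛ O⁺) (S P⁺)) ⟩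
  N (Θ ⊛ O⁺ ⊛ S P⁺) ≈⟨ N-cong Θ-product ⟩
  N (O⁻ ⊛ S P⁻) ≈⟨ N-⊛ O⁻ (S P⁻) ⟩
  N O⁻ ⊛ N (S P⁻) ≈⟨ ⊛-cong N-O⁻ (N-S P⁻) ⟩
  O⁺ ⊛ S P⁻ ∎

SΘ-product : S Θ ⊛ S P⁺ ≐ S P⁻
SΘ-product = ≋-trans (≋-sym (S-⊛ Θ P⁺)) (S-cong Gauss)

-- This is `φ(q) φ(-q) = φ(-q²)²`: in the product of the two product formulas the odd parts cancel,
-- and `Gauss` at `q²` remains.
φΘ : φ ⊛ Θ ≐ S Θ ⊛ S Θ
φΘ = ⊛-cancelʳ (O⁺ ⊛ O⁻ ⊛ (S P⁺ ⊛ S P⁺)) refl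
  (linear₃ (Θ ⊛ O⁺ ⊛ S P⁺) (O⁺ ⊛ S P⁻) (⊖ (O⁺ ⊛ O⁻ ⊛ (S P⁻ ⊕ S Θ ⊛ S P⁺))) φ-product Θ-product SΘ-product
    (solve 7 (λ f t st o⁺ o⁻ p⁺ p⁻ → f :* t :* (o⁺ :* o⁻ :* (p⁺ :* p⁺)) :=
       st :* st :* (o⁺ :* o⁻ :* (p⁺ :* p⁺)) :+ (t :* o⁺ :* p⁺) :* (f :* o⁻ :* p⁺ :+ :- (o⁺ :* p⁻))
       :+ (o⁺ :* p⁻) :* (t :* o⁺ :* p⁺ :+ :- (o⁻ :* p⁻)) :+ (:- (o⁺ :* o⁻ :* (p⁻ :+ st :* p⁺))) :* (st :* p⁺ :+ :- p⁻))
      ≋-refl φ Θ (S Θ) O⁺ O⁻ (S P⁺) (S P⁻)))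

φ/Θ : φ ⊛ (O⁻ ⊛ O⁻) ≐ Θ ⊛ (O⁺ ⊛ O⁺)
φ/Θ = ⊛-cancelʳ (S P⁺) refl
  (linear₂ O⁻ (⊖ O⁺) φ-product Θ-product
    (solve 6 (λ f t o⁺ o⁻ p⁺ p⁻ → f :* (o⁻ :* o⁻) :* p⁺ := t :* (o⁺ :* o⁺) :* p⁺
       :+ o⁻ :* (f :* o⁻ :* p⁺ :+ :- (o⁺ :* p⁻)) :+ (:- o⁺) :* (t :* o⁺ :* p⁺ :+ :- (o⁻ :* p⁻)))
      ≋-refl φ Θ O⁺ O⁻ (S P⁺) (S P⁻)))

-- Even and odd squares: `(2n)² = 4n²`, and `(2n + 1)²` is one more than eight times a triangular
-- number.
φ-dissection : φ ≐ S (S φ) ⊕ κ (+ 2) ⊛ X 1 ⊛ S (S (S ψ))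
φ-dissection = limit λ n → let module T = Ser (truncated n) in
  T.≋-trans (weaken (ℕ.m≤n⇒m≤1+n (ℕ.m≤m+n n n)) (φ-truncated (suc (n ℕ.+ n)))) (T.≋-trans (≐⇒≋ (go n))
    (T.⊕-cong (S-cong-truncated n (S-cong-truncated n (T.≋-sym (φ-truncated n))))
      (T.⊛-cong T.≋-refl (S-cong-truncated n (S-cong-truncated n (S-cong-truncated n (T.≋-sym (ψ-truncated n))))))))
  where
  S²-term : ∀ c e → S (S (κ c ⊛ X e)) ≐ κ c ⊛ X (4 ℕ.* e)
  S²-term c e = begin
    S (S (κ c ⊛ X e)) ≈⟨ S-cong (S-term c e) ⟩
    S (κ c ⊛ X (e ℕ.+ e)) ≈⟨ S-term c (e ℕ.+ e) ⟩
    κ c ⊛ X (e ℕ.+ e ℕ.+ (e ℕ.+ e)) ≡⟨ cong (λ j → κ c ⊛ X j) (lemma e) ⟩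
    κ c ⊛ X (4 ℕ.* e) ∎
    where
    S-term : ∀ c e → S (κ c ⊛ X e) ≐ κ c ⊛ X (e ℕ.+ e)
    S-term c e = ≋-trans (S-⊛ (κ c) (X e)) (⊛-cong (S-κ c) (S-X e))
    lemma : ∀ e → e ℕ.+ e ℕ.+ (e ℕ.+ e) ≡ 4 ℕ.* e
    lemma = ℕ-Solver.solve-∀
  triangle-closed : ∀ n → triangle n ℕ.+ triangle n ≡ n ℕ.* suc n
  triangle-closed zero = refl
  triangle-closed (suc n) = trans (lemma₁ (triangle n) n) (trans (cong (λ t → t ℕ.+ (suc n ℕ.+ suc n)) (triangle-closed n)) (lemma₂ n))
    where
    lemma₁ : ∀ t n → t ℕ.+ suc n ℕ.+ (t ℕ.+ suc n) ≡ t ℕ.+ t ℕ.+ (suc n ℕ.+ suc n)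
    lemma₁ = ℕ-Solver.solve-∀
    lemma₂ : ∀ n → n ℕ.* suc n ℕ.+ (suc n ℕ.+ suc n) ≡ suc n ℕ.* suc (suc n)
    lemma₂ = ℕ-Solver.solve-∀
  even-square : ∀ n → square (suc (suc (n ℕ.+ n))) ≡ 4 ℕ.* square (suc n)
  even-square = unfolded
    where
    unfolded : ∀ n → suc (suc (n ℕ.+ n)) ℕ.* suc (suc (n ℕ.+ n)) ≡ 4 ℕ.* (suc n ℕ.* suc n)
    unfolded = ℕ-Solver.solve-∀
  odd-square : ∀ n → square (suc (n ℕ.+ n)) ≡ suc (4 ℕ.* (triangle n ℕ.+ triangle n))
  odd-square n = trans (unfolded n) (cong (λ t → suc (4 ℕ.* t)) (sym (triangle-closed n)))
    where
    unfolded : ∀ n → suc (n ℕ.+ n) ℕ.* suc (n ℕ.+ n) ≡ suc (4 ℕ.* (n ℕ.* suc n))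
    unfolded = ℕ-Solver.solve-∀
  S³-term : ∀ n → X 1 ⊛ S (S (S (κ (+ 1) ⊛ X (triangle n)))) ≐ X (square (suc (n ℕ.+ n)))
  S³-term n = begin
    X 1 ⊛ S (S (S (κ (+ 1) ⊛ X (triangle n))))
      ≈⟨ ⊛-cong ≋-refl (S-cong (S-cong (≋-trans (S-⊛ (κ (+ 1)) (X (triangle n))) (⊛-cong (S-κ (+ 1)) (S-X (triangle n)))))) ⟩
    X 1 ⊛ S (S (κ (+ 1) ⊛ X (triangle n ℕ.+ triangle n))) ≈⟨ ⊛-cong ≋-refl (S²-term (+ 1) (triangle n ℕ.+ triangle n)) ⟩
    X 1 ⊛ (κ (+ 1) ⊛ X (4 ℕ.* (triangle n ℕ.+ triangle n))) ≈⟨ solve 2 (λ x y → x :* (con (+ 1) :* y) := x :* y) ≋-refl (X 1) (X (4 ℕ.* (triangle n ℕ.+ triangle n))) ⟩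
    X 1 ⊛ X (4 ℕ.* (triangle n ℕ.+ triangle n)) ≈⟨ ≋-sym (X-suc (4 ℕ.* (triangle n ℕ.+ triangle n))) ⟩
    X (suc (4 ℕ.* (triangle n ℕ.+ triangle n))) ≡⟨ cong X (sym (odd-square n)) ⟩
    X (square (suc (n ℕ.+ n))) ∎
  go : ∀ n → phiSum (suc (n ℕ.+ n)) ≐ S (S (phiSum n)) ⊕ κ (+ 2) ⊛ X 1 ⊛ S (S (S (psiSum n)))
  go zero = ≋-sym (begin
    S (S (κ (+ 1))) ⊕ κ (+ 2) ⊛ X 1 ⊛ S (S (S (κ (+ 1))))
      ≈⟨ ⊕-cong (≋-trans (S-cong (S-κ (+ 1))) (S-κ (+ 1))) (⊛-cong ≋-refl (≋-trans (S-cong (≋-trans (S-cong (S-κ (+ 1))) (S-κ (+ 1)))) (S-κ (+ 1)))) ⟩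
    κ (+ 1) ⊕ κ (+ 2) ⊛ X 1 ⊛ κ (+ 1) ≈⟨ solve 1 (λ x → con (+ 1) :+ con (+ 2) :* x :* con (+ 1) := con (+ 1) :+ con (+ 2) :* x) ≋-refl (X 1) ⟩
    κ (+ 1) ⊕ κ (+ 2) ⊛ X 1 ∎)
  go (suc n) = begin
    phiSum (suc (n ℕ.+ suc n)) ⊕ κ (+ 2) ⊛ X (square (suc (suc n ℕ.+ suc n)))
      ≈⟨ ⊕-cong (ptw λ k → cong (λ j → phiSum (suc j) k) (ℕ.+-suc n n)) (⊛-cong ≋-refl (≋-sym (S³-term (suc n)))) ⟩
    phiSum (suc (n ℕ.+ n)) ⊕ κ (+ 2) ⊛ X (square (suc (suc (n ℕ.+ n)))) ⊕ κ (+ 2) ⊛ (X 1 ⊛ S (S (S (κ (+ 1) ⊛ X (triangle (suc n))))))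
      ≈⟨ ⊕-cong (⊕-cong (go n) (≋-trans (ptw λ k → cong (λ j → (κ (+ 2) ⊛ X j) k) (even-square n)) (≋-sym (S²-term (+ 2) (square (suc n)))))) ≋-refl ⟩
    S (S (phiSum n)) ⊕ κ (+ 2) ⊛ X 1 ⊛ S (S (S (psiSum n))) ⊕ S (S t₁) ⊕ κ (+ 2) ⊛ (X 1 ⊛ S (S (S t₂)))
      ≈⟨ solve 5 (λ a x b c d → a :+ con (+ 2) :* x :* b :+ c :+ con (+ 2) :* (x :* d) := (a :+ c) :+ con (+ 2) :* x :* (b :+ d)) ≋-refl
           (S (S (phiSum n))) (X 1) (S (S (S (psiSum n)))) (S (S t₁)) (S (S (S t₂))) ⟩
    (S (S (phiSum n)) ⊕ S (S t₁)) ⊕ κ (+ 2) ⊛ X 1 ⊛ (S (S (S (psiSum n))) ⊕ S (S (S t₂)))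
      ≈⟨ ⊕-cong (≋-sym (≋-trans (S-cong (S-⊕ _ t₁)) (S-⊕ _ (S t₁))))
                (⊛-cong ≋-refl (≋-sym (≋-trans (S-cong (S-cong (S-⊕ _ t₂))) (≋-trans (S-cong (S-⊕ _ (S t₂))) (S-⊕ _ (S (S t₂))))))) ⟩
    S (S (phiSum (suc n))) ⊕ κ (+ 2) ⊛ X 1 ⊛ S (S (S (psiSum (suc n)))) ∎
    where
    t₁ = κ (+ 2) ⊛ X (square (suc n))
    t₂ = κ (+ 1) ⊛ X (triangle (suc n))

N-X1 : N (X 1) ≐ ⊖ X 1
N-X1 = ≋-trans (N-X 1) (solve 1 (λ x → con (- + 1) :* x := :- x) ≋-refl (X 1))

S-X1 : S (X 1) ≐ X 1 ⊛ X 1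
S-X1 = ≋-trans (S-X 1) (X-+ 1 1)

Θ-dissection : Θ ≐ S (S φ) ⊕ ⊖ (κ (+ 2) ⊛ X 1 ⊛ S (S (S ψ)))
Θ-dissection = begin
  Θ ≈⟨ ≋-sym N-φ ⟩
  N φ ≈⟨ N-cong φ-dissection ⟩
  N (S (S φ) ⊕ κ (+ 2) ⊛ X 1 ⊛ Q) ≈⟨ N-⊕ (S (S φ)) (κ (+ 2) ⊛ X 1 ⊛ Q) ⟩
  N (S (S φ)) ⊕ N (κ (+ 2) ⊛ X 1 ⊛ Q) ≈⟨ ⊕-cong (N-S (S φ)) (≋-trans (N-⊛ (κ (+ 2) ⊛ X 1) Q) (⊛-cong (N-⊛ (κ (+ 2)) (X 1)) (N-S (S (S ψ))))) ⟩
  S (S φ) ⊕ N (κ (+ 2)) ⊛ N (X 1) ⊛ Q ≈⟨ ⊕-cong (≋-refl {S (S φ)}) (⊛-cong (⊛-cong (N-κ (+ 2)) N-X1) (≋-refl {Q})) ⟩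
  S (S φ) ⊕ κ (+ 2) ⊛ (⊖ X 1) ⊛ Q ≈⟨ solve 3 (λ p x q → p :+ con (+ 2) :* (:- x) :* q := p :+ :- (con (+ 2) :* x :* q)) ≋-refl (S (S φ)) (X 1) Q ⟩
  S (S φ) ⊕ ⊖ (κ (+ 2) ⊛ X 1 ⊛ Q) ∎
  where Q = S (S (S ψ))

S-term² : ∀ f g → S (f ⊛ f ⊕ κ (+ 4) ⊛ X 1 ⊛ (g ⊛ g)) ≐ S f ⊛ S f ⊕ κ (+ 4) ⊛ (X 1 ⊛ X 1) ⊛ (S g ⊛ S g)
S-term² f g = ≋-trans (S-⊕ (f ⊛ f) (κ (+ 4) ⊛ X 1 ⊛ (g ⊛ g))) (⊕-cong (S-⊛ f f)
  (≋-trans (S-⊛ (κ (+ 4) ⊛ X 1) (g ⊛ g)) (⊛-cong (≋-trans (S-⊛ (κ (+ 4)) (X 1)) (⊛-cong (S-κ (+ 4)) S-X1)) (S-⊛ g g))))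

-- After `q ↦ q²` the left side is `φ ⊛ Θ` by `φΘ`, and the dissections of `φ` and `Θ` are a sum and
-- a difference of the same two series.
Θ²-duplication : Θ ⊛ Θ ≐ S φ ⊛ S φ ⊕ ⊖ (κ (+ 4) ⊛ X 1 ⊛ (S (S ψ) ⊛ S (S ψ)))
Θ²-duplication = S-injective (begin
  S (Θ ⊛ Θ) ≈⟨ S-⊛ Θ Θ ⟩
  S Θ ⊛ S Θ ≈⟨ ≋-sym φΘ ⟩
  φ ⊛ Θ ≈⟨ ⊛-cong φ-dissection Θ-dissection ⟩
  (P ⊕ κ (+ 2) ⊛ X 1 ⊛ Q) ⊛ (P ⊕ ⊖ (κ (+ 2) ⊛ X 1 ⊛ Q))
    ≈⟨ solve 3 (λ p x q → (p :+ con (+ 2) :* x :* q) :* (p :+ :- (con (+ 2) :* x :* q)) := p :* p :+ :- (con (+ 4) :* (x :* x) :* (q :* q)))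
         ≋-refl P (X 1) Q ⟩
  P ⊛ P ⊕ ⊖ (κ (+ 4) ⊛ (X 1 ⊛ X 1) ⊛ (Q ⊛ Q))
    ≈⟨ ≋-sym (≋-trans (S-⊕ (S φ ⊛ S φ) (⊖ t)) (⊕-cong (S-⊛ (S φ) (S φ)) (≋-trans (S-⊖ t) (⊖-cong
         (≋-trans (S-⊛ (κ (+ 4) ⊛ X 1) (S (S ψ) ⊛ S (S ψ))) (⊛-cong (≋-trans (S-⊛ (κ (+ 4)) (X 1)) (⊛-cong (S-κ (+ 4)) S-X1)) (S-⊛ (S (S ψ)) (S (S ψ))))))))) ⟩
  S (S φ ⊛ S φ ⊕ ⊖ t) ∎)
  where
  P = S (S φ)
  Q = S (S (S ψ))
  t = κ (+ 4) ⊛ X 1 ⊛ (S (S ψ) ⊛ S (S ψ))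

φ²-duplication : φ ⊛ φ ≐ S φ ⊛ S φ ⊕ κ (+ 4) ⊛ X 1 ⊛ (S (S ψ) ⊛ S (S ψ))
φ²-duplication = begin
  φ ⊛ φ ≈⟨ ≋-sym (≋-trans (N-⊛ Θ Θ) (⊛-cong N-Θ N-Θ)) ⟩
  N (Θ ⊛ Θ) ≈⟨ N-cong Θ²-duplication ⟩
  N (S φ ⊛ S φ ⊕ ⊖ t) ≈⟨ N-cong (⊕-cong (≋-refl {S φ ⊛ S φ}) (solve 2 (λ x r → :- (con (+ 4) :* x :* r) := con (- + 4) :* x :* r) ≋-refl (X 1) R)) ⟩
  N (S φ ⊛ S φ ⊕ κ (- + 4) ⊛ X 1 ⊛ R) ≈⟨ N-⊕ (S φ ⊛ S φ) (κ (- + 4) ⊛ X 1 ⊛ R) ⟩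
  N (S φ ⊛ S φ) ⊕ N (κ (- + 4) ⊛ X 1 ⊛ R)
    ≈⟨ ⊕-cong (≋-trans (N-⊛ (S φ) (S φ)) (⊛-cong (N-S φ) (N-S φ)))
              (≋-trans (N-⊛ (κ (- + 4) ⊛ X 1) R) (⊛-cong (≋-trans (N-⊛ (κ (- + 4)) (X 1)) (⊛-cong (N-κ (- + 4)) N-X1))
                 (≋-trans (N-⊛ (S (S ψ)) (S (S ψ))) (⊛-cong (N-S (S ψ)) (N-S (S ψ)))))) ⟩
  S φ ⊛ S φ ⊕ κ (- + 4) ⊛ (⊖ X 1) ⊛ R
    ≈⟨ solve 3 (λ p x r → p :+ con (- + 4) :* (:- x) :* r := p :+ con (+ 4) :* x :* r) ≋-refl (S φ ⊛ S φ) (X 1) R ⟩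
  S φ ⊛ S φ ⊕ κ (+ 4) ⊛ X 1 ⊛ R ∎
  where
  R = S (S ψ) ⊛ S (S ψ)
  t = κ (+ 4) ⊛ X 1 ⊛ R

4q-cancel : ∀ {f g} → κ (+ 4) ⊛ X 1 ⊛ f ≐ κ (+ 4) ⊛ X 1 ⊛ g → f ≐ g
4q-cancel {f} {g} h = ptw λ n → ℤ.*-cancelˡ-≡ (+ 4) (f n) (g n) (trans (sym (coefficient f n)) (trans (h ‼ suc n) (coefficient g n)))
  where
  coefficient : ∀ f n → (κ (+ 4) ⊛ X 1 ⊛ f) (suc n) ≡ + 4 * f n
  coefficient f n = trans (⊛-assoc (κ (+ 4)) (X 1) f (suc n)) (trans (κ-⊛ (+ 4) (X 1 ⊛ f) (suc n)) (cong (_*_ (+ 4)) (sym (shift-X {exact} f ‼ suc n))))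

-- Squaring the dissection of `φ`, and applying `φ²-duplication` at `q` and at `q²`, gives two
-- expansions of `φ²`. What remains after cancellation is the claim at `q⁴`, multiplied by `4q`.
ψ²-duplication : ψ ⊛ ψ ≐ φ ⊛ S ψ
ψ²-duplication = S-injective (S-injective (begin
  S (S (ψ ⊛ ψ)) ≈⟨ ≋-trans (S-cong (S-⊛ ψ ψ)) (S-⊛ (S ψ) (S ψ)) ⟩
  S (S ψ) ⊛ S (S ψ) ≈⟨ 4q-cancel main ⟩
  S (S φ) ⊛ S (S (S ψ)) ≈⟨ ≋-sym (≋-trans (S-cong (S-⊛ φ (S ψ))) (S-⊛ (S φ) (S (S ψ)))) ⟩
  S (S (φ ⊛ S ψ)) ∎))
  where
  P = S (S φ)
  Q = S (S (S ψ))
  R = S (S ψ) ⊛ S (S ψ)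
  doubled : S φ ⊛ S φ ≐ P ⊛ P ⊕ κ (+ 4) ⊛ (X 1 ⊛ X 1) ⊛ (Q ⊛ Q)
  doubled = ≋-trans (≋-sym (S-⊛ φ φ)) (≋-trans (S-cong φ²-duplication) (S-term² (S φ) (S (S ψ))))
  main : κ (+ 4) ⊛ X 1 ⊛ R ≐ κ (+ 4) ⊛ X 1 ⊛ (P ⊛ Q)
  main = linear₃ (⊖ κ (+ 1)) (⊖ κ (+ 1)) (φ ⊕ (P ⊕ κ (+ 2) ⊛ X 1 ⊛ Q)) φ²-duplication doubled φ-dissection
    (solve 6 (λ f s x p q r → con (+ 4) :* x :* r := con (+ 4) :* x :* (p :* q)
        :+ (:- con (+ 1)) :* (f :* f :+ :- (s :* s :+ con (+ 4) :* x :* r))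
        :+ (:- con (+ 1)) :* (s :* s :+ :- (p :* p :+ con (+ 4) :* (x :* x) :* (q :* q)))
        :+ (f :+ (p :+ con (+ 2) :* x :* q)) :* (f :+ :- (p :+ con (+ 2) :* x :* q)))
      ≋-refl φ (S φ) (X 1) P Q R)

vanishing-⊛ : ∀ {f} g n → (∀ k → k < n → f k ≡ + 0) → (f ⊛ g) n ≡ f n * g 0
vanishing-⊛ g zero h = refl
vanishing-⊛ {f} g (suc n) h = trans (cong₂ _+_ (cong (_* g (suc n)) (h 0 (s≤s z≤n))) (vanishing-⊛ g n (λ k k<n → h (suc k) (s≤s k<n)))) (ℤ.+-identityˡ _)

vanishing-⊛′ : ∀ {f} g n → (∀ k → k < n → f k ≡ + 0) → ∀ k → k < n → (f ⊛ g) k ≡ + 0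
vanishing-⊛′ g n h k k<n = trans (vanishing-⊛ g k (λ j j<k → h j (ℕ.<-trans j<k k<n))) (cong (_* g 0) (h k k<n))

-- For `δ = ρ - 1` the hypothesis reads `2 δ + δ² = S δ`. At the lowest possible order of `δ`, which
-- is positive, neither the square nor `S δ` contributes.
square-root-of-unity : ∀ ρ → ρ 0 ≡ + 1 → ρ ⊛ ρ ≐ S ρ → ρ ≐ κ (+ 1)
square-root-of-unity ρ ρ0 h = begin
  ρ ≈⟨ solve 1 (λ r → r := (r :+ :- con (+ 1)) :+ con (+ 1)) ≋-refl ρ ⟩
  δ ⊕ κ (+ 1) ≈⟨ ⊕-cong (ptw {g = κ (+ 0)} λ n → trans (strong-induction (λ n → δ n ≡ + 0) step n) (sym (κ0 n))) (≋-refl {κ (+ 1)}) ⟩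
  κ (+ 0) ⊕ κ (+ 1) ≈⟨ solve 0 (con (+ 0) :+ con (+ 1) := con (+ 1)) ≋-refl ⟩
  κ (+ 1) ∎
  where
  δ = ρ ⊕ ⊖ κ (+ 1)
  κ0 : ∀ n → κ (+ 0) n ≡ + 0
  κ0 zero = refl
  κ0 (suc n) = refl
  relation : κ (+ 2) ⊛ δ ⊕ δ ⊛ δ ≐ S δ
  relation = ≋-sym (begin
    S (ρ ⊕ ⊖ κ (+ 1)) ≈⟨ S-⊕ ρ (⊖ κ (+ 1)) ⟩
    S ρ ⊕ S (⊖ κ (+ 1)) ≈⟨ ⊕-cong (≋-sym h) (≋-trans (S-⊖ (κ (+ 1))) (⊖-cong (S-κ (+ 1)))) ⟩
    ρ ⊛ ρ ⊕ ⊖ κ (+ 1) ≈⟨ solve 1 (λ r → r :* r :+ :- con (+ 1) := con (+ 2) :* (r :+ :- con (+ 1)) :+ (r :+ :- con (+ 1)) :* (r :+ :- con (+ 1))) ≋-refl ρ ⟩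
    κ (+ 2) ⊛ δ ⊕ δ ⊛ δ ∎)
  δ0 : δ 0 ≡ + 0
  δ0 = cong (_+ - + 1) ρ0
  step : ∀ n → (∀ k → k < n → δ k ≡ + 0) → δ n ≡ + 0
  step zero ih = δ0
  step (suc n) ih = ℤ.*-cancelˡ-≡ (+ 2) (δ (suc n)) (+ 0) (E.begin
    + 2 * δ (suc n) E.≡⟨ sym (κ-⊛ (+ 2) δ (suc n)) ⟩
    (κ (+ 2) ⊛ δ) (suc n) E.≡⟨ sym (ℤ.+-identityʳ _) ⟩
    (κ (+ 2) ⊛ δ) (suc n) + + 0 E.≡⟨ cong (_+_ ((κ (+ 2) ⊛ δ) (suc n))) (sym (trans (vanishing-⊛ δ (suc n) ih) (trans (cong (_*_ (δ (suc n))) δ0) (ℤ.*-zeroʳ (δ (suc n)))))) ⟩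
    (κ (+ 2) ⊛ δ ⊕ δ ⊛ δ) (suc n) E.≡⟨ relation ‼ suc n ⟩
    S δ (suc n) E.≡⟨ S-vanishing (suc n) ih (suc n) (s≤s (ℕ.m≤n+m (suc n) n)) ⟩
    + 0 E.∎)
    where module E = ≡-Reasoning

-- Gauss's product for `ψ`. The duplication formulas show that the quotient `ρ` of the two sides
-- satisfies `ρ² = S ρ`, so it is `1`.
ψP⁻ : ψ ⊛ P⁻ ≐ S P⁻ ⊛ S P⁻
ψP⁻ = begin
  w ≈⟨ linear₁ (⊖ w) v-inverse (solve 3 (λ w v r → w := w :* r :* v :+ (:- w) :* (v :* r :+ :- con (+ 1))) ≋-refl w v r) ⟩
  w ⊛ r ⊛ v ≈⟨ ⊛-cong (square-root-of-unity (w ⊛ r) refl relation) (≋-refl {v}) ⟩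
  κ (+ 1) ⊛ v ≈⟨ solve 1 (λ v → con (+ 1) :* v := v) ≋-refl v ⟩
  v ∎
  where
  w = ψ ⊛ P⁻
  v = S P⁻ ⊛ S P⁻
  r = recip v
  v-inverse : v ⊛ r ≐ κ (+ 1)
  v-inverse = recip-inverse v refl
  Sv-inverse : S v ⊛ S r ≐ κ (+ 1)
  Sv-inverse = ≋-trans (≋-sym (S-⊛ v r)) (≋-trans (S-cong v-inverse) (S-κ (+ 1)))
  ΘSP : Θ ⊛ S P⁻ ≐ P⁻ ⊛ P⁻
  ΘSP = linear₂ P⁻ (⊖ Θ) Gauss P⁻P⁺
    (solve 4 (λ t s p b → t :* s := p :* p :+ p :* (t :* b :+ :- p) :+ (:- t) :* (p :* b :+ :- s)) ≋-refl Θ (S P⁻) P⁻ P⁺)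
  Sv : S v ≐ S (S P⁻) ⊛ S (S P⁻)
  Sv = S-⊛ (S P⁻) (S P⁻)
  SΘSSP : S Θ ⊛ S (S P⁻) ≐ v
  SΘSSP = ≋-trans (≋-sym (S-⊛ Θ (S P⁻))) (≋-trans (S-cong ΘSP) (S-⊛ P⁻ P⁻))
  crossed : w ⊛ w ⊛ S v ≐ S w ⊛ (v ⊛ v)
  crossed = begin
    w ⊛ w ⊛ S v ≈⟨ ⊛-cong (≋-refl {w ⊛ w}) Sv ⟩
    w ⊛ w ⊛ (S (S P⁻) ⊛ S (S P⁻)) ≈⟨ solve 3 (λ y p s → (y :* p) :* (y :* p) :* (s :* s) := (y :* y) :* (p :* p) :* (s :* s)) ≋-refl ψ P⁻ (S (S P⁻)) ⟩
    (ψ ⊛ ψ) ⊛ (P⁻ ⊛ P⁻) ⊛ (S (S P⁻) ⊛ S (S P⁻)) ≈⟨ ⊛-cong (⊛-cong ψ²-duplication (≋-sym ΘSP)) (≋-refl {S (S P⁻) ⊛ S (S P⁻)}) ⟩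
    (φ ⊛ S ψ) ⊛ (Θ ⊛ S P⁻) ⊛ (S (S P⁻) ⊛ S (S P⁻))
      ≈⟨ solve 5 (λ f y t s z → (f :* y) :* (t :* s) :* (z :* z) := (f :* t) :* (y :* s) :* (z :* z)) ≋-refl φ (S ψ) Θ (S P⁻) (S (S P⁻)) ⟩
    (φ ⊛ Θ) ⊛ (S ψ ⊛ S P⁻) ⊛ (S (S P⁻) ⊛ S (S P⁻)) ≈⟨ ⊛-cong (⊛-cong φΘ (≋-sym (S-⊛ ψ P⁻))) (≋-refl {S (S P⁻) ⊛ S (S P⁻)}) ⟩
    (S Θ ⊛ S Θ) ⊛ S w ⊛ (S (S P⁻) ⊛ S (S P⁻)) ≈⟨ solve 3 (λ t w z → (t :* t) :* w :* (z :* z) := w :* ((t :* z) :* (t :* z))) ≋-refl (S Θ) (S w) (S (S P⁻)) ⟩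
    S w ⊛ ((S Θ ⊛ S (S P⁻)) ⊛ (S Θ ⊛ S (S P⁻))) ≈⟨ ⊛-cong (≋-refl {S w}) (⊛-cong SΘSSP SΘSSP) ⟩
    S w ⊛ (v ⊛ v) ∎
  relation : (w ⊛ r) ⊛ (w ⊛ r) ≐ S (w ⊛ r)
  relation = ≋-trans (linear₃ (r ⊛ r ⊛ S r) (S w ⊛ S r ⊛ (v ⊛ r ⊕ κ (+ 1))) (⊖ (w ⊛ w ⊛ r ⊛ r)) crossed v-inverse Sv-inverse
      (solve 6 (λ w r Sw Sr v Sv → (w :* r) :* (w :* r) := Sw :* Sr :+ (r :* r :* Sr) :* (w :* w :* Sv :+ :- (Sw :* (v :* v)))
          :+ (Sw :* Sr :* (v :* r :+ con (+ 1))) :* (v :* r :+ :- con (+ 1)) :+ (:- (w :* w :* r :* r)) :* (Sv :* Sr :+ :- con (+ 1)))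
        ≋-refl w r (S w) (S r) v (S v)))
    (≋-sym (S-⊛ w r))

ψΘ : ψ ⊛ Θ ≐ P⁻ ⊛ S P⁻
ψΘ = ⊛-cancelʳ (P⁻ ⊛ P⁺) refl (linear₃ (Θ ⊛ P⁺) (S P⁻ ⊛ S P⁻) (⊖ (P⁻ ⊛ S P⁻)) ψP⁻ Gauss P⁻P⁺
  (solve 5 (λ y t p b s → y :* t :* (p :* b) := p :* s :* (p :* b) :+ (t :* b) :* (y :* p :+ :- (s :* s)) :+ (s :* s) :* (t :* b :+ :- p)
      :+ (:- (p :* s)) :* (p :* b :+ :- s)) ≋-refl ψ Θ P⁻ P⁺ (S P⁻)))

-- The modular parametrisation u and the weight-one form F

-- `F = φ(q²)²` and `β = q ψ(q⁴)²`, with `a = 1 / F` and `u = β / F`. In terms of elliptic functions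
-- of nome `q²`, `4u` is the modulus `k` and `F` is `2K / π`.
F β a u : Series
F = S (φ ⊛ φ)
β = X 1 ⊛ S (S (ψ ⊛ ψ))
a = recip F
u = β ⊛ a

Fa : F ⊛ a ≐ κ (+ 1)
Fa = recip-inverse F refl

SFa : S F ⊛ S a ≐ κ (+ 1)
SFa = ≋-trans (≋-sym (S-⊛ F a)) (≋-trans (S-cong Fa) (S-κ (+ 1)))

uF : u ⊛ F ≐ β
uF = linear₁ β Fa (solve 3 (λ b f a → b :* a :* f := b :+ b :* (f :* a :+ :- con (+ 1))) ≋-refl β F a)

SuF : S u ⊛ S F ≐ S β
SuF = ≋-trans (≋-sym (S-⊛ u F)) (S-cong uF)

SF-split : S F ≐ S (S φ) ⊛ S (S φ)
SF-split = ≋-trans (S-cong (S-⊛ φ φ)) (S-⊛ (S φ) (S φ))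

Sβ-split : S β ≐ (X 1 ⊛ X 1) ⊛ (S (S (S ψ)) ⊛ S (S (S ψ)))
Sβ-split = ≋-trans (S-⊛ (X 1) (S (S (ψ ⊛ ψ)))) (⊛-cong S-X1
  (≋-trans (S-cong (≋-trans (S-cong (S-⊛ ψ ψ)) (S-⊛ (S ψ) (S ψ)))) (S-⊛ (S (S ψ)) (S (S ψ)))))

k₂ k₂⁻ : Series
k₂ = κ (+ 1) ⊕ κ (+ 4) ⊛ S u
k₂⁻ = κ (+ 1) ⊕ ⊖ (κ (+ 4) ⊛ S u)

landen₁ : F ≐ S F ⊛ k₂
landen₁ = begin
  F ≈⟨ S-cong φ²-duplication ⟩
  S (S φ ⊛ S φ ⊕ κ (+ 4) ⊛ X 1 ⊛ (S (S ψ) ⊛ S (S ψ)))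
    ≈⟨ S-term² (S φ) (S (S ψ)) ⟩
  S (S φ) ⊛ S (S φ) ⊕ κ (+ 4) ⊛ (X 1 ⊛ X 1) ⊛ (S (S (S ψ)) ⊛ S (S (S ψ)))
    ≈⟨ ⊕-cong (≋-sym SF-split) (ptw (⊛-assoc (κ (+ 4)) (X 1 ⊛ X 1) (S (S (S ψ)) ⊛ S (S (S ψ))))) ⟩
  S F ⊕ κ (+ 4) ⊛ ((X 1 ⊛ X 1) ⊛ (S (S (S ψ)) ⊛ S (S (S ψ))))
    ≈⟨ ⊕-cong (≋-refl {S F}) (⊛-cong (≋-refl {κ (+ 4)}) (≋-sym (≋-trans SuF Sβ-split))) ⟩
  S F ⊕ κ (+ 4) ⊛ (S u ⊛ S F)
    ≈⟨ solve 2 (λ f v → f :+ con (+ 4) :* (v :* f) := f :* (con (+ 1) :+ con (+ 4) :* v)) ≋-refl (S F) (S u) ⟩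
  S F ⊛ k₂ ∎

landen₂ : β ⊛ β ≐ S β ⊛ S F
landen₂ = begin
  β ⊛ β ≈⟨ ⊛-cong β′ β′ ⟩
  (X 1 ⊛ (p ⊛ q)) ⊛ (X 1 ⊛ (p ⊛ q)) ≈⟨ solve 3 (λ x p q → (x :* (p :* q)) :* (x :* (p :* q)) := (x :* x) :* (q :* q) :* (p :* p)) ≋-refl (X 1) p q ⟩
  (X 1 ⊛ X 1) ⊛ (q ⊛ q) ⊛ (p ⊛ p) ≈⟨ ⊛-cong (≋-sym Sβ-split) (≋-sym SF-split) ⟩
  S β ⊛ S F ∎
  where
  p = S (S φ)
  q = S (S (S ψ))
  β′ : β ≐ X 1 ⊛ (p ⊛ q)
  β′ = ⊛-cong (≋-refl {X 1}) (≋-trans (S-cong (S-cong ψ²-duplication)) (≋-trans (S-cong (S-⊛ φ (S ψ))) (S-⊛ (S φ) (S (S ψ)))))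

-- Landen's transformation of the modulus: with `k = 4 u(q)` and `l = 4 u(q²)` it says
-- `k² (1 + l)² = 4 l`.
uk₂-square : (u ⊛ k₂) ⊛ (u ⊛ k₂) ≐ S u
uk₂-square = ⊛-cancelʳ (S F ⊛ S F) refl
  (linear₃ (⊖ (u ⊛ u ⊛ (F ⊕ S F ⊛ k₂))) (u ⊛ F ⊕ β) (κ (+ 1)) landen₁ uF landen₂ (linear₁ (⊖ S F) SuF
    (solve 7 (λ u k f F b Sb v → (u :* k) :* (u :* k) :* (f :* f) := v :* (f :* f) :+ (:- (u :* u :* (F :+ f :* k))) :* (F :+ :- (f :* k))
        :+ (u :* F :+ b) :* (u :* F :+ :- b) :+ con (+ 1) :* (b :* b :+ :- (Sb :* f)) :+ (:- f) :* (v :* f :+ :- Sb))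
      ≋-refl u k₂ (S F) F β (S β) (S u))))

κ-cancel : ∀ c .{{_ : ℤ.NonZero c}} {f g} → κ c ⊛ f ≐ κ c ⊛ g → f ≐ g
κ-cancel c {f} {g} h = ptw λ n → ℤ.*-cancelˡ-≡ c (f n) (g n) (trans (sym (κ-⊛ c f n)) (trans (h ‼ n) (κ-⊛ c g n)))

D-k₂ : D k₂ ≐ κ (+ 8) ⊛ S (D u)
D-k₂ = begin
  D (κ (+ 1) ⊕ κ (+ 4) ⊛ S u) ≈⟨ D-⊕ (κ (+ 1)) (κ (+ 4) ⊛ S u) ⟩
  D (κ (+ 1)) ⊕ D (κ (+ 4) ⊛ S u) ≈⟨ ⊕-cong (D-κ (+ 1)) (D-⊛ (κ (+ 4)) (S u)) ⟩
  κ (+ 0) ⊕ (D (κ (+ 4)) ⊛ S u ⊕ κ (+ 4) ⊛ D (S u)) ≈⟨ ⊕-cong (≋-refl {κ (+ 0)}) (⊕-cong (⊛-cong (D-κ (+ 4)) (≋-refl {S u})) (⊛-cong (≋-refl {κ (+ 4)}) (D-S u))) ⟩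
  κ (+ 0) ⊕ (κ (+ 0) ⊛ S u ⊕ κ (+ 4) ⊛ (κ (+ 2) ⊛ S (D u)))
    ≈⟨ solve 2 (λ v d → con (+ 0) :+ (con (+ 0) :* v :+ con (+ 4) :* (con (+ 2) :* d)) := con (+ 8) :* d) ≋-refl (S u) (S (D u)) ⟩
  κ (+ 8) ⊛ S (D u) ∎

Du-relation : u ⊛ D u ⊛ (k₂ ⊛ k₂ ⊛ k₂) ≐ k₂⁻ ⊛ S (D u)
Du-relation = linear₂ k₂ (⊖ (κ (+ 8) ⊛ S (D u))) (κ-cancel (+ 2) doubled) uk₂-square
  (solve 4 (λ u d v s → let k = con (+ 1) :+ con (+ 4) :* v in
      u :* d :* (k :* k :* k) := (con (+ 1) :+ :- (con (+ 4) :* v)) :* s :+ k :* ((u :* k) :* (d :* k :+ u :* (con (+ 8) :* s)) :+ :- s)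
        :+ (:- (con (+ 8) :* s)) :* ((u :* k) :* (u :* k) :+ :- v))
    ≋-refl u (D u) (S u) (S (D u)))
  where
  w = u ⊛ k₂
  Dw : D w ≐ D u ⊛ k₂ ⊕ u ⊛ (κ (+ 8) ⊛ S (D u))
  Dw = ≋-trans (D-⊛ u k₂) (⊕-cong (≋-refl {D u ⊛ k₂}) (⊛-cong (≋-refl {u}) D-k₂))
  doubled : κ (+ 2) ⊛ (w ⊛ (D u ⊛ k₂ ⊕ u ⊛ (κ (+ 8) ⊛ S (D u)))) ≐ κ (+ 2) ⊛ S (D u)
  doubled = begin
    κ (+ 2) ⊛ (w ⊛ (D u ⊛ k₂ ⊕ u ⊛ (κ (+ 8) ⊛ S (D u)))) ≈⟨ ⊛-cong (≋-refl {κ (+ 2)}) (⊛-cong (≋-refl {w}) (≋-sym Dw)) ⟩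
    κ (+ 2) ⊛ (w ⊛ D w) ≈⟨ solve 2 (λ w d → con (+ 2) :* (w :* d) := d :* w :+ w :* d) ≋-refl w (D w) ⟩
    D w ⊛ w ⊕ w ⊛ D w ≈⟨ ≋-sym (D-⊛ w w) ⟩
    D (w ⊛ w) ≈⟨ D-cong uk₂-square ⟩
    D (S u) ≈⟨ D-S u ⟩
    κ (+ 2) ⊛ S (D u) ∎

weight : Series → Series
weight v = κ (+ 1) ⊕ ⊖ (κ (+ 16) ⊛ (v ⊛ v))

S-weight : S (weight u) ≐ weight (S u)
S-weight = ≋-trans (S-⊕ (κ (+ 1)) (⊖ (κ (+ 16) ⊛ (u ⊛ u)))) (⊕-cong (S-κ (+ 1)) (≋-trans (S-⊖ (κ (+ 16) ⊛ (u ⊛ u)))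
  (⊖-cong (≋-trans (S-⊛ (κ (+ 16)) (u ⊛ u)) (⊛-cong (S-κ (+ 16)) (S-⊛ u u))))))

κ0-coeff : ∀ n → κ (+ 0) n ≡ + 0
κ0-coeff zero = refl
κ0-coeff (suc n) = refl

difference-zero : ∀ {f g} → (∀ n → (f ⊕ ⊖ g) n ≡ + 0) → f ≐ g
difference-zero {f} {g} h = ptw λ n → ℤ.i-j≡0⇒i≡j (f n) (g n) (h n)

-- Both sides of this differential equation transform in the same way under the Landen
-- transformation q ↦ q², which forces their difference to vanish.
Du : D u ≐ u ⊛ weight u ⊛ (F ⊛ F)
Du = difference-zero (strong-induction (λ n → Y n ≡ + 0) step)
  where
  Y = D u ⊕ ⊖ (u ⊛ weight u ⊛ (F ⊛ F))
  SY : S Y ≐ S (D u) ⊕ ⊖ (S u ⊛ weight (S u) ⊛ (S F ⊛ S F))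
  SY = ≋-trans (S-⊕ (D u) (⊖ (u ⊛ weight u ⊛ (F ⊛ F)))) (⊕-cong (≋-refl {S (D u)}) (≋-trans (S-⊖ (u ⊛ weight u ⊛ (F ⊛ F)))
    (⊖-cong (≋-trans (S-⊛ (u ⊛ weight u) (F ⊛ F)) (⊛-cong (≋-trans (S-⊛ u (weight u)) (⊛-cong (≋-refl {S u}) S-weight)) (S-⊛ F F))))))
  relation : u ⊛ (k₂ ⊛ k₂ ⊛ k₂) ⊛ Y ≐ k₂⁻ ⊛ S Y
  relation = linear₃ (κ (+ 1)) (⊖ k₂⁻) (⊖ (u ⊛ u ⊛ weight u ⊛ (k₂ ⊛ k₂ ⊛ k₂) ⊛ (F ⊕ S F ⊛ k₂))) Du-relation SY landen₁
    (linear₁ (⊖ (k₂ ⊛ k₂ ⊛ k₂ ⊛ S F ⊛ S F ⊛ (κ (+ 1) ⊕ ⊖ (κ (+ 16) ⊛ (u ⊛ u)))) ⊕ κ (+ 16) ⊛ k₂ ⊛ S u ⊛ S F ⊛ S F) uk₂-square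
    (solve 7 (λ u d v s F f SY → let k = con (+ 1) :+ con (+ 4) :* v
                                     Y = d :+ :- (u :* (con (+ 1) :+ :- (con (+ 16) :* (u :* u))) :* (F :* F)) in
      u :* (k :* k :* k) :* Y := (con (+ 1) :+ :- (con (+ 4) :* v)) :* SY
        :+ con (+ 1) :* (u :* d :* (k :* k :* k) :+ :- ((con (+ 1) :+ :- (con (+ 4) :* v)) :* s))
        :+ (:- (con (+ 1) :+ :- (con (+ 4) :* v))) :* (SY :+ :- (s :+ :- (v :* (con (+ 1) :+ :- (con (+ 16) :* (v :* v))) :* (f :* f))))
        :+ (:- (u :* u :* (con (+ 1) :+ :- (con (+ 16) :* (u :* u))) :* (k :* k :* k) :* (F :+ f :* k))) :* (F :+ :- (f :* k))
        :+ (:- (k :* k :* k :* f :* f :* (con (+ 1) :+ :- (con (+ 16) :* (u :* u)))) :+ con (+ 16) :* k :* v :* f :* f) :* ((u :* k) :* (u :* k) :+ :- v))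
      ≋-refl u (D u) (S u) (S (D u)) F (S F) (S Y)))
  û = S (S (ψ ⊛ ψ)) ⊛ a ⊛ (k₂ ⊛ k₂ ⊛ k₂)
  shifted : shift (Y ⊛ û) ≐ k₂⁻ ⊛ S Y
  shifted = ≋-trans (≋-trans (shift-X (Y ⊛ û)) (solve 5 (λ x p a k y → x :* (y :* (p :* a :* k)) := (x :* p) :* a :* k :* y) ≋-refl (X 1) (S (S (ψ ⊛ ψ))) a (k₂ ⊛ k₂ ⊛ k₂) Y)) relation
  step : ∀ n → (∀ k → k < n → Y k ≡ + 0) → Y n ≡ + 0
  -- The factor `u` raises the order of the left side of `relation` by one, so the doubled order on
  -- the right exceeds it only from order `2` on; the first two coefficients are checked directly.
  step zero ih = refl
  step (suc zero) ih = refl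
  step (suc (suc n)) ih = E.begin
    Y (suc (suc n)) E.≡⟨ sym (ℤ.*-identityʳ _) ⟩
    Y (suc (suc n)) * û 0 E.≡⟨ sym (vanishing-⊛ û (suc (suc n)) ih) ⟩
    (Y ⊛ û) (suc (suc n)) E.≡⟨ shifted ‼ suc (suc (suc n)) ⟩
    (k₂⁻ ⊛ S Y) (suc (suc (suc n))) E.≡⟨ ⊛-comm k₂⁻ (S Y) (suc (suc (suc n))) ⟩
    (S Y ⊛ k₂⁻) (suc (suc (suc n)))
      E.≡⟨ vanishing-⊛′ k₂⁻ (suc (suc n) ℕ.+ suc (suc n)) (S-vanishing (suc (suc n)) ih) (suc (suc (suc n))) bound ⟩
    + 0 E.∎
    where
    module E = ≡-Reasoning
    bound : suc (suc (suc n)) < suc (suc n) ℕ.+ suc (suc n)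
    bound = s≤s (s≤s (ℕ.m≤n+m (suc (suc n)) n))

ak₂ : a ⊛ k₂ ≐ S a
ak₂ = linear₃ (⊖ (a ⊛ S a)) (S a) (⊖ (a ⊛ k₂)) landen₁ Fa SFa
  (solve 5 (λ a k b F f → a :* k := b :+ (:- (a :* b)) :* (F :+ :- (f :* k)) :+ b :* (F :* a :+ :- con (+ 1)) :+ (:- (a :* k)) :* (f :* b :+ :- con (+ 1)))
    ≋-refl a k₂ (S a) F (S F))

S-Du : S (D u) ≐ S u ⊛ weight (S u) ⊛ (S F ⊛ S F)
S-Du = ≋-trans (S-cong Du) (≋-trans (S-⊛ (u ⊛ weight u) (F ⊛ F)) (⊛-cong (≋-trans (S-⊛ u (weight u)) (⊛-cong (≋-refl {S u}) S-weight)) (S-⊛ F F)))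

k₂Da : k₂ ⊛ D a ≐ D (S a) ⊕ ⊖ (κ (+ 8) ⊛ S u ⊛ k₂⁻ ⊛ S F)
k₂Da = linear₃ (κ (+ 1)) (⊖ (a ⊛ κ (+ 8))) (⊖ (κ (+ 8) ⊛ S u ⊛ k₂⁻ ⊛ S F ⊛ S F)) differentiated S-Du ak₂
    (linear₁ (⊖ (κ (+ 8) ⊛ S u ⊛ k₂⁻ ⊛ S F)) SFa
    (solve 7 (λ a da v s f b db → let k = con (+ 1) :+ con (+ 4) :* v
                                      m = con (+ 1) :+ :- (con (+ 4) :* v) in
      k :* da := db :+ :- (con (+ 8) :* v :* m :* f)
        :+ con (+ 1) :* (da :* k :+ a :* (con (+ 8) :* s) :+ :- db)
        :+ (:- (a :* con (+ 8))) :* (s :+ :- (v :* (con (+ 1) :+ :- (con (+ 16) :* (v :* v))) :* (f :* f)))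
        :+ (:- (con (+ 8) :* v :* m :* f :* f)) :* (a :* k :+ :- b)
        :+ (:- (con (+ 8) :* v :* m :* f)) :* (f :* b :+ :- con (+ 1)))
      ≋-refl a (D a) (S u) (S (D u)) (S F) (S a) (D (S a))))
  where
  differentiated : D a ⊛ k₂ ⊕ a ⊛ (κ (+ 8) ⊛ S (D u)) ≐ D (S a)
  differentiated = ≋-trans (⊕-cong (≋-refl {D a ⊛ k₂}) (⊛-cong (≋-refl {a}) (≋-sym D-k₂))) (≋-trans (≋-sym (D-⊛ a k₂)) (D-cong ak₂))

D-constant : ∀ c f → D (κ c ⊛ f) ≐ κ c ⊛ D f
D-constant c f = ≋-trans (D-⊛ (κ c) f) (≋-trans (⊕-cong (⊛-cong (D-κ c) (≋-refl {f})) (≋-refl {κ c ⊛ D f}))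
  (solve 2 (λ f g → con (+ 0) :* f :+ g := g) ≋-refl f (κ c ⊛ D f)))

D-reciprocal : ∀ f g → f ⊛ g ≐ κ (+ 1) → D f ≐ ⊖ (f ⊛ f ⊛ D g)
D-reciprocal f g h = linear₂ (⊖ D f) f h differentiated
  (solve 4 (λ f g df dg → df := :- (f :* f :* dg) :+ (:- df) :* (f :* g :+ :- con (+ 1)) :+ f :* (df :* g :+ f :* dg :+ :- con (+ 0))) ≋-refl f g (D f) (D g))
  where
  differentiated : D f ⊛ g ⊕ f ⊛ D g ≐ κ (+ 0)
  differentiated = ≋-trans (≋-sym (D-⊛ f g)) (≋-trans (D-cong h) (D-κ (+ 1)))

-- The differential equation of `1 / F`. Differentiating `a ⊛ k₂ ≐ S a` twice gives `k₂ Y = 4 S Y`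
-- for the difference `Y` of the two sides, which is impossible for a nonzero series of positive
-- order.
DDa : D (D a) ≐ ⊖ (κ (+ 16) ⊛ (u ⊛ u) ⊛ weight u ⊛ (F ⊛ F ⊛ F))
DDa = difference-zero λ n → trans (cong (_+_ (D (D a) n)) (ℤ.neg-involutive (q n))) (strong-induction (λ n → Y n ≡ + 0) step n)
  where
  q = κ (+ 16) ⊛ (u ⊛ u) ⊛ weight u ⊛ (F ⊛ F ⊛ F)
  Y = D (D a) ⊕ q
  v = S u
  f = S F
  m = κ (+ 1) ⊕ ⊖ (κ (+ 4) ⊛ v)
  DSu : D v ≐ κ (+ 2) ⊛ (v ⊛ weight v ⊛ (f ⊛ f))
  DSu = ≋-trans (D-S u) (⊛-cong (≋-refl {κ (+ 2)}) S-Du)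
  DDSa : D (D (S a)) ≐ κ (+ 4) ⊛ S (D (D a))
  DDSa = begin
    D (D (S a)) ≈⟨ D-cong (D-S a) ⟩
    D (κ (+ 2) ⊛ S (D a)) ≈⟨ D-constant (+ 2) (S (D a)) ⟩
    κ (+ 2) ⊛ D (S (D a)) ≈⟨ ⊛-cong (≋-refl {κ (+ 2)}) (D-S (D a)) ⟩
    κ (+ 2) ⊛ (κ (+ 2) ⊛ S (D (D a))) ≈⟨ solve 1 (λ x → con (+ 2) :* (con (+ 2) :* x) := con (+ 4) :* x) ≋-refl (S (D (D a))) ⟩
    κ (+ 4) ⊛ S (D (D a)) ∎
  SY : S Y ≐ S (D (D a)) ⊕ κ (+ 16) ⊛ (v ⊛ v) ⊛ weight v ⊛ (f ⊛ f ⊛ f)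
  SY = ≋-trans (S-⊕ (D (D a)) q) (⊕-cong (≋-refl {S (D (D a))}) (≋-trans (S-⊛ (κ (+ 16) ⊛ (u ⊛ u) ⊛ weight u) (F ⊛ F ⊛ F)) (⊛-cong
    (≋-trans (S-⊛ (κ (+ 16) ⊛ (u ⊛ u)) (weight u)) (⊛-cong (≋-trans (S-⊛ (κ (+ 16)) (u ⊛ u)) (⊛-cong (S-κ (+ 16)) (S-⊛ u u))) S-weight))
    (≋-trans (S-⊛ (F ⊛ F) F) (⊛-cong (S-⊛ F F) (≋-refl {f}))))))
  G = κ (+ 8) ⊛ v ⊛ m ⊛ f
  DG : D G ≐ κ (+ 8) ⊛ D v ⊛ (κ (+ 1) ⊕ ⊖ (κ (+ 8) ⊛ v)) ⊛ f ⊕ κ (+ 8) ⊛ v ⊛ m ⊛ D f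
  DG = begin
    D (κ (+ 8) ⊛ v ⊛ m ⊛ f) ≈⟨ D-⊛ (κ (+ 8) ⊛ v ⊛ m) f ⟩
    D (κ (+ 8) ⊛ v ⊛ m) ⊛ f ⊕ κ (+ 8) ⊛ v ⊛ m ⊛ D f ≈⟨ ⊕-cong (⊛-cong (D-⊛ (κ (+ 8) ⊛ v) m) (≋-refl {f})) (≋-refl {κ (+ 8) ⊛ v ⊛ m ⊛ D f}) ⟩
    (D (κ (+ 8) ⊛ v) ⊛ m ⊕ κ (+ 8) ⊛ v ⊛ D m) ⊛ f ⊕ κ (+ 8) ⊛ v ⊛ m ⊛ D f
      ≈⟨ ⊕-cong (⊛-cong (⊕-cong (⊛-cong (D-constant (+ 8) v) (≋-refl {m})) (⊛-cong (≋-refl {κ (+ 8) ⊛ v}) Dm)) (≋-refl {f})) (≋-refl {κ (+ 8) ⊛ v ⊛ m ⊛ D f}) ⟩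
    (κ (+ 8) ⊛ D v ⊛ m ⊕ κ (+ 8) ⊛ v ⊛ (⊖ (κ (+ 4) ⊛ D v))) ⊛ f ⊕ κ (+ 8) ⊛ v ⊛ m ⊛ D f
      ≈⟨ solve 4 (λ v dv f df → let m = con (+ 1) :+ :- (con (+ 4) :* v) in
           (con (+ 8) :* dv :* m :+ con (+ 8) :* v :* (:- (con (+ 4) :* dv))) :* f :+ con (+ 8) :* v :* m :* df
           := con (+ 8) :* dv :* (con (+ 1) :+ :- (con (+ 8) :* v)) :* f :+ con (+ 8) :* v :* m :* df) ≋-refl v (D v) f (D f) ⟩
    κ (+ 8) ⊛ D v ⊛ (κ (+ 1) ⊕ ⊖ (κ (+ 8) ⊛ v)) ⊛ f ⊕ κ (+ 8) ⊛ v ⊛ m ⊛ D f ∎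
    where
    Dm : D m ≐ ⊖ (κ (+ 4) ⊛ D v)
    Dm = begin
      D (κ (+ 1) ⊕ ⊖ (κ (+ 4) ⊛ v)) ≈⟨ D-⊕ (κ (+ 1)) (⊖ (κ (+ 4) ⊛ v)) ⟩
      D (κ (+ 1)) ⊕ D (⊖ (κ (+ 4) ⊛ v)) ≈⟨ ⊕-cong (D-κ (+ 1)) (≋-trans (D-⊖ (κ (+ 4) ⊛ v)) (⊖-cong (D-constant (+ 4) v))) ⟩
      κ (+ 0) ⊕ ⊖ (κ (+ 4) ⊛ D v) ≈⟨ solve 1 (λ x → con (+ 0) :+ x := x) ≋-refl (⊖ (κ (+ 4) ⊛ D v)) ⟩
      ⊖ (κ (+ 4) ⊛ D v) ∎
  differentiated : D k₂ ⊛ D a ⊕ k₂ ⊛ D (D a) ≐ D (D (S a)) ⊕ ⊖ D G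
  differentiated = ≋-trans (≋-sym (D-⊛ k₂ (D a))) (≋-trans (D-cong k₂Da) (≋-trans (D-⊕ (D (S a)) (⊖ G)) (⊕-cong (≋-refl {D (D (S a))}) (D-⊖ G))))
  -- after eliminating D f and D k₂ the first derivatives of a cancel
  second : k₂ ⊛ D (D a) ≐ κ (+ 4) ⊛ S (D (D a)) ⊕ κ (+ 64) ⊛ (v ⊛ v) ⊛ (m ⊛ m) ⊛ (f ⊛ f ⊛ f) ⊕ ⊖ (κ (+ 16) ⊛ v ⊛ weight v ⊛ (κ (+ 1) ⊕ ⊖ (κ (+ 8) ⊛ v)) ⊛ (f ⊛ f ⊛ f))
  second = linear₃ (κ (+ 1)) (κ (+ 1)) (⊖ κ (+ 1)) differentiated DDSa DG
    (linear₃ (⊖ (κ (+ 8) ⊛ (κ (+ 1) ⊕ ⊖ (κ (+ 8) ⊛ v)) ⊛ f)) (⊖ (κ (+ 8) ⊛ v ⊛ m)) (⊖ D a) DSu (D-reciprocal f (S a) SFa) (≋-trans D-k₂ (⊛-cong (≋-refl {κ (+ 8)}) S-Du))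
    (linear₁ (⊖ (κ (+ 8) ⊛ v ⊛ m ⊛ (f ⊛ f))) k₂Da
    (solve 11 (λ v f df dv da dda db ddb sdd dk dG →
        let k = con (+ 1) :+ con (+ 4) :* v
            m = con (+ 1) :+ :- (con (+ 4) :* v)
            W = con (+ 1) :+ :- (con (+ 16) :* (v :* v))
            n = con (+ 1) :+ :- (con (+ 8) :* v) in
        k :* dda := con (+ 4) :* sdd :+ con (+ 64) :* (v :* v) :* (m :* m) :* (f :* f :* f) :+ :- (con (+ 16) :* v :* W :* n :* (f :* f :* f))
          :+ con (+ 1) :* (dk :* da :+ k :* dda :+ :- (ddb :+ :- dG))
          :+ con (+ 1) :* (ddb :+ :- (con (+ 4) :* sdd))
          :+ (:- con (+ 1)) :* (dG :+ :- (con (+ 8) :* dv :* n :* f :+ con (+ 8) :* v :* m :* df))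
          :+ (:- (con (+ 8) :* n :* f)) :* (dv :+ :- (con (+ 2) :* (v :* W :* (f :* f))))
          :+ (:- (con (+ 8) :* v :* m)) :* (df :+ :- (:- (f :* f :* db)))
          :+ (:- da) :* (dk :+ :- (con (+ 8) :* (v :* W :* (f :* f))))
          :+ (:- (con (+ 8) :* v :* m :* (f :* f))) :* (k :* da :+ :- (db :+ :- (con (+ 8) :* v :* m :* f))))
      ≋-refl v f (D f) (D v) (D a) (D (D a)) (D (S a)) (D (D (S a))) (S (D (D a))) (D k₂) (D G))))
  k₂q : k₂ ⊛ q ≐ κ (+ 16) ⊛ v ⊛ (m ⊛ m) ⊛ (f ⊛ f ⊛ f)
  k₂q = linear₂ (κ (+ 16) ⊛ k₂ ⊛ (u ⊛ u) ⊛ weight u ⊛ (F ⊛ F ⊕ F ⊛ (f ⊛ k₂) ⊕ (f ⊛ k₂) ⊛ (f ⊛ k₂)))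
                (κ (+ 16) ⊛ (k₂ ⊛ k₂) ⊛ (f ⊛ f ⊛ f) ⊕ ⊖ (κ (+ 256) ⊛ (f ⊛ f ⊛ f) ⊛ ((u ⊛ k₂) ⊛ (u ⊛ k₂) ⊕ v))) landen₁ uk₂-square
    (solve 4 (λ u v F f →
        let k = con (+ 1) :+ con (+ 4) :* v
            m = con (+ 1) :+ :- (con (+ 4) :* v)
            w = con (+ 1) :+ :- (con (+ 16) :* (u :* u)) in
        k :* (con (+ 16) :* (u :* u) :* w :* (F :* F :* F)) := con (+ 16) :* v :* (m :* m) :* (f :* f :* f)
          :+ (con (+ 16) :* k :* (u :* u) :* w :* (F :* F :+ F :* (f :* k) :+ (f :* k) :* (f :* k))) :* (F :+ :- (f :* k))
          :+ (con (+ 16) :* (k :* k) :* (f :* f :* f) :+ :- (con (+ 256) :* (f :* f :* f) :* ((u :* k) :* (u :* k) :+ v))) :* ((u :* k) :* (u :* k) :+ :- v))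
      ≋-refl u v F f)
  relation : k₂ ⊛ Y ≐ κ (+ 4) ⊛ S Y
  relation = linear₃ (κ (+ 1)) (κ (+ 1)) (⊖ κ (+ 4)) second k₂q SY
    (solve 6 (λ v f dda sdd q SY →
        let k = con (+ 1) :+ con (+ 4) :* v
            m = con (+ 1) :+ :- (con (+ 4) :* v)
            W = con (+ 1) :+ :- (con (+ 16) :* (v :* v))
            n = con (+ 1) :+ :- (con (+ 8) :* v)
            f³ = f :* f :* f in
        k :* (dda :+ q) := con (+ 4) :* SY
          :+ con (+ 1) :* (k :* dda :+ :- (con (+ 4) :* sdd :+ con (+ 64) :* (v :* v) :* (m :* m) :* f³ :+ :- (con (+ 16) :* v :* W :* n :* f³)))
          :+ con (+ 1) :* (k :* q :+ :- (con (+ 16) :* v :* (m :* m) :* f³))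
          :+ (:- con (+ 4)) :* (SY :+ :- (sdd :+ con (+ 16) :* (v :* v) :* W :* f³)))
      ≋-refl v f (D (D a)) (S (D (D a))) q (S Y))
  step : ∀ n → (∀ k → k < n → Y k ≡ + 0) → Y n ≡ + 0
  step zero ih = refl
  step (suc n) ih = E.begin
    Y (suc n) E.≡⟨ sym (ℤ.*-identityʳ _) ⟩
    Y (suc n) * k₂ 0 E.≡⟨ sym (vanishing-⊛ k₂ (suc n) ih) ⟩
    (Y ⊛ k₂) (suc n) E.≡⟨ ⊛-comm Y k₂ (suc n) ⟩
    (k₂ ⊛ Y) (suc n) E.≡⟨ relation ‼ suc n ⟩
    (κ (+ 4) ⊛ S Y) (suc n) E.≡⟨ κ-⊛ (+ 4) (S Y) (suc n) ⟩
    + 4 * S Y (suc n) E.≡⟨ cong (_*_ (+ 4)) (S-vanishing (suc n) ih (suc n) (s≤s (ℕ.m≤n+m (suc n) n))) ⟩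
    + 0 E.∎
    where module E = ≡-Reasoning

-- The newform as a product and as a Wronskian

newform e : Series
newform = F ⊛ F ⊛ D u
e = β ⊛ F

F+4β : F ⊕ κ (+ 4) ⊛ β ≐ φ ⊛ φ
F+4β = ≋-sym (≋-trans φ²-duplication (⊕-cong (≋-sym (S-⊛ φ φ)) (≋-trans (ptw (⊛-assoc (κ (+ 4)) (X 1) (S (S ψ) ⊛ S (S ψ))))
  (⊛-cong (≋-refl {κ (+ 4)}) (⊛-cong (≋-refl {X 1}) (≋-sym (≋-trans (S-cong (S-⊛ ψ ψ)) (S-⊛ (S ψ) (S ψ)))))))))

F-4β : F ⊕ ⊖ (κ (+ 4) ⊛ β) ≐ Θ ⊛ Θ
F-4β = ≋-sym (≋-trans Θ²-duplication (⊕-cong (≋-sym (S-⊛ φ φ)) (⊖-cong (≋-trans (ptw (⊛-assoc (κ (+ 4)) (X 1) (S (S ψ) ⊛ S (S ψ))))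
  (⊛-cong (≋-refl {κ (+ 4)}) (⊛-cong (≋-refl {X 1}) (≋-sym (≋-trans (S-cong (S-⊛ ψ ψ)) (S-⊛ (S ψ) (S ψ))))))))))

-- By `Du`, `newform` is `F β (F + 4β)(F - 4β)`, and the last two factors are `φ²` and `Θ²`.
newform-factored : newform ≐ e ⊛ ((φ ⊛ Θ) ⊛ (φ ⊛ Θ))
newform-factored = linear₃ (F ⊛ F) (F ⊛ F ⊛ F ⊕ ⊖ (κ (+ 16) ⊛ F ⊛ (u ⊛ F ⊛ (u ⊛ F) ⊕ (u ⊛ F) ⊛ β ⊕ β ⊛ β))) (e ⊛ (Θ ⊛ Θ)) Du uF F+4β
    (linear₁ (e ⊛ (F ⊕ κ (+ 4) ⊛ β)) F-4β
    (solve 6 (λ u d F b p t → F :* F :* d := b :* F :* ((p :* t) :* (p :* t))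
        :+ (F :* F) :* (d :+ :- (u :* (con (+ 1) :+ :- (con (+ 16) :* (u :* u))) :* (F :* F)))
        :+ (F :* F :* F :+ :- (con (+ 16) :* F :* (u :* F :* (u :* F) :+ (u :* F) :* b :+ b :* b))) :* (u :* F :+ :- b)
        :+ (b :* F :* (t :* t)) :* (F :+ con (+ 4) :* b :+ :- (p :* p))
        :+ (b :* F :* (F :+ con (+ 4) :* b)) :* (F :+ :- (con (+ 4) :* b) :+ :- (t :* t)))
      ≋-refl u (D u) F β φ Θ))

e-product : e ≐ X 1 ⊛ S ((ψ ⊛ ψ) ⊛ (ψ ⊛ ψ))
e-product = begin
  X 1 ⊛ S (S (ψ ⊛ ψ)) ⊛ S (φ ⊛ φ) ≈⟨ ptw (⊛-assoc (X 1) (S (S (ψ ⊛ ψ))) (S (φ ⊛ φ))) ⟩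
  X 1 ⊛ (S (S (ψ ⊛ ψ)) ⊛ S (φ ⊛ φ)) ≈⟨ ⊛-cong (≋-refl {X 1}) (≋-sym (S-⊛ (S (ψ ⊛ ψ)) (φ ⊛ φ))) ⟩
  X 1 ⊛ S (S (ψ ⊛ ψ) ⊛ (φ ⊛ φ)) ≈⟨ ⊛-cong (≋-refl {X 1}) (S-cong (≋-trans (⊛-cong (S-⊛ ψ ψ) (≋-refl {φ ⊛ φ}))
                                                 (solve 2 (λ y f → y :* y :* (f :* f) := (f :* y) :* (f :* y)) ≋-refl (S ψ) φ))) ⟩
  X 1 ⊛ S ((φ ⊛ S ψ) ⊛ (φ ⊛ S ψ)) ≈⟨ ⊛-cong (≋-refl {X 1}) (S-cong (⊛-cong (≋-sym ψ²-duplication) (≋-sym ψ²-duplication))) ⟩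
  X 1 ⊛ S ((ψ ⊛ ψ) ⊛ (ψ ⊛ ψ)) ∎

_⁴ : Series → Series
f ⁴ = (f ⊛ f) ⊛ (f ⊛ f)

⁴-cong : ∀ {f g} → f ≐ g → f ⁴ ≐ g ⁴
⁴-cong h = ⊛-cong (⊛-cong h h) (⊛-cong h h)

S-⁴ : ∀ f → S (f ⁴) ≐ S f ⁴
S-⁴ f = ≋-trans (S-⊛ (f ⊛ f) (f ⊛ f)) (⊛-cong (S-⊛ f f) (S-⊛ f f))

-- `e` is `q ψ⁴` and `φ Θ` is `Θ²`, both taken at `q²`, so the newform is `q (ψ Θ)⁴` at `q²`; `ψΘ`
-- turns this into the eta product.
newform-product : newform ≐ X 1 ⊛ (S P⁻ ⁴ ⊛ S (S P⁻) ⁴)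
newform-product = begin
  newform ≈⟨ newform-factored ⟩
  e ⊛ ((φ ⊛ Θ) ⊛ (φ ⊛ Θ)) ≈⟨ ⊛-cong e-product (⊛-cong φΘ φΘ) ⟩
  X 1 ⊛ S (ψ ⁴) ⊛ (S Θ ⁴) ≈⟨ ⊛-cong (⊛-cong (≋-refl {X 1}) (S-⁴ ψ)) (≋-refl {S Θ ⁴}) ⟩
  X 1 ⊛ S ψ ⁴ ⊛ S Θ ⁴ ≈⟨ solve 3 (λ x y t → x :* ((y :* y) :* (y :* y)) :* ((t :* t) :* (t :* t)) := x :* ((y :* t) :* (y :* t) :* ((y :* t) :* (y :* t)))) ≋-refl (X 1) (S ψ) (S Θ) ⟩
  X 1 ⊛ (S ψ ⊛ S Θ) ⁴ ≈⟨ ⊛-cong (≋-refl {X 1}) (⁴-cong (≋-trans (≋-sym (S-⊛ ψ Θ)) (≋-trans (S-cong ψΘ) (S-⊛ P⁻ (S P⁻))))) ⟩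
  X 1 ⊛ (S P⁻ ⊛ S (S P⁻)) ⁴
    ≈⟨ solve 3 (λ x y t → x :* ((y :* t) :* (y :* t) :* ((y :* t) :* (y :* t))) := x :* (((y :* y) :* (y :* y)) :* ((t :* t) :* (t :* t)))) ≋-refl (X 1) (S P⁻) (S (S P⁻)) ⟩
  X 1 ⊛ (S P⁻ ⁴ ⊛ S (S P⁻) ⁴) ∎

newform-wronskian : newform ≐ F ⊛ D β ⊕ ⊖ (β ⊛ D F)
newform-wronskian = linear₂ F (⊖ D F) (≋-trans (≋-sym (D-⊛ u F)) (D-cong uF)) uF
  (solve 6 (λ u d F dF b db → F :* F :* d := F :* db :+ :- (b :* dF)
      :+ F :* (d :* F :+ u :* dF :+ :- db) :+ (:- dF) :* (u :* F :+ :- b)) ≋-refl u (D u) F (D F) β (D β))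

-- The logarithmic derivative of `φ / Θ` is `4 e`: differentiate `φ² = F + 4β` and `Θ² = F - 4β` and
-- insert the Wronskian.
φ′Θ : D φ ⊛ Θ ⊕ ⊖ (φ ⊛ D Θ) ≐ κ (+ 4) ⊛ e ⊛ (φ ⊛ Θ)
φ′Θ = κ-cancel (+ 2) (⊛-cancelʳ (φ ⊛ Θ) refl
  (linear₃ (Θ ⊛ Θ) (⊖ (φ ⊛ φ)) (κ (+ 8)) D-φ² D-Θ² (≋-trans (≋-sym newform-wronskian) newform-factored)
    (linear₂ (D F ⊕ ⊖ (κ (+ 4) ⊛ D β)) (⊖ (D F ⊕ κ (+ 4) ⊛ D β)) F+4β F-4β
    (solve 8 (λ p t dp dt F dF b db →
        con (+ 2) :* (dp :* t :+ :- (p :* dt)) :* (p :* t) := con (+ 2) :* (con (+ 4) :* (b :* F) :* (p :* t)) :* (p :* t)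
          :+ (t :* t) :* (dp :* p :+ p :* dp :+ :- (dF :+ con (+ 4) :* db))
          :+ (:- (p :* p)) :* (dt :* t :+ t :* dt :+ :- (dF :+ :- (con (+ 4) :* db)))
          :+ con (+ 8) :* (F :* db :+ :- (b :* dF) :+ :- (b :* F :* ((p :* t) :* (p :* t))))
          :+ (dF :+ :- (con (+ 4) :* db)) :* (F :+ con (+ 4) :* b :+ :- (p :* p))
          :+ (:- (dF :+ con (+ 4) :* db)) :* (F :+ :- (con (+ 4) :* b) :+ :- (t :* t)))
      ≋-refl φ Θ (D φ) (D Θ) F (D F) β (D β)))))
  where
  D-φ² : D φ ⊛ φ ⊕ φ ⊛ D φ ≐ D F ⊕ κ (+ 4) ⊛ D β
  D-φ² = ≋-trans (≋-sym (D-⊛ φ φ)) (≋-trans (D-cong (≋-sym F+4β)) (≋-trans (D-⊕ F (κ (+ 4) ⊛ β)) (⊕-cong (≋-refl {D F}) (D-constant (+ 4) β))))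
  D-Θ² : D Θ ⊛ Θ ⊕ Θ ⊛ D Θ ≐ D F ⊕ ⊖ (κ (+ 4) ⊛ D β)
  D-Θ² = ≋-trans (≋-sym (D-⊛ Θ Θ)) (≋-trans (D-cong (≋-sym F-4β)) (≋-trans (D-⊕ F (⊖ (κ (+ 4) ⊛ β))) (⊕-cong (≋-refl {D F}) (≋-trans (D-⊖ (κ (+ 4) ⊛ β)) (⊖-cong (D-constant (+ 4) β))))))

-- Comparison with the eta product

coeff-addP : ∀ f g n → coeff (addP f g) n ≡ coeff f n + coeff g n
coeff-addP [] g n = sym (ℤ.+-identityˡ _)
coeff-addP (x ∷ f) [] zero = sym (ℤ.+-identityʳ x)
coeff-addP (x ∷ f) [] (suc n) = sym (ℤ.+-identityʳ (coeff f n))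
coeff-addP (x ∷ f) (y ∷ g) zero = refl
coeff-addP (x ∷ f) (y ∷ g) (suc n) = coeff-addP f g n

coeff-scaleP : ∀ c f n → coeff (scaleP c f) n ≡ c * coeff f n
coeff-scaleP c [] n = sym (ℤ.*-zeroʳ c)
coeff-scaleP c (x ∷ f) zero = refl
coeff-scaleP c (x ∷ f) (suc n) = coeff-scaleP c f n

coeff-mulP : ∀ f g → coeff (mulP f g) ≐ coeff f ⊛ coeff g
coeff-mulP f g = ptw (go f)
  where
  go : ∀ f n → coeff (mulP f g) n ≡ (coeff f ⊛ coeff g) n
  go [] n = sym (⊛-zeroˡ (coeff g) n)
  go (x ∷ f) zero = trans (coeff-addP (scaleP x g) _ 0) (trans (cong (_+ + 0) (coeff-scaleP x g 0)) (ℤ.+-identityʳ _))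
  go (x ∷ f) (suc n) = trans (coeff-addP (scaleP x g) _ (suc n)) (cong₂ _+_ (coeff-scaleP x g (suc n)) (go f n))

coeff-1 : coeff (+ 1 ∷ []) ≐ κ (+ 1)
coeff-1 = ptw λ { zero → refl ; (suc n) → refl }

coeff-pow4 : ∀ f → coeff (powP f 4) ≐ coeff f ⁴
coeff-pow4 f = begin
  coeff (powP f 4)
    ≈⟨ ≋-trans (coeff-mulP f (powP f 3)) (⊛-cong ≋-refl (≋-trans (coeff-mulP f (powP f 2)) (⊛-cong ≋-refl
        (≋-trans (coeff-mulP f (powP f 1)) (⊛-cong ≋-refl (≋-trans (coeff-mulP f (powP f 0)) (⊛-cong ≋-refl coeff-1))))))) ⟩
  coeff f ⊛ (coeff f ⊛ (coeff f ⊛ (coeff f ⊛ κ (+ 1))))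
    ≈⟨ solve 1 (λ f → f :* (f :* (f :* (f :* con (+ 1)))) := (f :* f) :* (f :* f)) ≋-refl (coeff f) ⟩
  coeff f ⁴ ∎

coeff-oneMinusQ : ∀ d → coeff (oneMinusQ (suc d)) ≐ κ (+ 1) ⊕ ⊖ X (suc d)
coeff-oneMinusQ d = ptw λ { zero → refl ; (suc n) → trans (go d n) (sym (ℤ.+-identityˡ _)) }
  where
  go : ∀ d n → coeff (replicate d (+ 0) ++ (- + 1) ∷ []) n ≡ - X d n
  go zero zero = refl
  go zero (suc n) = refl
  go (suc d) zero = refl
  go (suc d) (suc n) = go d n

S-factor : ∀ k → S (κ (+ 1) ⊕ ⊖ X k) ≐ κ (+ 1) ⊕ ⊖ X (2 ℕ.* k)
S-factor k = ≋-trans (S-⊕ (κ (+ 1)) (⊖ X k)) (⊕-cong (S-κ (+ 1)) (≋-trans (S-⊖ (X k)) (⊖-cong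
  (≋-trans (S-X k) (ptw λ n → cong (λ j → X (k ℕ.+ j) n) (sym (ℕ.+-identityʳ k)))))))

coeff-etaPartial : ∀ n → coeff (etaPartial n) ≐ S (prod⁻ n) ⁴ ⊛ S (S (prod⁻ n)) ⁴
coeff-etaPartial zero = ≋-trans coeff-1 (≋-sym (≋-trans
  (⊛-cong (⁴-cong (S-κ (+ 1))) (⁴-cong (≋-trans (S-cong (S-κ (+ 1))) (S-κ (+ 1)))))
  (solve 0 (let 1⁴ = (con (+ 1) :* con (+ 1)) :* (con (+ 1) :* con (+ 1)) in 1⁴ :* 1⁴ := con (+ 1)) ≋-refl)))
coeff-etaPartial (suc n) = begin
  coeff (etaPartial (suc n))
    ≈⟨ ≋-trans (coeff-mulP (mulP (powP (oneMinusQ (2 ℕ.* suc n)) 4) (powP (oneMinusQ (4 ℕ.* suc n)) 4)) (etaPartial n))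
         (⊛-cong (≋-trans (coeff-mulP (powP (oneMinusQ (2 ℕ.* suc n)) 4) (powP (oneMinusQ (4 ℕ.* suc n)) 4))
           (⊛-cong (≋-trans (coeff-pow4 (oneMinusQ (2 ℕ.* suc n))) (⁴-cong (coeff-oneMinusQ _)))
                   (≋-trans (coeff-pow4 (oneMinusQ (4 ℕ.* suc n))) (⁴-cong (coeff-oneMinusQ _))))) (coeff-etaPartial n)) ⟩
  (κ (+ 1) ⊕ ⊖ X (2 ℕ.* suc n)) ⁴ ⊛ (κ (+ 1) ⊕ ⊖ X (4 ℕ.* suc n)) ⁴ ⊛ (S (prod⁻ n) ⁴ ⊛ S (S (prod⁻ n)) ⁴)
    ≈⟨ ⊛-cong (⊛-cong (⁴-cong (≋-sym Sw)) (⁴-cong (≋-sym SSw))) ≋-refl ⟩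
  S w ⁴ ⊛ S (S w) ⁴ ⊛ (S (prod⁻ n) ⁴ ⊛ S (S (prod⁻ n)) ⁴)
    ≈⟨ solve 4 (λ a b c d → let p4 = λ x → (x :* x) :* (x :* x) in p4 a :* p4 b :* (p4 c :* p4 d) := p4 (c :* a) :* p4 (d :* b))
         ≋-refl (S w) (S (S w)) (S (prod⁻ n)) (S (S (prod⁻ n))) ⟩
  (S (prod⁻ n) ⊛ S w) ⁴ ⊛ (S (S (prod⁻ n)) ⊛ S (S w)) ⁴
    ≈⟨ ⊛-cong (⁴-cong (≋-sym (S-⊛ (prod⁻ n) w))) (⁴-cong (≋-sym (≋-trans (S-cong (S-⊛ (prod⁻ n) w)) (S-⊛ (S (prod⁻ n)) (S w))))) ⟩
  S (prod⁻ (suc n)) ⁴ ⊛ S (S (prod⁻ (suc n))) ⁴ ∎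
  where
  w = κ (+ 1) ⊕ ⊖ X (suc n)
  Sw : S w ≐ κ (+ 1) ⊕ ⊖ X (2 ℕ.* suc n)
  Sw = S-factor (suc n)
  SSw : S (S w) ≐ κ (+ 1) ⊕ ⊖ X (4 ℕ.* suc n)
  SSw = ≋-trans (S-cong Sw) (≋-trans (S-factor (2 ℕ.* suc n)) (ptw λ k → cong (λ j → (κ (+ 1) ⊕ ⊖ X j) k) (sym (ℕ.*-assoc 2 2 (suc n)))))

cf-newform : ∀ n → cf n ≡ newform n
cf-newform zero = refl
cf-newform (suc n) = trans (coeff-etaPartial (suc n) ‼ n) (trans (≈0⇒≡ (coeffs truncation n (ℕ.n≤1+n n)))
  (sym (trans (newform-product ‼ suc n) (sym (shift-X {exact} (S P⁻ ⁴ ⊛ S (S P⁻) ⁴) ‼ suc n)))))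
  where
  module T = Ser (truncated (suc n))
  h : S (prod⁻ (suc n)) ≋ S P⁻ at truncated (suc n)
  h = S-cong-truncated (suc n) (T.≋-sym (P⁻-truncated (suc n)))
  fourth : ∀ {f g} → f ≋ g at truncated (suc n) → f ⁴ ≋ g ⁴ at truncated (suc n)
  fourth h = T.⊛-cong (T.⊛-cong h h) (T.⊛-cong h h)
  truncation : S (prod⁻ (suc n)) ⁴ ⊛ S (S (prod⁻ (suc n))) ⁴ ≋ S P⁻ ⁴ ⊛ S (S P⁻) ⁴ at truncated (suc n)
  truncation = T.⊛-cong (fourth h) (fourth (S-cong-truncated (suc n) h))

-- Size of the coefficients of the newform and their residues modulo 8

Nonneg : Series → Set
Nonneg f = ∀ n → ∃ λ k → f n ≡ + k

nonneg-⊕ : ∀ {f g} → Nonneg f → Nonneg g → Nonneg (f ⊕ g)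
nonneg-⊕ h₁ h₂ n with h₁ n | h₂ n
... | k , p | l , q = k ℕ.+ l , cong₂ _+_ p q

nonneg-⊛ : ∀ {f g} → Nonneg f → Nonneg g → Nonneg (f ⊛ g)
nonneg-⊛ h₁ h₂ zero with h₁ 0 | h₂ 0
... | k , p | l , q = k ℕ.* l , trans (cong₂ _*_ p q) (sym (ℤ.pos-* k l))
nonneg-⊛ h₁ h₂ (suc n) with h₁ 0 | h₂ (suc n) | nonneg-⊛ (h₁ ∘ suc) h₂ n
... | k , p | l , q | j , r = k ℕ.* l ℕ.+ j , cong₂ _+_ (trans (cong₂ _*_ p q) (sym (ℤ.pos-* k l))) r

nonneg-S : ∀ {f} → Nonneg f → Nonneg (S f)
nonneg-S h zero = h 0
nonneg-S h (suc zero) = 0 , refl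
nonneg-S h (suc (suc n)) = nonneg-S (h ∘ suc) n

nonneg-D : ∀ {f} → Nonneg f → Nonneg (D f)
nonneg-D h n with h n
... | k , p = n ℕ.* k , trans (cong (_*_ (+ n)) p) (sym (ℤ.pos-* n k))

nonneg-κ : ∀ c → Nonneg (κ (+ c))
nonneg-κ c zero = c , refl
nonneg-κ c (suc n) = 0 , refl

nonneg-X : ∀ k → Nonneg (X k)
nonneg-X zero = nonneg-κ 1
nonneg-X (suc k) zero = 0 , refl
nonneg-X (suc k) (suc n) = nonneg-X k n

nonneg-φ : Nonneg φ
nonneg-φ n = go n n
  where
  go : ∀ n → Nonneg (phiSum n)
  go zero = nonneg-κ 1
  go (suc n) = nonneg-⊕ (go n) (nonneg-⊛ (nonneg-κ 2) (nonneg-X (square (suc n))))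

nonneg-ψ : Nonneg ψ
nonneg-ψ n = go n n
  where
  go : ∀ n → Nonneg (psiSum n)
  go zero = nonneg-κ 1
  go (suc n) = nonneg-⊕ (go n) (nonneg-⊛ (nonneg-κ 1) (nonneg-X (triangle (suc n))))

nonneg-F : Nonneg F
nonneg-F = nonneg-S (nonneg-⊛ nonneg-φ nonneg-φ)

nonneg-β : Nonneg β
nonneg-β = nonneg-⊛ (nonneg-X 1) (nonneg-S (nonneg-S (nonneg-⊛ nonneg-ψ nonneg-ψ)))

chiSum : ℕ → Series
chiSum zero = κ (+ 0)
chiSum (suc n) = chiSum n ⊕ X (square (suc n))

χ : Series
χ = diagonal chiSum

φ-odd : φ ≐ κ (+ 1) ⊕ κ (+ 2) ⊛ χ
φ-odd = ptw λ n → trans (go n ‼ n) (cong (_+_ (κ (+ 1) n)) (trans (κ-⊛ (+ 2) (chiSum n) n) (sym (κ-⊛ (+ 2) χ n))))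
  where
  go : ∀ n → phiSum n ≐ κ (+ 1) ⊕ κ (+ 2) ⊛ chiSum n
  go zero = solve 0 (con (+ 1) := con (+ 1) :+ con (+ 2) :* con (+ 0)) ≋-refl
  go (suc n) = ≋-trans (⊕-cong (go n) (≋-refl {κ (+ 2) ⊛ X (square (suc n))}))
    (solve 2 (λ c x → con (+ 1) :+ con (+ 2) :* c :+ con (+ 2) :* x := con (+ 1) :+ con (+ 2) :* (c :+ x)) ≋-refl (chiSum n) (X (square (suc n))))

-- `φ = 1 + 2χ` makes `φ² - 1` divisible by `4`, and `D` removes the constant.
DF-divisible : D F ≐ κ (+ 4) ⊛ D (S (χ ⊕ χ ⊛ χ))
DF-divisible = begin
  D (S (φ ⊛ φ)) ≈⟨ D-cong (S-cong (≋-trans (⊛-cong φ-odd φ-odd)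
      (solve 1 (λ c → (con (+ 1) :+ con (+ 2) :* c) :* (con (+ 1) :+ con (+ 2) :* c) := con (+ 1) :+ con (+ 4) :* (c :+ c :* c)) ≋-refl χ))) ⟩
  D (S (κ (+ 1) ⊕ κ (+ 4) ⊛ (χ ⊕ χ ⊛ χ))) ≈⟨ D-cong (≋-trans (S-⊕ (κ (+ 1)) _) (⊕-cong (S-κ (+ 1)) (≋-trans (S-⊛ (κ (+ 4)) (χ ⊕ χ ⊛ χ)) (⊛-cong (S-κ (+ 4)) ≋-refl)))) ⟩
  D (κ (+ 1) ⊕ κ (+ 4) ⊛ S (χ ⊕ χ ⊛ χ)) ≈⟨ ≋-trans (D-⊕ (κ (+ 1)) _) (⊕-cong (D-κ (+ 1)) (D-constant (+ 4) (S (χ ⊕ χ ⊛ χ)))) ⟩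
  κ (+ 0) ⊕ κ (+ 4) ⊛ D (S (χ ⊕ χ ⊛ χ)) ≈⟨ solve 1 (λ x → con (+ 0) :+ x := x) ≋-refl (κ (+ 4) ⊛ D (S (χ ⊕ χ ⊛ χ))) ⟩
  κ (+ 4) ⊛ D (S (χ ⊕ χ ⊛ χ)) ∎

-- `k` and `l` are the coefficients of `F ⊛ D β` and `β ⊛ D F`: their difference is the Wronskian,
-- and their sum is a coefficient of `D (β ⊛ F)`.
cf-bound : ∀ n → ∃ λ k → ∃ λ l → (cf n ≡ + k - + l) × (+ n * e n ≡ + k + + l)
cf-bound n with nonneg-⊛ nonneg-F (nonneg-D nonneg-β) n | nonneg-⊛ nonneg-β (nonneg-D nonneg-F) n
... | k , p | l , q = k , l
  , trans (cf-newform n) (trans (newform-wronskian ‼ n) (cong₂ (λ x y → x + - y) p q))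
  , trans (D-⊛ {exact} β F ‼ n) (cong₂ _+_ (trans (⊛-comm (D β) F n) p) q)

-- The Wronskian and `D (β ⊛ F)` differ by `2 (β ⊛ D F)`, and `4` divides `D F`.
cf-mod8 : ∀ n → cf n ≈ + n * e n [ + 8 ]
cf-mod8 n = by (- z) (E.begin
  cf n E.≡⟨ trans (cf-newform n) (newform-wronskian ‼ n) ⟩
  (F ⊛ D β) n + - (β ⊛ D F) n E.≡⟨ lemma ((F ⊛ D β) n) ((β ⊛ D F) n) ⟩
  (F ⊛ D β) n + (β ⊛ D F) n - + 2 * (β ⊛ D F) n
    E.≡⟨ cong₂ (λ x y → x - + 2 * y) (sym (trans (D-⊛ {exact} β F ‼ n) (cong (_+ (β ⊛ D F) n) (⊛-comm (D β) F n)))) divisible ⟩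
  + n * e n - + 2 * (+ 4 * z) E.≡⟨ lemma′ (+ n * e n) z ⟩
  + n * e n + - z * + 8 E.∎)
  where
  module E = ≡-Reasoning
  z = (β ⊛ D (S (χ ⊕ χ ⊛ χ))) n
  divisible : (β ⊛ D F) n ≡ + 4 * z
  divisible = trans (≋-trans (⊛-cong (≋-refl {β}) DF-divisible)
    (solve 2 (λ b x → b :* (con (+ 4) :* x) := con (+ 4) :* (b :* x)) ≋-refl β (D (S (χ ⊕ χ ⊛ χ)))) ‼ n) (κ-⊛ (+ 4) (β ⊛ D (S (χ ⊕ χ ⊛ χ))) n)
  lemma : ∀ x y → x + - y ≡ x + y - + 2 * y
  lemma = solve-∀
  lemma′ : ∀ x z → x - + 2 * (+ 4 * z) ≡ x + - z * + 8
  lemma′ = solve-∀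

-- The coefficient of `e` at a prime, from a Lambert series

e-relation : D O⁺ ⊛ O⁻ ⊕ ⊖ (O⁺ ⊛ D O⁻) ≐ κ (+ 2) ⊛ e ⊛ (O⁺ ⊛ O⁻)
e-relation = κ-cancel (+ 2) (⊛-cancelʳ (Θ ⊛ Θ ⊛ O⁺ ⊛ O⁻) refl
  (linear₃ (Θ ⊛ O⁻ ⊛ (κ (+ 2) ⊛ D O⁻) ⊕ O⁻ ⊛ O⁻ ⊛ D Θ ⊕ κ (+ 4) ⊛ e ⊛ Θ ⊛ (O⁻ ⊛ O⁻)) (⊖ (Θ ⊛ (O⁻ ⊛ O⁻))) ((O⁻ ⊛ O⁻) ⊛ (O⁻ ⊛ O⁻)) φ/Θ differentiated φ′Θ
    (solve 9 (λ p t dp dt c c′ dc dc′ e →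
       con (+ 2) :* (dc :* c′ :+ :- (c :* dc′)) :* (t :* t :* c :* c′) := con (+ 2) :* (con (+ 2) :* e :* (c :* c′)) :* (t :* t :* c :* c′)
         :+ (t :* c′ :* (con (+ 2) :* dc′) :+ c′ :* c′ :* dt :+ con (+ 4) :* e :* t :* (c′ :* c′)) :* (p :* (c′ :* c′) :+ :- (t :* (c :* c)))
         :+ (:- (t :* (c′ :* c′))) :* (dp :* (c′ :* c′) :+ p :* (dc′ :* c′ :+ c′ :* dc′) :+ :- (dt :* (c :* c) :+ t :* (dc :* c :+ c :* dc)))
         :+ ((c′ :* c′) :* (c′ :* c′)) :* (dp :* t :+ :- (p :* dt) :+ :- (con (+ 4) :* e :* (p :* t))))
      ≋-refl φ Θ (D φ) (D Θ) O⁺ O⁻ (D O⁺) (D O⁻) e)))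
  where
  differentiated : D φ ⊛ (O⁻ ⊛ O⁻) ⊕ φ ⊛ (D O⁻ ⊛ O⁻ ⊕ O⁻ ⊛ D O⁻) ≐ D Θ ⊛ (O⁺ ⊛ O⁺) ⊕ Θ ⊛ (D O⁺ ⊛ O⁺ ⊕ O⁺ ⊛ D O⁺)
  differentiated = ≋-trans (⊕-cong (≋-refl {D φ ⊛ (O⁻ ⊛ O⁻)}) (⊛-cong (≋-refl {φ}) (≋-sym (D-⊛ O⁻ O⁻)))) (≋-trans (≋-sym (D-⊛ φ (O⁻ ⊛ O⁻))) (≋-trans (D-cong φ/Θ)
    (≋-trans (D-⊛ Θ (O⁺ ⊛ O⁺)) (⊕-cong (≋-refl {D Θ ⊛ (O⁺ ⊛ O⁺)}) (⊛-cong (≋-refl {Θ}) (D-⊛ O⁺ O⁺))))))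

oddPowers : ℕ → ℕ → Series
oddPowers i zero = κ (+ 0)
oddPowers i (suc l) = oddPowers i l ⊕ X (i ℕ.* suc (l ℕ.+ l))

oddPowers-geometric : ∀ i K → (κ (+ 1) ⊕ ⊖ (X i ⊛ X i)) ⊛ oddPowers i K ≐ X i ⊕ ⊖ X (i ℕ.* suc (K ℕ.+ K))
oddPowers-geometric i zero = ≋-trans (solve 1 (λ x → (con (+ 1) :+ :- (x :* x)) :* con (+ 0) := x :+ :- x) ≋-refl (X i))
  (⊕-cong (≋-refl {X i}) (⊖-cong (ptw λ n → cong (λ j → X j n) (sym (ℕ.*-identityʳ i)))))
oddPowers-geometric i (suc K) = linear₂ (κ (+ 1)) (κ (+ 1)) (oddPowers-geometric i K) exponent
  (solve 4 (λ x o y z → (con (+ 1) :+ :- (x :* x)) :* (o :+ y) := (x :+ :- z) :+ con (+ 1) :* ((con (+ 1) :+ :- (x :* x)) :* o :+ :- (x :+ :- y)) :+ con (+ 1) :* (z :+ :- (y :* (x :* x))))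
    ≋-refl (X i) (oddPowers i K) (X (i ℕ.* suc (K ℕ.+ K))) (X (i ℕ.* suc (suc K ℕ.+ suc K))))
  where
  exponent : X (i ℕ.* suc (suc K ℕ.+ suc K)) ≐ X (i ℕ.* suc (K ℕ.+ K)) ⊛ (X i ⊛ X i)
  exponent = begin
    X (i ℕ.* suc (suc K ℕ.+ suc K)) ≡⟨ cong X (lemma i K) ⟩
    X (i ℕ.* suc (K ℕ.+ K) ℕ.+ (i ℕ.+ i)) ≈⟨ X-+ (i ℕ.* suc (K ℕ.+ K)) (i ℕ.+ i) ⟩
    X (i ℕ.* suc (K ℕ.+ K)) ⊛ X (i ℕ.+ i) ≈⟨ ⊛-cong ≋-refl (X-+ i i) ⟩
    X (i ℕ.* suc (K ℕ.+ K)) ⊛ (X i ⊛ X i) ∎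
    where
    lemma : ∀ i K → i ℕ.* suc (suc K ℕ.+ suc K) ≡ i ℕ.* suc (K ℕ.+ K) ℕ.+ (i ℕ.+ i)
    lemma = ℕ-Solver.solve-∀

-- Half the logarithmic derivative of the finite quotient of `odd⁺` by `odd⁻`: a factor
-- `(1 + q^i) / (1 - q^i)` contributes `2i (q^i + q^(3i) + ...)`, cut off after `M + 1` terms.
lambert : ℕ → ℕ → Series
lambert M zero = κ (+ 0)
lambert M (suc j) = lambert M j ⊕ κ (+ suc (j ℕ.+ j)) ⊛ oddPowers (suc (j ℕ.+ j)) (suc M)

D-factor : ∀ {π} c i → D (κ (+ 1) ⊕ κ c ⊛ X i) ≋ κ c ⊛ (κ (+ i) ⊛ X i) at π
D-factor {π} c i = ≐⇒≋ (≋-trans (D-⊕ (κ (+ 1)) (κ c ⊛ X i)) (≋-trans (⊕-cong (D-κ (+ 1)) (≋-trans (D-constant c (X i)) (⊛-cong (≋-refl {κ c}) (D-X i))))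
  (solve 1 (λ x → con (+ 0) :+ x := x) ≋-refl (κ c ⊛ (κ (+ i) ⊛ X i)))))

odd-logarithmic-derivative : ∀ M n → D (odd⁺ n) ⊛ odd⁻ n ⊕ ⊖ (odd⁺ n ⊛ D (odd⁻ n)) ≋ κ (+ 2) ⊛ lambert M n ⊛ (odd⁺ n ⊛ odd⁻ n) at truncated M
odd-logarithmic-derivative M zero = ≐⇒≋ (≋-trans (⊕-cong (⊛-cong (D-κ (+ 1)) (≋-refl {κ (+ 1)})) (⊖-cong (⊛-cong (≋-refl {κ (+ 1)}) (D-κ (+ 1)))))
  (solve 0 (con (+ 0) :* con (+ 1) :+ :- (con (+ 1) :* con (+ 0)) := con (+ 2) :* con (+ 0) :* (con (+ 1) :* con (+ 1))) ≋-refl))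
odd-logarithmic-derivative M (suc n) = linear₃ (c′ ⊛ (κ (+ 1) ⊕ κ (- + 1) ⊛ x)) (⊖ (c ⊛ (κ (+ 1) ⊕ κ (+ 1) ⊛ x))) ((κ (+ 1) ⊕ κ (+ 1) ⊛ x) ⊛ (κ (+ 1) ⊕ κ (- + 1) ⊛ x)) Dc Dc′ (odd-logarithmic-derivative M n)
  (linear₁ (⊖ (κ (+ 2) ⊛ κ (+ i) ⊛ (c ⊛ c′))) geometric
  (T.solve 10 (λ c c′ dc dc′ Dc Dc′ x I G L → let 1+x = T.con (+ 1) T.:+ T.con (+ 1) T.:* x ; 1-x = T.con (+ 1) T.:+ T.con (- + 1) T.:* x in
      Dc T.:* (c′ T.:* 1-x) T.:+ T.:- (c T.:* 1+x T.:* Dc′) T.:= T.con (+ 2) T.:* (L T.:+ I T.:* G) T.:* (c T.:* 1+x T.:* (c′ T.:* 1-x))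
        T.:+ (c′ T.:* 1-x) T.:* (Dc T.:+ T.:- (dc T.:* 1+x T.:+ c T.:* (T.con (+ 1) T.:* (I T.:* x))))
        T.:+ (T.:- (c T.:* 1+x)) T.:* (Dc′ T.:+ T.:- (dc′ T.:* 1-x T.:+ c′ T.:* (T.con (- + 1) T.:* (I T.:* x))))
        T.:+ (1+x T.:* 1-x) T.:* (dc T.:* c′ T.:+ T.:- (c T.:* dc′) T.:+ T.:- (T.con (+ 2) T.:* L T.:* (c T.:* c′)))
        T.:+ (T.:- (T.con (+ 2) T.:* I T.:* (c T.:* c′))) T.:* ((T.con (+ 1) T.:+ T.:- (x T.:* x)) T.:* G T.:+ T.:- x))
    T.≋-refl c c′ (D c) (D c′) (D (odd⁺ (suc n))) (D (odd⁻ (suc n))) x (κ (+ i)) (oddPowers i (suc M)) (lambert M n)))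
  where
  module T = Ser (truncated M)
  i = suc (n ℕ.+ n)
  x = X i
  c = odd⁺ n
  c′ = odd⁻ n
  Dc : D (odd⁺ (suc n)) ≋ D c ⊛ (κ (+ 1) ⊕ κ (+ 1) ⊛ x) ⊕ c ⊛ (κ (+ 1) ⊛ (κ (+ i) ⊛ x)) at truncated M
  Dc = T.≋-trans (D-⊛ c _) (T.⊕-cong (T.≋-refl {D c ⊛ (κ (+ 1) ⊕ κ (+ 1) ⊛ x)}) (T.⊛-cong (T.≋-refl {c}) (D-factor (+ 1) i)))
  Dc′ : D (odd⁻ (suc n)) ≋ D c′ ⊛ (κ (+ 1) ⊕ κ (- + 1) ⊛ x) ⊕ c′ ⊛ (κ (- + 1) ⊛ (κ (+ i) ⊛ x)) at truncated M
  Dc′ = T.≋-trans (D-⊛ c′ _) (T.⊕-cong (T.≋-refl {D c′ ⊛ (κ (+ 1) ⊕ κ (- + 1) ⊛ x)}) (T.⊛-cong (T.≋-refl {c′}) (D-factor (- + 1) i)))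
  remainder : X (i ℕ.* suc (suc M ℕ.+ suc M)) ≋ κ (+ 0) at truncated M
  remainder = T.≋-trans (T.solve 1 (λ x → x T.:= x T.:* T.con (+ 1)) T.≋-refl (X (i ℕ.* suc (suc M ℕ.+ suc M))))
    (X⊛-vanishes (i ℕ.* suc (suc M ℕ.+ suc M)) (κ (+ 1)) bound)
    where
    bound : M < i ℕ.* suc (suc M ℕ.+ suc M)
    bound = ℕ.≤-trans (ℕ.m≤m+n (suc M) (suc M)) (ℕ.≤-trans (ℕ.n≤1+n _) (ℕ.m≤m+n (suc (suc M ℕ.+ suc M)) _))
  geometric : (κ (+ 1) ⊕ ⊖ (x ⊛ x)) ⊛ oddPowers i (suc M) ≋ x at truncated M
  geometric = linear₂ (κ (+ 1)) (⊖ κ (+ 1)) (≐⇒≋ (oddPowers-geometric i (suc M))) remainder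
    (T.solve 3 (λ w x r → w T.:= x T.:+ T.con (+ 1) T.:* (w T.:+ T.:- (x T.:+ T.:- r)) T.:+ (T.:- T.con (+ 1)) T.:* (r T.:+ T.:- T.con (+ 0)))
      T.≋-refl ((κ (+ 1) ⊕ ⊖ (x ⊛ x)) ⊛ oddPowers i (suc M)) x (X (i ℕ.* suc (suc M ℕ.+ suc M))))

-- By `e-relation`, `2 e` is the logarithmic derivative of `O⁺ / O⁻`, which the finite products
-- determine up to `q^n`.
e-lambert : ∀ n → e n ≡ lambert n n n
e-lambert n = ℤ.*-cancelˡ-≡ (+ 2) (e n) (lambert n n n) (trans (sym (κ-⊛ (+ 2) e n)) (trans (≈0⇒≡ (coeffs doubled n ℕ.≤-refl)) (κ-⊛ (+ 2) (lambert n n) n)))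
  where
  module T = Ser (truncated n)
  p⁺ : O⁺ ≋ odd⁺ n at truncated n
  p⁺ = O⁺-truncated n
  p⁻ : O⁻ ≋ odd⁻ n at truncated n
  p⁻ = O⁻-truncated n
  doubled : κ (+ 2) ⊛ e ≋ κ (+ 2) ⊛ lambert n n at truncated n
  doubled = ⊛-cancelʳ (O⁺ ⊛ O⁻) refl (T.≋-trans (T.≋-sym (≐⇒≋ e-relation)) (T.≋-trans
    (T.⊕-cong (T.⊛-cong (D-cong p⁺) p⁻) (T.⊖-cong (T.⊛-cong p⁺ (D-cong p⁻)))) (T.≋-trans (odd-logarithmic-derivative n n)
    (T.⊛-cong (T.≋-refl {κ (+ 2) ⊛ lambert n n}) (T.⊛-cong (T.≋-sym p⁺) (T.≋-sym p⁻))))))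

oddPowers-coeff : ∀ i K n → oddPowers i K n ≡ sum K (λ l → X (i ℕ.* suc (l ℕ.+ l)) n)
oddPowers-coeff i zero n = κ0-coeff n
oddPowers-coeff i (suc K) n = cong (_+ X (i ℕ.* suc (K ℕ.+ K)) n) (oddPowers-coeff i K n)

lambert-coeff : ∀ M j n → lambert M j n ≡ sum j (λ j → + suc (j ℕ.+ j) * sum (suc M) (λ l → X (suc (j ℕ.+ j) ℕ.* suc (l ℕ.+ l)) n))
lambert-coeff M zero n = κ0-coeff n
lambert-coeff M (suc j) n = cong₂ _+_ (lambert-coeff M j n)
  (trans (κ-⊛ (+ suc (j ℕ.+ j)) (oddPowers (suc (j ℕ.+ j)) (suc M)) n) (cong (_*_ (+ suc (j ℕ.+ j))) (oddPowers-coeff (suc (j ℕ.+ j)) (suc M) n)))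

-- The Lambert series sums `i` over the factorisations of the exponent into two odd factors, the
-- first of them `i`; an odd prime has only the two trivial ones.
e-prime : ∀ m → 0 < m → Prime (suc (m ℕ.+ m)) → e (suc (m ℕ.+ m)) ≡ + 1 + + suc (m ℕ.+ m)
e-prime (suc m′) 0<m pr = trans (e-lambert p) (trans (lambert-coeff p p p) (trans (sum-suc (m ℕ.+ m) h) (cong₂ _+_ h0
    (trans (sum-single (m ℕ.+ m) m′ (h ∘ suc) (ℕ.m≤m+n m m) others) hm))))
  where
  m = suc m′
  p = suc (m ℕ.+ m)
  inner : ℕ → ℤ
  inner j = sum (suc p) (λ l → X (suc (j ℕ.+ j) ℕ.* suc (l ℕ.+ l)) p)
  h : ℕ → ℤ
  h j = + suc (j ℕ.+ j) * inner j
  double-injective : ∀ a b → a ℕ.+ a ≡ b ℕ.+ b → a ≡ b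
  double-injective zero zero _ = refl
  double-injective (suc a) (suc b) eq = cong suc (double-injective a b (ℕ.suc-injective (ℕ.suc-injective
    (trans (cong suc (sym (ℕ.+-suc a a))) (trans eq (cong suc (ℕ.+-suc b b)))))))
  h0 : h 0 ≡ + 1
  h0 = trans (ℤ.*-identityˡ (inner 0)) (trans (sum-single (suc p) m (λ l → X (1 ℕ.* suc (l ℕ.+ l)) p)
        (ℕ.≤-trans (ℕ.m≤m+n (suc m) m) (ℕ.n≤1+n _))
        (λ l _ l≢m → X-coeff-≢ (1 ℕ.* suc (l ℕ.+ l)) p (λ eq → l≢m (double-injective l m (ℕ.suc-injective (trans (sym (ℕ.*-identityˡ _)) (sym eq)))))))
      (trans (cong (λ k → X k p) (ℕ.*-identityˡ p)) (X-coeff-≡ p)))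
  hm : h m ≡ + p
  hm = trans (cong (_*_ (+ p)) (trans (sum-single (suc p) 0 (λ l → X (p ℕ.* suc (l ℕ.+ l)) p) (s≤s z≤n)
        (λ l _ l≢0 → X-coeff-≢ (p ℕ.* suc (l ℕ.+ l)) p (λ eq → l≢0 (double-injective l 0 (ℕ.suc-injective
            (ℕ.*-cancelˡ-≡ (suc (l ℕ.+ l)) 1 p (trans (sym eq) (sym (ℕ.*-identityʳ p)))))))))
      (trans (cong (λ k → X k p) (ℕ.*-identityʳ p)) (X-coeff-≡ p)))) (ℤ.*-identityʳ (+ p))
  others : ∀ j → j < m ℕ.+ m → j ≢ m′ → h (suc j) ≡ + 0
  others j _ j≢m′ = trans (cong (_*_ (+ suc (suc j ℕ.+ suc j))) (sum-zero (suc p) λ l _ → X-coeff-≢ (suc (suc j ℕ.+ suc j) ℕ.* suc (l ℕ.+ l)) p (bad l))) (ℤ.*-zeroʳ (+ suc (suc j ℕ.+ suc j)))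
    where
    bad : ∀ l → p ≢ suc (suc j ℕ.+ suc j) ℕ.* suc (l ℕ.+ l)
    bad l eq with prime⇒irreducible pr {suc (suc j ℕ.+ suc j)} (divides (suc (l ℕ.+ l)) (trans eq (ℕ.*-comm (suc (suc j ℕ.+ suc j)) _)))
    ... | inj₁ ()
    ... | inj₂ eq′ = j≢m′ (ℕ.suc-injective (double-injective (suc j) m (ℕ.suc-injective eq′)))

-- Polynomials in u²

U wF² : Series
U = u ⊛ u
wF² = weight u ⊛ (F ⊛ F)

U^ : ℕ → Series
U^ zero = κ (+ 1)
U^ (suc i) = U^ i ⊛ U

evalU : ℕ → (ℕ → ℤ) → Series
evalU zero g = κ (+ 0)
evalU (suc n) g = evalU n g ⊕ κ (g n) ⊛ U^ n

evalU-+ : ∀ n f g → evalU n (λ i → f i + g i) ≐ evalU n f ⊕ evalU n g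
evalU-+ zero f g = solve 0 (con (+ 0) := con (+ 0) :+ con (+ 0)) ≋-refl
evalU-+ (suc n) f g = ≋-trans (⊕-cong (evalU-+ n f g) (⊛-cong (κ-+ (f n) (g n)) (≋-refl {U^ n})))
  (solve 5 (λ x y a b u → x :+ y :+ (a :+ b) :* u := x :+ a :* u :+ (y :+ b :* u)) ≋-refl (evalU n f) (evalU n g) (κ (f n)) (κ (g n)) (U^ n))
  where
  κ-+ : ∀ a b → κ (a + b) ≐ κ a ⊕ κ b
  κ-+ a b = ptw λ { zero → refl ; (suc n) → refl }

κ-* : ∀ a b → κ (a * b) ≐ κ a ⊛ κ b
κ-* a b = ptw λ { zero → refl ; (suc n) → sym (trans (κ-⊛ a (κ b) (suc n)) (ℤ.*-zeroʳ a)) }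

evalU-* : ∀ n c g → evalU n (λ i → c * g i) ≐ κ c ⊛ evalU n g
evalU-* zero c g = solve 1 (λ c → con (+ 0) := c :* con (+ 0)) ≋-refl (κ c)
evalU-* (suc n) c g = ≋-trans (⊕-cong (evalU-* n c g) (⊛-cong (κ-* c (g n)) (≋-refl {U^ n})))
  (solve 4 (λ x c g u → c :* x :+ c :* g :* u := c :* (x :+ g :* u)) ≋-refl (evalU n g) (κ c) (κ (g n)) (U^ n))

evalU-coeff : ∀ n g f k → (evalU n g ⊛ f) k ≡ sum n (λ i → g i * (U^ i ⊛ f) k)
evalU-coeff zero g f k = trans (κ-⊛ (+ 0) f k) refl
evalU-coeff (suc n) g f k = trans (⊛-distribʳ f (evalU n g) (κ (g n) ⊛ U^ n) k) (cong₂ _+_ (evalU-coeff n g f k)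
  (trans (⊛-assoc (κ (g n)) (U^ n) f k) (κ-⊛ (g n) (U^ n ⊛ f) k)))

U^-+ : ∀ i j → U^ (i ℕ.+ j) ≐ U^ i ⊛ U^ j
U^-+ zero j = solve 1 (λ x → x := con (+ 1) :* x) ≋-refl (U^ j)
U^-+ (suc i) j = ≋-trans (⊛-cong (U^-+ i j) (≋-refl {U})) (solve 3 (λ x y z → x :* y :* z := x :* z :* y) ≋-refl (U^ i) (U^ j) U)

evalU-coeff₂ : ∀ n g n′ g′ f k → (evalU n g ⊛ (evalU n′ g′ ⊛ f)) k ≡ sum n (λ i → sum n′ (λ j → g i * g′ j * (U^ (i ℕ.+ j) ⊛ f) k))
evalU-coeff₂ n g n′ g′ f k = trans (evalU-coeff n g (evalU n′ g′ ⊛ f) k) (sum-ext n λ i → trans (cong (_*_ (g i)) (inner i))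
  (trans (sym (sum-*ˡ n′ (g i) (λ j → g′ j * (U^ (i ℕ.+ j) ⊛ f) k))) (sum-ext n′ λ j → sym (ℤ.*-assoc (g i) (g′ j) ((U^ (i ℕ.+ j) ⊛ f) k)))))
  where
  inner : ∀ i → (U^ i ⊛ (evalU n′ g′ ⊛ f)) k ≡ sum n′ (λ j → g′ j * (U^ (i ℕ.+ j) ⊛ f) k)
  inner i = trans (solve 3 (λ u e f → u :* (e :* f) := e :* (u :* f)) ≋-refl (U^ i) (evalU n′ g′) f ‼ k)
    (trans (evalU-coeff n′ g′ (U^ i ⊛ f) k) (sum-ext n′ λ j → cong (_*_ (g′ j)) (≋-trans (solve 3 (λ v u f → v :* (u :* f) := u :* v :* f) ≋-refl (U^ j) (U^ i) f) (⊛-cong (≋-sym (U^-+ i j)) (≋-refl {f})) ‼ k)))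

-- θ is u d/du.
θ : (ℕ → ℤ) → ℕ → ℤ
θ g i = + 2 * + i * g i

D-U : D U ≐ κ (+ 2) ⊛ (U ⊛ wF²)
D-U = ≋-trans (D-⊛ u u) (linear₁ (κ (+ 2) ⊛ u) Du
  (solve 4 (λ u d w f → d :* u :+ u :* d := con (+ 2) :* (u :* u :* (w :* f)) :+ con (+ 2) :* u :* (d :+ :- (u :* w :* f))) ≋-refl u (D u) (weight u) (F ⊛ F)))

D-U^ : ∀ i → D (U^ i) ≐ κ (+ 2 * + i) ⊛ (U^ i ⊛ wF²)
D-U^ zero = ≋-trans (D-κ (+ 1)) (solve 1 (λ x → con (+ 0) := con (+ 0) :* x) ≋-refl (κ (+ 1) ⊛ wF²))
D-U^ (suc i) = ≋-trans (D-⊛ (U^ i) U) (linear₃ U (U^ i) (⊖ (U^ i ⊛ U ⊛ wF²)) (D-U^ i) D-U next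
  (solve 7 (λ d v n V w e s → d :* v :+ V :* e := s :* (V :* v :* w) :+ v :* (d :+ :- (n :* (V :* w))) :+ V :* (e :+ :- (con (+ 2) :* (v :* w))) :+ (:- (V :* v :* w)) :* (s :+ :- (n :+ con (+ 2))))
    ≋-refl (D (U^ i)) U (κ (+ 2 * + i)) (U^ i) wF² (D U) (κ (+ 2 * + suc i))))
  where
  next : κ (+ 2 * + suc i) ≐ κ (+ 2 * + i) ⊕ κ (+ 2)
  next = ptw λ { zero → lemma (+ i) ; (suc n) → refl }
    where
    lemma : ∀ i → + 2 * (+ 1 + i) ≡ + 2 * i + + 2
    lemma = solve-∀

D-evalU : ∀ n g → D (evalU n g) ≐ wF² ⊛ evalU n (θ g)
D-evalU zero g = ≋-trans (D-κ (+ 0)) (solve 1 (λ x → con (+ 0) := x :* con (+ 0)) ≋-refl wF²)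
D-evalU (suc n) g = ≋-trans (D-⊕ (evalU n g) (κ (g n) ⊛ U^ n)) (≋-trans (⊕-cong (D-evalU n g) (≋-trans (D-constant (g n) (U^ n)) (⊛-cong (≋-refl {κ (g n)}) (D-U^ n))))
  (≋-trans (solve 5 (λ w y g k V → w :* y :+ g :* (k :* (V :* w)) := w :* (y :+ k :* g :* V)) ≋-refl wF² (evalU n (θ g)) (κ (g n)) (κ (+ 2 * + n)) (U^ n))
    (⊛-cong (≋-refl {wF²}) (⊕-cong (≋-refl {evalU n (θ g)}) (⊛-cong (≋-sym (κ-* (+ 2 * + n) (g n))) (≋-refl {U^ n}))))))

D-weight : D (weight u) ≐ ⊖ (κ (+ 32) ⊛ (U ⊛ wF²))
D-weight = ≋-trans (D-⊕ (κ (+ 1)) (⊖ (κ (+ 16) ⊛ U))) (≋-trans (⊕-cong (D-κ (+ 1)) (≋-trans (D-⊖ (κ (+ 16) ⊛ U)) (⊖-cong (≋-trans (D-constant (+ 16) U) (⊛-cong (≋-refl {κ (+ 16)}) D-U)))))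
  (solve 1 (λ x → con (+ 0) :+ :- (con (+ 16) :* (con (+ 2) :* x)) := :- (con (+ 32) :* x)) ≋-refl (U ⊛ wF²)))

D-wF² : D wF² ≐ ⊖ (κ (+ 32) ⊛ (U ⊛ wF²)) ⊛ (F ⊛ F) ⊕ weight u ⊛ (κ (+ 2) ⊛ (F ⊛ D F))
D-wF² = ≋-trans (D-⊛ (weight u) (F ⊛ F)) (⊕-cong (⊛-cong D-weight (≋-refl {F ⊛ F})) (⊛-cong (≋-refl {weight u}) (≋-trans (D-⊛ F F)
  (solve 2 (λ f d → d :* f :+ f :* d := con (+ 2) :* (f :* d)) ≋-refl F (D F)))))

aF : a ⊛ F ≐ κ (+ 1)
aF = ≋-trans (ptw (⊛-comm a F)) Fa

-- On multiples of `1 / F`, `D²` becomes the hypergeometric operator `θ² - 16 u² (θ + 1)²`: by `DDa`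
-- and `D-wF²` the terms with `D F` cancel. Applied to `F` itself it must give zero, since `F / F`
-- is constant.
D²-aE : ∀ n g → D (D (a ⊛ evalU n g)) ≐ wF² ⊛ F ⊛ (evalU n (θ (θ g)) ⊕ ⊖ (κ (+ 16) ⊛ U ⊛ (evalU n (θ (θ g)) ⊕ κ (+ 2) ⊛ evalU n (θ g) ⊕ evalU n g)))
D²-aE n g = begin
  D (D (a ⊛ y)) ≈⟨ D-cong (≋-trans (D-⊛ a y) (⊕-cong (≋-refl {D a ⊛ y}) (⊛-cong (≋-refl {a}) (D-evalU n g)))) ⟩
  D (D a ⊛ y ⊕ a ⊛ (wF² ⊛ y₁)) ≈⟨ D-⊕ (D a ⊛ y) (a ⊛ (wF² ⊛ y₁)) ⟩
  D (D a ⊛ y) ⊕ D (a ⊛ (wF² ⊛ y₁)) ≈⟨ ⊕-cong (D-⊛ (D a) y) (≋-trans (D-⊛ a (wF² ⊛ y₁)) (⊕-cong (≋-refl {D a ⊛ (wF² ⊛ y₁)}) (⊛-cong (≋-refl {a}) (D-⊛ wF² y₁)))) ⟩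
  (D (D a) ⊛ y ⊕ D a ⊛ D y) ⊕ (D a ⊛ (wF² ⊛ y₁) ⊕ a ⊛ (D wF² ⊛ y₁ ⊕ wF² ⊛ D y₁))
    ≈⟨ linear₃ y (D a) (a ⊛ wF²) DDa (D-evalU n g) (D-evalU n (θ g)) (linear₃ (a ⊛ y₁) (κ (+ 2) ⊛ (wF² ⊛ y₁)) (κ (+ 32) ⊛ (U ⊛ (⊖ (wF² ⊛ F ⊛ y₁))) ⊕ wF² ⊛ (weight u ⊛ F) ⊛ y₂) D-wF² (D-reciprocal a F aF) aF (linear₁ (⊖ (κ (+ 2) ⊛ (weight u ⊛ (y₁ ⊛ (D F ⊛ (a ⊛ F)))))) aF
       (solve 12 (λ a da dda F dF u y dy y₁ dy₁ y₂ dw →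
           let U = u :* u
               w = con (+ 1) :+ :- (con (+ 16) :* U)
               W = w :* (F :* F) in
           dda :* y :+ da :* dy :+ (da :* (W :* y₁) :+ a :* (dw :* y₁ :+ W :* dy₁))
           := W :* F :* (y₂ :+ :- (con (+ 16) :* U :* (y₂ :+ con (+ 2) :* y₁ :+ y)))
             :+ y :* (dda :+ :- (:- (con (+ 16) :* (u :* u) :* w :* (F :* F :* F))))
             :+ da :* (dy :+ :- (W :* y₁))
             :+ a :* W :* (dy₁ :+ :- (W :* y₂))
             :+ a :* y₁ :* (dw :+ :- (:- (con (+ 32) :* (U :* W)) :* (F :* F) :+ w :* (con (+ 2) :* (F :* dF))))
             :+ con (+ 2) :* (W :* y₁) :* (da :+ :- (:- (a :* a :* dF)))
             :+ (con (+ 32) :* (U :* (:- (W :* F :* y₁))) :+ W :* (w :* F) :* y₂) :* (a :* F :+ :- con (+ 1))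
             :+ (:- (con (+ 2) :* (w :* (y₁ :* (dF :* (a :* F)))))) :* (a :* F :+ :- con (+ 1)))
         ≋-refl a (D a) (D (D a)) F (D F) u y (D y) y₁ (D y₁) y₂ (D wF²)))) ⟩
  wF² ⊛ F ⊛ (y₂ ⊕ ⊖ (κ (+ 16) ⊛ U ⊛ (y₂ ⊕ κ (+ 2) ⊛ y₁ ⊕ y))) ∎
  where
  y = evalU n g
  y₁ = evalU n (θ g)
  y₂ = evalU n (θ (θ g))

-- Congruences between truncated series

modular : ℤ → ℕ → Precision
modular N M = record { modulus = N ; Index = _≤ M ; down = ℕ.≤-trans }

truncated⇒modular : ∀ {N M f g} → f ≋ g at truncated M → f ≋ g at modular N M
truncated⇒modular h = at λ n i → ≡⇒≈ (≈0⇒≡ (coeffs h n i))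

û : Series
û = S (S (ψ ⊛ ψ)) ⊛ a

u-û : u ≐ X 1 ⊛ û
u-û = ptw (⊛-assoc (X 1) (S (S (ψ ⊛ ψ))) a)

û^ : ℕ → Series
û^ zero = κ (+ 1)
û^ (suc i) = û^ i ⊛ (û ⊛ û)

û^-0 : ∀ i → û^ i 0 ≡ + 1
û^-0 zero = refl
û^-0 (suc i) = trans (ℤ.*-identityʳ (û^ i 0)) (û^-0 i)

U^-û : ∀ i → U^ i ≐ X (i ℕ.+ i) ⊛ û^ i
U^-û zero = solve 0 (con (+ 1) := con (+ 1) :* con (+ 1)) ≋-refl
U^-û (suc i) = ≋-trans (⊛-cong (U^-û i) (⊛-cong u-û u-û)) (≋-trans (solve 4 (λ x v y w → x :* v :* (y :* w :* (y :* w)) := y :* (y :* x) :* (v :* (w :* w))) ≋-refl (X (i ℕ.+ i)) (û^ i) (X 1) û)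
  (⊛-cong (≋-sym (≋-trans (ptw λ n → cong (λ k → X (suc k) n) (ℕ.+-suc i i)) (≋-trans (X-suc (suc (i ℕ.+ i))) (⊛-cong (≋-refl {X 1}) (X-suc (i ℕ.+ i)))))) (≋-refl {û^ i ⊛ (û ⊛ û)})))

U^-vanishes : ∀ i f {M} → M < i ℕ.+ i → U^ i ⊛ f ≋ κ (+ 0) at truncated M
U^-vanishes i f {M} M< = Ser.≋-trans (truncated M) (≐⇒≋ (≋-trans (⊛-cong (U^-û i) (≋-refl {f})) (ptw (⊛-assoc (X (i ℕ.+ i)) (û^ i) f)))) (X⊛-vanishes (i ℕ.+ i) (û^ i ⊛ f) M<)

X⊛-coeff : ∀ k f → (X k ⊛ f) k ≡ f 0
X⊛-coeff zero f = trans (κ-⊛ (+ 1) f 0) (ℤ.*-identityˡ (f 0))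
X⊛-coeff (suc k) f = trans (ℤ.+-identityˡ _) (X⊛-coeff k f)

U^Du : ∀ i f → U^ i ⊛ D u ⊛ f ≐ X (suc (i ℕ.+ i)) ⊛ (û^ i ⊛ û ⊛ wF² ⊛ f)
U^Du i f = begin
  U^ i ⊛ D u ⊛ f ≈⟨ ⊛-cong (⊛-cong (U^-û i) (≋-trans Du (⊛-cong (⊛-cong u-û (≋-refl {weight u})) (≋-refl {F ⊛ F})))) (≋-refl {f}) ⟩
  X (i ℕ.+ i) ⊛ û^ i ⊛ (X 1 ⊛ û ⊛ weight u ⊛ (F ⊛ F)) ⊛ f
    ≈⟨ solve 7 (λ x v y w W F f → x :* v :* (y :* w :* W :* F) :* f := y :* x :* (v :* w :* (W :* F) :* f)) ≋-refl (X (i ℕ.+ i)) (û^ i) (X 1) û (weight u) (F ⊛ F) f ⟩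
  X 1 ⊛ X (i ℕ.+ i) ⊛ (û^ i ⊛ û ⊛ wF² ⊛ f) ≈⟨ ⊛-cong (≋-sym (X-suc (i ℕ.+ i))) (≋-refl {û^ i ⊛ û ⊛ wF² ⊛ f}) ⟩
  X (suc (i ℕ.+ i)) ⊛ (û^ i ⊛ û ⊛ wF² ⊛ f) ∎

U^Du-coeff : ∀ i f → (U^ i ⊛ D u ⊛ f) (suc (i ℕ.+ i)) ≡ f 0
U^Du-coeff i f = trans (U^Du i f ‼ suc (i ℕ.+ i)) (trans (X⊛-coeff (suc (i ℕ.+ i)) (û^ i ⊛ û ⊛ wF² ⊛ f)) (trans (cong (λ x → x * û 0 * wF² 0 * f 0) (û^-0 i)) (ℤ.*-identityˡ (f 0))))

U^Du-low : ∀ i f k → k < suc (i ℕ.+ i) → (U^ i ⊛ D u ⊛ f) k ≡ + 0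
U^Du-low i f k k< = trans (U^Du i f ‼ k) (trans (≈0⇒≡ (coeffs (X⊛-vanishes (suc (i ℕ.+ i)) (û^ i ⊛ û ⊛ wF² ⊛ f) k<) k ℕ.≤-refl)) (κ0-coeff k))

D-uU^ : ∀ i → D (u ⊛ U^ i) ≐ κ (+ suc (i ℕ.+ i)) ⊛ (U^ i ⊛ D u)
D-uU^ i = ≋-trans (D-⊛ u (U^ i)) (linear₃ u (⊖ (κ (+ 2 * + i) ⊛ U^ i)) (⊖ (U^ i ⊛ D u)) (D-U^ i) Du odd
  (solve 8 (λ u d V e n w f s → d :* V :+ u :* e := s :* (V :* d) :+ u :* (e :+ :- (n :* (V :* (w :* f)))) :+ (:- (n :* V)) :* (d :+ :- (u :* w :* f)) :+ (:- (V :* d)) :* (s :+ :- (n :+ con (+ 1))))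
    ≋-refl u (D u) (U^ i) (D (U^ i)) (κ (+ 2 * + i)) (weight u) (F ⊛ F) (κ (+ suc (i ℕ.+ i)))))
  where
  odd : κ (+ suc (i ℕ.+ i)) ≐ κ (+ 2 * + i) ⊕ κ (+ 1)
  odd = ptw λ { zero → lemma (+ i) ; (suc n) → refl }
    where
    lemma : ∀ i → + 1 + (i + i) ≡ + 2 * i + + 1
    lemma = solve-∀

κ-≋ : ∀ {N M a b} → a ≈ b [ N ] → κ a ≋ κ b at modular N M
κ-≋ h = at λ { zero _ → h ; (suc n) _ → ≈-refl }

evalU-telescope : ∀ {N M} n (α β : ℕ → ℤ) → α 0 ≈ + 0 [ N ] → (∀ i → i < n → α (suc i) ≈ β i [ N ]) → evalU (suc n) α ≋ U ⊛ evalU n β at modular N M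
evalU-telescope {N} {M} zero α β h₀ h = R.≋-trans (R.⊕-cong (R.≋-refl {κ (+ 0)}) (R.⊛-cong (κ-≋ h₀) (R.≋-refl {κ (+ 1)})))
  (R.solve 1 (λ u → R.con (+ 0) R.:+ R.con (+ 0) R.:* R.con (+ 1) R.:= u R.:* R.con (+ 0)) R.≋-refl U)
  where module R = Ser (modular N M)
evalU-telescope {N} {M} (suc n) α β h₀ h = R.≋-trans (R.⊕-cong (evalU-telescope n α β h₀ (λ i i<n → h i (ℕ.m<n⇒m<1+n i<n))) (R.⊛-cong (κ-≋ (h n (ℕ.n<1+n n))) (R.≋-refl {U^ n ⊛ U})))
  (R.solve 4 (λ u y b v → u R.:* y R.:+ b R.:* (v R.:* u) R.:= u R.:* (y R.:+ b R.:* v)) R.≋-refl U (evalU n β) (κ (β n)) (U^ n))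
  where module R = Ser (modular N M)

-- The recurrence cancels every term except the topmost one, whose order `2 (n + 1)` in `q` lies
-- beyond the precision.
evalU-balance : ∀ {N M} n (α β : ℕ → ℤ) → M < suc n ℕ.+ suc n → α 0 ≈ + 0 [ N ] → (∀ i → i < n → α (suc i) ≈ β i [ N ]) →
                evalU (suc n) α ⊕ ⊖ (U ⊛ evalU (suc n) β) ≋ κ (+ 0) at modular N M
evalU-balance n α β M< h₀ h = linear₂ (κ (+ 1)) (⊖ κ (β n)) (evalU-telescope n α β h₀ h) (truncated⇒modular (U^-vanishes (suc n) (κ (+ 1)) M<))
  (≐⇒≋ (solve 5 (λ A u y b v → A :+ :- (u :* (y :+ b :* v)) := con (+ 0) :+ con (+ 1) :* (A :+ :- (u :* y)) :+ (:- b) :* (v :* u :* con (+ 1) :+ :- con (+ 0))) ≋-refl (evalU (suc n) α) U (evalU n β) (κ (β n)) (U^ n)))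

evalU-0 : ∀ n g → evalU (suc n) g 0 ≡ g 0
evalU-0 zero g = trans (ℤ.+-identityˡ _) (ℤ.*-identityʳ (g 0))
evalU-0 (suc n) g = trans (cong₂ _+_ (evalU-0 n g) (trans (cong (_*_ (g (suc n))) (ℤ.*-zeroʳ (U^ n 0))) (ℤ.*-zeroʳ (g (suc n))))) (ℤ.+-identityʳ (g 0))

θ+1² : (ℕ → ℤ) → ℕ → ℤ
θ+1² g i = θ (θ g) i + + 2 * θ g i + g i

D²-aE′ : ∀ n g → D (D (a ⊛ evalU n g)) ≐ wF² ⊛ F ⊛ (evalU n (θ (θ g)) ⊕ ⊖ (U ⊛ evalU n (λ i → + 16 * θ+1² g i)))
D²-aE′ n g = ≋-trans (D²-aE n g) (linear₁ (wF² ⊛ F ⊛ U) combination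
  (solve 7 (λ w F U y₂ y₁ y z → w :* F :* (y₂ :+ :- (con (+ 16) :* U :* (y₂ :+ con (+ 2) :* y₁ :+ y))) := w :* F :* (y₂ :+ :- (U :* z)) :+ w :* F :* U :* (z :+ :- (con (+ 16) :* (y₂ :+ con (+ 2) :* y₁ :+ y))))
    ≋-refl wF² F U (evalU n (θ (θ g))) (evalU n (θ g)) (evalU n g) (evalU n (λ i → + 16 * θ+1² g i))))
  where
  combination : evalU n (λ i → + 16 * θ+1² g i) ≐ κ (+ 16) ⊛ (evalU n (θ (θ g)) ⊕ κ (+ 2) ⊛ evalU n (θ g) ⊕ evalU n g)
  combination = ≋-trans (evalU-* n (+ 16) (θ+1² g)) (⊛-cong (≋-refl {κ (+ 16)}) (≋-trans (evalU-+ n (λ i → θ (θ g) i + + 2 * θ g i) g)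
    (⊕-cong (≋-trans (evalU-+ n (θ (θ g)) (λ i → + 2 * θ g i)) (⊕-cong (≋-refl {evalU n (θ (θ g))}) (evalU-* n (+ 2) (θ g)))) (≋-refl {evalU n g}))))

-- The second-order equation for F as a function of u identifies its u-expansion.
F-expansion : ∀ m → F ≋ evalU (suc m) g₀ at truncated (suc (m ℕ.+ m))
F-expansion m = linear₂ (⊖ F) y constant (≐⇒≋ Fa) (≐⇒≋ (solve 3 (λ F a y → F := y :+ (:- F) :* (a :* y :+ :- con (+ 1)) :+ y :* (F :* a :+ :- con (+ 1))) ≋-refl F a y))
  where
  M = suc (m ℕ.+ m)
  y = evalU (suc m) g₀
  recurrence : ∀ i → θ (θ g₀) (suc i) ≡ + 16 * θ+1² g₀ i
  recurrence i = trans (lemma₁ (+ suc i) (centralBinom (suc i))) (trans (cong (λ x → + 4 * (x * x)) (centralBinom-suc i)) (lemma₂ (+ i) (centralBinom i)))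
    where
    lemma₁ : ∀ n b → + 2 * n * (+ 2 * n * (b * b)) ≡ + 4 * (n * b * (n * b))
    lemma₁ = solve-∀
    lemma₂ : ∀ i c → + 4 * (+ 2 * (+ 1 + (i + i)) * c * (+ 2 * (+ 1 + (i + i)) * c)) ≡ + 16 * (+ 2 * i * (+ 2 * i * (c * c)) + + 2 * (+ 2 * i * (c * c)) + c * c)
    lemma₂ = solve-∀
  second : D (D (a ⊛ y)) ≋ κ (+ 0) at truncated M
  second = linear₂ (κ (+ 1)) (wF² ⊛ F) (≐⇒≋ (D²-aE′ (suc m) g₀)) (evalU-balance m (θ (θ g₀)) (λ i → + 16 * θ+1² g₀ i) (ℕ.≤-reflexive (cong suc (sym (ℕ.+-suc m m)))) (≡⇒≈ refl) (λ i _ → ≡⇒≈ (recurrence i)))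
    (≐⇒≋ (solve 3 (λ d w x → d := con (+ 0) :+ con (+ 1) :* (d :+ :- (w :* x)) :+ w :* (x :+ :- con (+ 0))) ≋-refl (D (D (a ⊛ y))) (wF² ⊛ F) (evalU (suc m) (θ (θ g₀)) ⊕ ⊖ (U ⊛ evalU (suc m) (λ i → + 16 * θ+1² g₀ i)))))
  constant : a ⊛ y ≋ κ (+ 1) at truncated M
  constant = at λ
    { zero _ → ≡⇒≈ (trans (cong (_*_ (a 0)) (evalU-0 m g₀)) (trans (ℤ.*-identityˡ (g₀ 0)) (cong (λ x → x * x) (binom-0 0))))
    ; (suc n) n≤M → ≡⇒≈ (ℤ.*-cancelˡ-≡ (+ suc n) ((a ⊛ y) (suc n)) (+ 0) (trans (ℤ.*-cancelˡ-≡ (+ suc n) (+ suc n * (a ⊛ y) (suc n)) (+ 0) (trans (≈0⇒≡ (coeffs second (suc n) n≤M)) (sym (ℤ.*-zeroʳ (+ suc n))))) (sym (ℤ.*-zeroʳ (+ suc n))))) }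

-- The coefficient of the newform at p, modulo p²

module NewformCoefficient (m : ℕ) (pr : Prime (suc (m ℕ.+ m))) where
  open PrimeField m pr using (2m; p; P; PP; Unit; Unit-*; cancel; unit-small; inv; inv-rightₚ; P²⇒P; P≈0)
  open PrimeSquare m pr using (cancel-P)
  open HarmonicSums m pr using (H)

  h : ℕ → ℤ
  h i = H (i ℕ.+ i) - H i

  -- Frobenius's method: this is the derivative of `g₀ i` with respect to the exponent `2i` of `u`,
  -- so that `F log u + Σ g₁ i u^(2i)` is the second solution of the differential equation of `F`.
  g₁ : ℕ → ℤ
  g₁ i = g₀ i * (+ 2 * h i)

  y₀ y₁ z : Series
  y₀ = evalU (suc m) g₀
  y₁ = evalU (suc m) g₁
  z = a ⊛ y₁

  h-suc : ∀ i → i < m → + 2 * + suc i * + suc (i ℕ.+ i) * (h (suc i) - h i) ≈ + 1 [ P ]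
  h-suc i i<m = linear-≈₃ (+ suc (i ℕ.+ i)) (+ 2 * + suc i) (- (+ 2 * + suc (i ℕ.+ i))) (inv-rightₚ (unit-small (suc (suc (i ℕ.+ i))) (s≤s z≤n) (s≤s i₂<))) (inv-rightₚ (unit-small (suc (i ℕ.+ i)) (s≤s z≤n) (ℕ.m<n⇒m<1+n i₂<))) (inv-rightₚ (unit-small (suc i) (s≤s z≤n) (s≤s (ℕ.≤-trans i<m (ℕ.m≤m+n m m)))))
    (trans (cong (λ n → + 2 * + suc i * + suc (i ℕ.+ i) * (H n - H (suc i) - (H (i ℕ.+ i) - H i))) (cong suc (ℕ.+-suc i i)))
      (lemma (+ i) (H (i ℕ.+ i)) (H i) (inv (+ suc (i ℕ.+ i))) (inv (+ suc (suc (i ℕ.+ i)))) (inv (+ suc i))))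
    where
    i₂< : suc (i ℕ.+ i) < 2m
    i₂< = subst (_≤ 2m) (cong suc (ℕ.+-suc i i)) (ℕ.+-mono-≤ i<m i<m)
    lemma : ∀ i A B x y w → + 2 * (+ 1 + i) * (+ 1 + (i + i)) * (A + x + y - (B + w) - (A - B)) ≡ + 1 + (+ 1 + (i + i)) * ((+ 2 + (i + i)) * y - + 1) + + 2 * (+ 1 + i) * ((+ 1 + (i + i)) * x - + 1) + - (+ 2 * (+ 1 + (i + i))) * ((+ 1 + i) * w - + 1)
    lemma = solve-∀

  -- The recurrence of `g₀`, differentiated with respect to the exponent.
  g₁-recurrence : ∀ i → i < m → θ (θ g₁) (suc i) + + 2 * θ g₀ (suc i) ≈ + 16 * θ+1² g₁ i + + 32 * (θ g₀ i + g₀ i) [ P ]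
  g₁-recurrence i i<m = cancel {_} {_} {n} (unit-small (suc i) (s≤s z≤n) (s≤s (ℕ.≤-trans i<m (ℕ.m≤m+n m m))))
    (≈-trans (≡⇒≈ (trans (lemma₁ n b (h (suc i))) (trans (cong (λ x → + 8 * n * (x * x) * h (suc i) + + 4 * (x * x)) (centralBinom-suc i)) (lemma₂ n (+ i) c (h (suc i)) (h i)))))
      (linear-≈ (+ 16 * (+ 1 + (+ i + + i)) * (c * c)) (h-suc i i<m) (lemma₃ (+ i) c (h (suc i)) (h i))))
    where
    n = + suc i
    b = centralBinom (suc i)
    c = centralBinom i
    lemma₁ : ∀ n b h → n * (+ 2 * n * (+ 2 * n * (b * b * (+ 2 * h))) + + 2 * (+ 2 * n * (b * b))) ≡ + 8 * n * (n * b * (n * b)) * h + + 4 * (n * b * (n * b))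
    lemma₁ = solve-∀
    lemma₂ : ∀ n i c h k → + 8 * n * (+ 2 * (+ 1 + (i + i)) * c * (+ 2 * (+ 1 + (i + i)) * c)) * h + + 4 * (+ 2 * (+ 1 + (i + i)) * c * (+ 2 * (+ 1 + (i + i)) * c))
                           ≡ + 32 * n * ((+ 1 + (i + i)) * (+ 1 + (i + i))) * (c * c) * k + + 16 * ((+ 1 + (i + i)) * (c * c)) * (+ 2 * n * (+ 1 + (i + i)) * (h - k)) + + 16 * ((+ 1 + (i + i)) * (+ 1 + (i + i))) * (c * c)
    lemma₂ = solve-∀
    lemma₃ : ∀ i c h k → + 32 * (+ 1 + i) * ((+ 1 + (i + i)) * (+ 1 + (i + i))) * (c * c) * k + + 16 * ((+ 1 + (i + i)) * (c * c)) * (+ 2 * (+ 1 + i) * (+ 1 + (i + i)) * (h - k)) + + 16 * ((+ 1 + (i + i)) * (+ 1 + (i + i))) * (c * c)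
                         ≡ (+ 1 + i) * (+ 16 * (+ 2 * i * (+ 2 * i * (c * c * (+ 2 * k))) + + 2 * (+ 2 * i * (c * c * (+ 2 * k))) + c * c * (+ 2 * k)) + + 32 * (+ 2 * i * (c * c) + c * c))
                           + + 16 * (+ 1 + (i + i)) * (c * c) * (+ 2 * (+ 1 + i) * (+ 1 + (i + i)) * (h - k) - + 1)
    lemma₃ = solve-∀

  p<2[1+m] : p < suc m ℕ.+ suc m
  p<2[1+m] = ℕ.≤-reflexive (cong suc (sym (ℕ.+-suc m m)))

  F≋y₀ : ∀ {N} → F ≋ y₀ at modular N p
  F≋y₀ = truncated⇒modular (F-expansion m)

  -- As `wF²` is the logarithmic derivative of `u`, this says that `z + log u` is annihilated by
  -- `D²`, that is, that `y₁ + F log u` solves the equation of `F` modulo `P`.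
  derivative : D (D z ⊕ wF²) ≋ κ (+ 0) at modular P p
  derivative = linear₃ (κ (+ 1)) (κ (+ 1)) (κ (+ 1)) (≐⇒≋ (D-⊕ (D z) wF²)) (≐⇒≋ (D²-aE′ (suc m) g₁)) (≐⇒≋ D-wF²)
    (linear₃ (κ (+ 2) ⊛ (weight u ⊛ F)) (⊖ (κ (+ 32) ⊛ (U ⊛ wF²) ⊛ F)) (κ (+ 2) ⊛ (weight u ⊛ F)) (D-cong F≋y₀) F≋y₀ (≐⇒≋ (D-evalU (suc m) g₀))
    (linear₃ (wF² ⊛ F) (wF² ⊛ F) (⊖ (wF² ⊛ F ⊛ U)) (evalU-balance m A B p<2[1+m] (≡⇒≈ refl) g₁-recurrence) (≐⇒≋ A-split) (≐⇒≋ B-split)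
    (≐⇒≋ (solve 13 (λ d dd dw u F dF y dy y′ x₂ x α β →
        let U = u :* u
            w = con (+ 1) :+ :- (con (+ 16) :* U)
            W = w :* (F :* F) in
        d := con (+ 0)
          :+ con (+ 1) :* (d :+ :- (dd :+ dw))
          :+ con (+ 1) :* (dd :+ :- (W :* F :* (x₂ :+ :- (U :* x))))
          :+ con (+ 1) :* (dw :+ :- ((:- (con (+ 32) :* (U :* W))) :* (F :* F) :+ w :* (con (+ 2) :* (F :* dF))))
          :+ con (+ 2) :* (w :* F) :* (dF :+ :- dy)
          :+ (:- (con (+ 32) :* (U :* W) :* F)) :* (F :+ :- y)
          :+ con (+ 2) :* (w :* F) :* (dy :+ :- (W :* y′))
          :+ W :* F :* (α :+ :- (U :* β) :+ :- con (+ 0))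
          :+ W :* F :* (x₂ :+ con (+ 2) :* y′ :+ :- α)
          :+ (:- (W :* F :* U)) :* (x :+ con (+ 32) :* (y′ :+ y) :+ :- β))
      ≋-refl (D (D z ⊕ wF²)) (D (D z)) (D wF²) u F (D F) y₀ (D y₀) (evalU (suc m) (θ g₀)) (evalU (suc m) (θ (θ g₁))) (evalU (suc m) (λ i → + 16 * θ+1² g₁ i)) (evalU (suc m) A) (evalU (suc m) B)))))
    where
    A B : ℕ → ℤ
    A i = θ (θ g₁) i + + 2 * θ g₀ i
    B i = + 16 * θ+1² g₁ i + + 32 * (θ g₀ i + g₀ i)
    A-split : evalU (suc m) (θ (θ g₁)) ⊕ κ (+ 2) ⊛ evalU (suc m) (θ g₀) ≐ evalU (suc m) A
    A-split = ≋-sym (≋-trans (evalU-+ (suc m) (θ (θ g₁)) (λ i → + 2 * θ g₀ i)) (⊕-cong (≋-refl {evalU (suc m) (θ (θ g₁))}) (evalU-* (suc m) (+ 2) (θ g₀))))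
    B-split : evalU (suc m) (λ i → + 16 * θ+1² g₁ i) ⊕ κ (+ 32) ⊛ (evalU (suc m) (θ g₀) ⊕ y₀) ≐ evalU (suc m) B
    B-split = ≋-sym (≋-trans (evalU-+ (suc m) (λ i → + 16 * θ+1² g₁ i) (λ i → + 32 * (θ g₀ i + g₀ i))) (⊕-cong (≋-refl {evalU (suc m) (λ i → + 16 * θ+1² g₁ i)}) (≋-trans (evalU-* (suc m) (+ 32) (λ i → θ g₀ i + g₀ i)) (⊛-cong (≋-refl {κ (+ 32)}) (evalU-+ (suc m) (θ g₀) g₀)))))

  -- modulo p the second solution of the differential equation is F log q up to q^(p-1)
  logarithmic : D z ⊕ wF² ≋ κ (+ 1) at modular P 2m
  logarithmic = at λ
    { zero _ → ≡⇒≈ refl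
    -- The division by the index fails at `q^p`, hence the precision `2m` in place of `p`.
    ; (suc n) n≤ → cancel {_} {_} {+ suc n} (unit-small (suc n) (s≤s z≤n) (s≤s n≤)) (≈-trans (coeffs derivative (suc n) (ℕ.m≤n⇒m≤1+n n≤)) (≡⇒≈ (sym (ℤ.*-zeroʳ (+ suc n))))) }

  ω η : ℕ → ℤ
  ω s = (U^ s ⊛ D u) p
  η s = (U^ s ⊛ (D u ⊛ z)) p

  ω-unit : ∀ s f → (U^ s ⊛ D u) f ≡ (U^ s ⊛ D u ⊛ κ (+ 1)) f
  ω-unit s n = solve 1 (λ x → x := x :* con (+ 1)) ≋-refl (U^ s ⊛ D u) ‼ n

  η-assoc : ∀ s → η s ≡ (U^ s ⊛ D u ⊛ z) p
  η-assoc s = sym (⊛-assoc (U^ s) (D u) z p)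

  z-0 : z 0 ≡ + 0
  z-0 = trans (cong (_*_ (a 0)) (evalU-0 m g₁)) (trans (ℤ.*-identityˡ (g₁ 0)) (ℤ.*-zeroʳ (g₀ 0)))

  -- For `s < m`, `(2s + 1) * ω s` is the coefficient of `q^p` in `D (u^(2s+1))`, hence `P` times
  -- that of `u^(2s+1)`, which is therefore needed modulo `P` only. Multiplying by `1 ≈ D z + wF²`
  -- and integrating by parts gives `- (2s + 1) * η s` for it. For `s ≥ m` the order `2s + 1` of
  -- `U^ s ⊛ D u` decides, and `η s` is zero.
  ω-evaluation : ∀ s → ω s ≈ kronecker s m - P * η s [ PP ]
  ω-evaluation s = go (ℕ.<-cmp s m)
    where
    go : Tri (s < m) (s ≡ m) (m < s) → ω s ≈ kronecker s m - P * η s [ PP ]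
    go (tri> _ s≢m m<s) = ≡⇒≈ (trans (trans (ω-unit s p) (U^Du-low s (κ (+ 1)) p p<)) (sym (trans (cong₂ (λ x y → x - P * y) (kronecker-≢ s≢m) (trans (η-assoc s) (U^Du-low s z p p<))) (cong (λ x → + 0 - x) (ℤ.*-zeroʳ P)))))
      where
      p< : p < suc (s ℕ.+ s)
      p< = s≤s (ℕ.+-mono-<-≤ m<s (ℕ.<⇒≤ m<s))
    go (tri≈ _ refl _) = ≡⇒≈ (trans (trans (ω-unit s p) (U^Du-coeff s (κ (+ 1)))) (sym (trans (cong₂ (λ x y → x - P * y) (kronecker-≡ m) (trans (η-assoc s) (trans (U^Du-coeff s z) z-0))) (cong (λ x → + 1 - x) (ℤ.*-zeroʳ P)))))
    go (tri< s<m s≢m _) = cancel-P {_} {_} {k} unit (≈-trans (≡⇒≈ kω) (≈-trans (≈-scale P v≈) (≡⇒≈ (trans (lemma P k (η s)) (cong (λ x → k * (x - P * η s)) (sym (kronecker-≢ s≢m)))))))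
      where
      k = + suc (s ℕ.+ s)
      unit : Unit k
      unit = unit-small (suc (s ℕ.+ s)) (s≤s z≤n) (s≤s (ℕ.+-mono-< s<m s<m))
      lemma : ∀ P k e → P * - (k * e) ≡ k * (+ 0 - P * e)
      lemma = solve-∀
      G G′ : Series
      G = u ⊛ U^ s
      G′ = û ⊛ U^ s
      kω : k * ω s ≡ P * G p
      kω = sym (trans (D-uU^ s ‼ p) (κ-⊛ k (U^ s ⊛ D u) p))
      ω≈0 : ω s ≈ + 0 [ P ]
      ω≈0 = cancel {_} {_} {k} unit (≈-trans (≡⇒≈ kω) (by (G p) (lemma′ P (G p) k)))
        where
        lemma′ : ∀ P g k → P * g ≡ k * + 0 + g * P
        lemma′ = solve-∀
      shifted : ∀ f → (G ⊛ f) p ≡ (G′ ⊛ f) 2m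
      shifted f = ≋-trans (⊛-cong (⊛-cong u-û (≋-refl {U^ s})) (≋-refl {f})) (≋-trans (solve 4 (λ x v V f → x :* v :* V :* f := x :* (v :* V :* f)) ≋-refl (X 1) û (U^ s) f) (≋-sym (shift-X (G′ ⊛ f)))) ‼ p
      unshifted : G p ≡ (G′ ⊛ κ (+ 1)) 2m
      unshifted = trans (solve 1 (λ x → x := x :* con (+ 1)) ≋-refl G ‼ p) (shifted (κ (+ 1)))
      G-wF² : G ⊛ wF² ≐ U^ s ⊛ D u
      G-wF² = linear₁ (⊖ U^ s) Du (solve 5 (λ u V w f d → u :* V :* (w :* f) := V :* d :+ (:- V) :* (d :+ :- (u :* w :* f))) ≋-refl u (U^ s) (weight u) (F ⊛ F) (D u))
      G-Dz : G ⊛ D z ≐ D (G ⊛ z) ⊕ ⊖ (κ k ⊛ (U^ s ⊛ (D u ⊛ z)))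
      G-Dz = linear₂ (⊖ κ (+ 1)) (⊖ z) (D-⊛ G z) (D-uU^ s)
          (solve 8 (λ G dz dGz dG z k V d → G :* dz := dGz :+ :- (k :* (V :* (d :* z))) :+ (:- con (+ 1)) :* (dGz :+ :- (dG :* z :+ G :* dz)) :+ (:- z) :* (dG :+ :- (k :* (V :* d)))) ≋-refl G (D z) (D (G ⊛ z)) (D G) z (κ k) (U^ s) (D u))
      v≈ : G p ≈ - (k * η s) [ P ]
      v≈ = R.begin
        G p R.≡⟨ unshifted ⟩
        (G′ ⊛ κ (+ 1)) 2m R.≈⟨ coeffs (Ser.⊛-cong (modular P 2m) (Ser.≋-refl (modular P 2m) {G′}) (Ser.≋-sym (modular P 2m) logarithmic)) 2m ℕ.≤-refl ⟩
        (G′ ⊛ (D z ⊕ wF²)) 2m R.≡⟨ trans (sym (shifted (D z ⊕ wF²))) (trans (solve 3 (λ g x y → g :* (x :+ y) := g :* x :+ g :* y) ≋-refl G (D z) wF² ‼ p) (cong₂ _+_ (trans (G-Dz ‼ p) (cong (λ x → P * (G ⊛ z) p - x) (κ-⊛ k (U^ s ⊛ (D u ⊛ z)) p))) (G-wF² ‼ p))) ⟩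
        P * (G ⊛ z) p - k * η s + ω s R.≈⟨ linear-≈₂ ((G ⊛ z) p) (+ 1) P≈0 ω≈0 (lemma′ P ((G ⊛ z) p) (k * η s) (ω s)) ⟩
        - (k * η s) R.∎
        where
        module R = ≈-Reasoning P
        lemma′ : ∀ P g e w → P * g - e + w ≡ - e + g * (P - + 0) + + 1 * (w - + 0)
        lemma′ = solve-∀

  kronecker-convolution : ∀ (f g : ℕ → ℤ) → sum (suc m) (λ i → sum (suc m) (λ j → f i * g j * kronecker (i ℕ.+ j) m)) ≡ sum (suc m) (λ i → f i * g (m ∸ i))
  kronecker-convolution f g = sum-cong (suc m) λ i i< → trans (sum-ext (suc m) λ j → cong (_*_ (f i * g j)) (kronecker-+ j (ℕ.≤-pred i<))) (sum-kronecker (suc m) (m ∸ i) (λ j → f i * g j) (s≤s (ℕ.m∸n≤m m i)))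

  -- With `F` replaced by its polynomial in `u²` only the numbers `ω` enter. Their corrections `η`
  -- reassemble to `P` times the coefficient of `F ⊛ (y₁ ⊛ D u)`, to which `ω-evaluation` applies
  -- once more, now modulo `P`.
  newform-mod-P² : newform p ≈ sum (suc m) (λ i → g₀ i * g₀ (m ∸ i) * (+ 1 - + 2 * P * h (m ∸ i))) [ PP ]
  newform-mod-P² = R.begin
    newform p R.≡⟨ ≈0⇒≡ (coeffs expanded p ℕ.≤-refl) ⟩
    (y₀ ⊛ (y₀ ⊛ D u)) p R.≡⟨ evalU-coeff₂ (suc m) g₀ (suc m) g₀ (D u) p ⟩
    sum (suc m) (λ i → sum (suc m) (λ j → g₀ i * g₀ j * ω (i ℕ.+ j))) R.≈⟨ sum-cong-≈ (suc m) (λ i _ → sum-cong-≈ (suc m) λ j _ → *-cong-≈ {g₀ i * g₀ j} ≈-refl (ω-evaluation (i ℕ.+ j))) ⟩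
    sum (suc m) (λ i → sum (suc m) (λ j → g₀ i * g₀ j * (kronecker (i ℕ.+ j) m - P * η (i ℕ.+ j))))
      R.≡⟨ trans (sum-ext (suc m) λ i → trans (sum-ext (suc m) λ j → lemma₁ (g₀ i * g₀ j) (kronecker (i ℕ.+ j) m) P (η (i ℕ.+ j))) (split (λ j → g₀ i * g₀ j * kronecker (i ℕ.+ j) m) (λ j → g₀ i * g₀ j * η (i ℕ.+ j))))
           (trans (split (λ i → sum (suc m) (λ j → g₀ i * g₀ j * kronecker (i ℕ.+ j) m)) (λ i → sum (suc m) (λ j → g₀ i * g₀ j * η (i ℕ.+ j))))
             (cong₂ (λ x y → x + - P * y) (kronecker-convolution g₀ g₀) (sym (evalU-coeff₂ (suc m) g₀ (suc m) g₀ (D u ⊛ z) p)))) ⟩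
    sum (suc m) (λ i → g₀ i * g₀ (m ∸ i)) + - P * (y₀ ⊛ (y₀ ⊛ (D u ⊛ z))) p R.≡⟨ lemma₂ (sum (suc m) (λ i → g₀ i * g₀ (m ∸ i))) P ((y₀ ⊛ (y₀ ⊛ (D u ⊛ z))) p) ⟩
    sum (suc m) (λ i → g₀ i * g₀ (m ∸ i)) + - (P * (y₀ ⊛ (y₀ ⊛ (D u ⊛ z))) p) R.≈⟨ +-cong-≈ (≈-refl {sum (suc m) (λ i → g₀ i * g₀ (m ∸ i))}) (-‿cong-≈ (≈-scale P corrected)) ⟩
    sum (suc m) (λ i → g₀ i * g₀ (m ∸ i)) + - (P * sum (suc m) (λ i → g₀ i * g₁ (m ∸ i)))
      R.≡⟨ sym (trans (sum-ext (suc m) λ i → lemma₃ (g₀ i) (g₀ (m ∸ i)) P (h (m ∸ i))) (trans (split (λ i → g₀ i * g₀ (m ∸ i)) (λ i → g₀ i * g₁ (m ∸ i))) (lemma₂ (sum (suc m) (λ i → g₀ i * g₀ (m ∸ i))) P (sum (suc m) (λ i → g₀ i * g₁ (m ∸ i)))))) ⟩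
    sum (suc m) (λ i → g₀ i * g₀ (m ∸ i) * (+ 1 - + 2 * P * h (m ∸ i))) R.∎
    where
    module R = ≈-Reasoning PP
    module Q = ≈-Reasoning P
    lemma₁ : ∀ g k P e → g * (k - P * e) ≡ g * k + - P * (g * e)
    lemma₁ = solve-∀
    lemma₂ : ∀ s P e → s + - P * e ≡ s + - (P * e)
    lemma₂ = solve-∀
    lemma₃ : ∀ a b P h → a * b * (+ 1 - + 2 * P * h) ≡ a * b + - P * (a * (b * (+ 2 * h)))
    lemma₃ = solve-∀
    split : ∀ (f g : ℕ → ℤ) → sum (suc m) (λ i → f i + - P * g i) ≡ sum (suc m) f + - P * sum (suc m) g
    split f g = trans (sum-+ (suc m) f (λ i → - P * g i)) (cong (_+_ (sum (suc m) f)) (sum-*ˡ (suc m) (- P) g))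
    expanded : newform ≋ y₀ ⊛ (y₀ ⊛ D u) at truncated p
    expanded = linear₁ (D u ⊛ (F ⊕ y₀)) (F-expansion m) (≐⇒≋ (solve 3 (λ F y d → F :* F :* d := y :* (y :* d) :+ d :* (F :+ y) :* (F :+ :- y)) ≋-refl F y₀ (D u)))
    collapsed : y₀ ⊛ (y₀ ⊛ (D u ⊛ z)) ≋ y₀ ⊛ (y₁ ⊛ D u) at truncated p
    collapsed = linear₂ (⊖ (y₀ ⊛ D u ⊛ z)) (y₀ ⊛ D u ⊛ y₁) (F-expansion m) (≐⇒≋ Fa)
      (≐⇒≋ (solve 5 (λ F a y x d → y :* (y :* (d :* (a :* x))) := y :* (x :* d) :+ (:- (y :* d :* (a :* x))) :* (F :+ :- y) :+ y :* d :* x :* (F :* a :+ :- con (+ 1))) ≋-refl F a y₀ y₁ (D u)))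
    corrected : (y₀ ⊛ (y₀ ⊛ (D u ⊛ z))) p ≈ sum (suc m) (λ i → g₀ i * g₁ (m ∸ i)) [ P ]
    corrected = Q.begin
      (y₀ ⊛ (y₀ ⊛ (D u ⊛ z))) p Q.≡⟨ ≈0⇒≡ (coeffs collapsed p ℕ.≤-refl) ⟩
      (y₀ ⊛ (y₁ ⊛ D u)) p Q.≡⟨ evalU-coeff₂ (suc m) g₀ (suc m) g₁ (D u) p ⟩
      sum (suc m) (λ i → sum (suc m) (λ j → g₀ i * g₁ j * ω (i ℕ.+ j))) Q.≈⟨ sum-cong-≈ (suc m) (λ i _ → sum-cong-≈ (suc m) λ j _ → *-cong-≈ {g₀ i * g₁ j} ≈-refl (≈-trans (P²⇒P (ω-evaluation (i ℕ.+ j))) (by (- η (i ℕ.+ j)) (lemma₄ (kronecker (i ℕ.+ j) m) P (η (i ℕ.+ j)))))) ⟩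
      sum (suc m) (λ i → sum (suc m) (λ j → g₀ i * g₁ j * kronecker (i ℕ.+ j) m)) Q.≡⟨ kronecker-convolution g₀ g₁ ⟩
      sum (suc m) (λ i → g₀ i * g₁ (m ∸ i)) Q.∎
      where
      lemma₄ : ∀ k P e → k - P * e ≡ k + - e * P
      lemma₄ = solve-∀

-- Comparison of the two sides modulo p²

module MainCongruence (m : ℕ) (pr : Prime (suc (m ℕ.+ m))) where
  open PrimeField m pr using (p; P; PP)
  open PointCounts m pr using (Z-B)
  open HarmonicSums m pr using (H)
  open SumOfSquares m pr using (E; Z-B-mod-P²)
  open BinomialSums m pr using (g₀-product; balanced)
  open NewformCoefficient m pr using (newform-mod-P²)

  newform-binomial : newform p ≈ sum (suc m) (λ i → binom m i ^ 4 * (+ 1 - + 2 * P * (H m - H (m ∸ i)))) [ PP ]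
  newform-binomial = ≈-trans newform-mod-P² (sum-cong-≈ (suc m) λ i i< → g₀-product i (m ∸ i) (ℕ.m+[n∸m]≡n (ℕ.≤-pred i<)))

  -- The binomial sums of the two sides differ by exactly `P` times the sum that `balanced`
  -- evaluates.
  Z-B-newform : Z-B ≈ - + 1 - + 3 * P - newform p [ PP ]
  Z-B-newform = R.begin
    Z-B R.≈⟨ Z-B-mod-P² ⟩
    - + 1 - + 2 * P - sum (suc m) a₁ R.≡⟨ lemma₁ P (sum (suc m) a₁) (sum (suc m) a₂) ⟩
    - + 1 - + 2 * P - sum (suc m) a₂ + - (sum (suc m) a₁ + - sum (suc m) a₂) R.≡⟨ cong (λ x → - + 1 - + 2 * P - sum (suc m) a₂ + - x) difference ⟩
    - + 1 - + 2 * P - sum (suc m) a₂ + - (P * sum (suc m) a₃) R.≈⟨ +-cong-≈ (+-cong-≈ (≈-refl { - + 1 - + 2 * P}) (-‿cong-≈ (≈-sym newform-binomial))) (-‿cong-≈ (≈-scale P balanced)) ⟩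
    - + 1 - + 2 * P - newform p + - (P * + 1) R.≡⟨ lemma₂ P (newform p) ⟩
    - + 1 - + 3 * P - newform p R.∎
    where
    module R = ≈-Reasoning PP
    a₁ a₂ a₃ : ℕ → ℤ
    a₁ i = binom m i ^ 4 * (+ 1 + P + + 4 * P * E i (m ∸ i))
    a₂ i = binom m i ^ 4 * (+ 1 - + 2 * P * (H m - H (m ∸ i)))
    a₃ i = binom m i ^ 4 * (+ 1 + + 4 * E i (m ∸ i) + + 2 * (H m - H (m ∸ i)))
    lemma₁ : ∀ P x y → - + 1 - + 2 * P - x ≡ - + 1 - + 2 * P - y + - (x + - y)
    lemma₁ = solve-∀
    lemma₂ : ∀ P x → - + 1 - + 2 * P - x + - (P * + 1) ≡ - + 1 - + 3 * P - x
    lemma₂ = solve-∀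
    difference : sum (suc m) a₁ + - sum (suc m) a₂ ≡ P * sum (suc m) a₃
    difference = trans (cong (_+_ (sum (suc m) a₁)) (sym (sum-neg (suc m) a₂))) (trans (sym (sum-+ (suc m) a₁ (λ i → - a₂ i))) (trans (sum-ext (suc m) λ i → lemma (binom m i ^ 4) P (E i (m ∸ i)) (H m - H (m ∸ i))) (sum-*ˡ (suc m) P a₃)))
      where
      lemma : ∀ c P e v → c * (+ 1 + P + + 4 * P * e) + - (c * (+ 1 - + 2 * P * v)) ≡ P * (c * (+ 1 + + 4 * e + + 2 * v))
      lemma = solve-∀

-- From the congruences to the two formulas

module Conclusion (m : ℕ) (pr : Prime (suc (m ℕ.+ m))) where
  open PrimeField m pr using (p; P; PP; 0<m)
  open CharacterSums m pr using (ε; euler; trit-≈; trit-ε; signPower)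
  open PointCounts m pr using (Z-A; Z-B; Z-relation)
  open Evaluation m pr using (sumA-Z; sumB-Z; Z-B-nonneg; Z-B-upper; Z-B-mod8)
  open MainCongruence m pr using (Z-B-newform)

  private
    -- `PP = 1 + 4k` with `k = m² + m`, so the two congruences give `8r = q + 4qk`. Substituting
    -- `q = 8r - 4qk` into itself shows that `8` divides `q`.
    8≈ : ∀ {x y} → x ≈ y [ + 8 ] → x ≈ y [ PP ] → x ≈ y [ + 8 * PP ]
    8≈ {x} {y} (by r e) (by q e′) = by (r - + 2 * (+ 2 * r - q * k) * k) (trans e′ (trans (cong (λ z → y + z * PP) q≡) (lemma₁ y (r - + 2 * (+ 2 * r - q * k) * k) PP)))
      where
      k = + m * + m + + m
      lemma₁ : ∀ y t N → y + + 8 * t * N ≡ y + t * (+ 8 * N)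
      lemma₁ = solve-∀
      lemma₅ : ∀ y r → + 8 * r ≡ y + r * + 8 - y
      lemma₅ = solve-∀
      lemma₂ : ∀ m y q → y + q * ((+ 1 + (m + m)) * (+ 1 + (m + m))) - y ≡ q + + 4 * q * (m * m + m)
      lemma₂ = solve-∀
      equal : + 8 * r ≡ q + + 4 * q * k
      equal = trans (lemma₅ y r) (trans (cong (_- y) (trans (sym e) e′)) (lemma₂ (+ m) y q))
      q≡ : q ≡ + 8 * (r - + 2 * (+ 2 * r - q * k) * k)
      q≡ = trans (lemma₃ q k) (trans (cong (λ x → x - + 4 * k * (x - + 4 * q * k)) (sym equal)) (lemma₄ r q k))
        where
        lemma₃ : ∀ q k → q ≡ q + + 4 * q * k - + 4 * k * (q + + 4 * q * k - + 4 * q * k)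
        lemma₃ = solve-∀
        lemma₄ : ∀ r q k → + 8 * r - + 4 * k * (+ 8 * r - + 4 * q * k) ≡ + 8 * (r - + 2 * (+ 2 * r - q * k) * k)
        lemma₄ = solve-∀

  Z-B-evaluation : Z-B ≡ P * P - + 3 * P - + 1 - cf p
  Z-B-evaluation = let k , l , cf≡ , e≡ = cf-bound p in rigidity p Z-B (cf p) k l (s≤s z≤n) Z-B-nonneg Z-B-upper cf≡
      (ℤ.+-injective (trans (sym e≡) (trans (cong (_*_ P) (e-prime m 0<m pr)) (sym (ℤ.pos-* p (suc p))))))
      -- Modulo `8`, `cf p` is `p (p + 1)`, so that the target becomes `- 4p - 1 = 3 - 8 (m + 1)`.
      (8≈ (≈-trans Z-B-mod8 (≈-sym (≈-trans (+-cong-≈ (≈-refl {P * P - + 3 * P - + 1}) (-‿cong-≈ (≈-trans (cf-mod8 p) (≡⇒≈ (cong (_*_ P) (e-prime m 0<m pr)))))) (by (- + 1 - + m) (lemma₁ (+ m))))))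
        (≈-trans Z-B-newform (≈-sym (≈-trans (≡⇒≈ (cong (λ c → P * P - + 3 * P - + 1 - c) (cf-newform p))) (by (+ 1) (lemma₂ P (newform p)))))))
    where
    lemma₁ : ∀ m → let P = + 1 + (m + m) in P * P - + 3 * P - + 1 - P * (+ 1 + P) ≡ + 3 + (- + 1 - m) * + 8
    lemma₁ = solve-∀
    lemma₂ : ∀ P f → P * P - + 3 * P - + 1 - f ≡ - + 1 - + 3 * P - f + + 1 * (P * P)
    lemma₂ = solve-∀

  sumB-evaluation : sumB p ≡ P * P - + 3 * P - + 4 - cf p
  sumB-evaluation = trans sumB-Z (trans (cong (_- + 3) Z-B-evaluation) (lemma P (cf p)))
    where
    lemma : ∀ P c → P * P - + 3 * P - + 1 - c - + 3 ≡ P * P - + 3 * P - + 4 - c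
    lemma = solve-∀

  sumA-evaluation : sumA p ≡ P * P - + 3 * P - + 2 - + 2 * P * ε (- + 1) - cf p
  sumA-evaluation = trans sumA-Z (trans (lemma Z-A P (ε (- + 1))) (trans (cong (λ z → z - + 2 * P * ε (- + 1) - + 1) (trans (sym Z-relation) Z-B-evaluation)) (lemma′ P (cf p) (ε (- + 1)))))
    where
    lemma : ∀ z P e → z - + 1 ≡ z + + 2 * P * e - + 2 * P * e - + 1
    lemma = solve-∀
    lemma′ : ∀ P c e → P * P - + 3 * P - + 1 - c - + 2 * P * e - + 1 ≡ P * P - + 3 * P - + 2 - + 2 * P * e - c
    lemma′ = solve-∀

  ε-minus-one : ∀ {s} → s ≡ + 1 ⊎ s ≡ - + 1 → signPower m ≡ s → ε (- + 1) ≡ s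
  ε-minus-one h eq = trit-≈ (trit-ε (- + 1)) (inj₂ h) (≈-trans (euler (- + 1)) (≡⇒≈ eq))

-- Parity of m and the residue of p modulo 4

signs : ∀ k → (- + 1) ^ (k ℕ.+ k) ≡ + 1
signs zero = refl
signs (suc k) = trans (cong ((- + 1) ^_) (ℕ.+-suc (suc k) k)) (trans (lemma ((- + 1) ^ (k ℕ.+ k))) (signs k))
  where
  lemma : ∀ x → - + 1 * (- + 1 * x) ≡ x
  lemma = solve-∀

odd-prime : ∀ p → Prime p → p ≢ 2 → ∃ λ m → p ≡ suc (m ℕ.+ m)
odd-prime p pr p≢2 with p % 2 in eq | m%n<n p 2 | m≡m%n+[m/n]*n p 2
... | 0 | _ | h with prime⇒irreducible pr (divides (p / 2) h)
... | inj₁ ()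
... | inj₂ 2≡p = contradiction (sym 2≡p) p≢2
odd-prime p pr p≢2 | 1 | _ | h = p / 2 , trans h (cong suc (double (p / 2)))
  where
  double : ∀ q → q ℕ.* 2 ≡ q ℕ.+ q
  double = ℕ-Solver.solve-∀
odd-prime p pr p≢2 | suc (suc _) | s≤s (s≤s ()) | _

half : ∀ m n → m ℕ.+ m ≡ n ℕ.+ n → m ≡ n
half m n eq = ℕ.*-cancelʳ-≡ m n 2 (trans (double m) (trans eq (sym (double n))))
  where
  double : ∀ q → q ℕ.* 2 ≡ q ℕ.+ q
  double = ℕ-Solver.solve-∀

module Residues (m : ℕ) (pr : Prime (suc (m ℕ.+ m))) where
  open PrimeField m pr using (p)
  open Conclusion m pr
  open CharacterSums m pr using (ε)

  quarter : ℕ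
  quarter = p / 4

  case₁ : p % 4 ≡ 1 → sumA p ≡ + p * + p - + 5 * + p - + 2 - cf p
  case₁ h = trans sumA-evaluation (trans (cong (λ e → + p * + p - + 3 * + p - + 2 - + 2 * + p * e - cf p) (ε-minus-one (inj₁ refl) (trans (cong ((- + 1) ^_) m≡) (signs (quarter))))) (lemma (+ p) (cf p)))
    where
    lemma : ∀ P c → P * P - + 3 * P - + 2 - + 2 * P * + 1 - c ≡ P * P - + 5 * P - + 2 - c
    lemma = solve-∀
    m≡ : m ≡ quarter ℕ.+ quarter
    m≡ = half m (quarter ℕ.+ quarter) (trans (ℕ.suc-injective (trans (m≡m%n+[m/n]*n p 4) (cong (ℕ._+ quarter ℕ.* 4) h))) (quadruple (quarter)))
      where
      quadruple : ∀ q → q ℕ.* 4 ≡ q ℕ.+ q ℕ.+ (q ℕ.+ q)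
      quadruple = ℕ-Solver.solve-∀
  case₃ : p % 4 ≡ 3 → sumA p ≡ + p * + p - + p - + 2 - cf p
  case₃ h = trans sumA-evaluation (trans (cong (λ e → + p * + p - + 3 * + p - + 2 - + 2 * + p * e - cf p) (ε-minus-one (inj₂ refl) (trans (cong ((- + 1) ^_) m≡) (cong (_*_ (- + 1)) (signs (quarter)))))) (lemma (+ p) (cf p)))
    where
    lemma : ∀ P c → P * P - + 3 * P - + 2 - + 2 * P * - + 1 - c ≡ P * P - P - + 2 - c
    lemma = solve-∀
    m≡ : m ≡ suc (quarter ℕ.+ quarter)
    m≡ = half m (suc (quarter ℕ.+ quarter)) (trans (ℕ.suc-injective (trans (m≡m%n+[m/n]*n p 4) (cong (ℕ._+ quarter ℕ.* 4) h))) (quadruple (quarter)))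
      where
      quadruple : ∀ q → suc (suc (q ℕ.* 4)) ≡ suc (q ℕ.+ q) ℕ.+ suc (q ℕ.+ q)
      quadruple = ℕ-Solver.solve-∀

theorem3p20 : (p : ℕ) → .{{_ : NonZero p}} → Prime p → p ≢ 2 →
    ((p % 4 ≡ 1 → sumA p ≡ + p * + p - + 5 * + p - + 2 - cf p)
     × (p % 4 ≡ 3 → sumA p ≡ + p * + p - + p - + 2 - cf p))
    × sumB p ≡ + p * + p - + 3 * + p - + 4 - cf p
theorem3p20 p pr p≢2 = go p (odd-prime p pr p≢2) pr
  where
  go : ∀ p → .{{_ : NonZero p}} → (∃ λ m → p ≡ suc (m ℕ.+ m)) → Prime p →
       ((p % 4 ≡ 1 → sumA p ≡ + p * + p - + 5 * + p - + 2 - cf p) × (p % 4 ≡ 3 → sumA p ≡ + p * + p - + p - + 2 - cf p)) × sumB p ≡ + p * + p - + 3 * + p - + 4 - cf p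
  go .(suc (m ℕ.+ m)) (m , refl) pr = (Residues.case₁ m pr , Residues.case₃ m pr) , Conclusion.sumB-evaluation m pr
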